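{- Every tight chiral polyhedron covers an atomic chiral polyhedron of one of the following types: $\{2m, m^{\alpha}\}$ or $\{m^{\alpha}, 2m\}$ for an odd prime $m$ and an integer $\alpha \geq 2$; or $\{8, 2^{\beta}\}$ or $\{2^{\beta}, 8\}$ with $\beta \geq 5$; or $\{2^{\alpha}, 2^{\alpha+1}\}$ or $\{2^{\alpha+1}, 2^{\alpha}\}$ with $\alpha \geq 4$.
   Context: An (abstract) polyhedron is a partially ordered set whose elements have rank $0$ (vertices), $1$ (edges) or $2$ (faces), where two elements are incident if they are comparable, such that: every edge is incident to exactly two vertices and two faces; whenever a vertex is incident to a face there are exactly two edges incident to both; the incidence graph is connected; and for every vertex or face $F$, the subgraph of the incidence graph induced on the neighbours of $F$ is connected. A flag is a mutually incident triple (vertex, edge, face); $\Phi^i$ denotes the unique flag differing from $\Phi$ exactly in its rank-$i$ element. Type $\{p,q\}$: every face is incident to $p$ edges and every vertex to $q$ edges. A polyhedron is regular if its automorphism group is transitive on flags, and chiral if its flags split into two classes such that $\Phi$ and $\Phi^i$ always lie in different classes and the automorphism group is transitive on each class but not on all flags. For a regular or chiral polyhedron with fixed base flag $\Phi$, $\sigma_1$ is the automorphism sending $\Phi$ to $(\Phi^1)^0$ and $\sigma_2$ the automorphism sending $\Phi$ to $(\Phi^2)^1$; the rotation group is $\Gamma^+(\mathcal{P})=\langle\sigma_1,\sigma_2\rangle$. A polyhedron of type $\{p,q\}$ is tight if it has exactly $2pq$ flags. For chiral or orientably regular polyhedra $\mathcal P,\mathcal Q$ with rotation groups $\langle\sigma_1,\sigma_2\rangle$,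 $\langle\lambda_1,\lambda_2\rangle$, $\mathcal P$ covers $\mathcal Q$ if there is a group homomorphism $\Gamma^+(\mathcal P)\to\Gamma^+(\mathcal Q)$ sending $\sigma_i\mapsto\lambda_i$ for $i=1,2$. A chiral polyhedron of type $\{p,q\}$ is atomic if it is tight and does not cover any tight chiral polyhedron of type $\{p',q\}$ with $p'<p$ or of type $\{p,q'\}$ with $q'<q$. -}

module Defs where

open import Data.Nat as ℕ using (ℕ; _*_; _^_; _≤_; _<_)
open import Data.Nat.Primality using (Prime)
open import Data.Fin as Fin using (Fin)
open import Data.Bool using (Bool; true; false)
open import Data.List using (List; []; _∷_)
open import Data.Product using (Σ; ∃; ∃-syntax; _×_; _,_)
open import Data.Sum using (_⊎_)
open import Relation.Nullary using (¬_)
open import Relation.Binary.PropositionalEquality using (_≡_; _≢_)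
open import Relation.Binary.Construct.Closure.ReflexiveTransitive using (Star)
open import Function.Bundles using (_↔_)

module RankedPoset {Elem : Set} (_≼_ : Elem → Elem → Set) (rank : Elem → Fin 3) where
  Inc : Elem → Elem → Set
  Inc x y = x ≼ y ⊎ y ≼ x

  IsVertex IsEdge IsFace : Elem → Set
  IsVertex x = rank x ≡ Fin.zero
  IsEdge x = rank x ≡ Fin.suc Fin.zero
  IsFace x = rank x ≡ Fin.suc (Fin.suc Fin.zero)

  ExactlyTwo : (Elem → Set) → Set
  ExactlyTwo P = Σ Elem λ a → Σ Elem λ b →
    a ≢ b × P a × P b × (∀ c → P c → c ≡ a ⊎ c ≡ b)

  Nbr : Elem → Elem → Set
  Nbr F x = Inc F x × x ≢ F


record Polyhedron : Set₁ where
  field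
    Elem  : Set
    _≼_   : Elem → Elem → Set
    ≼-irrelevant : ∀ {x y} (p q : x ≼ y) → p ≡ q
    ≼-refl  : ∀ {x} → x ≼ x
    ≼-trans : ∀ {x y z} → x ≼ y → y ≼ z → x ≼ z
    ≼-antisym : ∀ {x y} → x ≼ y → y ≼ x → x ≡ y
    rank  : Elem → Fin 3
    rank-mono : ∀ {x y} → x ≼ y → x ≢ y → rank x Fin.< rank y

  open RankedPoset _≼_ rank public


  field
    edge-vertices : ∀ e → IsEdge e → ExactlyTwo (λ v → IsVertex v × v ≼ e)
    edge-faces    : ∀ e → IsEdge e → ExactlyTwo (λ f → IsFace f × e ≼ f)
    diamond : ∀ v f → IsVertex v → IsFace f → v ≼ f →
              ExactlyTwo (λ e → IsEdge e × v ≼ e × e ≼ f)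
    connected : ∀ x y → Star Inc x y
    locally-connected : ∀ F → (IsVertex F ⊎ IsFace F) →
      ∀ x y → Nbr F x → Nbr F y →
      Star (λ a b → Nbr F a × Nbr F b × Inc a b) x y

module _ (P : Polyhedron) where
  open Polyhedron P

  record Flag : Set where
    constructor flag
    field
      v e f : Elem
      v-vert : IsVertex v
      e-edge : IsEdge e
      f-face : IsFace f
      v≼e : v ≼ e
      e≼f : e ≼ f

  FlagEq : Flag → Flag → Set
  FlagEq Φ Ψ = Flag.v Φ ≡ Flag.v Ψ × Flag.e Φ ≡ Flag.e Ψ × Flag.f Φ ≡ Flag.f Ψ

  Adj : Fin 3 → Flag → Flag → Set
  Adj Fin.zero Φ Ψ =
    Flag.v Φ ≢ Flag.v Ψ × Flag.e Φ ≡ Flag.e Ψ × Flag.f Φ ≡ Flag.f Ψ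
  Adj (Fin.suc Fin.zero) Φ Ψ =
    Flag.v Φ ≡ Flag.v Ψ × Flag.e Φ ≢ Flag.e Ψ × Flag.f Φ ≡ Flag.f Ψ
  Adj (Fin.suc (Fin.suc Fin.zero)) Φ Ψ =
    Flag.v Φ ≡ Flag.v Ψ × Flag.e Φ ≡ Flag.e Ψ × Flag.f Φ ≢ Flag.f Ψ

  record Aut : Set where
    field
      to   : Elem → Elem
      from : Elem → Elem
      to-from : ∀ x → to (from x) ≡ x
      from-to : ∀ x → from (to x) ≡ x
      mono  : ∀ {x y} → x ≼ y → to x ≼ to y
      mono⁻ : ∀ {x y} → to x ≼ to y → x ≼ y
      rank-pres : ∀ x → rank (to x) ≡ rank x

  AutEq : Aut → Aut → Set
  AutEq α β = ∀ x → Aut.to α x ≡ Aut.to β x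

  idAut : Aut
  idAut = record { to = λ x → x ; from = λ x → x ; to-from = λ _ → Relation.Binary.PropositionalEquality.refl
                 ; from-to = λ _ → Relation.Binary.PropositionalEquality.refl
                 ; mono = λ p → p ; mono⁻ = λ p → p ; rank-pres = λ _ → Relation.Binary.PropositionalEquality.refl }

  _∘A_ : Aut → Aut → Aut
  α ∘A β = record
    { to = λ x → A.to (B.to x)
    ; from = λ x → B.from (A.from x)
    ; to-from = λ x → Relation.Binary.PropositionalEquality.trans
        (Relation.Binary.PropositionalEquality.cong A.to (B.to-from (A.from x))) (A.to-from x)
    ; from-to = λ x → Relation.Binary.PropositionalEquality.trans
        (Relation.Binary.PropositionalEquality.cong B.from (A.from-to (B.to x))) (B.from-to x)
    ; mono = λ p → A.mono (B.mono p)
    ; mono⁻ = λ p → B.mono⁻ (A.mono⁻ p)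
    ; rank-pres = λ x → Relation.Binary.PropositionalEquality.trans (A.rank-pres (B.to x)) (B.rank-pres x)
    }
    where module A = Aut α
          module B = Aut β

  invAut : Aut → Aut
  invAut α = record
    { to = A.from ; from = A.to ; to-from = A.from-to ; from-to = A.to-from
    ; mono = λ {x} {y} p → A.mono⁻ (Relation.Binary.PropositionalEquality.subst₂ _≼_
        (Relation.Binary.PropositionalEquality.sym (A.to-from x))
        (Relation.Binary.PropositionalEquality.sym (A.to-from y)) p)
    ; mono⁻ = λ {x} {y} p → Relation.Binary.PropositionalEquality.subst₂ _≼_
        (A.to-from x) (A.to-from y) (A.mono p)
    ; rank-pres = λ x → Relation.Binary.PropositionalEquality.trans
        (Relation.Binary.PropositionalEquality.sym (A.rank-pres (A.from x)))
        (Relation.Binary.PropositionalEquality.cong rank (A.to-from x))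
    }
    where module A = Aut α

  act : Aut → Flag → Flag
  act α (flag v e f vv ee ff ve ef) =
    flag (to v) (to e) (to f)
      (Relation.Binary.PropositionalEquality.trans (rank-pres v) vv)
      (Relation.Binary.PropositionalEquality.trans (rank-pres e) ee)
      (Relation.Binary.PropositionalEquality.trans (rank-pres f) ff)
      (mono ve) (mono ef)
    where open Aut α

  EdgesOfFace : Elem → Set
  EdgesOfFace f = Σ Elem λ e → IsEdge e × e ≼ f

  EdgesAtVertex : Elem → Set
  EdgesAtVertex v = Σ Elem λ e → IsEdge e × v ≼ e

  HasType : ℕ → ℕ → Set
  HasType p q = (∀ f → IsFace f → EdgesOfFace f ↔ Fin p)
              × (∀ v → IsVertex v → EdgesAtVertex v ↔ Fin q)

  Tight : ℕ → ℕ → Set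
  Tight p q = HasType p q × (Flag ↔ Fin (2 * p * q))

  FlagTransitive : (Flag → Set) → Set
  FlagTransitive C = ∀ Φ Ψ → C Φ → C Ψ → ∃[ α ] FlagEq (act α Φ) Ψ

  Regular : Set
  Regular = FlagTransitive (λ _ → Data.Unit.⊤)
    where import Data.Unit

  Chiral : Set
  Chiral = Σ (Flag → Bool) λ cls →
      (∀ i Φ Ψ → Adj i Φ Ψ → cls Φ ≢ cls Ψ)
    × (∀ b → FlagTransitive (λ Φ → cls Φ ≡ b))
    × ¬ Regular

  IsSigma1 : Flag → Aut → Set
  IsSigma1 Φ α = Σ Flag λ Φ₁ → Σ Flag λ Φ₁₀ →
    Adj (Fin.suc Fin.zero) Φ Φ₁ × Adj Fin.zero Φ₁ Φ₁₀ × FlagEq (act α Φ) Φ₁₀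

  IsSigma2 : Flag → Aut → Set
  IsSigma2 Φ α = Σ Flag λ Φ₂ → Σ Flag λ Φ₂₁ →
    Adj (Fin.suc (Fin.suc Fin.zero)) Φ Φ₂ × Adj (Fin.suc Fin.zero) Φ₂ Φ₂₁ × FlagEq (act α Φ) Φ₂₁

  Gen : Set
  Gen = Bool × Bool   -- (which generator: false = σ₁, true = σ₂ ; inverted?)

  evalWord : Aut → Aut → List Gen → Aut
  evalWord σ₁ σ₂ [] = idAut
  evalWord σ₁ σ₂ ((g , inv) ∷ w) = gen g inv ∘A evalWord σ₁ σ₂ w
    where
      base : Bool → Aut
      base false = σ₁
      base true  = σ₂
      gen : Bool → Bool → Aut
      gen g false = base g
      gen g true  = invAut (base g)

  InRot : Aut → Aut → Aut → Set
  InRot σ₁ σ₂ α = ∃[ w ] AutEq (evalWord σ₁ σ₂ w) α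

-- P covers Q: for base flags of P and Q, there is a group homomorphism
-- Γ⁺(P) → Γ⁺(Q) sending σᵢ ↦ λᵢ.
Covers : Polyhedron → Polyhedron → Set
Covers P Q =
  Σ (Flag P) λ Φ → Σ (Flag Q) λ Ψ →
  Σ (Aut P) λ σ₁ → Σ (Aut P) λ σ₂ → Σ (Aut Q) λ λ₁ → Σ (Aut Q) λ λ₂ →
  IsSigma1 P Φ σ₁ × IsSigma2 P Φ σ₂ × IsSigma1 Q Ψ λ₁ × IsSigma2 Q Ψ λ₂ ×
  Σ ((α : Aut P) → InRot P σ₁ σ₂ α → Aut Q) λ φ →
      (∀ α β hα hβ → AutEq P α β → AutEq Q (φ α hα) (φ β hβ))
    × (∀ α β hα hβ hαβ →
         AutEq Q (φ (_∘A_ P α β) hαβ) (_∘A_ Q (φ α hα) (φ β hβ)))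
    × (∀ h → AutEq Q (φ σ₁ h) λ₁)
    × (∀ h → AutEq Q (φ σ₂ h) λ₂)

Atomic : Polyhedron → ℕ → ℕ → Set₁
Atomic P p q =
  Chiral P × Tight P p q ×
  (∀ (Q : Polyhedron) p' → p' < p → Chiral Q → Tight Q p' q → ¬ Covers P Q) ×
  (∀ (Q : Polyhedron) q' → q' < q → Chiral Q → Tight Q p q' → ¬ Covers P Q)

AtomicTypeList : ℕ → ℕ → Set
AtomicTypeList p q =
    (∃[ m ] ∃[ α ] Prime m × m ≢ 2 × 2 ≤ α ×
        ((p ≡ 2 * m × q ≡ m ^ α) ⊎ (p ≡ m ^ α × q ≡ 2 * m)))
  ⊎ (∃[ β ] 5 ≤ β × ((p ≡ 8 × q ≡ 2 ^ β) ⊎ (p ≡ 2 ^ β × q ≡ 8)))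
  ⊎ (∃[ α ] 4 ≤ α ×
        ((p ≡ 2 ^ α × q ≡ 2 ^ (ℕ.suc α)) ⊎ (p ≡ 2 ^ (ℕ.suc α) × q ≡ 2 ^ α)))

{-# OPTIONS --safe #-}
module Submission where

-- The rotation group of a tight chiral polyhedron of type {p,q} is G = ⟨x⟩⟨y⟩ with x = σ₁ of order p, y = σ₂ of order q,
-- ⟨x⟩ ∩ ⟨y⟩ = 1 and (xy)² = 1; chirality says that no automorphism inverts both x and y.  A tight quotient of type
-- {p′,q} is G / ⟨x^p′⟩, so atomic quotients are reached by dividing out normal subgroups of ⟨x⟩ or ⟨y⟩ as long as the
-- quotient stays chiral, and every such group is realised by its coset polyhedron.
--
-- Let G be atomic.  A counting argument based on Itô's theorem (G′ is abelian) shows that ⟨x⟩ or ⟨y⟩ contains a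
-- nontrivial normal subgroup of G; it cannot happen for both, since G would embed in a product of two regular quotients.
-- Say ⟨x⟩ has trivial core and ⟨z⟩ ≤ ⟨y⟩ is normal of prime order m.  Write x⁻¹y = y^i x^j, c = y^(1+i), d = x^(1-j).
-- Comparing with the mirror image, valid modulo ⟨z⟩, gives ζ ∈ ⟨z⟩ with y d y⁻¹ = dζ and x c x⁻¹ = cζ, while
-- y x² y⁻¹ = x⁻² d c⁻¹ and x y² x⁻¹ = y⁻² c d⁻¹.  If ζ = 1 then ⟨y²⟩ is normal and G is regular.  Otherwise x², c, d, ζ
-- commute, dᵐ = 1, and the trivial core of ⟨x⟩ turns the first relation into a bound on p: for m odd, cᵐ = 1, p = 2m and
-- q = m^α; for m = 2, c = y^(4k) with c^(p/4) = c^(2(k-1)) = ζ, and the parity of k separates p = 8 from q = 2p.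

open import Defs
open import Algebra.Bundles using (Group)
open import Axiom.UniquenessOfIdentityProofs.WithK using () renaming (uip to ≡-irrelevant)
open import Data.Bool using (Bool; true; false; not)
open import Data.Bool.Properties using (T-irrelevant; not-involutive; not-¬; ¬-not) renaming (_≟_ to _≟ᵇ_)
open import Data.Empty using (⊥; ⊥-elim)
open import Data.Fin as Fin using (Fin; zero; suc; toℕ; fromℕ<; punchOut; combine; remQuot)
open import Data.Fin.Properties as Finₚ using (toℕ<n; toℕ-fromℕ<; toℕ-injective; any?; all?; punchOut-injective; pigeonhole; injective⇒≤; fromℕ<-injective; remQuot-combine; combine-remQuot) renaming (_≟_ to _≟ᶠ_)
open import Data.List using (List; []; _∷_; _++_; map)
import Data.List.Relation.Unary.All as All
open import Data.Maybe as Maybe using (Maybe; just; nothing)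
open import Data.Maybe.Properties using (just-injective)
open import Data.Nat as ℕ using (ℕ; zero; suc; NonZero; _<_; _≤_; _∸_; z≤n; s≤s)
open import Data.Nat.Coprimality using (Coprime; coprime-Bézout; coprime⇒gcd≡1; coprime-divisor) renaming (sym to coprime-sym)
open import Data.Nat.DivMod using (_%_; _/_; m≡m%n+[m/n]*n; m%n<n)
open import Data.Nat.Divisibility hiding (quotient)
open import Data.Nat.GCD using (gcd; gcd-GCD; gcd[m,n]∣m; gcd[m,n]∣n; module Bézout)
open import Data.Nat.Induction using (<-wellFounded)
open import Data.Nat.Primality using (Prime; prime[2]; euclidsLemma; prime⇒irreducible; prime⇒nonZero; ¬prime[1])
open import Data.Nat.Primality.Factorisation using (factorise)
open import Data.Nat.ListAction using (product)
import Data.Nat.Properties as ℕₚ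
open import Data.Nat.Tactic.RingSolver using (solve-∀)
open import Data.Product using (_×_; _,_; proj₁; proj₂; ∃; ∃₂; Σ)
open import Data.Sum using (_⊎_; inj₁; inj₂; [_,_]′; swap)
open import Data.Unit using (tt)
open import Data.Vec using (Vec; lookup)
open import Function using (_∘_; Injective)
open import Function.Bundles using (_↔_; mk⇔; mk↔ₛ′; Inverse)
open import Induction.WellFounded using (Acc; acc)
open import Level using (0ℓ)
open import Relation.Binary.Construct.Closure.ReflexiveTransitive using (Star; _◅◅_; reverse) renaming (ε to nil; _◅_ to _◂_)
open import Relation.Binary.PropositionalEquality as ≡ using (_≡_; _≢_)
import Relation.Binary.Reflection as SolverReflection
open import Relation.Nullary using (Dec; yes; no; does; ¬_; contradiction)
open import Relation.Nullary.Decidable using (True; toWitness; fromWitness; map′; _×-dec_; _⊎-dec_; ¬?; dec-true; does-⇔; decidable-stable)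

-- Groups and powers

-- Chirality is treated as a statement about words. `mirror` inverts every letter of a word, and
-- regularity says that the mirror image of a relator is again a relator. This form asks for no
-- automorphism as a function, passes to a quotient by coarsening the equality, and becomes in the
-- polyhedron the reflection sending g Φ to mirror(g) Φ¹. It is decidable: unique factorisation
-- leaves only q equations x y^b = y^b′ x^a′ to be compared with their mirror images. That decision
-- is what makes the descent and the arguments by contradiction constructive. Two obstacles shape
-- the geometric half. `Polyhedron` demands propositional equality of elements and a
-- proof-irrelevant order, whereas the groups are setoids; cosets are therefore given by canonical
-- representatives found with a decidable equivalence. And `Covers` leaves the base flags free: a
-- base flag in the other class inverts both generators, so a cover yields a quotient of the group
-- only up to this inversion.

module GroupSolver (G : Group 0ℓ 0ℓ) where
  open Group G
  open import Algebra.Properties.Group G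
  open import Relation.Binary.Reasoning.Setoid setoid

  infixl 7 _⊕_
  data Expr (n : ℕ) : Set where
    var : Fin n → Expr n
    _⊕_ : Expr n → Expr n → Expr n
    ⊖_  : Expr n → Expr n
    𝟙   : Expr n

  ⟦_⟧ : ∀ {n} → Expr n → Vec Carrier n → Carrier
  ⟦ var i ⟧ ρ = lookup ρ i
  ⟦ a ⊕ b ⟧ ρ = ⟦ a ⟧ ρ ∙ ⟦ b ⟧ ρ
  ⟦ ⊖ a ⟧ ρ = ⟦ a ⟧ ρ ⁻¹
  ⟦ 𝟙 ⟧ ρ = ε

  signed : Bool → Carrier → Carrier
  signed false g = g
  signed true  g = g ⁻¹

  ⟦_⟧ₗ : ∀ {n} → List (Fin n × Bool) → Vec Carrier n → Carrier
  ⟦ [] ⟧ₗ ρ = ε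
  ⟦ (i , s) ∷ w ⟧ₗ ρ = signed s (lookup ρ i) ∙ ⟦ w ⟧ₗ ρ

  push : ∀ {n} → Fin n → Bool → List (Fin n × Bool) → List (Fin n × Bool)
  push i s [] = (i , s) ∷ []
  push i s ((j , t) ∷ w) with i ≟ᶠ j | s ≟ᵇ t
  ... | yes _ | no _ = w
  ... | _ | _ = (i , s) ∷ (j , t) ∷ w

  -- The Boolean records whether the expression stands under an inverse and the list is the word to
  -- its right, so inversion, concatenation and free cancellation happen in one pass.
  normal : ∀ {n} → Bool → Expr n → List (Fin n × Bool) → List (Fin n × Bool)
  normal s (var i) w = push i s w
  normal false (a ⊕ b) w = normal false a (normal false b w)
  normal true  (a ⊕ b) w = normal true b (normal true a w)
  normal s (⊖ a) w = normal (not s) a w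
  normal s 𝟙 w = w

  ⟦_⇓⟧ : ∀ {n} → Expr n → Vec Carrier n → Carrier
  ⟦ a ⇓⟧ ρ = ⟦ normal false a [] ⟧ₗ ρ

  signed-cancel : ∀ s t g h → s ≡.≢ t → h ≈ signed s g ∙ (signed t g ∙ h)
  signed-cancel false false g h ne with () ← ne ≡.refl
  signed-cancel false true g h _ = sym (\\-leftDividesˡ g h)
  signed-cancel true false g h _ = sym (\\-leftDividesʳ g h)
  signed-cancel true true g h ne with () ← ne ≡.refl

  push-correct : ∀ {n} (i : Fin n) s w ρ → ⟦ push i s w ⟧ₗ ρ ≈ signed s (lookup ρ i) ∙ ⟦ w ⟧ₗ ρ
  push-correct i s [] ρ = refl
  push-correct i s ((j , t) ∷ w) ρ with i ≟ᶠ j | s ≟ᵇ t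
  ... | yes ≡.refl | no ne = signed-cancel s t _ _ ne
  ... | yes _ | yes _ = refl
  ... | no _ | yes _ = refl
  ... | no _ | no _ = refl

  signed-∙ : ∀ s g k → signed s (g ⁻¹) ∙ k ≈ signed (not s) g ∙ k
  signed-∙ false g k = refl
  signed-∙ true g k = ∙-congʳ (⁻¹-involutive g)

  normal-correct : ∀ {n} s (a : Expr n) w ρ → ⟦ normal s a w ⟧ₗ ρ ≈ signed s (⟦ a ⟧ ρ) ∙ ⟦ w ⟧ₗ ρ
  normal-correct s (var i) w ρ = push-correct i s w ρ
  normal-correct false (a ⊕ b) w ρ = begin
    _ ≈⟨ normal-correct false a _ ρ ⟩
    _ ≈⟨ ∙-congˡ (normal-correct false b w ρ) ⟩
    _ ≈⟨ assoc _ _ _ ⟨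
    _ ∎
  normal-correct true (a ⊕ b) w ρ = begin
    _ ≈⟨ normal-correct true b _ ρ ⟩
    _ ≈⟨ ∙-congˡ (normal-correct true a w ρ) ⟩
    _ ≈⟨ assoc _ _ _ ⟨
    _ ≈⟨ ∙-congʳ (⁻¹-anti-homo-∙ _ _) ⟨
    _ ∎
  normal-correct s (⊖ a) w ρ = trans (normal-correct (not s) a w ρ) (sym (signed-∙ s (⟦ a ⟧ ρ) _))
  normal-correct false 𝟙 w ρ = sym (identityˡ _)
  normal-correct true 𝟙 w ρ = trans (sym (identityˡ _)) (∙-congʳ (sym ε⁻¹≈ε))

  correct : ∀ {n} (a : Expr n) ρ → ⟦ a ⇓⟧ ρ ≈ ⟦ a ⟧ ρ
  correct a ρ = trans (normal-correct false a [] ρ) (identityʳ _)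

  open SolverReflection setoid var ⟦_⟧ ⟦_⇓⟧ correct public using (solve; _⊜_)

module GroupPowers (G : Group 0ℓ 0ℓ) where
  open Group G
  open import Algebra.Properties.Group G
  open import Algebra.Properties.Monoid.Mult monoid using (×-congʳ; ×-homo-+; ×-assocˡ) renaming (_×_ to _×ᵐ_)
  open import Relation.Binary.Reasoning.Setoid setoid
  open GroupSolver G

  infixr 8 _^_
  _^_ : Carrier → ℕ → Carrier
  g ^ n = n ×ᵐ g

  ^-cong : ∀ {g h} n → g ≈ h → g ^ n ≈ h ^ n
  ^-cong n = ×-congʳ n

  ^-≡ : ∀ g {m n} → m ≡ n → g ^ m ≈ g ^ n
  ^-≡ g ≡.refl = refl

  ^-+ : ∀ g m n → g ^ (m ℕ.+ n) ≈ g ^ m ∙ g ^ n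
  ^-+ g m n = ×-homo-+ g m n

  ^-* : ∀ g m n → g ^ (m ℕ.* n) ≈ (g ^ m) ^ n
  ^-* g m n = trans (^-≡ g (ℕₚ.*-comm m n)) (sym (×-assocˡ g n m))

  ε^ : ∀ n → ε ^ n ≈ ε
  ε^ zero = refl
  ε^ (suc n) = trans (identityˡ _) (ε^ n)

  ^-ε : ∀ {g} n → g ≈ ε → g ^ n ≈ ε
  ^-ε n e = trans (^-cong n e) (ε^ n)

  ^-1 : ∀ g → g ^ 1 ≈ g
  ^-1 g = identityʳ g

  ^-2 : ∀ g → g ^ 2 ≈ g ∙ g
  ^-2 g = ∙-congˡ (identityʳ g)

  Commute : Carrier → Carrier → Set
  Commute a b = a ∙ b ≈ b ∙ a

  conj : Carrier → Carrier → Carrier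
  conj a g = a ∙ g ∙ a ⁻¹

  comm-sym : ∀ {a b} → Commute a b → Commute b a
  comm-sym = sym

  comm-refl : ∀ {a} → Commute a a
  comm-refl = refl

  comm-respʳ : ∀ {a b c} → b ≈ c → Commute a b → Commute a c
  comm-respʳ e h = trans (∙-congˡ (sym e)) (trans h (∙-congʳ e))

  comm-∙ : ∀ {a b c} → Commute a b → Commute a c → Commute a (b ∙ c)
  comm-∙ {a} {b} {c} h k = begin
    a ∙ (b ∙ c) ≈⟨ assoc _ _ _ ⟨
    a ∙ b ∙ c   ≈⟨ ∙-congʳ h ⟩
    b ∙ a ∙ c   ≈⟨ assoc _ _ _ ⟩
    b ∙ (a ∙ c) ≈⟨ ∙-congˡ k ⟩
    b ∙ (c ∙ a) ≈⟨ assoc _ _ _ ⟨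
    b ∙ c ∙ a   ∎

  comm-ε : ∀ {a} → Commute a ε
  comm-ε {a} = trans (identityʳ a) (sym (identityˡ a))

  comm-⁻¹ : ∀ {a b} → Commute a b → Commute a (b ⁻¹)
  comm-⁻¹ {a} {b} h = begin
    a ∙ b ⁻¹ ≈⟨ solve 2 (λ a b → a ⊕ ⊖ b ⊜ ⊖ b ⊕ (b ⊕ a) ⊕ ⊖ b) refl a b ⟩
    b ⁻¹ ∙ (b ∙ a) ∙ b ⁻¹ ≈⟨ ∙-congʳ (∙-congˡ h) ⟨
    b ⁻¹ ∙ (a ∙ b) ∙ b ⁻¹ ≈⟨ solve 2 (λ a b → ⊖ b ⊕ (a ⊕ b) ⊕ ⊖ b ⊜ ⊖ b ⊕ a) refl a b ⟩
    b ⁻¹ ∙ a ∎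

  comm-^ : ∀ {a b} n → Commute a b → Commute a (b ^ n)
  comm-^ zero h = comm-ε
  comm-^ (suc n) h = comm-∙ h (comm-^ n h)

  comm-^ˡ : ∀ {a b} n → Commute a b → Commute (a ^ n) b
  comm-^ˡ n h = comm-sym (comm-^ n (comm-sym h))

  comm-^^ : ∀ g m n → Commute (g ^ m) (g ^ n)
  comm-^^ g m n = comm-^ n (comm-^ˡ m comm-refl)

  ^-∙ : ∀ {a b} n → Commute a b → (a ∙ b) ^ n ≈ a ^ n ∙ b ^ n
  ^-∙ zero h = sym (identityˡ ε)
  ^-∙ {a} {b} (suc n) h = begin
    a ∙ b ∙ (a ∙ b) ^ n ≈⟨ ∙-congˡ (^-∙ n h) ⟩
    a ∙ b ∙ (a ^ n ∙ b ^ n) ≈⟨ solve 4 (λ a b c d → a ⊕ b ⊕ (c ⊕ d) ⊜ a ⊕ (b ⊕ c) ⊕ d) refl a b (a ^ n) (b ^ n) ⟩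
    a ∙ (b ∙ a ^ n) ∙ b ^ n ≈⟨ ∙-congʳ (∙-congˡ (comm-^ n (comm-sym h))) ⟩
    a ∙ (a ^ n ∙ b) ∙ b ^ n ≈⟨ solve 4 (λ a b c d → a ⊕ (c ⊕ b) ⊕ d ⊜ a ⊕ c ⊕ (b ⊕ d)) refl a b (a ^ n) (b ^ n) ⟩
    a ^ suc n ∙ b ^ suc n ∎

  ^-⁻¹ : ∀ g n → (g ⁻¹) ^ n ≈ (g ^ n) ⁻¹
  ^-⁻¹ g n = inverseˡ-unique _ _ (begin
    (g ⁻¹) ^ n ∙ g ^ n ≈⟨ ^-∙ n (comm-sym (comm-⁻¹ comm-refl)) ⟨
    (g ⁻¹ ∙ g) ^ n ≈⟨ ^-ε n (inverseˡ g) ⟩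
    ε ∎)

  conj-cong : ∀ a {g h} → g ≈ h → conj a g ≈ conj a h
  conj-cong a e = ∙-congʳ (∙-congˡ e)

  conj-congˡ : ∀ {a b} g → a ≈ b → conj a g ≈ conj b g
  conj-congˡ g e = ∙-cong (∙-congʳ e) (⁻¹-cong e)

  conj-∙ : ∀ a g h → conj a (g ∙ h) ≈ conj a g ∙ conj a h
  conj-∙ = solve 3 (λ a g h → a ⊕ (g ⊕ h) ⊕ ⊖ a ⊜ (a ⊕ g ⊕ ⊖ a) ⊕ (a ⊕ h ⊕ ⊖ a)) refl

  conj-⁻¹ : ∀ a g → conj a (g ⁻¹) ≈ conj a g ⁻¹
  conj-⁻¹ = solve 2 (λ a g → a ⊕ ⊖ g ⊕ ⊖ a ⊜ ⊖ (a ⊕ g ⊕ ⊖ a)) refl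

  conj-ε : ∀ a → conj a ε ≈ ε
  conj-ε = solve 1 (λ a → a ⊕ 𝟙 ⊕ ⊖ a ⊜ 𝟙) refl

  conj-^ : ∀ a g n → conj a (g ^ n) ≈ conj a g ^ n
  conj-^ a g zero = conj-ε a
  conj-^ a g (suc n) = trans (conj-∙ a g (g ^ n)) (∙-congˡ (conj-^ a g n))

  conj-conj : ∀ a b g → conj (a ∙ b) g ≈ conj a (conj b g)
  conj-conj = solve 3 (λ a b g → a ⊕ b ⊕ g ⊕ ⊖ (a ⊕ b) ⊜ a ⊕ (b ⊕ g ⊕ ⊖ b) ⊕ ⊖ a) refl

  conj-by-ε : ∀ g → conj ε g ≈ g
  conj-by-ε = solve 1 (λ g → 𝟙 ⊕ g ⊕ ⊖ 𝟙 ⊜ g) refl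

  conj-comm : ∀ {a g} → Commute a g → conj a g ≈ g
  conj-comm {a} {g} h = trans (∙-congʳ h) (solve 2 (λ a g → g ⊕ a ⊕ ⊖ a ⊜ g) refl a g)

  comm-conj : ∀ {a g} → conj a g ≈ g → Commute a g
  comm-conj {a} {g} h = trans (solve 2 (λ a g → a ⊕ g ⊜ a ⊕ g ⊕ ⊖ a ⊕ a) refl a g) (∙-congʳ h)

  conj-inj : ∀ a {g h} → conj a g ≈ conj a h → g ≈ h
  conj-inj a {g} {h} e = ∙-cancelˡ a g h (∙-cancelʳ (a ⁻¹) _ _ e)

  conj-inv : ∀ a {g h} → conj a g ≈ h → conj (a ⁻¹) h ≈ g
  conj-inv a {g} {h} e = trans (conj-cong (a ⁻¹) (sym e)) (solve 2 (λ a g → ⊖ a ⊕ (a ⊕ g ⊕ ⊖ a) ⊕ ⊖ ⊖ a ⊜ g) refl a g)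

  conj-swap : ∀ {a g h} → conj a g ≈ h → a ∙ g ≈ h ∙ a
  conj-swap {a} {g} {h} e = trans (solve 2 (λ a g → a ⊕ g ⊜ a ⊕ g ⊕ ⊖ a ⊕ a) refl a g) (∙-congʳ e)

  infix 4 _∈⟨_⟩
  -- Only natural exponents occur, so this is the cyclic subgroup once `a` has finite order;
  -- `Periodic` then supplies the inverses.
  _∈⟨_⟩ : Carrier → Carrier → Set
  g ∈⟨ a ⟩ = ∃ λ k → g ≈ a ^ k

  ∈-resp : ∀ {a g h} → g ≈ h → g ∈⟨ a ⟩ → h ∈⟨ a ⟩
  ∈-resp e (k , f) = k , trans (sym e) f

  ∈-ε : ∀ {a} → ε ∈⟨ a ⟩
  ∈-ε = 0 , refl

  ∈-self : ∀ {a} → a ∈⟨ a ⟩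
  ∈-self {a} = 1 , sym (^-1 a)

  ∈-∙ : ∀ {a g h} → g ∈⟨ a ⟩ → h ∈⟨ a ⟩ → g ∙ h ∈⟨ a ⟩
  ∈-∙ {a} (k , e) (l , f) = k ℕ.+ l , trans (∙-cong e f) (sym (^-+ a k l))

  ∈-^ : ∀ {a g} n → g ∈⟨ a ⟩ → g ^ n ∈⟨ a ⟩
  ∈-^ {a} n (k , e) = k ℕ.* n , trans (^-cong n e) (sym (^-* a k n))

  ∈-comm : ∀ {a b g} → g ∈⟨ a ⟩ → Commute b a → Commute b g
  ∈-comm (k , e) h = comm-respʳ (sym e) (comm-^ k h)

  ∈-trans : ∀ {a b g} → g ∈⟨ a ⟩ → a ∈⟨ b ⟩ → g ∈⟨ b ⟩
  ∈-trans (k , e) h = ∈-resp (sym e) (∈-^ k h)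

  conj-∈ : ∀ {a b g s} → g ∈⟨ a ⟩ → conj b a ∈⟨ s ⟩ → conj b g ∈⟨ s ⟩
  conj-∈ {a} {b} (k , e) h = ∈-resp (sym (trans (conj-cong b e) (conj-^ b a k))) (∈-^ k h)

  module _ {g : Carrier} {n : ℕ} (gⁿ : g ^ suc n ≈ ε) where
    ^-invert : ∀ k → (g ^ k) ⁻¹ ≈ g ^ (n ℕ.* k)
    ^-invert k = sym (inverseˡ-unique _ _ (begin
      g ^ (n ℕ.* k) ∙ g ^ k ≈⟨ ^-+ g (n ℕ.* k) k ⟨
      g ^ (n ℕ.* k ℕ.+ k) ≈⟨ ^-≡ g (ℕₚ.+-comm (n ℕ.* k) k) ⟩
      g ^ (suc n ℕ.* k) ≈⟨ ^-* g (suc n) k ⟩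
      (g ^ suc n) ^ k ≈⟨ ^-ε k gⁿ ⟩
      ε ∎))

  module Periodic {g : Carrier} {n : ℕ} .{{n≢0 : ℕ.NonZero n}} (gⁿ : g ^ n ≈ ε) where
    ∈-⁻¹ : ∀ {h} → h ∈⟨ g ⟩ → h ⁻¹ ∈⟨ g ⟩
    ∈-⁻¹ (k , e) = ℕ.pred n ℕ.* k , trans (⁻¹-cong e) (^-invert {n = ℕ.pred n} (trans (^-≡ g (ℕₚ.suc-pred n)) gⁿ) k)

    ^-∣ : ∀ {k} → n ∣ k → g ^ k ≈ ε
    ^-∣ (divides-refl c) = begin
      g ^ (c ℕ.* n) ≈⟨ ^-≡ g (ℕₚ.*-comm c n) ⟩
      g ^ (n ℕ.* c) ≈⟨ ^-* g n c ⟩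
      (g ^ n) ^ c ≈⟨ ^-ε c gⁿ ⟩
      ε ∎

    ^-% : ∀ k → g ^ k ≈ g ^ (k % n)
    ^-% k = begin
      g ^ k ≈⟨ ^-≡ g (m≡m%n+[m/n]*n k n) ⟩
      g ^ (k % n ℕ.+ (k / n) ℕ.* n) ≈⟨ ^-+ g (k % n) _ ⟩
      g ^ (k % n) ∙ g ^ ((k / n) ℕ.* n) ≈⟨ ∙-congˡ (^-∣ (divides-refl (k / n))) ⟩
      g ^ (k % n) ∙ ε ≈⟨ identityʳ _ ⟩
      g ^ (k % n) ∎

    -- Bézout modulo n. With natural coefficients the identity comes in two forms; the second
    -- expresses the power as an inverse, which finite order turns back into a positive power.
    ∈-gcd : ∀ k → g ^ gcd k n ∈⟨ g ^ k ⟩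
    ∈-gcd k with Bézout.identity (gcd-GCD k n)
    ... | Bézout.+- s t e = s , (begin
      g ^ gcd k n ≈⟨ identityʳ _ ⟨
      g ^ gcd k n ∙ ε ≈⟨ ∙-congˡ (^-∣ (divides-refl t)) ⟨
      g ^ gcd k n ∙ g ^ (t ℕ.* n) ≈⟨ ^-+ g (gcd k n) _ ⟨
      g ^ (gcd k n ℕ.+ t ℕ.* n) ≈⟨ ^-≡ g e ⟩
      g ^ (s ℕ.* k) ≈⟨ ^-≡ g (ℕₚ.*-comm s k) ⟩
      g ^ (k ℕ.* s) ≈⟨ ^-* g k s ⟩
      (g ^ k) ^ s ∎)
    ... | Bézout.-+ s t e = ℕ.pred n ℕ.* s , trans (begin
      g ^ gcd k n ≈⟨ inverseˡ-unique _ _ (begin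
        g ^ gcd k n ∙ (g ^ k) ^ s ≈⟨ ∙-congˡ (^-* g k s) ⟨
        g ^ gcd k n ∙ g ^ (k ℕ.* s) ≈⟨ ^-+ g (gcd k n) _ ⟨
        g ^ (gcd k n ℕ.+ k ℕ.* s) ≈⟨ ^-≡ g (≡.cong (gcd k n ℕ.+_) (ℕₚ.*-comm k s)) ⟩
        g ^ (gcd k n ℕ.+ s ℕ.* k) ≈⟨ ^-≡ g e ⟩
        g ^ (t ℕ.* n) ≈⟨ ^-∣ (divides-refl t) ⟩
        ε ∎) ⟩
      ((g ^ k) ^ s) ⁻¹ ∎) (^-invert {n = ℕ.pred n} per s)
      where
      per : (g ^ k) ^ suc (ℕ.pred n) ≈ ε
      per = trans (^-≡ (g ^ k) (ℕₚ.suc-pred n))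
        (trans (sym (^-* g k n)) (^-∣ (divides-refl k)))

  ^-multiple : ∀ {g} s m → g ^ m ≈ ε → g ^ (s ℕ.* m) ≈ ε
  ^-multiple {g} s m h = trans (^-≡ g (ℕₚ.*-comm s m)) (trans (^-* g m s) (^-ε s h))

  coprime-ε : ∀ {g m n} → Coprime m n → g ^ m ≈ ε → g ^ n ≈ ε → g ≈ ε
  coprime-ε {g} {m} {n} c gᵐ gⁿ with coprime-Bézout c
  ... | Bézout.+- s t e = begin
      g ≈⟨ ^-1 g ⟨
      g ^ 1 ≈⟨ identityʳ _ ⟨
      g ^ 1 ∙ ε ≈⟨ ∙-congˡ (^-multiple t n gⁿ) ⟨
      g ^ 1 ∙ g ^ (t ℕ.* n) ≈⟨ ^-+ g 1 (t ℕ.* n) ⟨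
      g ^ (1 ℕ.+ t ℕ.* n) ≈⟨ ^-≡ g e ⟩
      g ^ (s ℕ.* m) ≈⟨ ^-multiple s m gᵐ ⟩
      ε ∎
  ... | Bézout.-+ s t e = begin
      g ≈⟨ ^-1 g ⟨
      g ^ 1 ≈⟨ identityʳ _ ⟨
      g ^ 1 ∙ ε ≈⟨ ∙-congˡ (^-multiple s m gᵐ) ⟨
      g ^ 1 ∙ g ^ (s ℕ.* m) ≈⟨ ^-+ g 1 (s ℕ.* m) ⟨
      g ^ (1 ℕ.+ s ℕ.* m) ≈⟨ ^-≡ g e ⟩
      g ^ (t ℕ.* n) ≈⟨ ^-multiple t n gⁿ ⟩
      ε ∎

  module _ {g : Carrier} {n : ℕ} (order : ∀ k → g ^ k ≈ ε → n ∣ k) where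
    ^-injective-≤ : ∀ {i j} → j ℕ.< n → i ℕ.≤ j → g ^ j ≈ g ^ i → j ≡ i
    ^-injective-≤ {i} {j} j<n i≤j e with j ℕ.∸ i in eq
    ... | zero = ℕₚ.≤-antisym (ℕₚ.m∸n≡0⇒m≤n eq) i≤j
    ... | suc d = contradiction (∣⇒≤ (order (suc d) (∙-cancelʳ (g ^ i) _ _ (begin
      g ^ suc d ∙ g ^ i ≈⟨ ^-+ g (suc d) i ⟨
      g ^ (suc d ℕ.+ i) ≈⟨ ^-≡ g (≡.trans (≡.cong (ℕ._+ i) (≡.sym eq)) (ℕₚ.m∸n+n≡m i≤j)) ⟩
      g ^ j ≈⟨ e ⟩
      g ^ i ≈⟨ identityˡ _ ⟨
      ε ∙ g ^ i ∎)))) (ℕₚ.<⇒≱ (ℕₚ.≤-<-trans (≡.subst (ℕ._≤ j) eq (ℕₚ.m∸n≤m j i)) j<n))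

    ^-injective : ∀ {i j} → i ℕ.< n → j ℕ.< n → g ^ i ≈ g ^ j → i ≡ j
    ^-injective {i} {j} i<n j<n e with ℕₚ.≤-total i j
    ... | inj₁ i≤j = ≡.sym (^-injective-≤ j<n i≤j (sym e))
    ... | inj₂ j≤i = ^-injective-≤ i<n j≤i e

  -- A′⁻¹A = B′B⁻¹ lies in both cyclic groups, hence is trivial.
  factors-unique : ∀ {a b m n} .{{_ : ℕ.NonZero m}} .{{_ : ℕ.NonZero n}} → a ^ m ≈ ε → b ^ n ≈ ε →
    (∀ {g} → g ∈⟨ a ⟩ → g ∈⟨ b ⟩ → g ≈ ε) →
    ∀ {A A′ B B′} → A ∈⟨ a ⟩ → A′ ∈⟨ a ⟩ → B ∈⟨ b ⟩ → B′ ∈⟨ b ⟩ → A ∙ B ≈ A′ ∙ B′ → A ≈ A′ × B ≈ B′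
  factors-unique {m = m} {n = n} aᵐ bⁿ trivial {A} {A′} {B} {B′} A∈ A′∈ B∈ B′∈ e = A≈A′ , ∙-cancelˡ A _ _ (trans e (∙-congʳ (sym A≈A′)))
    where
    quot : A′ ⁻¹ ∙ A ≈ B′ ∙ B ⁻¹
    quot = trans (solve 3 (λ a A B → ⊖ a ⊕ A ⊜ ⊖ a ⊕ (A ⊕ B) ⊕ ⊖ B) refl A′ A B)
      (trans (∙-congʳ (∙-congˡ e)) (solve 3 (λ a b B → ⊖ a ⊕ (a ⊕ b) ⊕ ⊖ B ⊜ b ⊕ ⊖ B) refl A′ B′ B))
    A≈A′ : A ≈ A′
    A≈A′ = ∙-cancelˡ (A′ ⁻¹) _ _ (trans (trivial (∈-∙ (Periodic.∈-⁻¹ {n = m} aᵐ A′∈) A∈)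
      (∈-resp (sym quot) (∈-∙ B′∈ (Periodic.∈-⁻¹ {n = n} bⁿ B∈)))) (sym (inverseˡ A′)))

-- Words and tight groups

Word : Set
Word = List (Bool × Bool)

-- The automorphism of the free group inverting both generators: unlike in `invert`, the letters
-- keep their order.
mirror : Word → Word
mirror = map (λ (g , s) → g , not s)

invert : Word → Word
invert [] = []
invert ((g , s) ∷ w) = invert w ++ (g , not s) ∷ []

mirror-++ : ∀ v w → mirror (v ++ w) ≡ mirror v ++ mirror w
mirror-++ [] w = ≡.refl
mirror-++ (_ ∷ v) w = ≡.cong (_ ∷_) (mirror-++ v w)

mirror-invert : ∀ w → mirror (invert w) ≡ invert (mirror w)
mirror-invert [] = ≡.refl
mirror-invert (_ ∷ w) = ≡.trans (mirror-++ (invert w) _) (≡.cong (_++ _) (mirror-invert w))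

mirror-mirror : ∀ w → mirror (mirror w) ≡ w
mirror-mirror [] = ≡.refl
mirror-mirror ((g , s) ∷ w) = ≡.cong₂ _∷_ (≡.cong (g ,_) (not-involutive s)) (mirror-mirror w)

module Evaluation (G : Group 0ℓ 0ℓ) (x y : Group.Carrier G) where
  open Group G
  open GroupSolver G
  open import Algebra.Properties.Group G
  open import Relation.Binary.Reasoning.Setoid setoid

  generator : Bool → Carrier
  generator false = x
  generator true = y

  ev : Word → Carrier
  ev [] = ε
  ev ((g , s) ∷ w) = signed s (generator g) ∙ ev w

  ev-++ : ∀ v w → ev (v ++ w) ≈ ev v ∙ ev w
  ev-++ [] w = sym (identityˡ _)
  ev-++ (_ ∷ v) w = trans (∙-congˡ (ev-++ v w)) (sym (assoc _ _ _))

  signed-not : ∀ s g → signed (not s) g ≈ signed s g ⁻¹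
  signed-not false g = refl
  signed-not true g = sym (⁻¹-involutive g)

  ev-invert : ∀ w → ev (invert w) ≈ ev w ⁻¹
  ev-invert [] = sym ε⁻¹≈ε
  ev-invert ((g , s) ∷ w) = begin
    ev (invert w ++ (g , not s) ∷ []) ≈⟨ ev-++ (invert w) _ ⟩
    ev (invert w) ∙ (signed (not s) (generator g) ∙ ε) ≈⟨ ∙-cong (ev-invert w) (trans (identityʳ _) (signed-not s _)) ⟩
    ev w ⁻¹ ∙ signed s (generator g) ⁻¹ ≈⟨ ⁻¹-anti-homo-∙ _ _ ⟨
    (signed s (generator g) ∙ ev w) ⁻¹ ∎

  -- A relation and not a function: until regularity is known, the mirror image of an element
  -- depends on the word chosen for it.
  Mirror : Carrier → Carrier → Set
  Mirror g h = ∃ λ w → ev w ≈ g × ev (mirror w) ≈ h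

  mirror-ε : Mirror ε ε
  mirror-ε = [] , refl , refl

  mirror-x : Mirror x (x ⁻¹)
  mirror-x = (false , false) ∷ [] , identityʳ _ , identityʳ _

  mirror-y : Mirror y (y ⁻¹)
  mirror-y = (true , false) ∷ [] , identityʳ _ , identityʳ _

  mirror-∙ : ∀ {a a′ b b′} → Mirror a a′ → Mirror b b′ → Mirror (a ∙ b) (a′ ∙ b′)
  mirror-∙ (v , e , e′) (w , f , f′) = v ++ w , trans (ev-++ v w) (∙-cong e f) ,
    trans (reflexive (≡.cong ev (mirror-++ v w))) (trans (ev-++ (mirror v) (mirror w)) (∙-cong e′ f′))

  mirror-⁻¹ : ∀ {a a′} → Mirror a a′ → Mirror (a ⁻¹) (a′ ⁻¹)
  mirror-⁻¹ (w , e , e′) = invert w , trans (ev-invert w) (⁻¹-cong e) ,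
    trans (reflexive (≡.cong ev (mirror-invert w))) (trans (ev-invert (mirror w)) (⁻¹-cong e′))

  open GroupPowers G
  mirror-^ : ∀ {a a′} n → Mirror a a′ → Mirror (a ^ n) (a′ ^ n)
  mirror-^ zero m = mirror-ε
  mirror-^ (suc n) m = mirror-∙ m (mirror-^ n m)

  -- The quotient by N admits the automorphism inverting both generators.
  RegularModulo : (Carrier → Set) → Set
  RegularModulo N = ∀ w → N (ev w) → N (ev (mirror w))

-- Equality of the group is not assumed decidable: `factor`, the exact orders and `meet` reduce
-- every equation to divisibility of exponents.
record TightGroup (p q : ℕ) : Set₁ where
  field
    group : Group 0ℓ 0ℓ
  open Group group public
  open GroupPowers group public
  field
    x y : Carrier
    instance
      p≢0 : NonZero p
      q≢0 : NonZero q
    involution : (x ∙ y) ∙ (x ∙ y) ≈ ε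
    x-period : x ^ p ≈ ε
    y-period : y ^ q ≈ ε
    x-order : ∀ a → x ^ a ≈ ε → p ∣ a
    y-order : ∀ b → y ^ b ≈ ε → q ∣ b
    factor : ∀ g → ∃₂ λ a b → g ≈ x ^ a ∙ y ^ b
    meet : ∀ a b → x ^ a ≈ y ^ b → x ^ a ≈ ε
  open Evaluation group x y public

  Regular⁺ : Set
  Regular⁺ = RegularModulo (_≈ ε)

module Theory {p q : ℕ} (T : TightGroup p q) where
  open TightGroup T
  open GroupSolver group
  open import Algebra.Properties.Group group
  open import Relation.Binary.Reasoning.Setoid setoid
  open Periodic x-period public renaming (∈-⁻¹ to ∈x-⁻¹; ^-∣ to x^-∣; ^-% to x^-%; ∈-gcd to ∈x-gcd)
  open Periodic y-period public renaming (∈-⁻¹ to ∈y-⁻¹; ^-∣ to y^-∣; ^-% to y^-%; ∈-gcd to ∈y-gcd)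

  y⁻¹∈ : ∀ b → ∃ λ b′ → (y ^ b) ⁻¹ ≈ y ^ b′
  y⁻¹∈ b = ∈y-⁻¹ (b , refl)

  x⁻¹∈ : ∀ a → ∃ λ a′ → (x ^ a) ⁻¹ ≈ x ^ a′
  x⁻¹∈ a = ∈x-⁻¹ (a , refl)

  meet∈ : ∀ {g} → g ∈⟨ x ⟩ → g ∈⟨ y ⟩ → g ≈ ε
  meet∈ (a , e) (b , f) = trans e (meet a b (trans (sym e) f))

  factorʳ : ∀ g → ∃₂ λ b a → g ≈ y ^ b ∙ x ^ a
  factorʳ g with factor (g ⁻¹)
  ... | a , b , e with y⁻¹∈ b | x⁻¹∈ a
  ... | b′ , f | a′ , h = b′ , a′ , (begin
    g ≈⟨ ⁻¹-involutive g ⟨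
    g ⁻¹ ⁻¹ ≈⟨ ⁻¹-cong e ⟩
    (x ^ a ∙ y ^ b) ⁻¹ ≈⟨ ⁻¹-anti-homo-∙ _ _ ⟩
    (y ^ b) ⁻¹ ∙ (x ^ a) ⁻¹ ≈⟨ ∙-cong f h ⟩
    y ^ b′ ∙ x ^ a′ ∎)

  split-ε : ∀ {A B} → A ∈⟨ x ⟩ → B ∈⟨ y ⟩ → A ∙ B ≈ ε → A ≈ ε × B ≈ ε
  split-ε {A} {B} A∈ B∈ e = a≈ε , trans (sym (identityˡ B)) (trans (∙-congʳ (sym a≈ε)) e)
    where
    a≈ε : A ≈ ε
    a≈ε = meet∈ A∈ (∈-resp (sym (inverseˡ-unique _ _ e)) (∈y-⁻¹ B∈))

  split-εʳ : ∀ {A B} → B ∈⟨ y ⟩ → A ∈⟨ x ⟩ → B ∙ A ≈ ε → A ≈ ε × B ≈ ε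
  split-εʳ {A} {B} B∈ A∈ e = split-ε A∈ B∈ (trans (solve 2 (λ A B → A ⊕ B ⊜ ⊖ B ⊕ (B ⊕ A) ⊕ B) refl A B)
    (trans (∙-congʳ (trans (∙-congˡ e) (identityʳ _))) (inverseˡ B)))

  ε? : ∀ g → Dec (g ≈ ε)
  ε? g with factor g
  ... | a , b , e with p ∣? a | q ∣? b
  ... | yes u | yes v = yes (trans e (trans (∙-cong (x^-∣ u) (y^-∣ v)) (identityˡ ε)))
  ... | no ¬u | _ = no λ f → ¬u (x-order a (proj₁ (split-ε (a , refl) (b , refl) (trans (sym e) f))))
  ... | _ | no ¬v = no λ f → ¬v (y-order b (proj₂ (split-ε (a , refl) (b , refl) (trans (sym e) f))))

  _≈?_ : ∀ g h → Dec (g ≈ h)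
  g ≈? h = map′ (x∙y⁻¹≈ε⇒x≈y g h) x≈y⇒x∙y⁻¹≈ε (ε? (g ∙ h ⁻¹))

  x^-≈-∣ : ∀ {n} a b → n ∣ p → n ∣ b → x ^ a ≈ x ^ b → n ∣ a
  x^-≈-∣ {n} a b n∣p n∣b e = ∣m+n∣m⇒∣n (∣-trans n∣p (x-order (ℕ.pred p ℕ.* b ℕ.+ a) (begin
    x ^ (ℕ.pred p ℕ.* b ℕ.+ a) ≈⟨ ^-+ x (ℕ.pred p ℕ.* b) a ⟩
    x ^ (ℕ.pred p ℕ.* b) ∙ x ^ a ≈⟨ ∙-cong (sym (^-invert {n = ℕ.pred p} (trans (^-≡ x (ℕₚ.suc-pred p)) x-period) b)) e ⟩
    (x ^ b) ⁻¹ ∙ x ^ b ≈⟨ inverseˡ _ ⟩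
    ε ∎))) (∣n⇒∣m*n (ℕ.pred p) n∣b)

  ∈x^⇒∣ : ∀ {n} a b → n ∣ p → x ^ a ∙ y ^ b ∈⟨ x ^ n ⟩ → n ∣ a × q ∣ b
  ∈x^⇒∣ {n} a b n∣p (k , e) =
    x^-≈-∣ a (n ℕ.* k) n∣p (m∣m*n k) (trans (sym (identityʳ _)) (trans (∙-congˡ (sym y≈ε)) e′)) , y-order b y≈ε
    where
    e′ : x ^ a ∙ y ^ b ≈ x ^ (n ℕ.* k)
    e′ = trans e (sym (^-* x n k))
    y≈ε : y ^ b ≈ ε
    y≈ε = meet∈ (∈-resp (trans (∙-congˡ (sym e′)) (\\-leftDividesʳ _ _))
      (∈-∙ (x⁻¹∈ a) (n ℕ.* k , refl))) (b , refl)

  ∣⇒∈x^ : ∀ {n} a b → n ∣ a × q ∣ b → x ^ a ∙ y ^ b ∈⟨ x ^ n ⟩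
  ∣⇒∈x^ {n} _ b (divides-refl k , v) = k , (begin
    x ^ (k ℕ.* n) ∙ y ^ b ≈⟨ ∙-cong (^-≡ x (ℕₚ.*-comm k n)) (y^-∣ v) ⟩
    x ^ (n ℕ.* k) ∙ ε ≈⟨ identityʳ _ ⟩
    x ^ (n ℕ.* k) ≈⟨ ^-* x n k ⟩
    (x ^ n) ^ k ∎)

  ∈x^? : ∀ n → n ∣ p → ∀ g → Dec (g ∈⟨ x ^ n ⟩)
  ∈x^? n n∣p g with factor g
  ... | a , b , e = map′ (∈-resp (sym e) ∘ ∣⇒∈x^ a b) (∈x^⇒∣ a b n∣p ∘ ∈-resp e) (n ∣? a ×-dec q ∣? b)

  -- B′ and A′ play the role of y^b′ and x^a′ in the criterion x y^b = y^b′ x^a′ ⇒ x⁻¹ y^-b = y^-b′ x^-a′.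
  MirroredSwap : Carrier → Set
  MirroredSwap B = ∃₂ λ B′ A′ → B′ ∈⟨ y ⟩ × A′ ∈⟨ x ⟩ × x ∙ B ≈ B′ ∙ A′ × x ⁻¹ ∙ B ⁻¹ ≈ B′ ⁻¹ ∙ A′ ⁻¹

  module _ (swap : ∀ B → B ∈⟨ y ⟩ → MirroredSwap B) where
    MirroredForm : Word → Set
    MirroredForm w = ∃₂ λ B A → B ∈⟨ y ⟩ × A ∈⟨ x ⟩ × ev w ≈ B ∙ A × ev (mirror w) ≈ B ⁻¹ ∙ A ⁻¹

    y-letter : ∀ s {B A w} → s ∈⟨ y ⟩ → B ∈⟨ y ⟩ → A ∈⟨ x ⟩ → ev w ≈ B ∙ A → ev (mirror w) ≈ B ⁻¹ ∙ A ⁻¹ →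
      ∃₂ λ B A → B ∈⟨ y ⟩ × A ∈⟨ x ⟩ × s ∙ ev w ≈ B ∙ A × s ⁻¹ ∙ ev (mirror w) ≈ B ⁻¹ ∙ A ⁻¹
    y-letter s {B} {A} {w} s∈ B∈ A∈ e f = s ∙ B , A , ∈-∙ s∈ B∈ , A∈ , trans (∙-congˡ e) (sym (assoc _ _ _)) , (begin
      s ⁻¹ ∙ ev (mirror w) ≈⟨ ∙-congˡ f ⟩
      s ⁻¹ ∙ (B ⁻¹ ∙ A ⁻¹) ≈⟨ solve 3 (λ s B A → ⊖ s ⊕ (⊖ B ⊕ ⊖ A) ⊜ ⊖ (B ⊕ s) ⊕ ⊖ A) refl s B A ⟩
      (B ∙ s) ⁻¹ ∙ A ⁻¹ ≈⟨ ∙-congʳ (⁻¹-cong (∈-comm s∈ (comm-sym (∈-comm B∈ comm-refl)))) ⟩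
      (s ∙ B) ⁻¹ ∙ A ⁻¹ ∎)

    -- Letters are absorbed from the left: y merges into B because ⟨y⟩ is abelian, x passes B by
    -- `swap B`, and x⁻¹ passes B by `swap (B ⁻¹)`, whose two equations then exchange their roles.
    mirroredForm : ∀ w → MirroredForm w
    mirroredForm [] = ε , ε , ∈-ε , ∈-ε , sym (identityˡ ε) , solve 0 (𝟙 ⊜ ⊖ 𝟙 ⊕ ⊖ 𝟙) refl
    mirroredForm ((g , s) ∷ w) with mirroredForm w
    mirroredForm ((true , false) ∷ w) | B , A , B∈ , A∈ , e , f = y-letter y {w = w} ∈-self B∈ A∈ e f
    mirroredForm ((true , true) ∷ w) | B , A , B∈ , A∈ , e , f
      with B′ , A′ , B′∈ , A′∈ , e′ , f′ ← y-letter (y ⁻¹) {w = w} (∈y-⁻¹ ∈-self) B∈ A∈ e f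
      = B′ , A′ , B′∈ , A′∈ , e′ , trans (∙-congʳ (sym (⁻¹-involutive y))) f′
    mirroredForm ((false , false) ∷ w) | B , A , B∈ , A∈ , e , f
      with B′ , A′ , B′∈ , A′∈ , e′ , f′ ← swap B B∈
      = B′ , A′ ∙ A , B′∈ , ∈-∙ A′∈ A∈ , (begin
        x ∙ ev w ≈⟨ ∙-congˡ e ⟩
        x ∙ (B ∙ A) ≈⟨ assoc _ _ _ ⟨
        x ∙ B ∙ A ≈⟨ ∙-congʳ e′ ⟩
        B′ ∙ A′ ∙ A ≈⟨ assoc _ _ _ ⟩
        B′ ∙ (A′ ∙ A) ∎) , (begin
        x ⁻¹ ∙ ev (mirror w) ≈⟨ ∙-congˡ f ⟩
        x ⁻¹ ∙ (B ⁻¹ ∙ A ⁻¹) ≈⟨ assoc _ _ _ ⟨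
        x ⁻¹ ∙ B ⁻¹ ∙ A ⁻¹ ≈⟨ ∙-congʳ f′ ⟩
        B′ ⁻¹ ∙ A′ ⁻¹ ∙ A ⁻¹ ≈⟨ solve 3 (λ B A′ A → ⊖ B ⊕ ⊖ A′ ⊕ ⊖ A ⊜ ⊖ B ⊕ ⊖ (A ⊕ A′)) refl B′ A′ A ⟩
        B′ ⁻¹ ∙ (A ∙ A′) ⁻¹ ≈⟨ ∙-congˡ (⁻¹-cong (∈-comm A′∈ (comm-sym (∈-comm A∈ comm-refl)))) ⟩
        B′ ⁻¹ ∙ (A′ ∙ A) ⁻¹ ∎)
    mirroredForm ((false , true) ∷ w) | B , A , B∈ , A∈ , e , f
      with B′ , A′ , B′∈ , A′∈ , e′ , f′ ← swap (B ⁻¹) (∈y-⁻¹ B∈)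
      = B′ ⁻¹ , A′ ⁻¹ ∙ A , ∈y-⁻¹ B′∈ , ∈-∙ (∈x-⁻¹ A′∈) A∈ , (begin
        x ⁻¹ ∙ ev w ≈⟨ ∙-congˡ e ⟩
        x ⁻¹ ∙ (B ∙ A) ≈⟨ solve 3 (λ x B A → ⊖ x ⊕ (B ⊕ A) ⊜ ⊖ x ⊕ ⊖ ⊖ B ⊕ A) refl x B A ⟩
        x ⁻¹ ∙ B ⁻¹ ⁻¹ ∙ A ≈⟨ ∙-congʳ f′ ⟩
        B′ ⁻¹ ∙ A′ ⁻¹ ∙ A ≈⟨ assoc _ _ _ ⟩
        B′ ⁻¹ ∙ (A′ ⁻¹ ∙ A) ∎) , (begin
        x ∙ ev (mirror w) ≈⟨ ∙-congˡ f ⟩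
        x ∙ (B ⁻¹ ∙ A ⁻¹) ≈⟨ assoc _ _ _ ⟨
        x ∙ B ⁻¹ ∙ A ⁻¹ ≈⟨ ∙-congʳ e′ ⟩
        B′ ∙ A′ ∙ A ⁻¹ ≈⟨ assoc _ _ _ ⟩
        B′ ∙ (A′ ∙ A ⁻¹) ≈⟨ ∙-congˡ (comm-⁻¹ (∈-comm A∈ (comm-sym (∈-comm A′∈ comm-refl)))) ⟩
        B′ ∙ (A ⁻¹ ∙ A′) ≈⟨ solve 3 (λ B A′ A → B ⊕ (⊖ A ⊕ A′) ⊜ ⊖ ⊖ B ⊕ ⊖ (⊖ A′ ⊕ A)) refl B′ A′ A ⟩
        B′ ⁻¹ ⁻¹ ∙ (A′ ⁻¹ ∙ A) ⁻¹ ∎)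

    -- A word and its mirror image have the forms BA and B⁻¹A⁻¹ with the same factors, and BA = ε
    -- forces both factors to be trivial.
    swap⇒regular : Regular⁺
    swap⇒regular w h with mirroredForm w
    ... | B , A , B∈ , A∈ , e , f with split-εʳ B∈ A∈ (trans (sym e) h)
    ... | A≈ε , B≈ε = trans f (trans (∙-cong (⁻¹-cong B≈ε) (⁻¹-cong A≈ε)) (solve 0 (⊖ 𝟙 ⊕ ⊖ 𝟙 ⊜ 𝟙) refl))

  swap-mirror : ∀ {N} → RegularModulo N → (∀ {g h} → g ≈ h → N g → N h) →
    ∀ {g h} → Mirror g h → N g → N h
  swap-mirror reg resp (w , e , f) Ng = resp f (reg w (resp (sym e) Ng))

  SwapsAt : ℕ → Set
  SwapsAt b = let b′ , a′ , _ = factorʳ (x ∙ y ^ b) in x ⁻¹ ∙ (y ^ b) ⁻¹ ≈ (y ^ b′) ⁻¹ ∙ (x ^ a′) ⁻¹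

  swapsAt? : ∀ b → Dec (SwapsAt b)
  swapsAt? b = _ ≈? _

  -- Exponents of y count modulo q, so finitely many swaps suffice for `swap⇒regular`. Conversely
  -- each swap equation is a relator, and regularity gives its mirror image.
  regular? : Dec Regular⁺
  regular? with all? {n = q} (swapsAt? ∘ toℕ)
  ... | yes h = yes (swap⇒regular λ where
    B (b , e) →
      let r = b % q
          i = fromℕ< (m%n<n b q)
          b′ , a′ , eq = factorʳ (x ∙ y ^ toℕ i)
          B≈ : B ≈ y ^ toℕ i
          B≈ = trans e (trans (y^-% b) (^-≡ y (≡.sym (toℕ-fromℕ< (m%n<n b q)))))
      in y ^ b′ , x ^ a′ , (b′ , refl) , (a′ , refl) , trans (∙-congˡ B≈) eq , trans (∙-congˡ (⁻¹-cong B≈)) (h i))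
  ... | no ¬h = no λ reg → ¬h λ b →
    let b′ , a′ , eq = factorʳ (x ∙ y ^ toℕ b)
        m = mirror-∙ (mirror-∙ mirror-x (mirror-^ (toℕ b) mirror-y))
              (mirror-⁻¹ (mirror-∙ (mirror-^ b′ mirror-y) (mirror-^ a′ mirror-x)))
    in trans (∙-congˡ (sym (^-⁻¹ y (toℕ b)))) (trans
         (x∙y⁻¹≈ε⇒x≈y _ _ (swap-mirror reg (λ e f → trans (sym e) f) m (x≈y⇒x∙y⁻¹≈ε eq)))
         (∙-cong (^-⁻¹ y b′) (^-⁻¹ x a′)))

  -- B and xBx⁻¹ both commute with y, so conjugating B by (xy)² = ε has the same effect as
  -- conjugating by x².
  involution-conj : ∀ {B} → B ∈⟨ y ⟩ → conj x B ∈⟨ y ⟩ → Commute (x ∙ x) B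
  involution-conj {B} B∈ C∈ = comm-conj (begin
    conj (x ∙ x) B ≈⟨ conj-conj x x B ⟩
    conj x (conj x B) ≈⟨ conj-cong x (conj-cong x (conj-comm (∈-comm B∈ comm-refl))) ⟨
    conj x (conj x (conj y B)) ≈⟨ conj-cong x (conj-comm (∈-comm (∈-resp (conj-cong x (sym (conj-comm (∈-comm B∈ comm-refl)))) C∈) comm-refl)) ⟨
    conj x (conj y (conj x (conj y B))) ≈⟨ solve 3 (λ x y B → x ⊕ (y ⊕ (x ⊕ (y ⊕ B ⊕ ⊖ y) ⊕ ⊖ x) ⊕ ⊖ y) ⊕ ⊖ x ⊜
         (x ⊕ y) ⊕ (x ⊕ y) ⊕ B ⊕ ⊖ ((x ⊕ y) ⊕ (x ⊕ y))) refl x y B ⟩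
    conj ((x ∙ y) ∙ (x ∙ y)) B ≈⟨ conj-congˡ B involution ⟩
    conj ε B ≈⟨ conj-by-ε B ⟩
    B ∎)

exchange : Word → Word
exchange = map (λ (g , s) → not g , s)

mirror-exchange : ∀ w → mirror (exchange w) ≡ exchange (mirror w)
mirror-exchange [] = ≡.refl
mirror-exchange (_ ∷ w) = ≡.cong (_ ∷_) (mirror-exchange w)

exchange-exchange : ∀ w → exchange (exchange w) ≡ w
exchange-exchange [] = ≡.refl
exchange-exchange ((g , s) ∷ w) = ≡.cong₂ _∷_ (≡.cong (_, s) (not-involutive g)) (exchange-exchange w)

module _ {p q : ℕ} (T : TightGroup p q) where
  open TightGroup T
  open Theory T
  open GroupSolver group
  open import Algebra.Properties.Group group
  open import Relation.Binary.Reasoning.Setoid setoid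

  dual : TightGroup q p
  dual = record
    { group = group ; x = y ; y = x
    ; p≢0 = q≢0 ; q≢0 = p≢0
    ; involution = begin
        y ∙ x ∙ (y ∙ x) ≈⟨ solve 2 (λ x y → y ⊕ x ⊕ (y ⊕ x) ⊜ ⊖ x ⊕ (x ⊕ y ⊕ (x ⊕ y)) ⊕ x) refl x y ⟩
        x ⁻¹ ∙ (x ∙ y ∙ (x ∙ y)) ∙ x ≈⟨ ∙-congʳ (∙-congˡ involution) ⟩
        x ⁻¹ ∙ ε ∙ x ≈⟨ solve 1 (λ x → ⊖ x ⊕ 𝟙 ⊕ x ⊜ 𝟙) refl x ⟩
        ε ∎
    ; x-period = y-period ; y-period = x-period
    ; x-order = y-order ; y-order = x-order
    ; factor = factorʳ
    ; meet = λ b a e → trans e (meet a b (sym e))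
    }

  ev-dual : ∀ w → TightGroup.ev dual (exchange w) ≡ ev w
  ev-dual [] = ≡.refl
  ev-dual ((false , s) ∷ w) = ≡.cong (_ ∙_) (ev-dual w)
  ev-dual ((true , s) ∷ w) = ≡.cong (_ ∙_) (ev-dual w)

  ev-dual′ : ∀ w → TightGroup.ev dual w ≡ ev (exchange w)
  ev-dual′ w = ≡.trans (≡.cong (TightGroup.ev dual) (≡.sym (exchange-exchange w))) (ev-dual (exchange w))

  undual-regular : ∀ N → TightGroup.RegularModulo dual N → RegularModulo N
  undual-regular N reg w h = ≡.subst N
    (≡.trans (≡.cong (TightGroup.ev dual) (mirror-exchange w)) (ev-dual (mirror w)))
    (reg (exchange w) (≡.subst N (≡.sym (ev-dual w)) h))

-- Quotients by normal subgroups of ⟨x⟩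

module Quotient (G : Group 0ℓ 0ℓ) (N : Group.Carrier G → Set)
  (resp : ∀ {g h} → Group._≈_ G g h → N g → N h) (N-ε : N (Group.ε G))
  (N-∙ : ∀ {g h} → N g → N h → N (Group._∙_ G g h))
  (N-⁻¹ : ∀ {g} → N g → N (Group._⁻¹ G g))
  (N-conj : ∀ a {g} → N g → N (GroupPowers.conj G a g)) where
  open Group G
  open GroupSolver G
  open import Algebra.Properties.Group G

  infix 4 _≈′_
  -- The carrier is kept and only the equality is coarsened, so powers and values of words in the
  -- quotient are the old ones.
  _≈′_ : Carrier → Carrier → Set
  g ≈′ h = N (g ∙ h ⁻¹)

  ≈⇒≈′ : ∀ {g h} → g ≈ h → g ≈′ h
  ≈⇒≈′ e = resp (sym (x≈y⇒x∙y⁻¹≈ε e)) N-ε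

  ≈′ε⇒ : ∀ {g} → g ≈′ ε → N g
  ≈′ε⇒ {g} = resp (solve 1 (λ g → g ⊕ ⊖ 𝟙 ⊜ g) refl g)

  ⇒≈′ε : ∀ {g} → N g → g ≈′ ε
  ⇒≈′ε {g} = resp (solve 1 (λ g → g ⊜ g ⊕ ⊖ 𝟙) refl g)

  quotient : Group 0ℓ 0ℓ
  quotient = record
    { Carrier = Carrier ; _≈_ = _≈′_ ; _∙_ = _∙_ ; ε = ε ; _⁻¹ = _⁻¹
    ; isGroup = record
      { isMonoid = record
        { isSemigroup = record
          { isMagma = record
            { isEquivalence = record
              { refl = ≈⇒≈′ refl
              ; sym = λ {g} {h} n → resp (solve 2 (λ g h → ⊖ (g ⊕ ⊖ h) ⊜ h ⊕ ⊖ g) refl g h) (N-⁻¹ n)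
              ; trans = λ {g} {h} {k} m n → resp (solve 3 (λ g h k → g ⊕ ⊖ h ⊕ (h ⊕ ⊖ k) ⊜ g ⊕ ⊖ k) refl g h k) (N-∙ m n) }
            ; ∙-cong = λ {a} {b} {c} {d} m n →
                resp (solve 4 (λ a b c d → a ⊕ (c ⊕ ⊖ d) ⊕ ⊖ a ⊕ (a ⊕ ⊖ b) ⊜ a ⊕ c ⊕ ⊖ (b ⊕ d)) refl a b c d)
                  (N-∙ (N-conj a n) m) }
          ; assoc = λ a b c → ≈⇒≈′ (assoc a b c) }
        ; identity = (λ a → ≈⇒≈′ (identityˡ a)) , (λ a → ≈⇒≈′ (identityʳ a)) }
      ; inverse = (λ a → ≈⇒≈′ (inverseˡ a)) , (λ a → ≈⇒≈′ (inverseʳ a))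
      ; ⁻¹-cong = λ {a} {b} n →
          resp (solve 2 (λ a b → ⊖ a ⊕ ⊖ (a ⊕ ⊖ b) ⊕ ⊖ ⊖ a ⊜ ⊖ a ⊕ ⊖ ⊖ b) refl a b) (N-conj (a ⁻¹) (N-⁻¹ n)) } }

  ^-quotient : ∀ g n → GroupPowers._^_ quotient g n ≡ GroupPowers._^_ G g n
  ^-quotient g zero = ≡.refl
  ^-quotient g (suc n) = ≡.cong (g ∙_) (^-quotient g n)

  ev-quotient : ∀ x y w → Evaluation.ev quotient x y w ≡ Evaluation.ev G x y w
  ev-quotient x y [] = ≡.refl
  ev-quotient x y ((false , false) ∷ w) = ≡.cong (_ ∙_) (ev-quotient x y w)
  ev-quotient x y ((false , true) ∷ w) = ≡.cong (_ ∙_) (ev-quotient x y w)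
  ev-quotient x y ((true , false) ∷ w) = ≡.cong (_ ∙_) (ev-quotient x y w)
  ev-quotient x y ((true , true) ∷ w) = ≡.cong (_ ∙_) (ev-quotient x y w)

infix 4 _⇒_
-- Inclusion of relators stands for a homomorphism matching the generators.
_⇒_ : ∀ {p q p′ q′} → TightGroup p q → TightGroup p′ q′ → Set
T ⇒ T′ = ∀ w → T.ev w T.≈ T.ε → T′.ev w T′.≈ T′.ε
  where module T = TightGroup T
        module T′ = TightGroup T′

-- Containment under y alone suffices: x centralises ⟨x^n⟩, and every element is a product of
-- natural powers of x and y.
NormalX : ∀ {p q} → TightGroup p q → ℕ → Set
NormalX T n = conj y (x ^ n) ∈⟨ x ^ n ⟩
  where open TightGroup T

module QuotientX {p q : ℕ} (T : TightGroup p q) (n : ℕ) (n∣p : n ∣ p)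
  (normal : NormalX T n) where
  open TightGroup T
  open Theory T
  open import Algebra.Properties.Group group
  open import Relation.Binary.Reasoning.Setoid setoid

  N : Carrier → Set
  N = _∈⟨ x ^ n ⟩

  N-⁻¹ : ∀ {g} → N g → N (g ⁻¹)
  N-⁻¹ {g} = Periodic.∈-⁻¹ {n = p} (trans (sym (^-* x n p)) (x^-∣ (∣n⇒∣m*n n ∣-refl)))

  N-y : ∀ b {g} → N g → N (conj (y ^ b) g)
  N-y zero h = ∈-resp (sym (conj-by-ε _)) h
  N-y (suc b) {g} h = ∈-resp (sym (conj-conj y (y ^ b) g)) (conj-∈ (N-y b h) normal)

  N-conj : ∀ a {g} → N g → N (conj a g)
  N-conj a {g} h with factor a
  ... | i , j , e = ∈-resp (begin
    conj (y ^ j) g ≈⟨ conj-comm (∈-comm (N-y j h) (comm-^^ x i n)) ⟨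
    conj (x ^ i) (conj (y ^ j) g) ≈⟨ conj-conj (x ^ i) (y ^ j) g ⟨
    conj (x ^ i ∙ y ^ j) g ≈⟨ conj-congˡ g e ⟨
    conj a g ∎) (N-y j h)

  open Quotient group N ∈-resp ∈-ε ∈-∙ N-⁻¹ N-conj

  pow : ∀ g k → GroupPowers._^_ quotient g k ≡ g ^ k
  pow = ^-quotient

  n≢0 : NonZero n
  n≢0 = ℕ.≢-nonZero λ { ≡.refl → ℕ.≢-nonZero⁻¹ p (0∣⇒≡0 n∣p) }

  quotientX : TightGroup n q
  quotientX = record
    { group = quotient ; x = x ; y = y ; p≢0 = n≢0 ; q≢0 = q≢0
    ; involution = ≈⇒≈′ involution
    ; x-period = ≡.subst (_≈′ ε) (≡.sym (pow x n)) (⇒≈′ε (1 , sym (^-1 _)))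
    ; y-period = ≡.subst (_≈′ ε) (≡.sym (pow y q)) (≈⇒≈′ y-period)
    ; x-order = λ a e → proj₁ (∈x^⇒∣ a 0 n∣p (∈-resp (sym (identityʳ _)) (≈′ε⇒ (≡.subst (_≈′ ε) (pow x a) e))))
    ; y-order = λ b e → proj₂ (∈x^⇒∣ 0 b n∣p (∈-resp (sym (identityˡ _)) (≈′ε⇒ (≡.subst (_≈′ ε) (pow y b) e))))
    ; factor = λ g → let a , b , e = factor g in
        a , b , ≈⇒≈′ (trans e (reflexive (≡.sym (≡.cong₂ _∙_ (pow x a) (pow y b)))))
    ; meet = λ a b e → let
          e′ = ≡.subst₂ _≈′_ (pow x a) (pow y b) e
          b′ , f = y⁻¹∈ b
          u , v = ∈x^⇒∣ a b′ n∣p (∈-resp (∙-congˡ f) e′)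
        in ≡.subst (_≈′ ε) (≡.sym (pow x a))
             (⇒≈′ε (∈-resp (identityʳ _) (∣⇒∈x^ a 0 (u , divides-refl 0))))
    }

  ⇒quotientX : T ⇒ quotientX
  ⇒quotientX w e = ≡.subst (_≈′ ε) (≡.sym (ev-quotient x y w)) (≈⇒≈′ e)

  regular⇒ : TightGroup.Regular⁺ quotientX → RegularModulo N
  regular⇒ reg w h = ≈′ε⇒ (≡.subst (_≈′ ε) (ev-quotient x y (mirror w))
    (reg w (≡.subst (_≈′ ε) (≡.sym (ev-quotient x y w)) (⇒≈′ε h))))

  ⇒regular : RegularModulo N → TightGroup.Regular⁺ quotientX
  ⇒regular reg w h = ≡.subst (_≈′ ε) (≡.sym (ev-quotient x y (mirror w)))
    (⇒≈′ε (reg w (≈′ε⇒ (≡.subst (_≈′ ε) (ev-quotient x y w) h))))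

  regularModulo? : Dec (RegularModulo N)
  regularModulo? = map′ regular⇒ ⇒regular (Theory.regular? quotientX)

-- Atomic groups and descent

AtomicX : ∀ {p q} → TightGroup p q → Set
AtomicX {p} T = ∀ n → n ∣ p → n < p → NormalX T n → RegularModulo (_∈⟨ x ^ n ⟩)
  where open TightGroup T

Reducible : ∀ {p q} → TightGroup p q → Set₁
Reducible {p} {q} T = ∃ λ n → n < p × Σ (TightGroup n q) λ T′ → ¬ TightGroup.Regular⁺ T′ × T ⇒ T′

module Reduction {p q : ℕ} (T : TightGroup p q) where
  open TightGroup T
  open Theory T

  RegularX : ℕ → Set
  RegularX n = RegularModulo (_∈⟨ x ^ n ⟩)

  Bad : ℕ → Set
  Bad n = n ∣ p × NormalX T n × ¬ RegularX n

  regularX? : ∀ n → n ∣ p → NormalX T n → Dec (RegularX n)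
  regularX? n d h = QuotientX.regularModulo? T n d h

  bad₂ : ∀ n → n ∣ p → Dec (NormalX T n) → Dec (Bad n)
  bad₂ n d (no ¬h) = no λ (_ , h , _) → ¬h h
  bad₂ n d (yes h) = map′ (λ ¬r → d , h , ¬r) (λ (_ , _ , ¬r) → ¬r) (¬? (regularX? n d h))

  bad₁ : ∀ n → Dec (n ∣ p) → Dec (Bad n)
  bad₁ n (no ¬d) = no λ (d , _) → ¬d d
  bad₁ n (yes d) = bad₂ n d (∈x^? n d (conj y (x ^ n)))

  bad? : ∀ n → Dec (Bad n)
  bad? n = bad₁ n (n ∣? p)

  reducible : ∀ n → n < p → Bad n → Reducible T
  reducible n n<p (d , h , ¬r) = n , n<p , quotientX , (λ r → ¬r (regular⇒ r)) , ⇒quotientX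
    where open QuotientX T n d h

  reduceX : AtomicX T ⊎ Reducible T
  reduceX with any? {n = p} (λ i → bad? (toℕ i))
  ... | yes (i , b) = inj₂ (reducible (toℕ i) (toℕ<n i) b)
  ... | no ¬b = inj₁ λ n d n<p h → decidable-stable (regularX? n d h)
    λ ¬r → ¬b (fromℕ< n<p , ≡.subst Bad (≡.sym (toℕ-fromℕ< n<p)) (d , h , ¬r))

⇒-undual : ∀ {p q p′ q′} (T : TightGroup p q) (T′ : TightGroup q′ p′) → dual T ⇒ T′ → T ⇒ dual T′
⇒-undual T T′ f w e = ≡.subst (T′._≈ T′.ε) (≡.sym (ev-dual′ T′ w))
  (f (exchange w) (≡.subst (T._≈ T.ε) (≡.sym (ev-dual T w)) e))
  where module T = TightGroup T
        module T′ = TightGroup T′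

-- Every reduction keeps chirality and lowers p or q, so p + q decreases; reductions of q are made
-- in the dual and carried back.
descent : ∀ {p q} (T : TightGroup p q) → ¬ TightGroup.Regular⁺ T →
  ∃₂ λ p′ q′ → Σ (TightGroup p′ q′) λ T′ →
    ¬ TightGroup.Regular⁺ T′ × AtomicX T′ × AtomicX (dual T′) × T ⇒ T′
descent T ¬r = go T ¬r (<-wellFounded _)
  where
  go : ∀ {p q} (T : TightGroup p q) → ¬ TightGroup.Regular⁺ T → Acc _<_ (p ℕ.+ q) →
    ∃₂ λ p′ q′ → Σ (TightGroup p′ q′) λ T′ →
      ¬ TightGroup.Regular⁺ T′ × AtomicX T′ × AtomicX (dual T′) × T ⇒ T′
  go {p} {q} T ¬r (acc rs) with Reduction.reduceX T | Reduction.reduceX (dual T)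
  ... | inj₂ (n , n<p , T′ , ¬r′ , f) | _ =
    let p″ , q″ , T″ , ¬r″ , ax , ay , g = go T′ ¬r′ (rs (ℕₚ.+-monoˡ-< q n<p))
    in p″ , q″ , T″ , ¬r″ , ax , ay , λ w e → g w (f w e)
  ... | inj₁ _ | inj₂ (n , n<q , T′ , ¬r′ , f) =
    let p″ , q″ , T″ , ¬r″ , ax , ay , g = go (dual T′) (λ r → ¬r′ (undual-regular T′ (λ g → TightGroup._≈_ T′ g (TightGroup.ε T′)) r)) (rs (ℕₚ.+-monoʳ-< p n<q))
    in p″ , q″ , T″ , ¬r″ , ax , ay , λ w e → g w (⇒-undual T T′ f w e)
  ... | inj₁ ax | inj₁ ay = p , q , T , ¬r , ax , ay , λ _ e → e

-- Existence of a normal subgroup inside ⟨x⟩ or ⟨y⟩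

NormalSubgroup : ∀ {p q} → TightGroup p q → Set
NormalSubgroup {p} T = ∃ λ n → n ∣ p × n < p × NormalX T n

module Core {p q : ℕ} (T : TightGroup p q) where
  open TightGroup T
  open Theory T
  open GroupSolver group
  open import Algebra.Properties.Group group
  open import Relation.Binary.Reasoning.Setoid setoid

  normalX? : ∀ n → Dec (n ∣ p × NormalX T n)
  normalX? n with n ∣? p
  ... | no ¬d = no (¬d ∘ proj₁)
  ... | yes d with ∈x^? n d (conj y (x ^ n))
  ... | yes h = yes (d , h)
  ... | no ¬h = no (¬h ∘ proj₂)

  normalSubgroup? : NormalSubgroup T ⊎ ¬ NormalSubgroup T
  normalSubgroup? with any? {n = p} (λ i → normalX? (toℕ i))
  ... | yes (i , d , h) = inj₁ (toℕ i , d , toℕ<n i , h)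
  ... | no ¬h = inj₂ λ (n , d , n<p , h) → ¬h (fromℕ< n<p ,
    ≡.subst (λ n → n ∣ p × NormalX T n) (≡.sym (toℕ-fromℕ< n<p)) (d , h))

  -- An elementwise condition, apparently stronger than the absence of a normal subgroup: not even a
  -- single nontrivial element of ⟨x⟩ is conjugated by y into ⟨x⟩. `normal-gcd` bridges the gap.
  CorelessX : Set
  CorelessX = ∀ {A} → A ∈⟨ x ⟩ → conj y A ∈⟨ x ⟩ → A ≈ ε

  -- A cyclic group has one subgroup of each order, so a conjugate of ⟨x^k⟩ inside ⟨x⟩ is ⟨x^k⟩ itself.
  normal-gcd : ∀ k → conj y (x ^ k) ∈⟨ x ⟩ → NormalX T (gcd k p)
  normal-gcd k h = ∈-resp (sym e) (∈-resp (identityʳ _) (∣⇒∈x^ l 0 (n∣l , divides-refl 0)))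
    where
    n = gcd k p
    l = proj₁ (conj-∈ (∈x-gcd k) h)
    e : conj y (x ^ n) ≈ x ^ l
    e = proj₂ (conj-∈ (∈x-gcd k) h)
    t = _∣_.quotient (gcd[m,n]∣n k p)
    p≡ : p ≡ t ℕ.* n
    p≡ = _∣_.equality (gcd[m,n]∣n k p)
    t≢0 : NonZero t
    t≢0 = ℕ.≢-nonZero λ t≡0 → ℕ.≢-nonZero⁻¹ p (≡.trans p≡ (≡.cong (ℕ._* n) t≡0))
    n∣l : n ∣ l
    n∣l = *-cancelˡ-∣ t {{t≢0}} (≡.subst₂ _∣_ p≡ (ℕₚ.*-comm l t) (x-order (l ℕ.* t) (begin
      x ^ (l ℕ.* t) ≈⟨ ^-* x l t ⟩
      (x ^ l) ^ t ≈⟨ ^-cong t e ⟨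
      conj y (x ^ n) ^ t ≈⟨ conj-^ y (x ^ n) t ⟨
      conj y ((x ^ n) ^ t) ≈⟨ conj-cong y (^-* x n t) ⟨
      conj y (x ^ (n ℕ.* t)) ≈⟨ conj-cong y (x^-∣ (∣-reflexive (≡.trans p≡ (ℕₚ.*-comm t n)))) ⟩
      conj y ε ≈⟨ conj-ε y ⟩
      ε ∎)))

  gcd<p : ∀ k → ¬ x ^ k ≈ ε → gcd k p < p
  gcd<p k ne = ℕₚ.≤∧≢⇒< (∣⇒≤ (gcd[m,n]∣n k p)) λ e → ne (x^-∣ (≡.subst (_∣ k) e (gcd[m,n]∣m k p)))

  coreless : ¬ NormalSubgroup T → CorelessX
  coreless no-normal {A} (k , e) h with ε? A
  ... | yes A≈ε = A≈ε
  ... | no ¬A≈ε = contradiction (gcd k p , gcd[m,n]∣n k p , gcd<p k (¬A≈ε ∘ trans e) ,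
    normal-gcd k (∈-resp (conj-cong y e) h)) no-normal

  [_,_] : Carrier → Carrier → Carrier
  [ a , b ] = a ∙ b ∙ a ⁻¹ ∙ b ⁻¹

  []-cong : ∀ {a b a′ b′} → a ≈ a′ → b ≈ b′ → [ a , b ] ≈ [ a′ , b′ ]
  []-cong e f = ∙-cong (∙-cong (∙-cong e f) (⁻¹-cong e)) (⁻¹-cong f)

  -- Itô's argument that the derived group of a product of two abelian groups is abelian.
  ito : ∀ {a a′ b b′} → a ∈⟨ x ⟩ → a′ ∈⟨ x ⟩ → b ∈⟨ y ⟩ → b′ ∈⟨ y ⟩ → Commute [ a′ ⁻¹ , b′ ⁻¹ ] [ a , b ]
  ito {a} {a′} {b} {b′} a∈ a′∈ b∈ b′∈ = comm-conj (conj-inj (b′ ∙ a′) (begin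
    -- Since b′a′[a′⁻¹, b′⁻¹] = a′b′, the claim is that conjugation by a′b′ and by b′a′ agree on
    -- [a, b]. Both orders lead to [a₁, b₂].
    conj (b′ ∙ a′) (conj [ a′ ⁻¹ , b′ ⁻¹ ] [ a , b ])
      ≈⟨ solve 3 (λ a b g → (b ⊕ a) ⊕ ((⊖ a ⊕ ⊖ b ⊕ ⊖ ⊖ a ⊕ ⊖ ⊖ b) ⊕ g ⊕ ⊖ (⊖ a ⊕ ⊖ b ⊕ ⊖ ⊖ a ⊕ ⊖ ⊖ b)) ⊕ ⊖ (b ⊕ a)
            ⊜ a ⊕ (b ⊕ g ⊕ ⊖ b) ⊕ ⊖ a) refl a′ b′ [ a , b ] ⟩
    conj a′ (conj b′ [ a , b ]) ≈⟨ left ⟩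
    [ a₁ , b₂ ] ≈⟨ right ⟨
    conj b′ (conj a′ [ a , b ]) ≈⟨ conj-conj b′ a′ _ ⟨
    conj (b′ ∙ a′) [ a , b ] ∎))
    where
    F₁ = factor (conj b′ a)
    F₂ = factorʳ (conj a′ b)
    a₁ = x ^ proj₁ F₁
    b₁ = y ^ proj₁ (proj₂ F₁)
    b₂ = y ^ proj₁ F₂
    a₂ = x ^ proj₁ (proj₂ F₂)
    a₁∈ : a₁ ∈⟨ x ⟩
    a₁∈ = proj₁ F₁ , refl
    b₁∈ : b₁ ∈⟨ y ⟩
    b₁∈ = proj₁ (proj₂ F₁) , refl
    b₂∈ : b₂ ∈⟨ y ⟩
    b₂∈ = proj₁ F₂ , refl
    a₂∈ : a₂ ∈⟨ x ⟩
    a₂∈ = proj₁ (proj₂ F₂) , refl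
    e₁ : conj b′ a ≈ a₁ ∙ b₁
    e₁ = proj₂ (proj₂ F₁)
    e₂ : conj a′ b ≈ b₂ ∙ a₂
    e₂ = proj₂ (proj₂ F₂)
    xx : ∀ {u v} → u ∈⟨ x ⟩ → v ∈⟨ x ⟩ → Commute u v
    xx u∈ v∈ = ∈-comm v∈ (comm-sym (∈-comm u∈ comm-refl))
    yy : ∀ {u v} → u ∈⟨ y ⟩ → v ∈⟨ y ⟩ → Commute u v
    yy u∈ v∈ = ∈-comm v∈ (comm-sym (∈-comm u∈ comm-refl))
    conj-[] : ∀ g u v → conj g [ u , v ] ≈ [ conj g u , conj g v ]
    conj-[] = solve 3 (λ g u v → g ⊕ (u ⊕ v ⊕ ⊖ u ⊕ ⊖ v) ⊕ ⊖ g ⊜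
      (g ⊕ u ⊕ ⊖ g) ⊕ (g ⊕ v ⊕ ⊖ g) ⊕ ⊖ (g ⊕ u ⊕ ⊖ g) ⊕ ⊖ (g ⊕ v ⊕ ⊖ g)) refl
    drop-x : ∀ {u B A} → u ∈⟨ x ⟩ → A ∈⟨ x ⟩ → [ u , B ∙ A ] ≈ [ u , B ]
    drop-x {u} {B} {A} u∈ A∈ = begin
      [ u , B ∙ A ] ≈⟨ solve 3 (λ u B A → u ⊕ (B ⊕ A) ⊕ ⊖ u ⊕ ⊖ (B ⊕ A) ⊜ u ⊕ B ⊕ ⊖ u ⊕ ((u ⊕ A ⊕ ⊖ u) ⊕ ⊖ A) ⊕ ⊖ B) refl u B A ⟩
      u ∙ B ∙ u ⁻¹ ∙ (conj u A ∙ A ⁻¹) ∙ B ⁻¹ ≈⟨ ∙-congʳ (∙-congˡ (trans (∙-congʳ (conj-comm (xx u∈ A∈))) (inverseʳ A))) ⟩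
      u ∙ B ∙ u ⁻¹ ∙ ε ∙ B ⁻¹ ≈⟨ ∙-congʳ (identityʳ _) ⟩
      [ u , B ] ∎
    drop-y : ∀ {A B v} → B ∈⟨ y ⟩ → v ∈⟨ y ⟩ → [ A ∙ B , v ] ≈ [ A , v ]
    drop-y {A} {B} {v} B∈ v∈ = begin
      [ A ∙ B , v ] ≈⟨ solve 3 (λ A B v → A ⊕ B ⊕ v ⊕ ⊖ (A ⊕ B) ⊕ ⊖ v ⊜ A ⊕ (B ⊕ v ⊕ ⊖ B) ⊕ ⊖ A ⊕ ⊖ v) refl A B v ⟩
      A ∙ conj B v ∙ A ⁻¹ ∙ v ⁻¹ ≈⟨ ∙-congʳ (∙-congʳ (∙-congˡ (conj-comm (yy B∈ v∈)))) ⟩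
      [ A , v ] ∎
    left : conj a′ (conj b′ [ a , b ]) ≈ [ a₁ , b₂ ]
    left = begin
      conj a′ (conj b′ [ a , b ]) ≈⟨ conj-cong a′ (conj-[] b′ a b) ⟩
      conj a′ [ conj b′ a , conj b′ b ] ≈⟨ conj-cong a′ ([]-cong e₁ (conj-comm (yy b′∈ b∈))) ⟩
      conj a′ [ a₁ ∙ b₁ , b ] ≈⟨ conj-cong a′ (drop-y b₁∈ b∈) ⟩
      conj a′ [ a₁ , b ] ≈⟨ conj-[] a′ a₁ b ⟩
      [ conj a′ a₁ , conj a′ b ] ≈⟨ []-cong (conj-comm (xx a′∈ a₁∈)) e₂ ⟩
      [ a₁ , b₂ ∙ a₂ ] ≈⟨ drop-x a₁∈ a₂∈ ⟩
      [ a₁ , b₂ ] ∎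
    right : conj b′ (conj a′ [ a , b ]) ≈ [ a₁ , b₂ ]
    right = begin
      conj b′ (conj a′ [ a , b ]) ≈⟨ conj-cong b′ (conj-[] a′ a b) ⟩
      conj b′ [ conj a′ a , conj a′ b ] ≈⟨ conj-cong b′ ([]-cong (conj-comm (xx a′∈ a∈)) e₂) ⟩
      conj b′ [ a , b₂ ∙ a₂ ] ≈⟨ conj-cong b′ (drop-x a∈ a₂∈) ⟩
      conj b′ [ a , b₂ ] ≈⟨ conj-[] b′ a b₂ ⟩
      [ conj b′ a , conj b′ b₂ ] ≈⟨ []-cong e₁ (conj-comm (yy b′∈ b₂∈)) ⟩
      [ a₁ ∙ b₁ , b₂ ] ≈⟨ drop-y b₁∈ b₂∈ ⟩
      [ a₁ , b₂ ] ∎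

  -- With both cores trivial, the p conjugates of c₀ and ε lie in different cosets of ⟨x⟩, of which there are q.
  module _ (cx : CorelessX) (cy : ∀ {B} → B ∈⟨ y ⟩ → conj x B ∈⟨ y ⟩ → B ≈ ε) (p≢1 : p ≢ 1) where
    c₀ : Carrier
    c₀ = [ x ⁻¹ , y ⁻¹ ]

    conjugate : ℕ → Carrier
    conjugate k = conj (x ^ k) c₀

    -- For u = x^k, u[x⁻¹, y⁻¹]u⁻¹ = [ux⁻¹, y⁻¹][u, y⁻¹]⁻¹, and `ito` applies to each factor.
    conjugate-comm : ∀ k → Commute c₀ (conjugate k)
    conjugate-comm k = comm-respʳ
      (solve 3 (λ a b u → u ⊕ ⊖ a ⊕ ⊖ b ⊕ ⊖ (u ⊕ ⊖ a) ⊕ ⊖ ⊖ b ⊕ ⊖ (u ⊕ ⊖ b ⊕ ⊖ u ⊕ ⊖ ⊖ b)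
        ⊜ u ⊕ (⊖ a ⊕ ⊖ b ⊕ ⊖ ⊖ a ⊕ ⊖ ⊖ b) ⊕ ⊖ u) refl x y (x ^ k))
      (comm-∙ (ito (∈-∙ (k , refl) (∈x-⁻¹ ∈-self)) ∈-self (∈y-⁻¹ ∈-self) ∈-self)
        (comm-⁻¹ (ito (k , refl) ∈-self (∈y-⁻¹ ∈-self) ∈-self)))

    -- If a commutes with [x⁻¹, y⁻¹], then x commutes with yay⁻¹ = x^i y^j and so with y^j. The
    -- trivial core of ⟨y⟩ gives y^j = ε, and then that of ⟨x⟩ gives a = ε.
    centralizer-trivial : ∀ {a} → a ∈⟨ x ⟩ → Commute c₀ a → a ≈ ε
    centralizer-trivial {a} a∈ h with factor (conj y a)
    ... | i , j , e = cx a∈ (i , trans e (trans (∙-congˡ yʲ≈ε) (identityʳ _)))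
      where
      x-comm : Commute x (conj y a)
      x-comm = begin
        x ∙ conj y a ≈⟨ solve 3 (λ x y a → x ⊕ (y ⊕ a ⊕ ⊖ y) ⊜ y ⊕ x ⊕ ((⊖ x ⊕ ⊖ y ⊕ ⊖ ⊖ x ⊕ ⊖ ⊖ y) ⊕ a) ⊕ ⊖ y) refl x y a ⟩
        y ∙ x ∙ (c₀ ∙ a) ∙ y ⁻¹ ≈⟨ ∙-congʳ (∙-congˡ h) ⟩
        y ∙ x ∙ (a ∙ c₀) ∙ y ⁻¹ ≈⟨ ∙-congʳ (assoc _ _ _) ⟩
        y ∙ (x ∙ (a ∙ c₀)) ∙ y ⁻¹ ≈⟨ ∙-congʳ (∙-congˡ (trans (sym (assoc _ _ _)) (∙-congʳ (∈-comm a∈ comm-refl)))) ⟩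
        y ∙ (a ∙ x ∙ c₀) ∙ y ⁻¹ ≈⟨ solve 3 (λ x y a → y ⊕ (a ⊕ x ⊕ (⊖ x ⊕ ⊖ y ⊕ ⊖ ⊖ x ⊕ ⊖ ⊖ y)) ⊕ ⊖ y ⊜ (y ⊕ a ⊕ ⊖ y) ⊕ x) refl x y a ⟩
        conj y a ∙ x ∎
      y-comm : Commute x (y ^ j)
      y-comm = comm-respʳ (trans (∙-congˡ e) (\\-leftDividesʳ _ _)) (comm-∙ (comm-⁻¹ (comm-^ i comm-refl)) x-comm)
      yʲ≈ε : y ^ j ≈ ε
      yʲ≈ε = cy (j , refl) (j , conj-comm y-comm)

    c₀≉ε : ¬ c₀ ≈ ε
    c₀≉ε h = p≢1 (∣1⇒≡1 (x-order 1 (trans (^-1 x) (cx ∈-self (1 , trans (conj-comm yx) (sym (^-1 x)))))))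
      where
      yx : Commute y x
      yx = begin
        y ∙ x ≈⟨ identityʳ _ ⟨
        y ∙ x ∙ ε ≈⟨ ∙-congˡ h ⟨
        y ∙ x ∙ c₀ ≈⟨ solve 2 (λ x y → y ⊕ x ⊕ (⊖ x ⊕ ⊖ y ⊕ ⊖ ⊖ x ⊕ ⊖ ⊖ y) ⊜ x ⊕ y) refl x y ⟩
        x ∙ y ∎

    point : Fin (suc p) → Carrier
    point Fin.zero = ε
    point (Fin.suc i) = conjugate (toℕ i)

    point-comm : ∀ i → Commute c₀ (point i)
    point-comm Fin.zero = comm-ε
    point-comm (Fin.suc i) = conjugate-comm (toℕ i)

    point-injective : ∀ i j → point i ≈ point j → i ≡ j
    point-injective Fin.zero Fin.zero e = ≡.refl
    point-injective Fin.zero (Fin.suc j) e = contradiction (conj-inj (x ^ toℕ j) (trans (sym e) (sym (conj-ε _)))) c₀≉ε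
    point-injective (Fin.suc i) Fin.zero e = contradiction (conj-inj (x ^ toℕ i) (trans e (sym (conj-ε _)))) c₀≉ε
    point-injective (Fin.suc i) (Fin.suc j) e = ≡.cong Fin.suc (toℕ-injective (^-injective x-order (toℕ<n i) (toℕ<n j)
      (sym (trans (sym (identityʳ _)) (trans (∙-congˡ (sym (centralizer-trivial (∈-∙ (x⁻¹∈ (toℕ j)) (toℕ i , refl))
        (comm-sym (comm-conj (trans (conj-conj _ _ c₀) (trans (conj-cong _ e) (solve 2 (λ a g → ⊖ a ⊕ (a ⊕ g ⊕ ⊖ a) ⊕ ⊖ ⊖ a ⊜ g) refl (x ^ toℕ j) c₀))))))))
        (\\-leftDividesˡ _ _))))))

    coset : Carrier → Fin q
    coset g = fromℕ< (m%n<n (proj₁ (proj₂ (factor g))) q)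

    coset-≡ : ∀ g h → coset g ≡ coset h → g ∙ h ⁻¹ ∈⟨ x ⟩
    coset-≡ g h eq with factor g | factor h
    ... | a , b , e | a′ , b′ , e′ = ∈-resp (begin
        x ^ a ∙ (x ^ a′) ⁻¹ ≈⟨ solve 3 (λ a c b → a ⊕ ⊖ c ⊜ a ⊕ b ⊕ ⊖ (c ⊕ b)) refl (x ^ a) (x ^ a′) (y ^ b′) ⟩
        x ^ a ∙ y ^ b′ ∙ (x ^ a′ ∙ y ^ b′) ⁻¹ ≈⟨ ∙-cong (∙-congˡ same) (⁻¹-cong e′) ⟨
        x ^ a ∙ y ^ b ∙ h ⁻¹ ≈⟨ ∙-congʳ e ⟨
        g ∙ h ⁻¹ ∎) (∈-∙ (a , refl) (x⁻¹∈ a′))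
      where
      same : y ^ b ≈ y ^ b′
      same = trans (y^-% b) (trans (^-≡ y (fromℕ<-injective _ _ (m%n<n b q) (m%n<n b′ q) eq)) (sym (y^-% b′)))

    p<q : p < q
    -- The p + 1 points are sent injectively to q cosets: the quotient of two points in one coset
    -- lies in ⟨x⟩ and commutes with c₀. So `suc p ≤ q`, which is `p < q`.
    p<q = injective⇒≤ {f = coset ∘ point} λ {i} {j} eq → point-injective i j (x∙y⁻¹≈ε⇒x≈y _ _
      (centralizer-trivial (coset-≡ (point i) (point j) eq) (comm-∙ (point-comm i) (comm-⁻¹ (point-comm j)))))

-- The count is symmetric in x and y, so trivial cores on both sides give p < q and q < p.
some-normal : ∀ {p q} (T : TightGroup p q) → p ≢ 1 → q ≢ 1 → ¬ NormalSubgroup T → ¬ NormalSubgroup (dual T) → ⊥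
some-normal T p≢1 q≢1 nx ny = ℕₚ.<-asym (Core.p<q T cx cy p≢1) (Core.p<q (dual T) cy cx q≢1)
  where
  cx : Core.CorelessX T
  cx = Core.coreless T nx
  cy : Core.CorelessX (dual T)
  cy = Core.coreless (dual T) ny

-- Relations in an atomic chiral group

prime-divisor : ∀ n → .{{NonZero n}} → n ≢ 1 → ∃ λ l → Prime l × l ∣ n
prime-divisor n n≢1 with factorise n
... | record { factors = [] ; isFactorisation = e } = contradiction e n≢1
... | record { factors = l ∷ ls ; isFactorisation = e ; factorsPrime = pr All.∷ _ } = l , pr , ≡.subst (l ∣_) (≡.sym e) (m∣m*n _)

prime∣prime : ∀ {l m} → Prime l → Prime m → l ∣ m → l ≡ m
prime∣prime pl pm l∣m with prime⇒irreducible pm l∣m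
... | inj₁ ≡.refl = contradiction pl ¬prime[1]
... | inj₂ l≡m = l≡m

prime∣^ : ∀ {l} m b → Prime l → l ∣ m ℕ.^ b → l ∣ m
prime∣^ m zero pl d = contradiction (≡.subst Prime (∣1⇒≡1 d) pl) ¬prime[1]
prime∣^ m (suc b) pl d with euclidsLemma m (m ℕ.^ b) pl d
... | inj₁ e = e
... | inj₂ e = prime∣^ m b pl e

prime-coprime : ∀ {m k} → Prime m → m ∤ k → Coprime m k
prime-coprime pm m∤k {i} (i∣m , i∣k) with prime⇒irreducible pm i∣m
... | inj₁ i≡1 = i≡1
... | inj₂ ≡.refl = contradiction i∣k m∤k

prime-coprime-^ : ∀ {m k} b → Prime m → m ∤ k → Coprime (m ℕ.^ b) k
prime-coprime-^ {m} {k} b pm m∤k {i} (i∣mᵇ , i∣k) with i ℕ.≟ 1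
... | yes i≡1 = i≡1
... | no i≢1 = contradiction (∣-trans (≡.subst (_∣ i) (prime∣prime (proj₁ (proj₂ P)) pm (prime∣^ m b (proj₁ (proj₂ P)) (∣-trans (proj₂ (proj₂ P)) i∣mᵇ))) (proj₂ (proj₂ P))) i∣k) m∤k
  where
  instance
    i≢0 : NonZero i
    i≢0 = ℕ.≢-nonZero λ { ≡.refl → ℕ.≢-nonZero⁻¹ _ {{ℕₚ.m^n≢0 m b {{prime⇒nonZero pm}}}} (0∣⇒≡0 i∣mᵇ) }
  P = prime-divisor i i≢1

prime-power : ∀ {m} → Prime m → ∀ n → .{{NonZero n}} → (∀ l → Prime l → l ∣ n → l ≡ m) → ∃ λ b → n ≡ m ℕ.^ b
prime-power {m} pm n h with factorise n
... | record { factors = ls ; isFactorisation = ≡.refl ; factorsPrime = pr } = go ls pr h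
  where
  go : ∀ ls → All.All Prime ls → (∀ l → Prime l → l ∣ product ls → l ≡ m) → ∃ λ b → product ls ≡ m ℕ.^ b
  go [] All.[] h = 0 , ≡.refl
  go (l ∷ ls) (pl All.∷ pr) h with go ls pr (λ k pk d → h k pk (∣n⇒∣m*n l d)) | h l pl (m∣m*n _)
  ... | b , e | ≡.refl = suc b , ≡.cong (l ℕ.*_) e

even⊎odd : ∀ n → ∃ λ k → n ≡ 2 ℕ.* k ⊎ n ≡ suc (2 ℕ.* k)
even⊎odd zero = 0 , inj₁ ≡.refl
even⊎odd (suc n) with even⊎odd n
... | k , inj₁ e = k , inj₂ (≡.cong suc e)
... | k , inj₂ e = suc k , inj₁ (≡.trans (≡.cong suc e) (≡.cong suc (≡.sym (ℕₚ.+-suc k (k ℕ.+ 0)))))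

2∤odd : ∀ k → 2 ∤ suc (2 ℕ.* k)
2∤odd k d with () ← ∣1⇒≡1 (∣m+n∣m⇒∣n (≡.subst (2 ∣_) (ℕₚ.+-comm 1 (2 ℕ.* k)) d) (m∣m*n k))

-- ⟨x⟩ has trivial core, and ⟨z⟩ is the least nontrivial normal subgroup of the group inside ⟨y⟩.
record Reduced {p q : ℕ} (T : TightGroup p q) : Set where
  open TightGroup T
  field
    coreless : ∀ {A} → A ∈⟨ x ⟩ → conj y A ∈⟨ x ⟩ → A ≈ ε
    m : ℕ
    m-prime : Prime m
    z : Carrier
    z∈ : z ∈⟨ y ⟩
    zᵐ : z ^ m ≈ ε
    z≉ε : ¬ z ≈ ε
    conj-z : conj x z ∈⟨ z ⟩
    least : ∀ {B} → B ∈⟨ y ⟩ → conj x B ∈⟨ y ⟩ → ¬ B ≈ ε → z ∈⟨ B ⟩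
    regular-z : RegularModulo (_∈⟨ z ⟩)
    y²-not-normal : ¬ conj x (y ∙ y) ∈⟨ y ⟩

-- x⁻¹ y = y^i x^j, and the mirror image of this equation, which holds only modulo ⟨z⟩.
record Swap {p q : ℕ} (T : TightGroup p q) (R : Reduced T) : Set where
  open TightGroup T
  open Reduced R
  field
    yⁱ xʲ ζ : Carrier
    yⁱ∈ : yⁱ ∈⟨ y ⟩
    xʲ∈ : xʲ ∈⟨ x ⟩
    ζ∈z : ζ ∈⟨ z ⟩
    defining : x ⁻¹ ∙ y ≈ yⁱ ∙ xʲ
    mirrored : x ∙ y ⁻¹ ≈ ζ ⁻¹ ∙ (yⁱ ⁻¹ ∙ xʲ ⁻¹)

-- x⁻¹y(y^i x^j)⁻¹ is a relator. Regularity modulo ⟨z⟩ puts its mirror image into ⟨z⟩, and ζ is the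
-- inverse of that image.
swapping : ∀ {p q} (T : TightGroup p q) (R : Reduced T) → Swap T R
swapping T R = record
  { yⁱ = y ^ i ; xʲ = x ^ j ; ζ = ζ ; yⁱ∈ = i , refl ; xʲ∈ = j , refl
  ; ζ∈z = Periodic.∈-⁻¹ {n = m} {{prime⇒nonZero m-prime}} zᵐ (swap-mirror regular-z ∈-resp
      (mirror-∙ (mirror-∙ (mirror-⁻¹ mirror-x) mirror-y)
        (mirror-⁻¹ (mirror-∙ (mirror-^ i mirror-y) (mirror-^ j mirror-x))))
      (0 , x≈y⇒x∙y⁻¹≈ε defining))
  ; defining = defining
  ; mirrored = begin
      x ∙ y ⁻¹ ≈⟨ solve 4 (λ x y a b → x ⊕ ⊖ y ⊜ ⊖ ⊖ (⊖ ⊖ x ⊕ ⊖ y ⊕ ⊖ (a ⊕ b)) ⊕ (a ⊕ b)) refl x y ((y ⁻¹) ^ i) ((x ⁻¹) ^ j) ⟩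
      ζ ⁻¹ ∙ ((y ⁻¹) ^ i ∙ (x ⁻¹) ^ j) ≈⟨ ∙-congˡ (∙-cong (^-⁻¹ y i) (^-⁻¹ x j)) ⟩
      ζ ⁻¹ ∙ ((y ^ i) ⁻¹ ∙ (x ^ j) ⁻¹) ∎
  }
  where
  open TightGroup T
  open Theory T
  open Reduced R
  open GroupSolver group
  open import Algebra.Properties.Group group
  open import Relation.Binary.Reasoning.Setoid setoid
  i j : ℕ
  i = proj₁ (factorʳ (x ⁻¹ ∙ y))
  j = proj₁ (proj₂ (factorʳ (x ⁻¹ ∙ y)))
  ζ : Carrier
  ζ = (x ⁻¹ ⁻¹ ∙ y ⁻¹ ∙ ((y ⁻¹) ^ i ∙ (x ⁻¹) ^ j) ⁻¹) ⁻¹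
  defining : x ⁻¹ ∙ y ≈ y ^ i ∙ x ^ j
  defining = proj₂ (proj₂ (factorʳ (x ⁻¹ ∙ y)))

module Relations {p q : ℕ} (T : TightGroup p q) (R : Reduced T) (S : Swap T R) where
  open TightGroup T
  open Theory T
  open Reduced R
  open Swap S
  open GroupSolver group
  open import Algebra.Properties.Group group
  open import Relation.Binary.Reasoning.Setoid setoid

  instance
    m≢0 : NonZero m
    m≢0 = prime⇒nonZero m-prime

  prime-generates : ∀ {g h} → g ^ m ≈ ε → h ∈⟨ g ⟩ → ¬ h ≈ ε → g ∈⟨ h ⟩
  prime-generates {g} {h} gᵐ (k , e) h≉ε = ∈-resp (^-1 g) (≡.subst (λ n → g ^ n ∈⟨ h ⟩)
      (coprime⇒gcd≡1 {k} {m} (λ (u , v) → prime-coprime m-prime m∤k (v , u)))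
      (let s , f = Periodic.∈-gcd {n = m} gᵐ k in s , trans f (^-cong s (sym e))))
    where
    m∤k : m ∤ k
    m∤k d = h≉ε (trans e (Periodic.^-∣ {n = m} gᵐ d))

  xx : ∀ {u v} → u ∈⟨ x ⟩ → v ∈⟨ x ⟩ → Commute u v
  xx u∈ v∈ = ∈-comm v∈ (comm-sym (∈-comm u∈ comm-refl))
  yy : ∀ {u v} → u ∈⟨ y ⟩ → v ∈⟨ y ⟩ → Commute u v
  yy u∈ v∈ = ∈-comm v∈ (comm-sym (∈-comm u∈ comm-refl))

  x² : Carrier
  x² = x ∙ x
  x²∈ : x² ∈⟨ x ⟩
  x²∈ = ∈-∙ ∈-self ∈-self

  xy-swap : x ∙ y ≈ y ⁻¹ ∙ x ⁻¹
  xy-swap = trans (inverseˡ-unique _ _ involution) (⁻¹-anti-homo-∙ x y)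

  yx-swap : y ∙ x ≈ x ⁻¹ ∙ y ⁻¹
  yx-swap = begin
    y ∙ x ≈⟨ solve 2 (λ x y → y ⊕ x ⊜ ⊖ x ⊕ (x ⊕ y) ⊕ x) refl x y ⟩
    x ⁻¹ ∙ (x ∙ y) ∙ x ≈⟨ ∙-congʳ (∙-congˡ xy-swap) ⟩
    x ⁻¹ ∙ (y ⁻¹ ∙ x ⁻¹) ∙ x ≈⟨ solve 2 (λ x y → ⊖ x ⊕ (⊖ y ⊕ ⊖ x) ⊕ x ⊜ ⊖ x ⊕ ⊖ y) refl x y ⟩
    x ⁻¹ ∙ y ⁻¹ ∎

  c d : Carrier
  c = y ∙ yⁱ
  d = x ∙ xʲ ⁻¹

  c∈ : c ∈⟨ y ⟩
  c∈ = ∈-∙ ∈-self yⁱ∈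
  d∈ : d ∈⟨ x ⟩
  d∈ = ∈-∙ ∈-self (∈x-⁻¹ xʲ∈)

  ζ∈ : ζ ∈⟨ y ⟩
  ζ∈ = ∈-trans ζ∈z z∈

  ζᵐ : ζ ^ m ≈ ε
  ζᵐ with ζ∈z
  ... | k , e = begin
    ζ ^ m ≈⟨ ^-cong m e ⟩
    (z ^ k) ^ m ≈⟨ ^-* z k m ⟨
    z ^ (k ℕ.* m) ≈⟨ Periodic.^-∣ {n = m} zᵐ (divides-refl k) ⟩
    ε ∎

  x²ζ : Commute x² ζ
  x²ζ = involution-conj ζ∈ (∈-trans (conj-∈ ζ∈z conj-z) z∈)

  conj-y-x² : conj y x² ≈ x² ⁻¹ ∙ d ∙ c ⁻¹
  conj-y-x² = begin
    conj y x² ≈⟨ solve 2 (λ x y → y ⊕ (x ⊕ x) ⊕ ⊖ y ⊜ (y ⊕ x) ⊕ x ⊕ ⊖ y) refl x y ⟩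
    y ∙ x ∙ x ∙ y ⁻¹ ≈⟨ ∙-congʳ (∙-congʳ yx-swap) ⟩
    x ⁻¹ ∙ y ⁻¹ ∙ x ∙ y ⁻¹ ≈⟨ solve 2 (λ x y → ⊖ x ⊕ ⊖ y ⊕ x ⊕ ⊖ y ⊜ ⊖ x ⊕ ⊖ (⊖ x ⊕ y) ⊕ ⊖ y) refl x y ⟩
    x ⁻¹ ∙ (x ⁻¹ ∙ y) ⁻¹ ∙ y ⁻¹ ≈⟨ ∙-congʳ (∙-congˡ (⁻¹-cong defining)) ⟩
    x ⁻¹ ∙ (yⁱ ∙ xʲ) ⁻¹ ∙ y ⁻¹ ≈⟨ solve 4 (λ x y a b → ⊖ x ⊕ ⊖ (a ⊕ b) ⊕ ⊖ y ⊜ ⊖ (x ⊕ x) ⊕ (x ⊕ ⊖ b) ⊕ ⊖ (y ⊕ a)) refl x y yⁱ xʲ ⟩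
    x² ⁻¹ ∙ d ∙ c ⁻¹ ∎

  conj-x-y² : conj x (y ∙ y) ≈ (y ∙ y) ⁻¹ ∙ c ∙ d ⁻¹
  conj-x-y² = begin
    conj x (y ∙ y) ≈⟨ solve 2 (λ x y → x ⊕ (y ⊕ y) ⊕ ⊖ x ⊜ (x ⊕ y) ⊕ y ⊕ ⊖ x) refl x y ⟩
    x ∙ y ∙ y ∙ x ⁻¹ ≈⟨ ∙-congʳ (∙-congʳ xy-swap) ⟩
    y ⁻¹ ∙ x ⁻¹ ∙ y ∙ x ⁻¹ ≈⟨ ∙-congʳ (assoc _ _ _) ⟩
    y ⁻¹ ∙ (x ⁻¹ ∙ y) ∙ x ⁻¹ ≈⟨ ∙-congʳ (∙-congˡ defining) ⟩
    y ⁻¹ ∙ (yⁱ ∙ xʲ) ∙ x ⁻¹ ≈⟨ solve 4 (λ x y a b → ⊖ y ⊕ (a ⊕ b) ⊕ ⊖ x ⊜ ⊖ (y ⊕ y) ⊕ (y ⊕ a) ⊕ ⊖ (x ⊕ ⊖ b)) refl x y yⁱ xʲ ⟩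
    (y ∙ y) ⁻¹ ∙ c ∙ d ⁻¹ ∎

  -- yⁱ⁻¹ is computed twice: `left` rests on the defining equation, through `conj-y-x²`, and `right`
  -- on the mirrored one. The comparison isolates y d y⁻¹.
  conj-y-d : conj y d ≈ d ∙ ζ
  conj-y-d = begin
    conj y d ≈⟨ solve 3 (λ x y b → y ⊕ (x ⊕ ⊖ b) ⊕ ⊖ y ⊜ ⊖ b ⊕ (⊖ x ⊕ (x ⊕ b ⊕ y ⊕ (x ⊕ x)) ⊕ ⊖ x) ⊕ ⊖ b ⊕ ⊖ y) refl x y xʲ ⟩
    xʲ ⁻¹ ∙ (x ⁻¹ ∙ (x ∙ xʲ ∙ y ∙ x²) ∙ x ⁻¹) ∙ xʲ ⁻¹ ∙ y ⁻¹ ≈⟨ ∙-congʳ (∙-congʳ (∙-congˡ (∙-congʳ (∙-congˡ (trans left (sym right)))))) ⟩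
    xʲ ⁻¹ ∙ (x ⁻¹ ∙ (x² ∙ ζ ∙ y ∙ (xʲ ∙ x)) ∙ x ⁻¹) ∙ xʲ ⁻¹ ∙ y ⁻¹
      ≈⟨ solve 4 (λ x y b w → ⊖ b ⊕ (⊖ x ⊕ ((x ⊕ x) ⊕ w ⊕ y ⊕ (b ⊕ x)) ⊕ ⊖ x) ⊕ ⊖ b ⊕ ⊖ y ⊜ ⊖ b ⊕ x ⊕ w) refl x y xʲ ζ ⟩
    xʲ ⁻¹ ∙ x ∙ ζ ≈⟨ ∙-congʳ (comm-⁻¹ (xx ∈-self xʲ∈)) ⟨
    d ∙ ζ ∎
    where
    left : x ∙ xʲ ∙ y ∙ x² ≈ yⁱ ⁻¹
    left = begin
      x ∙ xʲ ∙ y ∙ x² ≈⟨ ∙-congʳ (∙-congʳ (xx ∈-self xʲ∈)) ⟩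
      xʲ ∙ x ∙ y ∙ x² ≈⟨ solve 3 (λ x y b → b ⊕ x ⊕ y ⊕ (x ⊕ x) ⊜ b ⊕ x ⊕ (y ⊕ (x ⊕ x) ⊕ ⊖ y) ⊕ y) refl x y xʲ ⟩
      xʲ ∙ x ∙ conj y x² ∙ y ≈⟨ ∙-congʳ (∙-congˡ conj-y-x²) ⟩
      xʲ ∙ x ∙ (x² ⁻¹ ∙ d ∙ c ⁻¹) ∙ y ≈⟨ solve 4 (λ x y b a → b ⊕ x ⊕ (⊖ (x ⊕ x) ⊕ (x ⊕ ⊖ b) ⊕ ⊖ (y ⊕ a)) ⊕ y ⊜ ⊖ a) refl x y xʲ yⁱ ⟩
      yⁱ ⁻¹ ∎
    right : x² ∙ ζ ∙ y ∙ (xʲ ∙ x) ≈ yⁱ ⁻¹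
    right = begin
      x² ∙ ζ ∙ y ∙ (xʲ ∙ x) ≈⟨ ∙-cong (∙-congʳ x²ζ) (xx xʲ∈ ∈-self) ⟩
      ζ ∙ x² ∙ y ∙ (x ∙ xʲ) ≈⟨ solve 4 (λ x y b w → w ⊕ (x ⊕ x) ⊕ y ⊕ (x ⊕ b) ⊜ w ⊕ x ⊕ (x ⊕ y) ⊕ (x ⊕ b)) refl x y xʲ ζ ⟩
      ζ ∙ x ∙ (x ∙ y) ∙ (x ∙ xʲ) ≈⟨ ∙-congʳ (∙-congˡ xy-swap) ⟩
      ζ ∙ x ∙ (y ⁻¹ ∙ x ⁻¹) ∙ (x ∙ xʲ) ≈⟨ solve 4 (λ x y b w → w ⊕ x ⊕ (⊖ y ⊕ ⊖ x) ⊕ (x ⊕ b) ⊜ w ⊕ (x ⊕ ⊖ y) ⊕ b) refl x y xʲ ζ ⟩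
      ζ ∙ (x ∙ y ⁻¹) ∙ xʲ ≈⟨ ∙-congʳ (∙-congˡ mirrored) ⟩
      ζ ∙ (ζ ⁻¹ ∙ (yⁱ ⁻¹ ∙ xʲ ⁻¹)) ∙ xʲ ≈⟨ solve 3 (λ b w a → w ⊕ (⊖ w ⊕ (⊖ a ⊕ ⊖ b)) ⊕ b ⊜ ⊖ a) refl xʲ ζ yⁱ ⟩
      yⁱ ⁻¹ ∎

  y⁻¹dy : conj (y ⁻¹) d ≈ d ∙ ζ ⁻¹
  y⁻¹dy = begin
    conj (y ⁻¹) d ≈⟨ conj-cong (y ⁻¹) (trans (sym (//-rightDividesʳ ζ d)) (∙-congʳ (sym conj-y-d))) ⟩
    conj (y ⁻¹) (conj y d ∙ ζ ⁻¹) ≈⟨ conj-∙ (y ⁻¹) _ _ ⟩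
    conj (y ⁻¹) (conj y d) ∙ conj (y ⁻¹) (ζ ⁻¹) ≈⟨ ∙-cong (conj-inv y refl) (conj-comm (yy (∈y-⁻¹ ∈-self) (∈y-⁻¹ ζ∈))) ⟩
    d ∙ ζ ⁻¹ ∎

  -- y⁻¹x²y is computed twice: as (xy)x²(xy)⁻¹, since xy = y⁻¹x⁻¹, and by conjugating `conj-y-x²`
  -- with y⁻¹. The equation appears conjugated once more by x, which `conj-inj` removes.
  conj-x-cζ : conj x (c ∙ ζ) ≈ c
  conj-x-cζ = conj-inj x (begin
    conj x (conj x (c ∙ ζ)) ≈⟨ conj-conj x x _ ⟨
    conj x² (c ∙ ζ) ≈⟨ solve 4 (λ X d c w → X ⊕ (c ⊕ w) ⊕ ⊖ X ⊜ ⊖ (⊖ d ⊕ (d ⊕ X) ⊕ ⊖ w ⊕ ⊖ c ⊕ ⊖ X)) refl x² d c ζ ⟩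
    (d ⁻¹ ∙ (d ∙ x²) ∙ ζ ⁻¹ ∙ c ⁻¹ ∙ x² ⁻¹) ⁻¹ ≈⟨ ⁻¹-cong (∙-congʳ (∙-congʳ (∙-congʳ (∙-congˡ (xx d∈ x²∈))))) ⟩
    (d ⁻¹ ∙ (x² ∙ d) ∙ ζ ⁻¹ ∙ c ⁻¹ ∙ x² ⁻¹) ⁻¹ ≈⟨ solve 4 (λ X d c w → ⊖ (⊖ d ⊕ (X ⊕ d) ⊕ ⊖ w ⊕ ⊖ c ⊕ ⊖ X) ⊜ ⊖ (⊖ d ⊕ X ⊕ (d ⊕ ⊖ w ⊕ ⊖ c ⊕ ⊖ X))) refl x² d c ζ ⟩
    (d ⁻¹ ∙ x² ∙ (d ∙ ζ ⁻¹ ∙ c ⁻¹ ∙ x² ⁻¹)) ⁻¹ ≈⟨ ⁻¹-cong (∙-congˡ (trans (sym W₂) W₁)) ⟩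
    (d ⁻¹ ∙ x² ∙ (x² ⁻¹ ∙ d ∙ conj x c ⁻¹)) ⁻¹ ≈⟨ solve 3 (λ X d k → ⊖ (⊖ d ⊕ X ⊕ (⊖ X ⊕ d ⊕ ⊖ k)) ⊜ k) refl x² d (conj x c) ⟩
    conj x c ∎)
    where
    W : Carrier
    W = conj (y ⁻¹) x²
    W₁ : W ≈ x² ⁻¹ ∙ d ∙ conj x c ⁻¹
    W₁ = begin
      conj (y ⁻¹) x² ≈⟨ solve 2 (λ x y → ⊖ y ⊕ (x ⊕ x) ⊕ ⊖ ⊖ y ⊜ (⊖ y ⊕ ⊖ x) ⊕ (x ⊕ x) ⊕ ⊖ (⊖ y ⊕ ⊖ x)) refl x y ⟩
      conj (y ⁻¹ ∙ x ⁻¹) x² ≈⟨ conj-congˡ x² xy-swap ⟨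
      conj (x ∙ y) x² ≈⟨ conj-conj x y x² ⟩
      conj x (conj y x²) ≈⟨ conj-cong x conj-y-x² ⟩
      conj x (x² ⁻¹ ∙ d ∙ c ⁻¹) ≈⟨ conj-∙ x _ _ ⟩
      conj x (x² ⁻¹ ∙ d) ∙ conj x (c ⁻¹) ≈⟨ ∙-cong (conj-comm (xx ∈-self (∈-∙ (∈x-⁻¹ x²∈) d∈))) (conj-⁻¹ x c) ⟩
      x² ⁻¹ ∙ d ∙ conj x c ⁻¹ ∎
    W₂ : W ≈ d ∙ ζ ⁻¹ ∙ c ⁻¹ ∙ x² ⁻¹
    W₂ = begin
      W ≈⟨ solve 2 (λ W X → W ⊜ W ⊕ X ⊕ ⊖ X) refl W x² ⟩
      W ∙ x² ∙ x² ⁻¹ ≈⟨ ∙-congʳ (∙-congˡ (conj-inv y conj-y-x²)) ⟨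
      W ∙ conj (y ⁻¹) (x² ⁻¹ ∙ d ∙ c ⁻¹) ∙ x² ⁻¹ ≈⟨ solve 4 (λ y X d c → ((⊖ y) ⊕ X ⊕ ⊖ ⊖ y) ⊕ (⊖ y ⊕ (⊖ X ⊕ d ⊕ ⊖ c) ⊕ ⊖ ⊖ y) ⊕ ⊖ X ⊜ (⊖ y ⊕ d ⊕ ⊖ ⊖ y) ⊕ (⊖ y ⊕ ⊖ c ⊕ ⊖ ⊖ y) ⊕ ⊖ X) refl y x² d c ⟩
      conj (y ⁻¹) d ∙ conj (y ⁻¹) (c ⁻¹) ∙ x² ⁻¹ ≈⟨ ∙-congʳ (∙-cong y⁻¹dy (conj-comm (yy (∈y-⁻¹ ∈-self) (∈y-⁻¹ c∈)))) ⟩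
      d ∙ ζ ⁻¹ ∙ c ⁻¹ ∙ x² ⁻¹ ∎

  -- `involution-conj` applies to cζ, whose conjugate by x is c, and ζ already commutes with x².
  x²c : Commute x² c
  x²c = comm-respʳ (//-rightDividesʳ ζ c)
    (comm-∙ (involution-conj (∈-∙ c∈ ζ∈) (∈-resp (sym conj-x-cζ) c∈)) (comm-⁻¹ x²ζ))

  -- As x² centralises c and ζ, conjugation by x is an involution on them; it sends cζ to c and
  -- therefore c to cζ.
  conj-x-c : conj x c ≈ c ∙ ζ
  conj-x-c = begin
    conj x c ≈⟨ conj-cong x conj-x-cζ ⟨
    conj x (conj x (c ∙ ζ)) ≈⟨ conj-conj x x _ ⟨
    conj x² (c ∙ ζ) ≈⟨ conj-comm (comm-∙ x²c x²ζ) ⟩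
    c ∙ ζ ∎

  conj-x-c∈ : conj x c ∈⟨ y ⟩
  conj-x-c∈ = ∈-resp (sym conj-x-c) (∈-∙ c∈ ζ∈)

  conj-x-ζ : conj x ζ ≈ ζ ⁻¹
  conj-x-ζ = ∙-cancelˡ (c ∙ ζ) _ _ (begin
    c ∙ ζ ∙ conj x ζ ≈⟨ ∙-congʳ conj-x-c ⟨
    conj x c ∙ conj x ζ ≈⟨ conj-∙ x c ζ ⟨
    conj x (c ∙ ζ) ≈⟨ conj-x-cζ ⟩
    c ≈⟨ //-rightDividesʳ ζ c ⟨
    c ∙ ζ ∙ ζ ⁻¹ ∎)

  -- Two applications of `conj-y-x²` cancel except for the ζ contributed by y d y⁻¹ = dζ.
  conj-y²-x² : conj (y ∙ y) x² ≈ x² ∙ ζ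
  conj-y²-x² = begin
    conj (y ∙ y) x² ≈⟨ conj-conj y y x² ⟩
    conj y (conj y x²) ≈⟨ conj-cong y conj-y-x² ⟩
    conj y (x² ⁻¹ ∙ d ∙ c ⁻¹) ≈⟨ solve 4 (λ y X d c → y ⊕ (⊖ X ⊕ d ⊕ ⊖ c) ⊕ ⊖ y ⊜ ⊖ (y ⊕ X ⊕ ⊖ y) ⊕ (y ⊕ d ⊕ ⊖ y) ⊕ (y ⊕ ⊖ c ⊕ ⊖ y)) refl y x² d c ⟩
    conj y x² ⁻¹ ∙ conj y d ∙ conj y (c ⁻¹) ≈⟨ ∙-cong (∙-cong (⁻¹-cong conj-y-x²) conj-y-d) (conj-comm (yy ∈-self (∈y-⁻¹ c∈))) ⟩
    (x² ⁻¹ ∙ d ∙ c ⁻¹) ⁻¹ ∙ (d ∙ ζ) ∙ c ⁻¹ ≈⟨ solve 4 (λ X d c w → ⊖ (⊖ X ⊕ d ⊕ ⊖ c) ⊕ (d ⊕ w) ⊕ ⊖ c ⊜ c ⊕ (⊖ d ⊕ (X ⊕ d) ⊕ w) ⊕ ⊖ c) refl x² d c ζ ⟩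
    conj c (d ⁻¹ ∙ (x² ∙ d) ∙ ζ) ≈⟨ conj-cong c (∙-congʳ (∙-congˡ (xx x²∈ d∈))) ⟩
    conj c (d ⁻¹ ∙ (d ∙ x²) ∙ ζ) ≈⟨ conj-cong c (∙-congʳ (\\-leftDividesʳ d x²)) ⟩
    conj c (x² ∙ ζ) ≈⟨ conj-comm (comm-∙ (comm-sym x²c) (yy c∈ ζ∈)) ⟩
    x² ∙ ζ ∎

  -- x²y²x⁻² is computed twice: `conj-x-y²`, applied twice, gives d(y²ζ)d⁻¹, and `conj-y²-x²` gives
  -- y²ζ⁻¹. Since d(ζy)d⁻¹ = y, squaring removes y² from the comparison.
  dζ : Commute d ζ
  dζ = comm-conj (⁻¹-injective (∙-cancelˡ (y ∙ y) _ _ (begin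
    y ∙ y ∙ conj d ζ ⁻¹ ≈⟨ ∙-congʳ (conj-d-y²) ⟨
    conj d (ζ ∙ ζ ∙ (y ∙ y)) ∙ conj d ζ ⁻¹ ≈⟨ solve 3 (λ d w Y → (d ⊕ (w ⊕ w ⊕ Y) ⊕ ⊖ d) ⊕ ⊖ (d ⊕ w ⊕ ⊖ d) ⊜ d ⊕ (w ⊕ (w ⊕ Y) ⊕ ⊖ w) ⊕ ⊖ d) refl d ζ (y ∙ y) ⟩
    conj d (conj ζ (ζ ∙ (y ∙ y))) ≈⟨ conj-cong d (conj-comm (yy ζ∈ (∈-∙ ζ∈ y²∈))) ⟩
    conj d (ζ ∙ (y ∙ y)) ≈⟨ conj-cong d (yy ζ∈ y²∈) ⟩
    conj d (y ∙ y ∙ ζ) ≈⟨ left ⟨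
    conj x² (y ∙ y) ≈⟨ right ⟩
    y ∙ y ∙ ζ ⁻¹ ∎)))
    where
    y²∈ : y ∙ y ∈⟨ y ⟩
    y²∈ = ∈-∙ ∈-self ∈-self
    conj-d-y : conj d (ζ ∙ y) ≈ y
    conj-d-y = begin
      d ∙ (ζ ∙ y) ∙ d ⁻¹ ≈⟨ ∙-congʳ (assoc _ _ _) ⟨
      d ∙ ζ ∙ y ∙ d ⁻¹ ≈⟨ ∙-congʳ (∙-congʳ conj-y-d) ⟨
      conj y d ∙ y ∙ d ⁻¹ ≈⟨ solve 2 (λ y d → (y ⊕ d ⊕ ⊖ y) ⊕ y ⊕ ⊖ d ⊜ y) refl y d ⟩
      y ∎
    conj-d-y² : conj d (ζ ∙ ζ ∙ (y ∙ y)) ≈ y ∙ y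
    conj-d-y² = begin
      conj d (ζ ∙ ζ ∙ (y ∙ y)) ≈⟨ conj-cong d (solve 2 (λ w y → w ⊕ w ⊕ (y ⊕ y) ⊜ w ⊕ (w ⊕ y) ⊕ y) refl ζ y) ⟩
      conj d (ζ ∙ (ζ ∙ y) ∙ y) ≈⟨ conj-cong d (∙-congʳ (∙-congˡ (yy ζ∈ ∈-self))) ⟩
      conj d (ζ ∙ (y ∙ ζ) ∙ y) ≈⟨ solve 3 (λ d w y → d ⊕ (w ⊕ (y ⊕ w) ⊕ y) ⊕ ⊖ d ⊜ (d ⊕ (w ⊕ y) ⊕ ⊖ d) ⊕ (d ⊕ (w ⊕ y) ⊕ ⊖ d)) refl d ζ y ⟩
      conj d (ζ ∙ y) ∙ conj d (ζ ∙ y) ≈⟨ ∙-cong conj-d-y conj-d-y ⟩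
      y ∙ y ∎
    left : conj x² (y ∙ y) ≈ conj d (y ∙ y ∙ ζ)
    left = begin
      conj x² (y ∙ y) ≈⟨ conj-conj x x _ ⟩
      conj x (conj x (y ∙ y)) ≈⟨ conj-cong x conj-x-y² ⟩
      conj x ((y ∙ y) ⁻¹ ∙ c ∙ d ⁻¹) ≈⟨ solve 4 (λ x Y c d → x ⊕ (⊖ Y ⊕ c ⊕ ⊖ d) ⊕ ⊖ x ⊜ ⊖ (x ⊕ Y ⊕ ⊖ x) ⊕ (x ⊕ c ⊕ ⊖ x) ⊕ (x ⊕ ⊖ d ⊕ ⊖ x)) refl x (y ∙ y) c d ⟩
      conj x (y ∙ y) ⁻¹ ∙ conj x c ∙ conj x (d ⁻¹) ≈⟨ ∙-cong (∙-cong (⁻¹-cong conj-x-y²) conj-x-c) (conj-comm (xx ∈-self (∈x-⁻¹ d∈))) ⟩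
      ((y ∙ y) ⁻¹ ∙ c ∙ d ⁻¹) ⁻¹ ∙ (c ∙ ζ) ∙ d ⁻¹ ≈⟨ solve 4 (λ Y c d w → ⊖ (⊖ Y ⊕ c ⊕ ⊖ d) ⊕ (c ⊕ w) ⊕ ⊖ d ⊜ d ⊕ (⊖ c ⊕ (Y ⊕ c) ⊕ w) ⊕ ⊖ d) refl (y ∙ y) c d ζ ⟩
      conj d (c ⁻¹ ∙ (y ∙ y ∙ c) ∙ ζ) ≈⟨ conj-cong d (∙-congʳ (∙-congˡ (yy y²∈ c∈))) ⟩
      conj d (c ⁻¹ ∙ (c ∙ (y ∙ y)) ∙ ζ) ≈⟨ conj-cong d (∙-congʳ (\\-leftDividesʳ _ _)) ⟩
      conj d (y ∙ y ∙ ζ) ∎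
    right : conj x² (y ∙ y) ≈ y ∙ y ∙ ζ ⁻¹
    right = begin
      conj x² (y ∙ y) ≈⟨ solve 2 (λ X Y → X ⊕ Y ⊕ ⊖ X ⊜ ⊖ ((Y ⊕ X ⊕ ⊖ Y) ⊕ ⊖ X) ⊕ Y) refl x² (y ∙ y) ⟩
      (conj (y ∙ y) x² ∙ x² ⁻¹) ⁻¹ ∙ (y ∙ y) ≈⟨ ∙-congʳ (⁻¹-cong (∙-congʳ (trans conj-y²-x² x²ζ))) ⟩
      (ζ ∙ x² ∙ x² ⁻¹) ⁻¹ ∙ (y ∙ y) ≈⟨ ∙-congʳ (⁻¹-cong (//-rightDividesʳ _ _)) ⟩
      ζ ⁻¹ ∙ (y ∙ y) ≈⟨ yy (∈y-⁻¹ ζ∈) y²∈ ⟩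
      y ∙ y ∙ ζ ⁻¹ ∎

  d≉ε : ¬ d ≈ ε
  d≉ε e = y²-not-normal (∈-resp (sym (trans conj-x-y² (trans (∙-congˡ (trans (⁻¹-cong e) ε⁻¹≈ε)) (identityʳ _))))
    (∈-∙ (∈y-⁻¹ (∈-∙ ∈-self ∈-self)) c∈))

  -- With ζ = ε, y would centralise d, against the trivial core of ⟨x⟩; and d = ε would put xy²x⁻¹ =
  -- y⁻²c into ⟨y⟩.
  ζ≉ε : ¬ ζ ≈ ε
  ζ≉ε e = d≉ε (coreless d∈ (∈-resp (sym (trans conj-y-d (trans (∙-congˡ e) (identityʳ d)))) d∈))

  c≉ε : ¬ c ≈ ε
  c≉ε e = ζ≉ε (∙-cancelˡ c _ _ (begin
    c ∙ ζ ≈⟨ conj-x-c ⟨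
    conj x c ≈⟨ conj-cong x e ⟩
    conj x ε ≈⟨ conj-ε x ⟩
    ε ≈⟨ e ⟨
    c ≈⟨ identityʳ c ⟨
    c ∙ ε ∎))

  least-ζ : ∀ {B} → B ∈⟨ y ⟩ → conj x B ∈⟨ y ⟩ → ¬ B ≈ ε → ζ ∈⟨ B ⟩
  least-ζ B∈ h ne = ∈-trans ζ∈z (least B∈ h ne)

  ζᵏ≈ε⇒∣ : ∀ k → ζ ^ k ≈ ε → m ∣ k
  ζᵏ≈ε⇒∣ k e with m ∣? k
  ... | yes h = h
  ... | no ¬h = contradiction (coprime-ε (prime-coprime m-prime ¬h) ζᵐ e) ζ≉ε

  -- y multiplies d^m by ζ^m = ε, so it fixes an element of the core-free group ⟨x⟩.
  dᵐ : d ^ m ≈ ε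
  dᵐ = coreless (∈-^ m d∈) (∈-resp (sym (begin
    conj y (d ^ m) ≈⟨ conj-^ y d m ⟩
    conj y d ^ m ≈⟨ ^-cong m conj-y-d ⟩
    (d ∙ ζ) ^ m ≈⟨ ^-∙ m dζ ⟩
    d ^ m ∙ ζ ^ m ≈⟨ ∙-congˡ ζᵐ ⟩
    d ^ m ∙ ε ≈⟨ identityʳ _ ⟩
    d ^ m ∎)) (∈-^ m d∈))

  x²^ : ∀ k → x² ^ k ≈ x ^ (2 ℕ.* k)
  x²^ k = trans (^-cong k (sym (^-2 x))) (sym (^-* x 2 k))

  -- Conjugation by y² multiplies (x²)^k by ζ^k.
  m∣order-x² : ∀ k → x² ^ k ≈ ε → m ∣ k
  m∣order-x² k e = ζᵏ≈ε⇒∣ k (begin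
    ζ ^ k ≈⟨ identityˡ _ ⟨
    ε ∙ ζ ^ k ≈⟨ ∙-congʳ e ⟨
    x² ^ k ∙ ζ ^ k ≈⟨ ^-∙ k x²ζ ⟨
    (x² ∙ ζ) ^ k ≈⟨ ^-cong k conj-y²-x² ⟨
    conj (y ∙ y) x² ^ k ≈⟨ conj-^ (y ∙ y) x² k ⟨
    conj (y ∙ y) (x² ^ k) ≈⟨ conj-cong (y ∙ y) e ⟩
    conj (y ∙ y) ε ≈⟨ conj-ε _ ⟩
    ε ∎)

  odd-p⇒x∈ : ∀ {n} → p ≡ suc (2 ℕ.* n) → x ∈⟨ x² ⟩
  odd-p⇒x∈ {n} e = suc n , (begin
    x ≈⟨ identityʳ x ⟨
    x ∙ ε ≈⟨ ∙-congˡ x-period ⟨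
    x ^ suc p ≈⟨ ^-≡ x (≡.cong suc e) ⟩
    x ^ suc (suc (2 ℕ.* n)) ≈⟨ ^-≡ x (≡.cong suc (≡.sym (ℕₚ.+-suc n (n ℕ.+ 0)))) ⟩
    x ^ (2 ℕ.* suc n) ≈⟨ x²^ (suc n) ⟨
    x² ^ suc n ∎)

  d∈x²-even : ∀ n k → p ≡ 2 ℕ.* n → d ≈ x ^ k → m ∣ n → d ∈⟨ x² ⟩
  d∈x²-even _ k e f (divides-refl l) = even (*-cancelʳ-∣ {2 ℕ.* l} {k} m
      (≡.subst (_∣ k ℕ.* m) (≡.trans e (≡.sym (ℕₚ.*-assoc 2 l m)))
        (x-order (k ℕ.* m) (trans (^-* x k m) (trans (^-cong m (sym f)) dᵐ)))))
    where
    even : 2 ℕ.* l ∣ k → d ∈⟨ x² ⟩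
    even (divides h k≡) = h ℕ.* l , trans f (trans (^-≡ x (≡.trans k≡
      (≡.trans (≡.sym (ℕₚ.*-assoc h 2 l)) (≡.trans (≡.cong (ℕ._* l) (ℕₚ.*-comm h 2)) (ℕₚ.*-assoc 2 h l)))))
      (sym (x²^ (h ℕ.* l))))

  -- Needed to make c and d commute. For odd p, x itself is a power of x². For p = 2n the order of
  -- x² makes m divide n, and then dᵐ = ε forces the exponent of d to be a multiple of 2n/m, hence
  -- even.
  d∈x² : d ∈⟨ x² ⟩
  d∈x² = [ (λ e → d∈x²-even n (proj₁ d∈) e (proj₂ d∈)
             (m∣order-x² n (trans (x²^ n) (trans (^-≡ x (≡.sym e)) x-period))))
         , (λ e → ∈-trans d∈ (odd-p⇒x∈ {n} e)) ]′ (proj₂ (even⊎odd p))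
    where n = proj₁ (even⊎odd p)

  cd : Commute c d
  cd = ∈-comm d∈x² (comm-sym x²c)

  conj-y-x²^ : ∀ k → conj y (x² ^ k) ≈ (x² ^ k) ⁻¹ ∙ d ^ k ∙ (c ^ k) ⁻¹
  conj-y-x²^ k = begin
    conj y (x² ^ k) ≈⟨ conj-^ y x² k ⟩
    conj y x² ^ k ≈⟨ ^-cong k conj-y-x² ⟩
    (x² ⁻¹ ∙ d ∙ c ⁻¹) ^ k ≈⟨ ^-∙ k (comm-sym (comm-∙ (comm-⁻¹ (comm-sym (comm-⁻¹ x²c))) (comm-sym (comm-⁻¹ (comm-sym cd))))) ⟩
    (x² ⁻¹ ∙ d) ^ k ∙ (c ⁻¹) ^ k ≈⟨ ∙-cong (^-∙ k (xx (∈x-⁻¹ x²∈) d∈)) (^-⁻¹ c k) ⟩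
    (x² ⁻¹) ^ k ∙ d ^ k ∙ (c ^ k) ⁻¹ ≈⟨ ∙-congʳ (∙-congʳ (^-⁻¹ x² k)) ⟩
    (x² ^ k) ⁻¹ ∙ d ^ k ∙ (c ^ k) ⁻¹ ∎

  -- `conj-y-x²^` degenerates to inversion, which keeps (x²)^k inside ⟨x⟩; the trivial core then
  -- kills it. All bounds on p come from here or from the undegenerated relation.
  conj-y-x²^-ε : ∀ k → d ^ k ≈ ε → c ^ k ≈ ε → x² ^ k ≈ ε
  conj-y-x²^-ε k dᵏ cᵏ = coreless (∈-^ k x²∈) (∈-resp (sym (begin
    conj y (x² ^ k) ≈⟨ conj-y-x²^ k ⟩
    (x² ^ k) ⁻¹ ∙ d ^ k ∙ (c ^ k) ⁻¹ ≈⟨ ∙-cong (∙-congˡ dᵏ) (⁻¹-cong cᵏ) ⟩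
    (x² ^ k) ⁻¹ ∙ ε ∙ ε ⁻¹ ≈⟨ solve 1 (λ g → ⊖ g ⊕ 𝟙 ⊕ ⊖ 𝟙 ⊜ ⊖ g) refl (x² ^ k) ⟩
    (x² ^ k) ⁻¹ ∎)) (∈x-⁻¹ (∈-^ k x²∈)))

-- The types for odd and for even m

triangle : ℕ → ℕ
triangle zero = 0
triangle (suc n) = n ℕ.+ triangle n

triangle-double : ∀ n → n ℕ.+ 2 ℕ.* triangle n ≡ n ℕ.* n
triangle-double zero = ≡.refl
triangle-double (suc n) = ≡.trans (lemma n (triangle n)) (≡.trans (≡.cong (suc (2 ℕ.* n) ℕ.+_) (triangle-double n)) (lemma′ n))
  where
  lemma : ∀ n t → suc n ℕ.+ 2 ℕ.* (n ℕ.+ t) ≡ suc (2 ℕ.* n) ℕ.+ (n ℕ.+ 2 ℕ.* t)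
  lemma = solve-∀
  lemma′ : ∀ n → suc (2 ℕ.* n) ℕ.+ n ℕ.* n ≡ suc n ℕ.* suc n
  lemma′ = solve-∀

^-∣-^ : ∀ m {a b} → a ≤ b → m ℕ.^ a ∣ m ℕ.^ b
^-∣-^ m {a} {b} a≤b = ≡.subst (m ℕ.^ a ∣_) (≡.trans (≡.sym (ℕₚ.^-distribˡ-+-* m a (b ∸ a))) (≡.cong (m ℕ.^_) (ℕₚ.m+[n∸m]≡n a≤b))) (m∣m*n _)

module Cases {p q : ℕ} (T : TightGroup p q) (R : Reduced T) (S : Swap T R) where
  open TightGroup T
  open Theory T
  open Reduced R
  open Swap S
  open Relations T R S
  open GroupSolver group
  open import Algebra.Properties.Group group
  open import Relation.Binary.Reasoning.Setoid setoid

  -- ζ, of order m, is a power of every nontrivial element of ⟨y⟩ that x conjugates into ⟨y⟩. This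
  -- is how other primes are excluded from q.
  order-∣ : ∀ {B} k → B ∈⟨ y ⟩ → conj x B ∈⟨ y ⟩ → ¬ B ≈ ε → B ^ k ≈ ε → m ∣ k
  order-∣ {B} k B∈ h ne e = let s , f = least-ζ B∈ h ne in ζᵏ≈ε⇒∣ k (begin
    ζ ^ k ≈⟨ ^-cong k f ⟩
    (B ^ s) ^ k ≈⟨ ^-* B s k ⟨
    B ^ (s ℕ.* k) ≈⟨ ^-≡ B (ℕₚ.*-comm s k) ⟩
    B ^ (k ℕ.* s) ≈⟨ ^-* B k s ⟩
    (B ^ k) ^ s ≈⟨ ^-ε s e ⟩
    ε ∎)

  y∈⇒y^q : ∀ {B} → B ∈⟨ y ⟩ → B ^ q ≈ ε
  y∈⇒y^q {B} (k , e) = trans (^-cong q e) (trans (sym (^-* y k q)) (y^-∣ (divides-refl k)))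

  m∣q : m ∣ q
  m∣q = ζᵏ≈ε⇒∣ q (y∈⇒y^q ζ∈)

  prime≢1 : ∀ {l} → Prime l → ¬ l ∣ 1
  prime≢1 pl d = ¬prime[1] (≡.subst Prime (∣1⇒≡1 d) pl)

  y^t-order : ∀ t k l → q ≡ t ℕ.* l → y ^ (t ℕ.* k) ≈ ε → l ∣ k
  y^t-order t k l q≡ e = *-cancelˡ-∣ t {{t≢0}} (≡.subst (_∣ t ℕ.* k) q≡ (y-order (t ℕ.* k) e))
    where
    t≢0 : NonZero t
    t≢0 = ℕ.≢-nonZero λ t≡0 → ℕ.≢-nonZero⁻¹ q (≡.trans q≡ (≡.cong (ℕ._* l) t≡0))

  module OddPrime (m≢2 : m ≢ 2) where
    x-ζ-not-comm : ¬ Commute x ζ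
    x-ζ-not-comm h = m≢2 (prime∣prime m-prime prime[2] (ζᵏ≈ε⇒∣ 2 (begin
      ζ ^ 2 ≈⟨ ^-2 ζ ⟩
      ζ ∙ ζ ≈⟨ ∙-congʳ (trans (sym (conj-comm h)) conj-x-ζ) ⟩
      ζ ⁻¹ ∙ ζ ≈⟨ inverseˡ ζ ⟩
      ε ∎)))

    -- x fixes c^m because ζ^m = ε. Were c^m nontrivial, ζ would be a power of it and would commute
    -- with x, whereas x inverts ζ and m is odd.
    cᵐ : c ^ m ≈ ε
    cᵐ = decidable-stable (ε? (c ^ m)) λ ne →
      x-ζ-not-comm (∈-comm (least-ζ (∈-^ m c∈) (∈-resp (sym fixed) (∈-^ m c∈)) ne) (comm-conj fixed))
      where
      fixed : conj x (c ^ m) ≈ c ^ m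
      fixed = begin
        conj x (c ^ m) ≈⟨ conj-^ x c m ⟩
        conj x c ^ m ≈⟨ ^-cong m conj-x-c ⟩
        (c ∙ ζ) ^ m ≈⟨ ^-∙ m (yy c∈ ζ∈) ⟩
        c ^ m ∙ ζ ^ m ≈⟨ ∙-congˡ ζᵐ ⟩
        c ^ m ∙ ε ≈⟨ identityʳ _ ⟩
        c ^ m ∎

    x²ᵐ : x² ^ m ≈ ε
    x²ᵐ = conj-y-x²^-ε m dᵐ cᵐ

    -- For odd p, x would be a power of x² and commute with ζ. For p = 2n, `x²ᵐ` gives that n
    -- divides m, and n = 1 contradicts `m∣order-x²`.
    p≡2m : p ≡ 2 ℕ.* m
    p≡2m = [ even , (λ e → contradiction (comm-sym (∈-comm (odd-p⇒x∈ {n} e) (comm-sym x²ζ))) x-ζ-not-comm) ]′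
        (proj₂ (even⊎odd p))
      where
      n = proj₁ (even⊎odd p)
      even : p ≡ 2 ℕ.* n → p ≡ 2 ℕ.* m
      even e = [ (λ n≡1 → contradiction (m∣order-x² 1 (trans (x²^ 1)
                   (trans (^-≡ x (≡.trans (≡.cong (2 ℕ.*_) (≡.sym n≡1)) (≡.sym e))) x-period))) (prime≢1 m-prime))
               , (λ n≡m → ≡.trans e (≡.cong (2 ℕ.*_) n≡m)) ]′
        (prime⇒irreducible m-prime (*-cancelˡ-∣ {n} {m} 2 (≡.subst (_∣ 2 ℕ.* m) e (x-order (2 ℕ.* m) (trans (sym (x²^ m)) x²ᵐ)))))

    -- Collection in nilpotency class two: moving b past a^k costs η^k, and these costs add up to
    -- `triangle n`, which is n(n-1)/2.
    collect : ∀ {a b η} n → b ∙ a ≈ a ∙ b ∙ η → Commute η a → Commute η b →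
      (a ∙ b) ^ n ≈ a ^ n ∙ b ^ n ∙ η ^ triangle n
    collect zero h ηa ηb = solve 0 (𝟙 ⊜ 𝟙 ⊕ 𝟙 ⊕ 𝟙) refl
    collect {a} {b} {η} (suc n) h ηa ηb = begin
      a ∙ b ∙ (a ∙ b) ^ n ≈⟨ ∙-congˡ (collect n h ηa ηb) ⟩
      a ∙ b ∙ (a ^ n ∙ b ^ n ∙ η ^ triangle n) ≈⟨ solve 5 (λ a b A B H → a ⊕ b ⊕ (A ⊕ B ⊕ H) ⊜ a ⊕ (b ⊕ A) ⊕ B ⊕ H) refl a b (a ^ n) (b ^ n) (η ^ triangle n) ⟩
      a ∙ (b ∙ a ^ n) ∙ b ^ n ∙ η ^ triangle n ≈⟨ ∙-congʳ (∙-congʳ (∙-congˡ (move n))) ⟩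
      a ∙ (a ^ n ∙ b ∙ η ^ n) ∙ b ^ n ∙ η ^ triangle n ≈⟨ solve 6 (λ a b A B H K → a ⊕ (A ⊕ b ⊕ K) ⊕ B ⊕ H ⊜ a ⊕ A ⊕ b ⊕ (K ⊕ B) ⊕ H) refl a b (a ^ n) (b ^ n) (η ^ triangle n) (η ^ n) ⟩
      a ^ suc n ∙ b ∙ (η ^ n ∙ b ^ n) ∙ η ^ triangle n ≈⟨ ∙-congʳ (∙-congˡ (comm-^ n (comm-^ˡ n ηb))) ⟩
      a ^ suc n ∙ b ∙ (b ^ n ∙ η ^ n) ∙ η ^ triangle n ≈⟨ solve 5 (λ A b B H K → A ⊕ b ⊕ (B ⊕ K) ⊕ H ⊜ A ⊕ (b ⊕ B) ⊕ (K ⊕ H)) refl (a ^ suc n) b (b ^ n) (η ^ triangle n) (η ^ n) ⟩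
      a ^ suc n ∙ b ^ suc n ∙ (η ^ n ∙ η ^ triangle n) ≈⟨ ∙-congˡ (^-+ η n (triangle n)) ⟨
      a ^ suc n ∙ b ^ suc n ∙ η ^ triangle (suc n) ∎
      where
      move : ∀ n → b ∙ a ^ n ≈ a ^ n ∙ b ∙ η ^ n
      move zero = solve 1 (λ b → b ⊕ 𝟙 ⊜ 𝟙 ⊕ b ⊕ 𝟙) refl b
      move (suc n) = begin
        b ∙ (a ∙ a ^ n) ≈⟨ assoc _ _ _ ⟨
        b ∙ a ∙ a ^ n ≈⟨ ∙-congʳ h ⟩
        a ∙ b ∙ η ∙ a ^ n ≈⟨ assoc _ _ _ ⟩
        a ∙ b ∙ (η ∙ a ^ n) ≈⟨ ∙-congˡ (comm-^ n ηa) ⟩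
        a ∙ b ∙ (a ^ n ∙ η) ≈⟨ solve 4 (λ a b A H → a ⊕ b ⊕ (A ⊕ H) ⊜ a ⊕ (b ⊕ A) ⊕ H) refl a b (a ^ n) η ⟩
        a ∙ (b ∙ a ^ n) ∙ η ≈⟨ ∙-congʳ (∙-congˡ (move n)) ⟩
        a ∙ (a ^ n ∙ b ∙ η ^ n) ∙ η ≈⟨ solve 5 (λ a b A H K → a ⊕ (A ⊕ b ⊕ K) ⊕ H ⊜ a ⊕ A ⊕ b ⊕ (K ⊕ H)) refl a b (a ^ n) η (η ^ n) ⟩
        a ^ suc n ∙ b ∙ (η ^ n ∙ η) ≈⟨ ∙-congˡ (comm-sym (comm-^ n comm-refl)) ⟩
        a ^ suc n ∙ b ∙ η ^ suc n ∎

    m∣triangle : m ∣ triangle m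
    m∣triangle = [ (λ m∣2 → contradiction (prime∣prime m-prime prime[2] m∣2) m≢2) , (λ h → h) ]′
      (euclidsLemma 2 (triangle m) m-prime (∣m+n∣m⇒∣n (≡.subst (m ∣_) (≡.sym (triangle-double m)) (m∣m*n m)) ∣-refl))

    -- xyx⁻¹ = y⁻¹x⁻², whose m-th power is collected. As d generates the group of order m containing
    -- x², x² = d^k and y x² y⁻¹ = x²ζ^k; the error term vanishes because an odd m divides m(m-1)/2.
    conj-x-yᵐ : conj x (y ^ m) ≈ (y ^ m) ⁻¹
    conj-x-yᵐ = begin
      conj x (y ^ m) ≈⟨ conj-^ x y m ⟩
      conj x y ^ m ≈⟨ ^-cong m (trans (∙-congʳ xy-swap) (solve 2 (λ x y → ⊖ y ⊕ ⊖ x ⊕ ⊖ x ⊜ ⊖ y ⊕ ⊖ (x ⊕ x)) refl x y)) ⟩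
      (y ⁻¹ ∙ x² ⁻¹) ^ m ≈⟨ collect m twist (yy η∈ (∈y-⁻¹ ∈-self)) (comm-⁻¹ (comm-sym (comm-⁻¹ (comm-^ k x²ζ)))) ⟩
      (y ⁻¹) ^ m ∙ (x² ⁻¹) ^ m ∙ η ^ triangle m ≈⟨ ∙-cong (∙-cong (^-⁻¹ y m) (trans (^-⁻¹ x² m) (trans (⁻¹-cong x²ᵐ) ε⁻¹≈ε))) (Periodic.^-∣ {n = m} ηᵐ m∣triangle) ⟩
      (y ^ m) ⁻¹ ∙ ε ∙ ε ≈⟨ trans (identityʳ _) (identityʳ _) ⟩
      (y ^ m) ⁻¹ ∎
      where
      k = proj₁ (prime-generates x²ᵐ d∈x² d≉ε)
      e : x² ≈ d ^ k
      e = proj₂ (prime-generates x²ᵐ d∈x² d≉ε)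
      η : Carrier
      η = (ζ ^ k) ⁻¹
      η∈ : η ∈⟨ y ⟩
      η∈ = ∈y-⁻¹ (∈-^ k ζ∈)
      ηᵐ : η ^ m ≈ ε
      ηᵐ = trans (^-⁻¹ _ m) (trans (⁻¹-cong (trans (sym (^-* ζ k m)) (Periodic.^-∣ {n = m} ζᵐ (divides-refl k)))) ε⁻¹≈ε)
      conj-y : conj y x² ≈ x² ∙ ζ ^ k
      conj-y = begin
        conj y x² ≈⟨ conj-cong y e ⟩
        conj y (d ^ k) ≈⟨ conj-^ y d k ⟩
        conj y d ^ k ≈⟨ ^-cong k conj-y-d ⟩
        (d ∙ ζ) ^ k ≈⟨ ^-∙ k dζ ⟩
        d ^ k ∙ ζ ^ k ≈⟨ ∙-congʳ e ⟨
        x² ∙ ζ ^ k ∎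
      twist : x² ⁻¹ ∙ y ⁻¹ ≈ y ⁻¹ ∙ x² ⁻¹ ∙ η
      twist = begin
        x² ⁻¹ ∙ y ⁻¹ ≈⟨ solve 2 (λ X y → ⊖ X ⊕ ⊖ y ⊜ ⊖ y ⊕ ⊖ (y ⊕ X ⊕ ⊖ y)) refl x² y ⟩
        y ⁻¹ ∙ conj y x² ⁻¹ ≈⟨ ∙-congˡ (⁻¹-cong (trans conj-y (comm-^ k x²ζ))) ⟩
        y ⁻¹ ∙ (ζ ^ k ∙ x²) ⁻¹ ≈⟨ solve 3 (λ X y w → ⊖ y ⊕ ⊖ (w ⊕ X) ⊜ ⊖ y ⊕ ⊖ X ⊕ ⊖ w) refl x² y (ζ ^ k) ⟩
        y ⁻¹ ∙ x² ⁻¹ ∙ η ∎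

    -- y^(q/l) has order l. If m divides q/l, it is a power of y^m, which x inverts, and `order-∣`
    -- makes m divide l; otherwise m divides l at once, from m ∣ q.
    only-prime : ∀ l → Prime l → l ∣ q → l ≡ m
    only-prime l pl (divides t q≡) = [ (λ m∣t → ≡.sym (prime∣prime m-prime pl (order-∣ l (t , refl)
      (conj-∈ (t∈ m∣t) (∈-resp (sym conj-x-yᵐ) (∈y-⁻¹ (m , refl))))
      (λ e → prime≢1 pl (y^t-order t 1 l q≡ (trans (^-≡ y (ℕₚ.*-identityʳ t)) e)))
      (trans (sym (^-* y t l)) (trans (^-≡ y (≡.sym q≡)) y-period)))))
      , (λ m∣l → ≡.sym (prime∣prime m-prime pl m∣l)) ]′ (euclidsLemma t l m-prime (≡.subst (m ∣_) q≡ m∣q))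
      where
      t∈ : m ∣ t → y ^ t ∈⟨ y ^ m ⟩
      t∈ (divides-refl s) = s , trans (^-≡ y (ℕₚ.*-comm s m)) (^-* y m s)

    q≡m^b : ∃ λ b → q ≡ m ℕ.^ b
    q≡m^b = prime-power m-prime q only-prime

    y∉z : ¬ y ^ m ≈ ε
    y∉z e = y²-not-normal (conj-∈ {a = y} (∈-∙ ∈-self ∈-self) (∈-trans (conj-∈ (prime-generates e z∈ z≉ε) conj-z) z∈))

    2≤b : ∀ b → q ≡ m ℕ.^ b → 2 ≤ b
    2≤b zero e = contradiction (^-ε m (trans (sym (^-1 y)) (trans (^-≡ y (≡.sym e)) y-period))) y∉z
    2≤b (suc zero) e = contradiction (trans (^-≡ y (≡.sym (≡.trans e (ℕₚ.*-identityʳ m)))) y-period) y∉z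
    2≤b (suc (suc b)) e = s≤s (s≤s z≤n)

    types : AtomicTypeList p q
    types = let b , e = q≡m^b in inj₁ (m , b , m-prime , m≢2 , 2≤b b e , inj₁ (p≡2m , e))

  module EvenPrime (m≡2 : m ≡ 2) where
    ζ² : ζ ∙ ζ ≈ ε
    ζ² = trans (sym (^-2 ζ)) (≡.subst (λ n → ζ ^ n ≈ ε) m≡2 ζᵐ)
    d^2 : d ^ 2 ≈ ε
    d^2 = ≡.subst (λ n → d ^ n ≈ ε) m≡2 dᵐ
    ζ⁻¹≈ζ : ζ ⁻¹ ≈ ζ
    ζ⁻¹≈ζ = sym (inverseˡ-unique _ _ ζ²)
    d⁻¹≈d : d ⁻¹ ≈ d
    d⁻¹≈d = sym (inverseˡ-unique _ _ (trans (sym (^-2 d)) d^2))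

    y² Q : Carrier
    y² = y ∙ y
    Q = y² ^ 2
    y²∈ : y² ∈⟨ y ⟩
    y²∈ = ∈-∙ ∈-self ∈-self
    Q∈ : Q ∈⟨ y ⟩
    Q∈ = ∈-^ 2 y²∈

    Q^ : ∀ k → Q ^ k ≈ y ^ (4 ℕ.* k)
    Q^ k = begin
      Q ^ k ≈⟨ ^-cong k (solve 1 (λ y → (y ⊕ y) ⊕ ((y ⊕ y) ⊕ 𝟙) ⊜ y ⊕ (y ⊕ (y ⊕ (y ⊕ 𝟙)))) refl y) ⟩
      (y ^ 4) ^ k ≈⟨ ^-* y 4 k ⟨
      y ^ (4 ℕ.* k) ∎

    y²d : Commute y² d
    y²d = comm-conj (begin
      conj y² d ≈⟨ conj-conj y y d ⟩
      conj y (conj y d) ≈⟨ conj-cong y conj-y-d ⟩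
      conj y (d ∙ ζ) ≈⟨ conj-∙ y d ζ ⟩
      conj y d ∙ conj y ζ ≈⟨ ∙-cong conj-y-d (conj-comm (yy ∈-self ζ∈)) ⟩
      d ∙ ζ ∙ ζ ≈⟨ assoc _ _ _ ⟩
      d ∙ (ζ ∙ ζ) ≈⟨ ∙-congˡ ζ² ⟩
      d ∙ ε ≈⟨ identityʳ d ⟩
      d ∎)

    -- Squaring removes d from `conj-x-y²`: the factors commute and d² = ε. So x conjugates y⁴ into
    -- ⟨y⟩, although it does not do so with y².
    conj-x-Q : conj x Q ≈ Q ⁻¹ ∙ c ^ 2
    conj-x-Q = begin
      conj x (y² ^ 2) ≈⟨ conj-^ x y² 2 ⟩
      conj x y² ^ 2 ≈⟨ ^-cong 2 conj-x-y² ⟩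
      (y² ⁻¹ ∙ c ∙ d ⁻¹) ^ 2 ≈⟨ ^-∙ 2 (comm-sym (comm-∙ (comm-⁻¹ (comm-sym (comm-⁻¹ y²d))) (comm-sym (comm-⁻¹ cd)))) ⟩
      (y² ⁻¹ ∙ c) ^ 2 ∙ (d ⁻¹) ^ 2 ≈⟨ ∙-cong (^-∙ 2 (yy (∈y-⁻¹ y²∈) c∈)) (trans (^-cong 2 d⁻¹≈d) d^2) ⟩
      (y² ⁻¹) ^ 2 ∙ c ^ 2 ∙ ε ≈⟨ identityʳ _ ⟩
      (y² ⁻¹) ^ 2 ∙ c ^ 2 ≈⟨ ∙-congʳ (^-⁻¹ y² 2) ⟩
      Q ⁻¹ ∙ c ^ 2 ∎

    conj-x-Q∈ : conj x Q ∈⟨ y ⟩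
    conj-x-Q∈ = ∈-resp (sym conj-x-Q) (∈-∙ (∈y-⁻¹ Q∈) (∈-^ 2 c∈))

    -- For odd l, Q^(q/l) is nontrivial since l does not divide 4; its l-th power is trivial, and
    -- `order-∣` would make 2 divide l.
    only-prime : ∀ l → Prime l → l ∣ q → l ≡ 2
    only-prime l pl (divides t q≡) = decidable-stable (l ℕ.≟ 2) λ l≢2 → l≢2 (≡.sym (prime∣prime prime[2] pl (≡.subst (_∣ l) m≡2 (order-∣ l (∈-^ t Q∈)
        (conj-∈ {a = Q} (t , refl) conj-x-Q∈)
        (λ e → l≢2 (prime∣prime pl prime[2] (prime∣^ 2 2 pl (y^t-order t 4 l q≡ (trans (^-≡ y (ℕₚ.*-comm t 4)) (trans (sym (Q^ t)) e))))))
        (trans (sym (^-* Q t l)) (trans (Q^ (t ℕ.* l)) (y^-∣ (∣n⇒∣m*n 4 (∣-reflexive q≡)))))))))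

    b : ℕ
    b = proj₁ (prime-power prime[2] q only-prime)
    q≡2^b : q ≡ 2 ℕ.^ b
    q≡2^b = proj₂ (prime-power prime[2] q only-prime)

    -- The exponent 2q kills both c and d, so x^(4q) = ε. This coarse bound shows that p is a power
    -- of 2.
    p∣ : p ∣ 2 ℕ.^ (2 ℕ.+ b)
    p∣ = ≡.subst (λ n → p ∣ 2 ℕ.* (2 ℕ.* n)) q≡2^b (x-order (2 ℕ.* (2 ℕ.* q)) (trans (sym (x²^ (2 ℕ.* q)))
      (conj-y-x²^-ε (2 ℕ.* q) (trans (^-* d 2 q) (^-ε q d^2))
        (trans (^-≡ c (ℕₚ.*-comm 2 q)) (trans (^-* c q 2) (^-ε 2 (y∈⇒y^q c∈)))))))

    p-power : ∃ λ a → p ≡ 2 ℕ.^ a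
    p-power = prime-power prime[2] p λ l pl l∣p → prime∣prime pl prime[2] (prime∣^ 2 (2 ℕ.+ b) pl (∣-trans l∣p p∣))

    p∤2 : p ∤ 2
    p∤2 h = prime≢1 m-prime (m∣order-x² 1 (trans (x²^ 1) (x^-∣ h)))

    odd-generates : ∀ {g} k → g ∈⟨ y ⟩ → 2 ∤ k → g ∈⟨ g ^ k ⟩
    odd-generates {g} k g∈ 2∤k = ∈-resp (^-1 g) (≡.subst (λ n → g ^ n ∈⟨ g ^ k ⟩)
      (coprime⇒gcd≡1 {k} {q} (coprime-sym (≡.subst (λ n → Coprime n k) (≡.sym q≡2^b) (prime-coprime-^ b prime[2] 2∤k))))
      (Periodic.∈-gcd {n = q} (y∈⇒y^q g∈) k))

    odd-ε : ∀ {g} k → g ∈⟨ y ⟩ → 2 ∤ k → g ^ k ≈ ε → g ≈ ε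
    odd-ε {g} k g∈ 2∤k e = coprime-ε (≡.subst (λ n → Coprime n k) (≡.sym q≡2^b) (prime-coprime-^ b prime[2] 2∤k)) (y∈⇒y^q g∈) e

    c-odd : ∀ k → c ≈ y ^ suc (2 ℕ.* k) → ⊥
    c-odd k e = y²-not-normal (conj-∈ {a = y} y²∈
      (conj-∈ (let s , f = odd-generates (suc (2 ℕ.* k)) ∈-self (2∤odd k) in s , trans f (^-cong s (sym e))) conj-x-c∈))

    c-twice-odd : ∀ k → c ≈ y² ^ suc (2 ℕ.* k) → ⊥
    c-twice-odd k e = y²-not-normal
      (conj-∈ (let s , f = odd-generates (suc (2 ℕ.* k)) y²∈ (2∤odd k) in s , trans f (^-cong s (sym e))) conj-x-c∈)

    -- An odd or twice odd exponent would make y² a power of c, because q is a power of 2; since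
    -- xcx⁻¹ lies in ⟨y⟩, so would xy²x⁻¹.
    c∈Q : c ∈⟨ Q ⟩
    c∈Q = first (proj₁ c∈) (proj₂ c∈) (even⊎odd (proj₁ c∈))
      where
      second : ∀ k → c ≈ y² ^ k → (∃ λ h → k ≡ 2 ℕ.* h ⊎ k ≡ suc (2 ℕ.* h)) → c ∈⟨ Q ⟩
      second _ e (h , inj₁ ≡.refl) = h , trans e (^-* y² 2 h)
      second _ e (h , inj₂ ≡.refl) = ⊥-elim (c-twice-odd h e)
      first : ∀ k → c ≈ y ^ k → (∃ λ h → k ≡ 2 ℕ.* h ⊎ k ≡ suc (2 ℕ.* h)) → c ∈⟨ Q ⟩
      first _ e (h , inj₁ ≡.refl) = second h (trans e (trans (^-* y 2 h) (^-cong h (^-2 y)))) (even⊎odd h)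
      first _ e (h , inj₂ ≡.refl) = ⊥-elim (c-odd h e)

    -- xcx⁻¹ is cζ by `conj-x-c`, and c⁻¹c^(2(t+1)) when `conj-x-Q` is raised to the power t + 1.
    c-relation : ∀ t → c ≈ Q ^ suc t → c ^ (2 ℕ.* t) ≈ ζ
    c-relation t e = ∙-cancelˡ (c ^ 2) _ _ (begin
      c ^ 2 ∙ c ^ (2 ℕ.* t) ≈⟨ ^-+ c 2 (2 ℕ.* t) ⟨
      c ^ (2 ℕ.+ 2 ℕ.* t) ≈⟨ ^-≡ c (≡.sym (ℕₚ.*-suc 2 t)) ⟩
      c ^ (2 ℕ.* suc t) ≈⟨ ^-* c 2 (suc t) ⟩
      (c ^ 2) ^ suc t ≈⟨ \\-leftDividesˡ c _ ⟨
      c ∙ (c ⁻¹ ∙ (c ^ 2) ^ suc t) ≈⟨ ∙-congˡ (∙-congʳ (⁻¹-cong e)) ⟩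
      c ∙ ((Q ^ suc t) ⁻¹ ∙ (c ^ 2) ^ suc t) ≈⟨ ∙-congˡ (∙-congʳ (^-⁻¹ Q (suc t))) ⟨
      c ∙ ((Q ⁻¹) ^ suc t ∙ (c ^ 2) ^ suc t) ≈⟨ ∙-congˡ (^-∙ (suc t) (yy (∈y-⁻¹ Q∈) (∈-^ 2 c∈))) ⟨
      c ∙ (Q ⁻¹ ∙ c ^ 2) ^ suc t ≈⟨ ∙-congˡ (^-cong (suc t) conj-x-Q) ⟨
      c ∙ conj x Q ^ suc t ≈⟨ ∙-congˡ (conj-^ x Q (suc t)) ⟨
      c ∙ conj x (Q ^ suc t) ≈⟨ ∙-congˡ (conj-cong x e) ⟨
      c ∙ conj x c ≈⟨ ∙-congˡ conj-x-c ⟩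
      c ∙ (c ∙ ζ) ≈⟨ solve 2 (λ c w → c ⊕ (c ⊕ w) ⊜ c ⊕ (c ⊕ 𝟙) ⊕ w) refl c ζ ⟩
      c ^ 2 ∙ ζ ∎)

    -- P stands for p / 4.
    d≈ : ∀ P → p ≡ 2 ℕ.* (2 ℕ.* P) → d ≈ x² ^ P
    -- d is the involution x^(p/2) of ⟨x⟩: d² = ε makes P divide its exponent over x², and d ≠ ε
    -- makes the cofactor odd.
    d≈ P p≡ = by (proj₁ d∈x²) (proj₂ d∈x²) (*-cancelˡ-∣ 2 (*-cancelˡ-∣ 2 (≡.subst₂ _∣_ p≡ (≡.cong (2 ℕ.*_) (ℕₚ.*-comm k 2))
        (x-order (2 ℕ.* (k ℕ.* 2)) (trans (sym (x²^ (k ℕ.* 2))) (trans (^-* x² k 2) (trans (^-cong 2 (sym (proj₂ d∈x²))) d^2)))))))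
      where
      k = proj₁ d∈x²
      arith : ∀ h P → 2 ℕ.* (2 ℕ.* h ℕ.* P) ≡ h ℕ.* (2 ℕ.* (2 ℕ.* P))
      arith = solve-∀
      even-ε : ∀ h → x² ^ (2 ℕ.* h ℕ.* P) ≈ ε
      even-ε h = trans (x²^ (2 ℕ.* h ℕ.* P)) (x^-∣ (divides h (≡.trans (arith h P) (≡.cong (h ℕ.*_) (≡.sym p≡)))))
      parity : ∀ k′ → d ≈ x² ^ (k′ ℕ.* P) → (∃ λ h → k′ ≡ 2 ℕ.* h ⊎ k′ ≡ suc (2 ℕ.* h)) → d ≈ x² ^ P
      parity _ e (h , inj₁ ≡.refl) = contradiction (trans e (even-ε h)) d≉ε
      parity _ e (h , inj₂ ≡.refl) = begin
        d ≈⟨ e ⟩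
        x² ^ (P ℕ.+ 2 ℕ.* h ℕ.* P) ≈⟨ ^-+ x² P (2 ℕ.* h ℕ.* P) ⟩
        x² ^ P ∙ x² ^ (2 ℕ.* h ℕ.* P) ≈⟨ ∙-congˡ (even-ε h) ⟩
        x² ^ P ∙ ε ≈⟨ identityʳ _ ⟩
        x² ^ P ∎
      by : ∀ k → d ≈ x² ^ k → P ∣ k → d ≈ x² ^ P
      by _ e (divides-refl k′) = parity k′ e (even⊎odd k′)

    dζ-relation : ∀ P → p ≡ 2 ℕ.* (2 ℕ.* P) → d ∙ ζ ≈ d ⁻¹ ∙ d ^ P ∙ (c ^ P) ⁻¹
    dζ-relation P p≡ = begin
      d ∙ ζ ≈⟨ conj-y-d ⟨
      conj y d ≈⟨ conj-cong y (d≈ P p≡) ⟩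
      conj y (x² ^ P) ≈⟨ conj-y-x²^ P ⟩
      (x² ^ P) ⁻¹ ∙ d ^ P ∙ (c ^ P) ⁻¹ ≈⟨ ∙-congʳ (∙-congʳ (⁻¹-cong (d≈ P p≡))) ⟨
      d ⁻¹ ∙ d ^ P ∙ (c ^ P) ⁻¹ ∎

    -- For p/4 = 1 the relation reads dζ = c⁻¹ and puts d into ⟨y⟩.
    p≢4 : p ≢ 4
    p≢4 p≡ = d≉ε (meet∈ d∈ (∈-resp (begin
      (c ^ 1) ⁻¹ ∙ ζ ⁻¹ ≈⟨ ∙-congʳ (trans (sym (identityˡ _)) (∙-congʳ (trans (sym (inverseˡ d)) (∙-congˡ (sym (^-1 d)))))) ⟩
      d ⁻¹ ∙ d ^ 1 ∙ (c ^ 1) ⁻¹ ∙ ζ ⁻¹ ≈⟨ ∙-congʳ (dζ-relation 1 p≡) ⟨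
      d ∙ ζ ∙ ζ ⁻¹ ≈⟨ //-rightDividesʳ ζ d ⟩
      d ∎) (∈-∙ (∈y-⁻¹ (∈-^ 1 c∈)) (∈y-⁻¹ ζ∈))))

    -- Here P is p/8, so the exponent p/4 = 2P is even, d^(p/4) = ε, and `dζ-relation` leaves
    -- c^(p/4) = ζ.
    c^P : ∀ P → p ≡ 2 ℕ.* (2 ℕ.* (2 ℕ.* P)) → c ^ (2 ℕ.* P) ≈ ζ
    c^P P p≡ = begin
      c ^ (2 ℕ.* P) ≈⟨ ⁻¹-involutive _ ⟨
      (c ^ (2 ℕ.* P)) ⁻¹ ⁻¹ ≈⟨ ⁻¹-cong (∙-cancelˡ d _ _ (begin
        d ∙ (c ^ (2 ℕ.* P)) ⁻¹ ≈⟨ ∙-congʳ (trans (sym d⁻¹≈d) (sym (identityʳ _))) ⟩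
        d ⁻¹ ∙ ε ∙ (c ^ (2 ℕ.* P)) ⁻¹ ≈⟨ ∙-congʳ (∙-congˡ (trans (^-* d 2 P) (^-ε P d^2))) ⟨
        d ⁻¹ ∙ d ^ (2 ℕ.* P) ∙ (c ^ (2 ℕ.* P)) ⁻¹ ≈⟨ dζ-relation (2 ℕ.* P) p≡ ⟨
        d ∙ ζ ∎)) ⟩
      ζ ⁻¹ ≈⟨ ζ⁻¹≈ζ ⟩
      ζ ∎

    c^-ε : ∀ k l → c ^ k ≈ ε → k ∣ l → c ^ l ≈ ε
    c^-ε k _ e (divides-refl s) = trans (^-≡ c (ℕₚ.*-comm s k)) (trans (^-* c k s) (^-ε s e))

    -- Here t is odd. In the 2-group ⟨y⟩ an odd exponent can be removed, so c^(2t) = ζ yields c⁴ = ε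
    -- and c² = ζ. If 16 divided p, then 4 would divide p/4 and c^(p/4) could not be ζ. And ζ = c²
    -- is a power of y^16, so q does not divide 16.
    types-odd : ∀ a h → p ≡ 2 ℕ.^ (3 ℕ.+ a) → c ≈ Q ^ suc (suc (2 ℕ.* h)) → AtomicTypeList p q
    types-odd a h p≡ e = inj₂ (inj₁ (b , 5≤b , inj₁ (p≡8 a p≡ , q≡2^b)))
      where
      t = suc (2 ℕ.* h)
      2t : c ^ (2 ℕ.* t) ≈ ζ
      2t = c-relation t e
      c⁴ : c ^ 4 ≈ ε
      c⁴ = odd-ε t (∈-^ 4 c∈) (2∤odd h) (begin
        (c ^ 4) ^ t ≈⟨ ^-* c 4 t ⟨
        c ^ (4 ℕ.* t) ≈⟨ ^-≡ c (arith t) ⟩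
        c ^ (2 ℕ.* t ℕ.* 2) ≈⟨ ^-* c (2 ℕ.* t) 2 ⟩
        (c ^ (2 ℕ.* t)) ^ 2 ≈⟨ ^-cong 2 2t ⟩
        ζ ^ 2 ≈⟨ trans (^-2 ζ) ζ² ⟩
        ε ∎)
        where
        arith : ∀ t → 4 ℕ.* t ≡ 2 ℕ.* t ℕ.* 2
        arith = solve-∀
      c²≈ζ : c ^ 2 ≈ ζ
      c²≈ζ = begin
        c ^ 2 ≈⟨ identityʳ _ ⟨
        c ^ 2 ∙ ε ≈⟨ ∙-congˡ (c^-ε 4 (4 ℕ.* h) c⁴ (m∣m*n h)) ⟨
        c ^ 2 ∙ c ^ (4 ℕ.* h) ≈⟨ ^-+ c 2 (4 ℕ.* h) ⟨
        c ^ (2 ℕ.+ 4 ℕ.* h) ≈⟨ ^-≡ c (arith h) ⟩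
        c ^ (2 ℕ.* t) ≈⟨ 2t ⟩
        ζ ∎
        where
        arith : ∀ h → 2 ℕ.+ 4 ℕ.* h ≡ 2 ℕ.* suc (2 ℕ.* h)
        arith = solve-∀
      p≡8 : ∀ a → p ≡ 2 ℕ.^ (3 ℕ.+ a) → p ≡ 8
      p≡8 zero p≡ = p≡
      p≡8 (suc a) p≡ = contradiction (trans (sym (c^P (2 ℕ.^ suc a) p≡)) (c^-ε 4 (2 ℕ.* (2 ℕ.* 2 ℕ.^ a)) c⁴ (divides (2 ℕ.^ a) (arith (2 ℕ.^ a))))) ζ≉ε
        where
        arith : ∀ n → 2 ℕ.* (2 ℕ.* n) ≡ n ℕ.* 4
        arith = solve-∀
      5≤b : 5 ≤ b
      5≤b = decidable-stable (5 ℕ.≤? b) λ ¬h → ζ≉ε (begin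
        ζ ≈⟨ c²≈ζ ⟨
        c ^ 2 ≈⟨ ^-cong 2 e ⟩
        (Q ^ suc t) ^ 2 ≈⟨ ^-* Q (suc t) 2 ⟨
        Q ^ (suc t ℕ.* 2) ≈⟨ Q^ (suc t ℕ.* 2) ⟩
        y ^ (4 ℕ.* (suc t ℕ.* 2)) ≈⟨ y^-∣ (∣-trans (≡.subst (_∣ 16) (≡.sym q≡2^b) (^-∣-^ 2 (ℕ.s≤s⁻¹ (ℕₚ.≰⇒> ¬h)))) (divides (suc h) (arith h))) ⟩
        ε ∎)
        where
        arith : ∀ h → 4 ℕ.* (suc (suc (2 ℕ.* h)) ℕ.* 2) ≡ suc h ℕ.* 16
        arith = solve-∀

    -- Write κ for the odd exponent of Q. Then c^(p/4) = ζ reads y^(κp) = ζ, an element of order 2: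
    -- q divides 2p but not p. For p = 8 this would give c² = ζ, hence c⁴ = ε, against c^(4h) = ζ.
    types-even : ∀ a h → p ≡ 2 ℕ.^ (3 ℕ.+ a) → c ≈ Q ^ suc (2 ℕ.* h) → AtomicTypeList p q
    types-even a h p≡ e = inj₂ (inj₂ (3 ℕ.+ a , 4≤ a p≡ , inj₁ (p≡ , ≡.trans q≡2^b (≡.cong (2 ℕ.^_) b≡))))
      where
      t = 2 ℕ.* h
      P = 2 ℕ.* 2 ℕ.^ a
      cᴾ : c ^ P ≈ ζ
      cᴾ = c^P (2 ℕ.^ a) p≡
      c²ᴾ : c ^ (P ℕ.* 2) ≈ ε
      c²ᴾ = trans (^-* c P 2) (trans (^-cong 2 cᴾ) (trans (^-2 ζ) ζ²))
      c^≈ : ∀ k → c ^ k ≈ y ^ (4 ℕ.* (suc t ℕ.* k))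
      c^≈ k = trans (^-cong k e) (trans (sym (^-* Q (suc t) k)) (Q^ (suc t ℕ.* k)))
      q∣ : q ∣ 2 ℕ.^ (4 ℕ.+ a)
      q∣ = coprime-divisor (≡.subst (λ n → Coprime n (suc t)) (≡.sym q≡2^b) (prime-coprime-^ b prime[2] (2∤odd h)))
        (≡.subst (q ∣_) (arith (suc t) (2 ℕ.^ a)) (y-order (4 ℕ.* (suc t ℕ.* (P ℕ.* 2))) (trans (sym (c^≈ (P ℕ.* 2))) c²ᴾ)))
        where
        arith : ∀ k n → 4 ℕ.* (k ℕ.* (2 ℕ.* n ℕ.* 2)) ≡ k ℕ.* (2 ℕ.* (2 ℕ.* (2 ℕ.* (2 ℕ.* n))))
        arith = solve-∀
      q∤ : q ∤ 2 ℕ.^ (3 ℕ.+ a)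
      q∤ d = ζ≉ε (trans (sym cᴾ) (trans (c^≈ P) (y^-∣ (∣-trans d (divides (suc t) (arith (suc t) (2 ℕ.^ a)))))))
        where
        arith : ∀ k n → 4 ℕ.* (k ℕ.* (2 ℕ.* n)) ≡ k ℕ.* (2 ℕ.* (2 ℕ.* (2 ℕ.* n)))
        arith = solve-∀
      b≡ : b ≡ 4 ℕ.+ a
      b≡ = ℕₚ.≤-antisym
        (ℕₚ.≮⇒≥ λ lt → ℕₚ.<⇒≱ (ℕₚ.^-monoʳ-< 2 (s≤s (s≤s z≤n)) lt) (∣⇒≤ {{ℕₚ.m^n≢0 2 (4 ℕ.+ a)}} (≡.subst (_∣ 2 ℕ.^ (4 ℕ.+ a)) q≡2^b q∣)))
        (ℕₚ.≰⇒> λ b≤ → q∤ (≡.subst (_∣ 2 ℕ.^ (3 ℕ.+ a)) (≡.sym q≡2^b) (^-∣-^ 2 b≤)))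
      4≤ : ∀ a → p ≡ 2 ℕ.^ (3 ℕ.+ a) → 4 ≤ 3 ℕ.+ a
      4≤ (suc a) _ = s≤s (s≤s (s≤s (s≤s z≤n)))
      4≤ zero p≡ = contradiction (trans (sym (c-relation t e)) (c^-ε 4 (2 ℕ.* t)
        (trans (^-* c 2 2) (trans (^-cong 2 (c^P 1 p≡)) (trans (^-2 ζ) ζ²))) (divides h (arith h)))) ζ≉ε
        where
        arith : ∀ h → 2 ℕ.* (2 ℕ.* h) ≡ h ℕ.* 4
        arith = solve-∀

    types-parity : ∀ a t → p ≡ 2 ℕ.^ (3 ℕ.+ a) → c ≈ Q ^ suc t →
      (∃ λ h → t ≡ 2 ℕ.* h ⊎ t ≡ suc (2 ℕ.* h)) → AtomicTypeList p q
    types-parity a _ p≡ e (h , inj₁ ≡.refl) = types-even a h p≡ e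
    types-parity a _ p≡ e (h , inj₂ ≡.refl) = types-odd a h p≡ e

    types-by : ∀ a κ → p ≡ 2 ℕ.^ a → c ≈ Q ^ κ → AtomicTypeList p q
    types-by _ zero _ e = contradiction e c≉ε
    types-by zero (suc _) p≡ _ = contradiction (≡.subst (_∣ 2) (≡.sym p≡) (1∣ 2)) p∤2
    types-by 1 (suc _) p≡ _ = contradiction (≡.subst (_∣ 2) (≡.sym p≡) ∣-refl) p∤2
    types-by 2 (suc _) p≡ _ = contradiction p≡ p≢4
    types-by (suc (suc (suc a))) (suc t) p≡ e = types-parity a t p≡ e (even⊎odd t)

    types : AtomicTypeList p q
    types = types-by (proj₁ p-power) (proj₁ c∈Q) (proj₂ p-power) (proj₂ c∈Q)

  types-dec : Dec (m ≡ 2) → AtomicTypeList p q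
  types-dec (yes e) = EvenPrime.types e
  types-dec (no ne) = OddPrime.types ne

  types : AtomicTypeList p q
  types = types-dec (m ℕ.≟ 2)

-- The types of atomic chiral groups

module RegularityCriteria {p q : ℕ} (T : TightGroup p q) where
  open TightGroup T
  open Theory T
  open GroupSolver group
  open import Algebra.Properties.Group group
  open import Relation.Binary.Reasoning.Setoid setoid

  regular-∩ : ∀ {a b} → RegularModulo (_∈⟨ a ⟩) → RegularModulo (_∈⟨ b ⟩) →
    (∀ {g} → g ∈⟨ a ⟩ → g ∈⟨ b ⟩ → g ≈ ε) → Regular⁺
  regular-∩ ra rb trivial w e = trivial (ra w (0 , e)) (rb w (0 , e))

  p≡1⇒regular : p ≡ 1 → Regular⁺
  p≡1⇒regular ≡.refl = swap⇒regular λ B B∈ → B , ε , B∈ , ∈-ε ,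
    trans (∙-congʳ x≈ε) (trans (identityˡ B) (sym (identityʳ B))) ,
    trans (∙-congʳ (⁻¹-cong x≈ε)) (solve 1 (λ B → ⊖ 𝟙 ⊕ ⊖ B ⊜ ⊖ B ⊕ ⊖ 𝟙) refl B)
    where
    x≈ε : x ≈ ε
    x≈ε = trans (sym (^-1 x)) x-period

  module _ (normal : conj x (y ∙ y) ∈⟨ y ⟩) where
    y² : Carrier
    y² = y ∙ y
    y²∈ : y² ∈⟨ y ⟩
    y²∈ = ∈-∙ ∈-self ∈-self
    yy : ∀ {u v} → u ∈⟨ y ⟩ → v ∈⟨ y ⟩ → Commute u v
    yy u∈ v∈ = ∈-comm v∈ (comm-sym (∈-comm u∈ comm-refl))

    conj-x⁻¹ : ∀ {C} → C ∈⟨ y² ⟩ → conj (x ⁻¹) C ≈ conj x C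
    conj-x⁻¹ {C} C∈ = conj-inv x (trans (sym (conj-conj x x C)) (conj-comm (∈-comm C∈ (involution-conj y²∈ normal))))

    even-swap : ∀ {C} → C ∈⟨ y² ⟩ → MirroredSwap C
    even-swap {C} C∈ = conj x C , x , conj-∈ C∈ normal , ∈-self , conj-swap refl , (begin
      x ⁻¹ ∙ C ⁻¹ ≈⟨ solve 2 (λ x C → ⊖ x ⊕ ⊖ C ⊜ ⊖ (⊖ x ⊕ C ⊕ ⊖ ⊖ x) ⊕ ⊖ x) refl x C ⟩
      conj (x ⁻¹) C ⁻¹ ∙ x ⁻¹ ≈⟨ ∙-congʳ (⁻¹-cong (conj-x⁻¹ C∈)) ⟩
      conj x C ⁻¹ ∙ x ⁻¹ ∎)

    odd-swap : ∀ {C} → C ∈⟨ y² ⟩ → MirroredSwap (C ∙ y)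
    odd-swap {C} C∈ = conj x C ∙ y ⁻¹ , x ⁻¹ , ∈-∙ D∈ (∈y-⁻¹ ∈-self) , ∈x-⁻¹ ∈-self , (begin
        x ∙ (C ∙ y) ≈⟨ solve 3 (λ x y C → x ⊕ (C ⊕ y) ⊜ (x ⊕ C ⊕ ⊖ x) ⊕ (x ⊕ y)) refl x y C ⟩
        conj x C ∙ (x ∙ y) ≈⟨ ∙-congˡ (trans (inverseˡ-unique _ _ involution) (⁻¹-anti-homo-∙ x y)) ⟩
        conj x C ∙ (y ⁻¹ ∙ x ⁻¹) ≈⟨ assoc _ _ _ ⟨
        conj x C ∙ y ⁻¹ ∙ x ⁻¹ ∎) , (begin
        x ⁻¹ ∙ (C ∙ y) ⁻¹ ≈⟨ ∙-congˡ (⁻¹-cong (yy (∈-trans C∈ y²∈) ∈-self)) ⟩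
        x ⁻¹ ∙ (y ∙ C) ⁻¹ ≈⟨ solve 3 (λ x y C → ⊖ x ⊕ ⊖ (y ⊕ C) ⊜ ⊖ (⊖ x ⊕ C ⊕ ⊖ ⊖ x) ⊕ (⊖ x ⊕ ⊖ (x ⊕ y) ⊕ x)) refl x y C ⟩
        conj (x ⁻¹) C ⁻¹ ∙ (x ⁻¹ ∙ (x ∙ y) ⁻¹ ∙ x) ≈⟨ ∙-cong (⁻¹-cong (conj-x⁻¹ C∈)) (∙-congʳ (∙-congˡ (sym (inverseˡ-unique _ _ involution)))) ⟩
        conj x C ⁻¹ ∙ (x ⁻¹ ∙ (x ∙ y) ∙ x) ≈⟨ solve 3 (λ x y D → ⊖ D ⊕ (⊖ x ⊕ (x ⊕ y) ⊕ x) ⊜ ⊖ (⊖ y ⊕ D) ⊕ x) refl x y (conj x C) ⟩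
        (y ⁻¹ ∙ conj x C) ⁻¹ ∙ x ≈⟨ ∙-cong (⁻¹-cong (yy (∈y-⁻¹ ∈-self) D∈)) (sym (⁻¹-involutive x)) ⟩
        (conj x C ∙ y ⁻¹) ⁻¹ ∙ x ⁻¹ ⁻¹ ∎)
      where
      D∈ : conj x C ∈⟨ y ⟩
      D∈ = conj-∈ C∈ normal

    swap-resp : ∀ {B C} → B ≈ C → MirroredSwap C → MirroredSwap B
    swap-resp e (B′ , A′ , B∈ , A∈ , f , g) = B′ , A′ , B∈ , A∈ , trans (∙-congˡ e) f , trans (∙-congˡ (⁻¹-cong e)) g

    y^2k : ∀ k → y ^ (2 ℕ.* k) ≈ y² ^ k
    y^2k k = trans (^-* y 2 k) (^-cong k (^-2 y))

    -- x² centralises ⟨y²⟩, so x and x⁻¹ conjugate it alike and swaps with even powers of y are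
    -- mirrored; for odd powers, xy = y⁻¹x⁻¹ handles the remaining letter.
    y²-normal⇒regular : Regular⁺
    y²-normal⇒regular = swap⇒regular λ B (b , e) → parity b e (even⊎odd b)
      where
      parity : ∀ {B} b → B ≈ y ^ b → (∃ λ k → b ≡ 2 ℕ.* k ⊎ b ≡ suc (2 ℕ.* k)) → MirroredSwap B
      parity _ e (k , inj₁ ≡.refl) = swap-resp (trans e (y^2k k)) (even-swap (k , refl))
      parity _ e (k , inj₂ ≡.refl) = swap-resp (trans e (trans (∙-congˡ (y^2k k)) (yy ∈-self (∈-^ k y²∈)))) (odd-swap (k , refl))

module Reducing {p q : ℕ} (T : TightGroup p q) (chiral : ¬ TightGroup.Regular⁺ T)
  (atomicX : AtomicX T) (atomicY : AtomicX (dual T)) where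
  open TightGroup T
  open Theory T
  open RegularityCriteria T
  open import Algebra.Properties.Group group
  open import Relation.Binary.Reasoning.Setoid setoid

  regularY : ∀ n → n ∣ q → n < q → NormalX (dual T) n → RegularModulo (_∈⟨ y ^ n ⟩)
  regularY n d lt h = undual-regular T (_∈⟨ y ^ n ⟩) (atomicY n d lt h)

  module _ (s t m u : ℕ) (s<q : s < q) (normal : NormalX (dual T) s)
    (q≡ts : q ≡ t ℕ.* s) (m-prime : Prime m) (t≡um : t ≡ u ℕ.* m) where
    r : ℕ
    -- r = q/m: y^r generates the subgroup of order m of the normal group ⟨y^s⟩ and inherits its
    -- normality.
    r = u ℕ.* s
    q≡ : q ≡ r ℕ.* m
    q≡ = ≡.trans q≡ts (≡.trans (≡.cong (ℕ._* s) t≡um) (≡.trans (ℕₚ.*-assoc u m s)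
      (≡.trans (≡.cong (u ℕ.*_) (ℕₚ.*-comm m s)) (≡.sym (ℕₚ.*-assoc u s m)))))
    instance
      m≢0 : NonZero m
      m≢0 = prime⇒nonZero m-prime
      r≢0 : NonZero r
      r≢0 = ℕ.≢-nonZero λ r≡0 → ℕ.≢-nonZero⁻¹ q (≡.trans q≡ (≡.cong (ℕ._* m) r≡0))

    z : Carrier
    z = y ^ r
    zᵐ : z ^ m ≈ ε
    zᵐ = trans (sym (^-* y r m)) (trans (^-≡ y (≡.sym q≡)) y-period)
    z≉ε : ¬ z ≈ ε
    z≉ε e = ¬prime[1] (≡.subst Prime (∣1⇒≡1 (*-cancelˡ-∣ {m} {1} r (≡.subst₂ _∣_ q≡ (≡.sym (ℕₚ.*-identityʳ r)) (y-order r e)))) m-prime)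
    r<q : r < q
    r<q = ℕₚ.≤∧≢⇒< (∣⇒≤ (≡.subst (r ∣_) (≡.sym q≡) (m∣m*n m))) λ r≡q → z≉ε (trans (^-≡ y r≡q) y-period)
    z≈ : z ≈ (y ^ s) ^ u
    z≈ = trans (^-≡ y (ℕₚ.*-comm u s)) (^-* y s u)
    conj-z : conj x z ∈⟨ z ⟩
    conj-z = let k , e = normal in k , (begin
      conj x z ≈⟨ conj-cong x z≈ ⟩
      conj x ((y ^ s) ^ u) ≈⟨ conj-^ x (y ^ s) u ⟩
      conj x (y ^ s) ^ u ≈⟨ ^-cong u e ⟩
      ((y ^ s) ^ k) ^ u ≈⟨ ^-* (y ^ s) k u ⟨
      (y ^ s) ^ (k ℕ.* u) ≈⟨ ^-≡ (y ^ s) (ℕₚ.*-comm k u) ⟩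
      (y ^ s) ^ (u ℕ.* k) ≈⟨ ^-* (y ^ s) u k ⟩
      ((y ^ s) ^ u) ^ k ≈⟨ ^-cong k z≈ ⟨
      z ^ k ∎)

    regular-z : RegularModulo (_∈⟨ z ⟩)
    regular-z = regularY r (≡.subst (r ∣_) (≡.sym q≡) (m∣m*n m)) r<q conj-z

    ∈^-ε : ∀ {g a} n → a ^ n ≈ ε → g ∈⟨ a ⟩ → g ^ n ≈ ε
    ∈^-ε {g} {a} n aⁿ (k , e) = begin
      g ^ n ≈⟨ ^-cong n e ⟩
      (a ^ k) ^ n ≈⟨ ^-* a k n ⟨
      a ^ (k ℕ.* n) ≈⟨ ^-≡ a (ℕₚ.*-comm k n) ⟩
      a ^ (n ℕ.* k) ≈⟨ ^-* a n k ⟩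
      (a ^ n) ^ k ≈⟨ ^-ε k aⁿ ⟩
      ε ∎

    -- ⟨B⟩ contains a nontrivial normal subgroup ⟨y^n⟩ of order t′. If m divides t′, it contains z.
    -- If not, ⟨y^n⟩ and ⟨z⟩ meet trivially, and regularity modulo both would make the group
    -- regular.
    least : ∀ {B} → B ∈⟨ y ⟩ → conj x B ∈⟨ y ⟩ → ¬ B ≈ ε → z ∈⟨ B ⟩
    least {B} (b , e) h ne = by (m ∣? t′)
      where
      n = gcd b q
      n∣q = gcd[m,n]∣n b q
      t′ = _∣_.quotient n∣q
      q≡′ : q ≡ t′ ℕ.* n
      q≡′ = _∣_.equality n∣q
      n<q : n < q
      n<q = Core.gcd<p (dual T) b (λ f → ne (trans e f))
      n-normal : NormalX (dual T) n
      n-normal = Core.normal-gcd (dual T) b (∈-resp (conj-cong x e) h)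
      yⁿ∈ : y ^ n ∈⟨ B ⟩
      yⁿ∈ = let k , f = ∈y-gcd b in k , trans f (^-cong k (sym e))
      by : Dec (m ∣ t′) → z ∈⟨ B ⟩
      by (yes (divides v t′≡)) = ∈-trans (v , trans (^-≡ y r≡) (^-* y n v)) yⁿ∈
        where
        r≡ : r ≡ n ℕ.* v
        r≡ = ℕₚ.*-cancelʳ-≡ r (n ℕ.* v) m (≡.trans (≡.sym q≡) (≡.trans q≡′ (≡.trans (≡.cong (ℕ._* n) t′≡)
          (≡.trans (ℕₚ.*-comm (v ℕ.* m) n) (≡.sym (ℕₚ.*-assoc n v m))))))
      by (no m∤t′) = contradiction (regular-∩ regular-z (regularY n n∣q n<q n-normal) λ g∈z g∈n →
        coprime-ε (prime-coprime m-prime m∤t′) (∈^-ε m zᵐ g∈z)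
          (∈^-ε t′ (trans (sym (^-* y n t′)) (trans (^-≡ y (≡.trans (ℕₚ.*-comm n t′) (≡.sym q≡′))) y-period)) g∈n)) chiral

    no-normalX : ¬ NormalSubgroup T
    no-normalX (n , d , lt , h) = chiral (regular-∩ (atomicX n d lt h) regular-z λ g∈x g∈y →
      meet∈ (∈-trans g∈x (n , refl)) (∈-trans g∈y (r , refl)))

    reduced : Reduced T
    reduced = record
      { coreless = Core.coreless T no-normalX
      ; m = m ; m-prime = m-prime ; z = z ; z∈ = r , refl ; zᵐ = zᵐ ; z≉ε = z≉ε ; conj-z = conj-z
      ; least = least ; regular-z = regular-z
      ; y²-not-normal = λ h → chiral (y²-normal⇒regular h) }

  types : NormalSubgroup (dual T) → AtomicTypeList p q
  types (s , divides t q≡ , s<q , normal) = Cases.types T R (swapping T R)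
    where
    instance
      t≢0 : NonZero t
      t≢0 = ℕ.≢-nonZero λ t≡0 → ℕ.≢-nonZero⁻¹ q (≡.trans q≡ (≡.cong (ℕ._* s) t≡0))
    t≢1 : t ≢ 1
    t≢1 t≡1 = ℕₚ.<⇒≢ s<q (≡.sym (≡.trans q≡ (≡.trans (≡.cong (ℕ._* s) t≡1) (ℕₚ.*-identityˡ s))))
    D = prime-divisor t t≢1
    m = proj₁ D
    m∣t = proj₂ (proj₂ D)
    R : Reduced T
    R = reduced s t m (_∣_.quotient m∣t) s<q normal q≡ (proj₁ (proj₂ D)) (_∣_.equality m∣t)

dual-types : ∀ {p q} → AtomicTypeList q p → AtomicTypeList p q
dual-types = λ where
    (inj₁ (m , a , h₁ , h₂ , h₃ , e)) → inj₁ (m , a , h₁ , h₂ , h₃ , flip e)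
    (inj₂ (inj₁ (b , h , e))) → inj₂ (inj₁ (b , h , flip e))
    (inj₂ (inj₂ (a , h , e))) → inj₂ (inj₂ (a , h , flip e))
  where
  flip : ∀ {A B C D : Set} → (A × B) ⊎ (C × D) → (D × C) ⊎ (B × A)
  flip (inj₁ (a , b)) = inj₂ (b , a)
  flip (inj₂ (c , d)) = inj₁ (d , c)

classification : ∀ {p q} (T : TightGroup p q) → ¬ TightGroup.Regular⁺ T →
  AtomicX T → AtomicX (dual T) → AtomicTypeList p q
classification {p} {q} T chiral ax ay = by (Core.normalSubgroup? T) (Core.normalSubgroup? (dual T))
  where
  open TightGroup T
  chiral′ : ¬ TightGroup.Regular⁺ (dual T)
  chiral′ r = chiral (undual-regular T (_≈ ε) r)
  by : NormalSubgroup T ⊎ ¬ NormalSubgroup T → NormalSubgroup (dual T) ⊎ ¬ NormalSubgroup (dual T) → AtomicTypeList p q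
  by _ (inj₁ h) = Reducing.types T chiral ax ay h
  by (inj₁ h) (inj₂ _) = dual-types (Reducing.types (dual T) chiral′ ay ax h)
  by (inj₂ nx) (inj₂ ny) = ⊥-elim (some-normal T (chiral ∘ RegularityCriteria.p≡1⇒regular T)
    (chiral′ ∘ RegularityCriteria.p≡1⇒regular (dual T)) nx ny)

-- Flags of a polyhedron

pattern 0F = zero
pattern 1F = suc zero
pattern 2F = suc (suc zero)

flagEq⇒≡ : (P : Polyhedron) {Φ Ψ : Flag P} → FlagEq P Φ Ψ → Φ ≡ Ψ
flagEq⇒≡ P {flag v e f a b c d g} {flag _ _ _ a′ b′ c′ d′ g′} (≡.refl , ≡.refl , ≡.refl)
  with ≡.refl ← ≡-irrelevant a a′ | ≡.refl ← ≡-irrelevant b b′ | ≡.refl ← ≡-irrelevant c c′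
     | ≡.refl ← Polyhedron.≼-irrelevant P d d′ | ≡.refl ← Polyhedron.≼-irrelevant P g g′ = ≡.refl

-- Edges through every vertex and face are assumed separately: a lone vertex satisfies all the
-- axioms. Type {p,q} with p and q nonzero provides them.
module Flags (P : Polyhedron)
  (edgeAt : ∀ v → Polyhedron.IsVertex P v → EdgesAtVertex P v)
  (edgeOf : ∀ f → Polyhedron.IsFace P f → EdgesOfFace P f) where
  open Polyhedron P
  open Flag

  flag-≡ : ∀ {Φ Ψ : Flag P} → FlagEq P Φ Ψ → Φ ≡ Ψ
  flag-≡ = flagEq⇒≡ P

  rankView : ∀ x → IsVertex x ⊎ IsEdge x ⊎ IsFace x
  rankView x with rank x
  ... | 0F = inj₁ ≡.refl
  ... | 1F = inj₂ (inj₁ ≡.refl)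
  ... | 2F = inj₂ (inj₂ ≡.refl)

  -- `Elem` has no decidable equality, but two members of a known pair can be compared through the
  -- pair.
  two-dec : ∀ {Pr : Elem → Set} → ExactlyTwo Pr → ∀ {c d} → Pr c → Pr d → c ≡ d ⊎ c ≢ d
  two-dec (a , b , a≢b , _ , _ , all) {c} {d} pc pd with all c pc | all d pd
  ... | inj₁ ≡.refl | inj₁ ≡.refl = inj₁ ≡.refl
  ... | inj₁ ≡.refl | inj₂ ≡.refl = inj₂ a≢b
  ... | inj₂ ≡.refl | inj₁ ≡.refl = inj₂ (a≢b ∘ ≡.sym)
  ... | inj₂ ≡.refl | inj₂ ≡.refl = inj₁ ≡.refl

  other : ∀ {Pr : Elem → Set} → ExactlyTwo Pr → ∀ {c} → Pr c →
    Σ Elem λ c′ → Pr c′ × c ≢ c′ × (∀ c″ → Pr c″ → c ≢ c″ → c″ ≡ c′)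
  other (a , b , a≢b , pa , pb , all) {c} pc with all c pc
  ... | inj₁ ≡.refl = b , pb , a≢b , λ c″ p ne → [ (λ e → contradiction (≡.sym e) ne) , (λ e → e) ]′ (all c″ p)
  ... | inj₂ ≡.refl = a , pa , (a≢b ∘ ≡.sym) , λ c″ p ne → [ (λ e → e) , (λ e → contradiction (≡.sym e) ne) ]′ (all c″ p)

  module At (Φ : Flag P) where
    vertices : ExactlyTwo (λ w → IsVertex w × w ≼ e Φ)
    vertices = edge-vertices (e Φ) (e-edge Φ)
    edges : ExactlyTwo (λ d → IsEdge d × v Φ ≼ d × d ≼ f Φ)
    edges = diamond (v Φ) (f Φ) (v-vert Φ) (f-face Φ) (≼-trans (v≼e Φ) (e≼f Φ))
    faces : ExactlyTwo (λ g → IsFace g × e Φ ≼ g)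
    faces = edge-faces (e Φ) (e-edge Φ)

    otherVertex = other vertices (v-vert Φ , v≼e Φ)
    otherEdge = other edges (e-edge Φ , v≼e Φ , e≼f Φ)
    otherFace = other faces (f-face Φ , e≼f Φ)

  opaque
    adj : Fin 3 → Flag P → Flag P
    adj 0F Φ = let v′ , (vv , ve) , _ = At.otherVertex Φ in flag v′ (e Φ) (f Φ) vv (e-edge Φ) (f-face Φ) ve (e≼f Φ)
    adj 1F Φ = let e′ , (ee , ve , ef) , _ = At.otherEdge Φ in flag (v Φ) e′ (f Φ) (v-vert Φ) ee (f-face Φ) ve ef
    adj 2F Φ = let f′ , (ff , ef) , _ = At.otherFace Φ in flag (v Φ) (e Φ) f′ (v-vert Φ) (e-edge Φ) ff (v≼e Φ) ef

    adj-Adj : ∀ i Φ → Adj P i Φ (adj i Φ)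
    adj-Adj 0F Φ = proj₁ (proj₂ (proj₂ (At.otherVertex Φ))) , ≡.refl , ≡.refl
    adj-Adj 1F Φ = ≡.refl , proj₁ (proj₂ (proj₂ (At.otherEdge Φ))) , ≡.refl
    adj-Adj 2F Φ = ≡.refl , ≡.refl , proj₁ (proj₂ (proj₂ (At.otherFace Φ)))

    adj-unique : ∀ i Φ Ψ → Adj P i Φ Ψ → Ψ ≡ adj i Φ
    adj-unique 0F Φ Ψ@(flag _ _ _ vv _ _ ve _) (ne , ≡.refl , ≡.refl) =
      flag-≡ (proj₂ (proj₂ (proj₂ (At.otherVertex Φ))) (v Ψ) (vv , ve) ne , ≡.refl , ≡.refl)
    adj-unique 1F Φ Ψ@(flag _ _ _ _ ee _ ve ef) (≡.refl , ne , ≡.refl) =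
      flag-≡ (≡.refl , proj₂ (proj₂ (proj₂ (At.otherEdge Φ))) (e Ψ) (ee , ve , ef) ne , ≡.refl)
    adj-unique 2F Φ Ψ@(flag _ _ _ _ _ ff _ ef) (≡.refl , ≡.refl , ne) =
      flag-≡ (≡.refl , ≡.refl , proj₂ (proj₂ (proj₂ (At.otherFace Φ))) (f Ψ) (ff , ef) ne)

    adj-0-2 : ∀ Φ → adj 0F (adj 2F Φ) ≡ adj 2F (adj 0F Φ)
    adj-0-2 Φ = adj-unique 2F (adj 0F Φ) (adj 0F (adj 2F Φ)) (≡.sym same-v , ≡.refl , proj₂ (proj₂ (adj-Adj 2F Φ)))
      where
      same-v : v (adj 0F (adj 2F Φ)) ≡ v (adj 0F Φ)
      same-v = proj₂ (proj₂ (proj₂ (At.otherVertex Φ))) _ (v-vert (adj 0F (adj 2F Φ)) , v≼e (adj 0F (adj 2F Φ)))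
        (proj₁ (adj-Adj 0F (adj 2F Φ)))

  Adj-sym : ∀ i {Φ Ψ} → Adj P i Φ Ψ → Adj P i Ψ Φ
  Adj-sym 0F (a , b , c) = ≡.≢-sym a , ≡.sym b , ≡.sym c
  Adj-sym 1F (a , b , c) = ≡.sym a , ≡.≢-sym b , ≡.sym c
  Adj-sym 2F (a , b , c) = ≡.sym a , ≡.sym b , ≡.≢-sym c

  adj-adj : ∀ i Φ → adj i (adj i Φ) ≡ Φ
  adj-adj i Φ = ≡.sym (adj-unique i (adj i Φ) Φ (Adj-sym i (adj-Adj i Φ)))

  adj-injective : ∀ i {Φ Ψ} → adj i Φ ≡ adj i Ψ → Φ ≡ Ψ
  adj-injective i eq = ≡.trans (≡.sym (adj-adj i _)) (≡.trans (≡.cong (adj i) eq) (adj-adj i _))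

  act-∘ : ∀ α β Φ → act P (_∘A_ P α β) Φ ≡ act P α (act P β Φ)
  act-∘ α β Φ = flag-≡ (≡.refl , ≡.refl , ≡.refl)

  act-id : ∀ Φ → act P (idAut P) Φ ≡ Φ
  act-id Φ = flag-≡ (≡.refl , ≡.refl , ≡.refl)

  act-cong : ∀ {α β} → AutEq P α β → ∀ Φ → act P α Φ ≡ act P β Φ
  act-cong h Φ = flag-≡ (h _ , h _ , h _)

  act-inv : ∀ α Φ → act P (invAut P α) (act P α Φ) ≡ Φ
  act-inv α Φ = flag-≡ (Aut.from-to α _ , Aut.from-to α _ , Aut.from-to α _)

  act-invʳ : ∀ α Φ → act P α (act P (invAut P α) Φ) ≡ Φ
  act-invʳ α Φ = flag-≡ (Aut.to-from α _ , Aut.to-from α _ , Aut.to-from α _)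

  act-inv′ : ∀ α {Φ Ψ} → act P α Φ ≡ Ψ → act P (invAut P α) Ψ ≡ Φ
  act-inv′ α ≡.refl = act-inv α _

  to-injective : ∀ (α : Aut P) {a b} → Aut.to α a ≡ Aut.to α b → a ≡ b
  to-injective α eq = ≡.trans (≡.sym (Aut.from-to α _)) (≡.trans (≡.cong (Aut.from α) eq) (Aut.from-to α _))

  act-adj : ∀ α i Φ → act P α (adj i Φ) ≡ adj i (act P α Φ)
  act-adj α i Φ = adj-unique i _ _ (preserves i (adj-Adj i Φ))
    where
    preserves : ∀ i → Adj P i Φ (adj i Φ) → Adj P i (act P α Φ) (act P α (adj i Φ))
    preserves 0F (a , b , c) = (a ∘ to-injective α) , ≡.cong (Aut.to α) b , ≡.cong (Aut.to α) c
    preserves 1F (a , b , c) = ≡.cong (Aut.to α) a , (b ∘ to-injective α) , ≡.cong (Aut.to α) c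
    preserves 2F (a , b , c) = ≡.cong (Aut.to α) a , ≡.cong (Aut.to α) b , (c ∘ to-injective α)

  act-adj-adj : ∀ α i j Ψ → act P α (adj i (adj j Ψ)) ≡ adj i (adj j (act P α Ψ))
  act-adj-adj α i j Ψ = ≡.trans (act-adj α i (adj j Ψ)) (≡.cong (adj i) (act-adj α j Ψ))

  same₀ : ∀ {Φ Ψ} → e Φ ≡ e Ψ → f Φ ≡ f Ψ → Ψ ≡ Φ ⊎ Ψ ≡ adj 0F Φ
  same₀ {Φ} {Ψ@(flag _ _ _ vv _ _ ve _)} ≡.refl ≡.refl with two-dec (At.vertices Φ) (v-vert Φ , v≼e Φ) (vv , ve)
  ... | inj₁ eq = inj₁ (flag-≡ (≡.sym eq , ≡.refl , ≡.refl))
  ... | inj₂ ne = inj₂ (adj-unique 0F Φ Ψ (ne , ≡.refl , ≡.refl))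

  same₁ : ∀ {Φ Ψ} → v Φ ≡ v Ψ → f Φ ≡ f Ψ → Ψ ≡ Φ ⊎ Ψ ≡ adj 1F Φ
  same₁ {Φ} {Ψ@(flag _ _ _ _ ee _ ve ef)} ≡.refl ≡.refl with two-dec (At.edges Φ) (e-edge Φ , v≼e Φ , e≼f Φ) (ee , ve , ef)
  ... | inj₁ eq = inj₁ (flag-≡ (≡.refl , ≡.sym eq , ≡.refl))
  ... | inj₂ ne = inj₂ (adj-unique 1F Φ Ψ (≡.refl , ne , ≡.refl))

  same₂ : ∀ {Φ Ψ} → v Φ ≡ v Ψ → e Φ ≡ e Ψ → Ψ ≡ Φ ⊎ Ψ ≡ adj 2F Φ
  same₂ {Φ} {Ψ@(flag _ _ _ _ _ ff _ ef)} ≡.refl ≡.refl with two-dec (At.faces Φ) (f-face Φ , e≼f Φ) (ff , ef)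
  ... | inj₁ eq = inj₁ (flag-≡ (≡.refl , ≡.refl , ≡.sym eq))
  ... | inj₂ ne = inj₂ (adj-unique 2F Φ Ψ (≡.refl , ≡.refl , ne))

  edgeFlag : ∀ {d} → IsEdge d → Σ (Flag P) λ Φ → e Φ ≡ d
  edgeFlag {d} dd with edge-vertices d dd | edge-faces d dd
  ... | w , _ , _ , (ww , wd) , _ | g , _ , _ , (gg , dg) , _ = flag w d g ww dd gg wd dg , ≡.refl

  vertexFlag : ∀ {w d} → IsVertex w → IsEdge d → w ≼ d → Σ (Flag P) λ Φ → v Φ ≡ w × e Φ ≡ d
  vertexFlag {w} {d} ww dd wd with edge-faces d dd
  ... | g , _ , _ , (gg , dg) , _ = flag w d g ww dd gg wd dg , ≡.refl , ≡.refl

  faceFlag : ∀ {d g} → IsEdge d → IsFace g → d ≼ g → Σ (Flag P) λ Φ → e Φ ≡ d × f Φ ≡ g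
  faceFlag {d} {g} dd gg dg with edge-vertices d dd
  ... | w , _ , _ , (ww , wd) , _ = flag w d g ww dd gg wd dg , ≡.refl , ≡.refl

  cornerFlag : ∀ {w g} → IsVertex w → IsFace g → w ≼ g → Σ (Flag P) λ Φ → v Φ ≡ w × f Φ ≡ g
  cornerFlag {w} {g} ww gg wg with diamond w g ww gg wg
  ... | d , _ , _ , (dd , wd , dg) , _ = flag w d g ww dd gg wd dg , ≡.refl , ≡.refl

  -- rank-mono only refutes a ≢ b; the equality itself is decided by the ExactlyTwo data.
  same-rank : ∀ {a b} → a ≼ b → rank a ≡ rank b → a ≡ b
  same-rank {a} {b} a≼b eq with rankView b
  ... | inj₁ bb with edgeAt b bb
  ... | d , dd , bd with two-dec (edge-vertices d dd) (≡.trans eq bb , ≼-trans a≼b bd) (bb , bd)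
  ... | inj₁ a≡b = a≡b
  ... | inj₂ a≢b = ⊥-elim (Finₚ.<-irrefl eq (rank-mono a≼b a≢b))
  same-rank {a} {b} a≼b eq | inj₂ (inj₁ bb) with edge-vertices a (≡.trans eq bb) | edge-faces b bb
  ... | w , _ , _ , (ww , wa) , _ | g , _ , _ , (gg , bg) , _
    with two-dec (diamond w g ww gg (≼-trans wa (≼-trans a≼b bg))) (≡.trans eq bb , wa , ≼-trans a≼b bg) (bb , ≼-trans wa a≼b , bg)
  ... | inj₁ a≡b = a≡b
  ... | inj₂ a≢b = ⊥-elim (Finₚ.<-irrefl eq (rank-mono a≼b a≢b))
  same-rank {a} {b} a≼b eq | inj₂ (inj₂ bb) with edgeOf a (≡.trans eq bb)
  ... | d , dd , da with two-dec (edge-faces d dd) (≡.trans eq bb , da) (bb , ≼-trans da a≼b)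
  ... | inj₁ a≡b = a≡b
  ... | inj₂ a≢b = ⊥-elim (Finₚ.<-irrefl eq (rank-mono a≼b a≢b))

  same-rank-Inc : ∀ {a b} → Inc a b → rank a ≡ rank b → a ≡ b
  same-rank-Inc (inj₁ h) eq = same-rank h eq
  same-rank-Inc (inj₂ h) eq = ≡.sym (same-rank h (≡.sym eq))

  rank-≤ : ∀ {a b} → a ≼ b → ¬ rank b Fin.< rank a
  rank-≤ {a} {b} h lt = Finₚ.<-asym lt (rank-mono h λ { ≡.refl → Finₚ.<-irrefl ≡.refl lt })

  ≼-of-Inc : ∀ {a b} → Inc a b → rank a Fin.< rank b → a ≼ b
  ≼-of-Inc (inj₁ h) _ = h
  ≼-of-Inc (inj₂ h) lt = ⊥-elim (rank-≤ h lt)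

  ranks-< : ∀ {a b i j} → rank a ≡ i → rank b ≡ j → i Fin.< j → rank a Fin.< rank b
  ranks-< ≡.refl ≡.refl lt = lt

  0<1 : Fin._<_ {3} {3} 0F 1F
  0<1 = ℕ.s≤s ℕ.z≤n
  0<2 : Fin._<_ {3} {3} 0F 2F
  0<2 = ℕ.s≤s ℕ.z≤n
  1<2 : Fin._<_ {3} {3} 1F 2F
  1<2 = ℕ.s≤s (ℕ.s≤s ℕ.z≤n)

  _∈ᶠ_ : Elem → Flag P → Set
  x ∈ᶠ Φ = v Φ ≡ x ⊎ e Φ ≡ x ⊎ f Φ ≡ x

  common : ∀ {a b} → Inc a b → Σ (Flag P) λ Φ → a ∈ᶠ Φ × b ∈ᶠ Φ
  common {a} {b} h with rankView a | rankView b
  ... | inj₁ va | inj₁ vb with ≡.refl ← same-rank-Inc h (≡.trans va (≡.sym vb)) =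
    let d , dd , vd = edgeAt a va ; Φ , p , _ = vertexFlag va dd vd in Φ , inj₁ p , inj₁ p
  ... | inj₁ va | inj₂ (inj₁ eb) =
    let Φ , p , q = vertexFlag va eb (≼-of-Inc h (ranks-< va eb 0<1)) in Φ , inj₁ p , inj₂ (inj₁ q)
  ... | inj₁ va | inj₂ (inj₂ fb) =
    let Φ , p , q = cornerFlag va fb (≼-of-Inc h (ranks-< va fb 0<2)) in Φ , inj₁ p , inj₂ (inj₂ q)
  ... | inj₂ (inj₁ ea) | inj₁ vb =
    let Φ , p , q = vertexFlag vb ea (≼-of-Inc (swap h) (ranks-< vb ea 0<1)) in Φ , inj₂ (inj₁ q) , inj₁ p
  ... | inj₂ (inj₁ ea) | inj₂ (inj₁ eb) with ≡.refl ← same-rank-Inc h (≡.trans ea (≡.sym eb)) =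
    let Φ , p = edgeFlag ea in Φ , inj₂ (inj₁ p) , inj₂ (inj₁ p)
  ... | inj₂ (inj₁ ea) | inj₂ (inj₂ fb) =
    let Φ , p , q = faceFlag ea fb (≼-of-Inc h (ranks-< ea fb 1<2)) in Φ , inj₂ (inj₁ p) , inj₂ (inj₂ q)
  ... | inj₂ (inj₂ fa) | inj₁ vb =
    let Φ , p , q = cornerFlag vb fa (≼-of-Inc (swap h) (ranks-< vb fa 0<2)) in Φ , inj₂ (inj₂ q) , inj₁ p
  ... | inj₂ (inj₂ fa) | inj₂ (inj₁ eb) =
    let Φ , p , q = faceFlag eb fa (≼-of-Inc (swap h) (ranks-< eb fa 1<2)) in Φ , inj₂ (inj₂ q) , inj₂ (inj₁ p)
  ... | inj₂ (inj₂ fa) | inj₂ (inj₂ fb) with ≡.refl ← same-rank-Inc h (≡.trans fa (≡.sym fb)) =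
    let d , dd , df = edgeOf a fa ; Φ , _ , q = faceFlag dd fa df in Φ , inj₂ (inj₂ q) , inj₂ (inj₂ q)

  inFlag : ∀ x → Σ (Flag P) λ Φ → x ∈ᶠ Φ
  inFlag x = let Φ , p , _ = common {x} {x} (inj₁ ≼-refl) in Φ , p

  module Local (S : Flag P → Set) (i : Fin 3) (closed : ∀ Φ → S Φ → S (adj i Φ)) where
    via : ∀ {Φ Ψ} → S Φ → Ψ ≡ Φ ⊎ Ψ ≡ adj i Φ → S Ψ
    via s (inj₁ ≡.refl) = s
    via s (inj₂ ≡.refl) = closed _ s

  module Around (S : Flag P → Set) (closed₁ : ∀ Φ → S Φ → S (adj 1F Φ)) where
    module _ (closed₂ : ∀ Φ → S Φ → S (adj 2F Φ)) (Φ : Flag P) (s : S Φ) where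
      private
        F = v Φ
      Linked : Elem → Set
      Linked a = Σ (Flag P) λ Ψ → S Ψ × v Ψ ≡ F × (e Ψ ≡ a ⊎ f Ψ ≡ a)

      above : ∀ {a} → Nbr F a → F ≼ a × (IsEdge a ⊎ IsFace a)
      above {a} (h , ne) with rankView a
      ... | inj₁ va = contradiction (≡.sym (same-rank-Inc h (≡.trans (v-vert Φ) (≡.sym va)))) ne
      ... | inj₂ (inj₁ ea) = ≼-of-Inc h (ranks-< (v-vert Φ) ea 0<1) , inj₁ ea
      ... | inj₂ (inj₂ fa) = ≼-of-Inc h (ranks-< (v-vert Φ) fa 0<2) , inj₂ fa

      step : ∀ {a b} → Nbr F a × Nbr F b × Inc a b → Linked a → Linked b
      step {a} {b} (na , nb , h) (Ψ , t , eq , m) with above nb | m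
      ... | F≼b , inj₁ eb | inj₁ ≡.refl with ≡.refl ← same-rank-Inc h (≡.trans (e-edge Ψ) (≡.sym eb)) = Ψ , t , eq , inj₁ ≡.refl
      ... | F≼b , inj₂ fb | inj₁ ≡.refl = flag (v Ψ) (e Ψ) b (v-vert Ψ) (e-edge Ψ) fb (v≼e Ψ) (≼-of-Inc h (ranks-< (e-edge Ψ) fb 1<2)) ,
        Local.via S 2F closed₂ t (same₂ ≡.refl ≡.refl) , eq , inj₂ ≡.refl
      ... | F≼b , inj₂ fb | inj₂ ≡.refl with ≡.refl ← same-rank-Inc h (≡.trans (f-face Ψ) (≡.sym fb)) = Ψ , t , eq , inj₂ ≡.refl
      ... | F≼b , inj₁ eb | inj₂ ≡.refl = flag (v Ψ) b (f Ψ) (v-vert Ψ) eb (f-face Ψ) (≡.subst (_≼ b) (≡.sym eq) F≼b) (≼-of-Inc (swap h) (ranks-< eb (f-face Ψ) 1<2)) ,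
        Local.via S 1F closed₁ t (same₁ ≡.refl ≡.refl) , eq , inj₁ ≡.refl

      nbr : ∀ (Ψ : Flag P) → v Ψ ≡ F → Nbr F (e Ψ)
      nbr Ψ ≡.refl = inj₁ (v≼e Ψ) , λ { eq → Finₚ.<-irrefl (≡.cong rank (≡.sym eq)) (ranks-< (v-vert Ψ) (e-edge Ψ) 0<1) }

      -- Each step of a path in the link of the vertex joins an edge to a face or stays in place;
      -- the flag they span differs from the previous one in one rank, so S travels along the path.
      atVertex : ∀ (Ψ : Flag P) → v Ψ ≡ F → S Ψ
      atVertex Ψ eq with walk (locally-connected F (inj₁ (v-vert Φ)) (e Φ) (e Ψ) (nbr Φ ≡.refl) (nbr Ψ eq)) (Φ , s , ≡.refl , inj₁ ≡.refl)
        where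
        walk : ∀ {a b} → Star (λ a b → Nbr F a × Nbr F b × Inc a b) a b → Linked a → Linked b
        walk nil l = l
        walk (h ◂ hs) l = walk hs (step h l)
      ... | Ψ′ , t , eq′ , inj₁ m = Local.via S 2F closed₂ t (same₂ (≡.trans eq′ (≡.sym eq)) m)
      ... | Ψ′ , t , eq′ , inj₂ m = ⊥-elim (Finₚ.<-irrefl (≡.cong rank (≡.sym m)) (ranks-< (e-edge Ψ) (f-face Ψ′) 1<2))

    module _ (closed₀ : ∀ Φ → S Φ → S (adj 0F Φ)) (Φ : Flag P) (s : S Φ) where
      private
        F = f Φ
      Linked′ : Elem → Set
      Linked′ a = Σ (Flag P) λ Ψ → S Ψ × f Ψ ≡ F × (e Ψ ≡ a ⊎ v Ψ ≡ a)

      below : ∀ {a} → Nbr F a → a ≼ F × (IsEdge a ⊎ IsVertex a)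
      below {a} (h , ne) with rankView a
      ... | inj₂ (inj₂ fa) = contradiction (≡.sym (same-rank-Inc h (≡.trans (f-face Φ) (≡.sym fa)))) ne
      ... | inj₂ (inj₁ ea) = ≼-of-Inc (swap h) (ranks-< ea (f-face Φ) 1<2) , inj₁ ea
      ... | inj₁ va = ≼-of-Inc (swap h) (ranks-< va (f-face Φ) 0<2) , inj₂ va

      step′ : ∀ {a b} → Nbr F a × Nbr F b × Inc a b → Linked′ a → Linked′ b
      step′ {a} {b} (na , nb , h) (Ψ , t , eq , m) with below nb | m
      ... | b≼F , inj₁ eb | inj₁ ≡.refl with ≡.refl ← same-rank-Inc h (≡.trans (e-edge Ψ) (≡.sym eb)) = Ψ , t , eq , inj₁ ≡.refl
      ... | b≼F , inj₂ vb | inj₁ ≡.refl = flag b (e Ψ) (f Ψ) vb (e-edge Ψ) (f-face Ψ) (≼-of-Inc (swap h) (ranks-< vb (e-edge Ψ) 0<1)) (e≼f Ψ) ,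
        Local.via S 0F closed₀ t (same₀ ≡.refl ≡.refl) , eq , inj₂ ≡.refl
      ... | b≼F , inj₂ vb | inj₂ ≡.refl with ≡.refl ← same-rank-Inc h (≡.trans (v-vert Ψ) (≡.sym vb)) = Ψ , t , eq , inj₂ ≡.refl
      ... | b≼F , inj₁ eb | inj₂ ≡.refl = flag (v Ψ) b (f Ψ) (v-vert Ψ) eb (f-face Ψ) (≼-of-Inc h (ranks-< (v-vert Ψ) eb 0<1)) (≡.subst (b ≼_) (≡.sym eq) b≼F) ,
        Local.via S 1F closed₁ t (same₁ ≡.refl ≡.refl) , eq , inj₁ ≡.refl

      nbr′ : ∀ (Ψ : Flag P) → f Ψ ≡ F → Nbr F (e Ψ)
      nbr′ Ψ ≡.refl = inj₂ (e≼f Ψ) , λ { eq → Finₚ.<-irrefl (≡.cong rank eq) (ranks-< (e-edge Ψ) (f-face Ψ) 1<2) }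

      atFace : ∀ (Ψ : Flag P) → f Ψ ≡ F → S Ψ
      atFace Ψ eq with walk (locally-connected F (inj₂ (f-face Φ)) (e Φ) (e Ψ) (nbr′ Φ ≡.refl) (nbr′ Ψ eq)) (Φ , s , ≡.refl , inj₁ ≡.refl)
        where
        walk : ∀ {a b} → Star (λ a b → Nbr F a × Nbr F b × Inc a b) a b → Linked′ a → Linked′ b
        walk nil l = l
        walk (h ◂ hs) l = walk hs (step′ h l)
      ... | Ψ′ , t , eq′ , inj₁ m = Local.via S 0F closed₀ t (same₀ m (≡.trans eq′ (≡.sym eq)))
      ... | Ψ′ , t , eq′ , inj₂ m = ⊥-elim (Finₚ.<-irrefl (≡.cong rank m) (ranks-< (v-vert Ψ′) (e-edge Ψ) 0<1))

  -- Consecutive elements of a connecting path lie in a common flag. Local connectedness carries S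
  -- around a vertex or a face, and two adjacency moves carry it around an edge.
  flag-connected : (S : Flag P → Set) → (∀ i Φ → S Φ → S (adj i Φ)) → ∀ {Φ} → S Φ → ∀ Ψ → S Ψ
  flag-connected S closed {Φ} s Ψ = walk (connected (v Φ) (v Ψ)) (spread Φ s (inj₁ ≡.refl)) Ψ (inj₁ ≡.refl)
    where
    Everywhere : Elem → Set
    Everywhere x = ∀ Ψ → x ∈ᶠ Ψ → S Ψ
    spreadV : ∀ Φ Ψ → S Φ → v Ψ ≡ v Φ → S Ψ
    spreadV Φ Ψ s = Around.atVertex S (closed 1F) (closed 2F) Φ s Ψ
    spreadF : ∀ Φ Ψ → S Φ → f Ψ ≡ f Φ → S Ψ
    spreadF Φ Ψ s = Around.atFace S (closed 1F) (closed 0F) Φ s Ψ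
    spreadE : ∀ Φ Ψ → S Φ → e Ψ ≡ e Φ → S Ψ
    spreadE Φ Ψ@(flag w _ _ ww _ _ wd _) s ≡.refl =
      spreadV (flag w (e Φ) (f Φ) ww (e-edge Φ) (f-face Φ) wd (e≼f Φ)) Ψ
        (Local.via S 0F (closed 0F) s (same₀ ≡.refl ≡.refl)) ≡.refl
    absurd-ve : ∀ Φ Ψ → v Φ ≢ e Ψ
    absurd-ve Φ Ψ eq = Finₚ.<-irrefl (≡.cong rank eq) (ranks-< (v-vert Φ) (e-edge Ψ) 0<1)
    absurd-vf : ∀ Φ Ψ → v Φ ≢ f Ψ
    absurd-vf Φ Ψ eq = Finₚ.<-irrefl (≡.cong rank eq) (ranks-< (v-vert Φ) (f-face Ψ) 0<2)
    absurd-ef : ∀ Φ Ψ → e Φ ≢ f Ψ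
    absurd-ef Φ Ψ eq = Finₚ.<-irrefl (≡.cong rank eq) (ranks-< (e-edge Φ) (f-face Ψ) 1<2)
    spread : ∀ Φ {x} → S Φ → x ∈ᶠ Φ → Everywhere x
    spread Φ s (inj₁ ≡.refl) Ψ (inj₁ eq) = spreadV Φ Ψ s eq
    spread Φ s (inj₁ ≡.refl) Ψ (inj₂ (inj₁ eq)) = ⊥-elim (absurd-ve Φ Ψ (≡.sym eq))
    spread Φ s (inj₁ ≡.refl) Ψ (inj₂ (inj₂ eq)) = ⊥-elim (absurd-vf Φ Ψ (≡.sym eq))
    spread Φ s (inj₂ (inj₁ ≡.refl)) Ψ (inj₁ eq) = ⊥-elim (absurd-ve Ψ Φ eq)
    spread Φ s (inj₂ (inj₁ ≡.refl)) Ψ (inj₂ (inj₁ eq)) = spreadE Φ Ψ s eq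
    spread Φ s (inj₂ (inj₁ ≡.refl)) Ψ (inj₂ (inj₂ eq)) = ⊥-elim (absurd-ef Φ Ψ (≡.sym eq))
    spread Φ s (inj₂ (inj₂ ≡.refl)) Ψ (inj₁ eq) = ⊥-elim (absurd-vf Ψ Φ eq)
    spread Φ s (inj₂ (inj₂ ≡.refl)) Ψ (inj₂ (inj₁ eq)) = ⊥-elim (absurd-ef Ψ Φ eq)
    spread Φ s (inj₂ (inj₂ ≡.refl)) Ψ (inj₂ (inj₂ eq)) = spreadF Φ Ψ s eq
    walk : ∀ {a b} → Star Inc a b → Everywhere a → Everywhere b
    walk nil all = all
    walk (h ◂ hs) all = let Ψ , a∈ , b∈ = common h in walk hs (spread Ψ (all Ψ a∈) b∈)

  -- Agreement of two automorphisms on a flag passes to its neighbours, hence to all flags and all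
  -- elements.
  rigid : ∀ {α β} Φ → act P α Φ ≡ act P β Φ → AutEq P α β
  rigid {α} {β} Φ h x with inFlag x
  ... | Ψ , m = component m (flag-connected (λ Ψ → act P α Ψ ≡ act P β Ψ)
      (λ i Ψ eq → ≡.trans (act-adj α i Ψ) (≡.trans (≡.cong (adj i) eq) (≡.sym (act-adj β i Ψ)))) {Φ} h Ψ)
    where
    component : x ∈ᶠ Ψ → act P α Ψ ≡ act P β Ψ → Aut.to α x ≡ Aut.to β x
    component (inj₁ ≡.refl) eq = ≡.cong v eq
    component (inj₂ (inj₁ ≡.refl)) eq = ≡.cong e eq
    component (inj₂ (inj₂ ≡.refl)) eq = ≡.cong f eq

-- The rotation group of a tight chiral polyhedron

module WordGroup (H : Group 0ℓ 0ℓ) (x y : Group.Carrier H) where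
  open Group H
  open Evaluation H x y
  open GroupPowers H

  X Y : Word
  X = (false , false) ∷ []
  Y = (true , false) ∷ []

  -- The subgroup ⟨x, y⟩ of H without a subset type: an element is a word and equality is equality
  -- of values.
  wordGroup : Group 0ℓ 0ℓ
  wordGroup = record
    { Carrier = Word ; _≈_ = λ v w → ev v ≈ ev w ; _∙_ = _++_ ; ε = [] ; _⁻¹ = invert
    ; isGroup = record
      { isMonoid = record
        { isSemigroup = record
          { isMagma = record
            { isEquivalence = record { refl = refl ; sym = sym ; trans = trans }
            ; ∙-cong = λ {a} {b} {c} {d} e f → trans (ev-++ a c) (trans (∙-cong e f) (sym (ev-++ b d))) }
          ; assoc = λ a b c → trans (ev-++ (a ++ b) c) (trans (∙-congʳ (ev-++ a b)) (trans (assoc _ _ _)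
              (sym (trans (ev-++ a (b ++ c)) (∙-congˡ (ev-++ b c)))))) }
        ; identity = (λ a → refl) , (λ a → trans (ev-++ a []) (identityʳ _)) }
      ; inverse = (λ a → trans (ev-++ (invert a) a) (trans (∙-congʳ (ev-invert a)) (inverseˡ _)))
                , (λ a → trans (ev-++ a (invert a)) (trans (∙-congˡ (ev-invert a)) (inverseʳ _)))
      ; ⁻¹-cong = λ {a} {b} e → trans (ev-invert a) (trans (⁻¹-cong e) (sym (ev-invert b))) } }

  module W = GroupPowers wordGroup
  module WE = Evaluation wordGroup X Y

  ev-^ : ∀ w n → ev (w W.^ n) ≈ ev w ^ n
  ev-^ w zero = refl
  ev-^ w (suc n) = trans (ev-++ w (w W.^ n)) (∙-congˡ (ev-^ w n))

  ev-X^ : ∀ n → ev (X W.^ n) ≈ x ^ n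
  ev-X^ n = trans (ev-^ X n) (^-cong n (identityʳ x))

  ev-Y^ : ∀ n → ev (Y W.^ n) ≈ y ^ n
  ev-Y^ n = trans (ev-^ Y n) (^-cong n (identityʳ y))

  ev-ev : ∀ w → ev (WE.ev w) ≈ ev w
  ev-ev [] = refl
  ev-ev ((false , false) ∷ w) = ∙-congˡ (ev-ev w)
  ev-ev ((false , true) ∷ w) = ∙-congˡ (ev-ev w)
  ev-ev ((true , false) ∷ w) = ∙-congˡ (ev-ev w)
  ev-ev ((true , true) ∷ w) = ∙-congˡ (ev-ev w)

  tightGroup : ∀ p q → NonZero p → NonZero q → (x ∙ y) ∙ (x ∙ y) ≈ ε →
    x ^ p ≈ ε → y ^ q ≈ ε → (∀ a → x ^ a ≈ ε → p ∣ a) → (∀ b → y ^ b ≈ ε → q ∣ b) →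
    (∀ w → ∃₂ λ a b → ev w ≈ x ^ a ∙ y ^ b) → (∀ a b → x ^ a ≈ y ^ b → x ^ a ≈ ε) → TightGroup p q
  tightGroup p q p≢0 q≢0 inv xp yq xo yo fac mt = record
    { group = wordGroup ; x = X ; y = Y ; p≢0 = p≢0 ; q≢0 = q≢0
    ; involution = trans (sym (assoc _ _ _)) (trans (∙-congˡ (∙-congˡ (identityʳ y))) inv)
    ; x-period = trans (ev-X^ p) xp
    ; y-period = trans (ev-Y^ q) yq
    ; x-order = λ a e → xo a (trans (sym (ev-X^ a)) e)
    ; y-order = λ b e → yo b (trans (sym (ev-Y^ b)) e)
    ; factor = λ w → let a , b , e = fac w in a , b , trans e (sym (trans (ev-++ (X W.^ a) (Y W.^ b)) (∙-cong (ev-X^ a) (ev-Y^ b))))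
    ; meet = λ a b e → trans (ev-X^ a) (mt a b (trans (sym (ev-X^ a)) (trans e (ev-Y^ b))))
    }

module _ (P : Polyhedron) where
  open Aut
  autGroup : Group 0ℓ 0ℓ
  autGroup = record
    { Carrier = Aut P ; _≈_ = AutEq P ; _∙_ = _∘A_ P ; ε = idAut P ; _⁻¹ = invAut P
    ; isGroup = record
      { isMonoid = record
        { isSemigroup = record
          { isMagma = record
            { isEquivalence = record { refl = λ _ → ≡.refl ; sym = λ h x → ≡.sym (h x) ; trans = λ h k x → ≡.trans (h x) (k x) }
            ; ∙-cong = λ {α} {β} {γ} {δ} h k x → ≡.trans (h (to γ x)) (≡.cong (to β) (k x)) }
          ; assoc = λ _ _ _ _ → ≡.refl }
        ; identity = (λ _ _ → ≡.refl) , (λ _ _ → ≡.refl) }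
      ; inverse = (λ α → from-to α) , (λ α → to-from α)
      ; ⁻¹-cong = λ {α} {β} h x → ≡.trans (≡.cong (from α) (≡.trans (≡.sym (to-from β x)) (≡.sym (h (from β x))))) (from-to α (from β x)) } }

  evalWord≈ev : ∀ σ₁ σ₂ w → AutEq P (evalWord P σ₁ σ₂ w) (Evaluation.ev autGroup σ₁ σ₂ w)
  evalWord≈ev σ₁ σ₂ [] x = ≡.refl
  evalWord≈ev σ₁ σ₂ ((false , false) ∷ w) x = ≡.cong (to σ₁) (evalWord≈ev σ₁ σ₂ w x)
  evalWord≈ev σ₁ σ₂ ((false , true) ∷ w) x = ≡.cong (from σ₁) (evalWord≈ev σ₁ σ₂ w x)
  evalWord≈ev σ₁ σ₂ ((true , false) ∷ w) x = ≡.cong (to σ₂) (evalWord≈ev σ₁ σ₂ w x)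
  evalWord≈ev σ₁ σ₂ ((true , true) ∷ w) x = ≡.cong (from σ₂) (evalWord≈ev σ₁ σ₂ w x)

-- Periods of orbits in finite sets

least-witness : (Q : ℕ → Set) → (∀ n → Dec (Q n)) → ∀ n → Q n → ∃ λ m → Q m × (∀ k → k < m → ¬ Q k)
least-witness Q Q? zero q = 0 , q , λ _ ()
least-witness Q Q? (suc n) q with Q? 0
... | yes q₀ = 0 , q₀ , λ _ ()
... | no ¬q₀ with least-witness (Q ∘ suc) (Q? ∘ suc) n q
... | m , qm , below = suc m , qm , λ { zero _ → ¬q₀ ; (suc k) (s≤s lt) → below k lt }

injective⇒surjective : ∀ {n} (f : Fin n → Fin n) → Injective _≡_ _≡_ f → ∀ j → ∃ λ i → f i ≡ j
injective⇒surjective {suc n} f inj j with any? (λ i → f i ≟ᶠ j)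
... | yes h = h
... | no ¬h = contradiction (injective⇒≤ {f = λ i → punchOut {i = j} {j = f i} (λ e → ¬h (i , ≡.sym e))}
    (λ {i} {k} e → inj (punchOut-injective {i = j} {j = f i} {k = f k} (λ e → ¬h (i , ≡.sym e)) (λ e → ¬h (k , ≡.sym e)) e))) ℕₚ.1+n≰n

iterate : ∀ {A : Set} → (A → A) → ℕ → A → A
iterate R zero a = a
iterate R (suc k) a = R (iterate R k a)

iterate-+ : ∀ {A : Set} (R : A → A) m n a → iterate R (m ℕ.+ n) a ≡ iterate R m (iterate R n a)
iterate-+ R zero n a = ≡.refl
iterate-+ R (suc m) n a = ≡.cong R (iterate-+ R m n a)

module FiniteOrbit {A : Set} {N : ℕ} (A↔ : A ↔ Fin N) (R : A → A) (R-injective : ∀ {a b} → R a ≡ R b → a ≡ b) (a₀ : A) where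
  index : A → Fin N
  index = Inverse.to A↔

  index-injective : ∀ {a b} → index a ≡ index b → a ≡ b
  index-injective e = ≡.trans (≡.sym (Inverse.strictlyInverseʳ A↔ _)) (≡.trans (≡.cong (Inverse.from A↔) e) (Inverse.strictlyInverseʳ A↔ _))

  _≟ᴬ_ : ∀ a b → Dec (a ≡ b)
  a ≟ᴬ b = map′ index-injective (≡.cong index) (index a ≟ᶠ index b)

  orbit : ℕ → A
  orbit k = iterate R k a₀

  iterate-injective : ∀ k {a b} → iterate R k a ≡ iterate R k b → a ≡ b
  iterate-injective zero e = e
  iterate-injective (suc k) e = iterate-injective k (R-injective e)

  cancel : ∀ {i j} → i ≤ j → orbit i ≡ orbit j → orbit (j ∸ i) ≡ a₀
  cancel {i} {j} i≤j e = ≡.sym (iterate-injective i (≡.trans e (≡.trans (≡.cong orbit (≡.sym (ℕₚ.m+[n∸m]≡n i≤j))) (iterate-+ R i (j ∸ i) a₀))))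

  some-period : ∃ λ k → orbit (suc k) ≡ a₀
  some-period with pigeonhole {m = N} (ℕₚ.n<1+n N) (λ i → index (orbit (toℕ i)))
  ... | i , j , i<j , e with cancel (ℕₚ.<⇒≤ i<j) (index-injective e) | ℕₚ.m<n⇒0<n∸m i<j
  ... | c | pos with toℕ j ∸ toℕ i
  ... | suc k = k , c

  Period : Set
  Period = ∃ λ m → orbit (suc m) ≡ a₀ × (∀ k → k < m → orbit (suc k) ≢ a₀)

  period : Period
  period = least-witness (λ k → orbit (suc k) ≡ a₀) (λ k → orbit (suc k) ≟ᴬ a₀) (proj₁ some-period) (proj₂ some-period)

module PeriodicOrbit {A : Set} {N : ℕ} (A↔ : A ↔ Fin N) (R : A → A) (R-injective : ∀ {a b} → R a ≡ R b → a ≡ b) (a₀ : A)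
  (m : ℕ) (orbit-d : iterate R (suc m) a₀ ≡ a₀) (minimal : ∀ k → k < m → iterate R (suc k) a₀ ≢ a₀) where
  open FiniteOrbit A↔ R R-injective a₀

  d : ℕ
  d = suc m

  orbit-* : ∀ c → orbit (c ℕ.* d) ≡ a₀
  orbit-* zero = ≡.refl
  orbit-* (suc c) = ≡.trans (iterate-+ R d (c ℕ.* d) a₀) (≡.trans (≡.cong (iterate R d) (orbit-* c)) orbit-d)

  orbit-% : ∀ k → orbit (k % d) ≡ orbit k
  orbit-% k = ≡.sym (≡.trans (≡.cong orbit (m≡m%n+[m/n]*n k d)) (≡.trans (iterate-+ R (k % d) ((k / d) ℕ.* d) a₀) (≡.cong (iterate R (k % d)) (orbit-* (k / d)))))

  small : ∀ k → k < d → orbit k ≡ a₀ → k ≡ 0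
  small zero _ _ = ≡.refl
  small (suc k) (s≤s lt) e = contradiction e (minimal k lt)

  period⇒∣ : ∀ k → orbit k ≡ a₀ → d ∣ k
  period⇒∣ k e = m%n≡0⇒n∣m k d (small (k % d) (m%n<n k d) (≡.trans (orbit-% k) e))

  orbit-injective : ∀ {i j} → i < d → j < d → orbit i ≡ orbit j → i ≡ j
  orbit-injective {i} {j} i<d j<d e with ℕₚ.≤-total i j
  ... | inj₁ i≤j = ℕₚ.≤-antisym i≤j (ℕₚ.m∸n≡0⇒m≤n (small (j ∸ i) (ℕₚ.≤-<-trans (ℕₚ.m∸n≤m j i) j<d) (cancel i≤j e)))
  ... | inj₂ j≤i = ℕₚ.≤-antisym (ℕₚ.m∸n≡0⇒m≤n (small (i ∸ j) (ℕₚ.≤-<-trans (ℕₚ.m∸n≤m i j) i<d) (cancel j≤i (≡.sym e)))) j≤i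

  -- Identifies the period with n by two injections: orbit points into labels, and labels back into
  -- indices reduced modulo d. The labels will be the edges of the base face or at the base vertex.
  module Labelled {n : ℕ} (label : ℕ → Fin n) (label-injective : ∀ i j → label i ≡ label j → orbit i ≡ orbit j)
    (label-cong : ∀ i j → orbit i ≡ orbit j → label i ≡ label j) (onto : ∀ l → ∃ λ k → label k ≡ l) where
    d≡n : d ≡ n
    d≡n = ℕₚ.≤-antisym
      (injective⇒≤ {f = label ∘ toℕ} λ {i} {j} e → toℕ-injective (orbit-injective (toℕ<n i) (toℕ<n j) (label-injective _ _ e)))
      (injective⇒≤ {f = λ l → fromℕ< (m%n<n (proj₁ (onto l)) d)} λ {l} {l′} e →
        ≡.trans (≡.sym (proj₂ (onto l))) (≡.trans (label-cong (proj₁ (onto l)) (proj₁ (onto l′))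
          (≡.trans (≡.sym (orbit-% (proj₁ (onto l)))) (≡.trans (≡.cong orbit (fromℕ<-injective _ _ (m%n<n (proj₁ (onto l)) d) (m%n<n (proj₁ (onto l′)) d) e)) (orbit-% (proj₁ (onto l′))))))
          (proj₂ (onto l′))))

    orbit-n : orbit n ≡ a₀
    orbit-n = ≡.subst (λ k → orbit k ≡ a₀) d≡n orbit-d

    n∣ : ∀ k → orbit k ≡ a₀ → n ∣ k
    n∣ k e = ≡.subst (_∣ k) d≡n (period⇒∣ k e)

module TightFlags (P : Polyhedron) (p q : ℕ) (tight : Tight P p q) (Φ : Flag P) where
  open Polyhedron P

  flags↔ : Flag P ↔ Fin (2 ℕ.* p ℕ.* q)
  flags↔ = proj₂ tight

  2pq≢0 : 2 ℕ.* p ℕ.* q ≢ 0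
  2pq≢0 eq with () ← ≡.subst Fin eq (Inverse.to flags↔ Φ)

  instance
    p≢0 : NonZero p
    p≢0 = ℕ.≢-nonZero λ { ≡.refl → 2pq≢0 ≡.refl }
    q≢0 : NonZero q
    q≢0 = ℕ.≢-nonZero λ { ≡.refl → 2pq≢0 (ℕₚ.*-zeroʳ (2 ℕ.* p)) }

  some : ∀ n → NonZero n → Fin n
  some (suc n) _ = zero

  edgeAt : ∀ v → IsVertex v → EdgesAtVertex P v
  edgeAt v vv = Inverse.from (proj₂ (proj₁ tight) v vv) (some q q≢0)
  edgeOf : ∀ f → IsFace f → EdgesOfFace P f
  edgeOf f ff = Inverse.from (proj₁ (proj₁ tight) f ff) (some p p≢0)

module Rotation (P : Polyhedron) (p q : ℕ) (tight : Tight P p q) (chiral : Chiral P)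
  (Φ : Flag P) (σ₁ σ₂ : Aut P) (isσ₁ : IsSigma1 P Φ σ₁) (isσ₂ : IsSigma2 P Φ σ₂) where
  open Polyhedron P
  open Flag

  open TightFlags P p q tight Φ public
  open Flags P edgeAt edgeOf public

  module A = Group (autGroup P)
  open GroupPowers (autGroup P) public
  open Evaluation (autGroup P) σ₁ σ₂ public

  cls : Flag P → Bool
  cls = proj₁ chiral

  cls-adj : ∀ i Ψ → cls (adj i Ψ) ≡ not (cls Ψ)
  cls-adj i Ψ = ¬-not (λ e → proj₁ (proj₂ chiral) i Ψ (adj i Ψ) (adj-Adj i Ψ) (≡.sym e))

  cls-adj-adj : ∀ i j Ψ → cls (adj i (adj j Ψ)) ≡ cls Ψ
  cls-adj-adj i j Ψ = ≡.trans (cls-adj i (adj j Ψ)) (≡.trans (≡.cong not (cls-adj j Ψ)) (not-involutive (cls Ψ)))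

  act-σ₁ : act P σ₁ Φ ≡ adj 0F (adj 1F Φ)
  act-σ₁ = let Φ₁ , Φ₁₀ , a₁ , a₀ , eq = isσ₁ in
    ≡.trans (flag-≡ eq) (≡.trans (adj-unique 0F Φ₁ Φ₁₀ a₀) (≡.cong (adj 0F) (adj-unique 1F Φ Φ₁ a₁)))

  act-σ₂ : act P σ₂ Φ ≡ adj 1F (adj 2F Φ)
  act-σ₂ = let Φ₂ , Φ₂₁ , a₂ , a₁ , eq = isσ₂ in
    ≡.trans (flag-≡ eq) (≡.trans (adj-unique 1F Φ₂ Φ₂₁ a₁) (≡.cong (adj 1F) (adj-unique 2F Φ Φ₂ a₂)))

  -- Both σ₁ and σ₂⁻¹ act on Φ as adj B ∘ adj 1F, with B = 0 and B = 2, so that one argument gives both orders.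
  act-σ₂⁻¹ : act P (invAut P σ₂) Φ ≡ adj 2F (adj 1F Φ)
  act-σ₂⁻¹ = act-inv′ σ₂ {adj 2F (adj 1F Φ)} {Φ} (≡.trans (act-adj-adj σ₂ 2F 1F Φ) (≡.trans (≡.cong (adj 2F ∘ adj 1F) act-σ₂)
    (≡.trans (≡.cong (adj 2F) (adj-adj 1F (adj 2F Φ))) (adj-adj 2F Φ))))

  cls-act : ∀ α → cls (act P α Φ) ≡ cls Φ → ∀ Ψ → cls (act P α Ψ) ≡ cls Ψ
  cls-act α h = flag-connected (λ Ψ → cls (act P α Ψ) ≡ cls Ψ)
    (λ i Ψ e → ≡.trans (≡.cong cls (act-adj α i Ψ)) (≡.trans (cls-adj i (act P α Ψ)) (≡.trans (≡.cong not e) (≡.sym (cls-adj i Ψ))))) h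

  cls-inv : ∀ α → (∀ Ψ → cls (act P α Ψ) ≡ cls Ψ) → ∀ Ψ → cls (act P (invAut P α) Ψ) ≡ cls Ψ
  cls-inv α h Ψ = ≡.trans (≡.sym (h _)) (≡.cong cls (act-invʳ α Ψ))

  cls-σ₁ : ∀ Ψ → cls (act P σ₁ Ψ) ≡ cls Ψ
  cls-σ₁ = cls-act σ₁ (≡.trans (≡.cong cls act-σ₁) (cls-adj-adj 0F 1F Φ))

  cls-σ₂ : ∀ Ψ → cls (act P σ₂ Ψ) ≡ cls Ψ
  cls-σ₂ = cls-act σ₂ (≡.trans (≡.cong cls act-σ₂) (cls-adj-adj 1F 2F Φ))

  cls-ev : ∀ w Ψ → cls (act P (ev w) Ψ) ≡ cls Ψ
  cls-ev [] Ψ = ≡.cong cls (act-id Ψ)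
  cls-ev ((false , false) ∷ w) Ψ = ≡.trans (≡.cong cls (act-∘ σ₁ (ev w) Ψ)) (≡.trans (cls-σ₁ _) (cls-ev w Ψ))
  cls-ev ((false , true) ∷ w) Ψ = ≡.trans (≡.cong cls (act-∘ (invAut P σ₁) (ev w) Ψ)) (≡.trans (cls-inv σ₁ cls-σ₁ _) (cls-ev w Ψ))
  cls-ev ((true , false) ∷ w) Ψ = ≡.trans (≡.cong cls (act-∘ σ₂ (ev w) Ψ)) (≡.trans (cls-σ₂ _) (cls-ev w Ψ))
  cls-ev ((true , true) ∷ w) Ψ = ≡.trans (≡.cong cls (act-∘ (invAut P σ₂) (ev w) Ψ)) (≡.trans (cls-inv σ₂ cls-σ₂ _) (cls-ev w Ψ))

  record Turning (τ : Aut P) (n : ℕ) (Inside : Flag P → Set) : Set where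
    field
      period : AutEq P (τ ^ n) (idAut P)
      order : ∀ k → AutEq P (τ ^ k) (idAut P) → n ∣ k
      inside : ∀ k → Inside (act P (τ ^ k) Φ)
      reach : ∀ Ψ → Inside Ψ → cls Ψ ≡ cls Φ → ∃ λ k → act P (τ ^ k) Φ ≡ Ψ

  module Side (B : Fin 3) (n : ℕ) (e-B : ∀ Ψ → e (adj B Ψ) ≡ e Ψ)
    (Inside : Flag P → Set) (inside-Φ : Inside Φ)
    (inside-R : ∀ Ψ → Inside Ψ → Inside (adj B (adj 1F Ψ)))
    (same : ∀ {Ψ Ψ′} → Inside Ψ → Inside Ψ′ → e Ψ ≡ e Ψ′ → Ψ′ ≡ Ψ ⊎ Ψ′ ≡ adj B Ψ)
    (lab : ∀ Ψ → Inside Ψ → Fin n)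
    (lab-injective : ∀ {Ψ Ψ′} i i′ → lab Ψ i ≡ lab Ψ′ i′ → e Ψ ≡ e Ψ′)
    (lab-cong : ∀ {Ψ Ψ′} i i′ → e Ψ ≡ e Ψ′ → lab Ψ i ≡ lab Ψ′ i′)
    (lab-onto : ∀ l → Σ (Flag P) λ Ψ → Σ (Inside Ψ) λ i → lab Ψ i ≡ l)
    (spread : ∀ (S : Flag P → Set) → (∀ Ψ → S Ψ → S (adj 1F Ψ)) → (∀ Ψ → S Ψ → S (adj B Ψ)) → S Φ → ∀ Ψ → Inside Ψ → S Ψ)
    (τ : Aut P) (act-τ : act P τ Φ ≡ adj B (adj 1F Φ)) where

    R : Flag P → Flag P
    R Ψ = adj B (adj 1F Ψ)

    R-injective : ∀ {Ψ Ψ′} → R Ψ ≡ R Ψ′ → Ψ ≡ Ψ′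
    R-injective eq = adj-injective 1F (adj-injective B eq)

    open FiniteOrbit flags↔ R R-injective Φ

    inside-orbit : ∀ k → Inside (orbit k)
    inside-orbit zero = inside-Φ
    inside-orbit (suc k) = inside-R _ (inside-orbit k)

    cls-orbit : ∀ k → cls (orbit k) ≡ cls Φ
    cls-orbit zero = ≡.refl
    cls-orbit (suc k) = ≡.trans (cls-adj-adj B 1F _) (cls-orbit k)

    label : ℕ → Fin n
    label k = lab (orbit k) (inside-orbit k)

    -- Flags of the orbit with the same edge are equal or B-adjacent, and all flags of the orbit lie
    -- in one class.
    label-injective : ∀ i j → label i ≡ label j → orbit i ≡ orbit j
    label-injective i j eq with same (inside-orbit i) (inside-orbit j) (lab-injective (inside-orbit i) (inside-orbit j) eq)
    ... | inj₁ h = ≡.sym h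
    ... | inj₂ h = ⊥-elim (not-¬ {cls Φ} ≡.refl (≡.trans (≡.sym (cls-orbit j)) (≡.trans (≡.cong cls h) (≡.trans (cls-adj B (orbit i)) (≡.cong not (cls-orbit i))))))

    act-τ^ : ∀ k → act P (τ ^ k) Φ ≡ orbit k
    act-τ^ zero = act-id Φ
    act-τ^ (suc k) = ≡.trans (act-∘ τ (τ ^ k) Φ) (≡.trans (≡.cong (act P τ) (act-τ^ k)) (through k))
      where
      through : ∀ k → act P τ (orbit k) ≡ orbit (suc k)
      through zero = act-τ
      through (suc k) = ≡.trans (act-adj-adj τ B 1F (orbit k)) (≡.cong R (through k))

    module Go (m : ℕ) (orbit-d : orbit (suc m) ≡ Φ) (minimal : ∀ k → k < m → orbit (suc k) ≢ Φ) where
      Reached : Flag P → Set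
      Reached Ψ = ∃ λ k → Ψ ≡ orbit k ⊎ Ψ ≡ adj 1F (orbit k)

      reached₁ : ∀ Ψ → Reached Ψ → Reached (adj 1F Ψ)
      reached₁ _ (k , inj₁ ≡.refl) = k , inj₂ ≡.refl
      reached₁ _ (k , inj₂ ≡.refl) = k , inj₁ (adj-adj 1F (orbit k))

      reachedB : ∀ Ψ → Reached Ψ → Reached (adj B Ψ)
      -- The orbit closes up: Φ = `orbit (suc m)`, so its B-neighbour is the 1-neighbour of
      -- `orbit m`.
      reachedB _ (zero , inj₁ ≡.refl) = m , inj₂ (≡.trans (≡.cong (adj B) (≡.sym orbit-d)) (adj-adj B _))
      reachedB _ (suc k , inj₁ ≡.refl) = k , inj₂ (adj-adj B (adj 1F (orbit k)))
      reachedB _ (k , inj₂ ≡.refl) = suc k , inj₁ ≡.refl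

      onto : ∀ l → ∃ λ k → label k ≡ l
      onto l with lab-onto l
      ... | Ψ , i , eq with spread Reached reached₁ reachedB (0 , inj₁ ≡.refl) Ψ i
      ... | k , inj₁ h = k , ≡.trans (lab-cong (inside-orbit k) i (≡.cong e (≡.sym h))) eq
      ... | k , inj₂ h = suc k , ≡.trans (lab-cong (inside-orbit (suc k)) i (≡.trans (e-B _) (≡.cong e (≡.sym h)))) eq

      open PeriodicOrbit.Labelled flags↔ R R-injective Φ m orbit-d minimal label label-injective (λ i j eq → lab-cong (inside-orbit i) (inside-orbit j) (≡.cong e eq)) onto

      turning : Turning τ n Inside
      turning = record
        { period = rigid {τ ^ n} {idAut P} Φ (≡.trans (act-τ^ n) (≡.trans orbit-n (≡.sym (act-id Φ))))
        ; order = λ k h → n∣ k (≡.trans (≡.sym (act-τ^ k)) (≡.trans (act-cong {τ ^ k} {idAut P} h Φ) (act-id Φ)))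
        ; inside = λ k → ≡.subst Inside (≡.sym (act-τ^ k)) (inside-orbit k)
        ; reach = reach }
        where
        reach : ∀ Ψ → Inside Ψ → cls Ψ ≡ cls Φ → ∃ λ k → act P (τ ^ k) Φ ≡ Ψ
        reach Ψ i h with spread Reached reached₁ reachedB (0 , inj₁ ≡.refl) Ψ i
        ... | k , inj₁ eq = k , ≡.trans (act-τ^ k) (≡.sym eq)
        ... | k , inj₂ eq = ⊥-elim (not-¬ {cls Φ} ≡.refl (≡.trans (≡.sym h) (≡.trans (≡.cong cls eq)
          (≡.trans (cls-adj 1F (orbit k)) (≡.cong not (cls-orbit k))))))

    opaque
      turning : Turning τ n Inside
      turning = Go.turning (proj₁ period) (proj₁ (proj₂ period)) (proj₂ (proj₂ period))

  ≡-label : ∀ {n : ℕ} {B : Elem → Set} (I : (Σ Elem λ d → IsEdge d × B d) ↔ Fin n) → (∀ {d} (b b′ : B d) → b ≡ b′) →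
    ∀ {a b} → proj₁ a ≡ proj₁ b → Inverse.to I a ≡ Inverse.to I b
  ≡-label I irr {d , i , b} {_ , i′ , b′} ≡.refl = ≡.cong₂ (λ i b → Inverse.to I (d , i , b)) (≡-irrelevant i i′) (irr b b′)

  label-≡ : ∀ {n : ℕ} {B : Elem → Set} (I : (Σ Elem λ d → IsEdge d × B d) ↔ Fin n) →
    ∀ {a b} → Inverse.to I a ≡ Inverse.to I b → proj₁ a ≡ proj₁ b
  label-≡ I eq = ≡.cong proj₁ (≡.trans (≡.sym (Inverse.strictlyInverseʳ I _)) (≡.trans (≡.cong (Inverse.from I) eq) (Inverse.strictlyInverseʳ I _)))

  faceEdges : EdgesOfFace P (f Φ) ↔ Fin p
  faceEdges = proj₁ (proj₁ tight) (f Φ) (f-face Φ)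
  vertexEdges : EdgesAtVertex P (v Φ) ↔ Fin q
  vertexEdges = proj₂ (proj₁ tight) (v Φ) (v-vert Φ)

  onFace : ∀ (Ψ : Flag P) → f Ψ ≡ f Φ → EdgesOfFace P (f Φ)
  onFace Ψ eq = e Ψ , e-edge Ψ , ≡.subst (e Ψ ≼_) eq (e≼f Ψ)
  onVertex : ∀ (Ψ : Flag P) → v Ψ ≡ v Φ → EdgesAtVertex P (v Φ)
  onVertex Ψ eq = e Ψ , e-edge Ψ , ≡.subst (_≼ e Ψ) eq (v≼e Ψ)

  faceTurning : Turning σ₁ p (λ Ψ → f Ψ ≡ f Φ)
  faceTurning = Side.turning 0F p (λ Ψ → ≡.sym (proj₁ (proj₂ (adj-Adj 0F Ψ)))) (λ Ψ → f Ψ ≡ f Φ) ≡.refl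
    (λ Ψ h → ≡.trans (≡.sym (proj₂ (proj₂ (adj-Adj 0F (adj 1F Ψ))))) (≡.trans (≡.sym (proj₂ (proj₂ (adj-Adj 1F Ψ)))) h))
    (λ i i′ h → same₀ h (≡.trans i (≡.sym i′)))
    (λ Ψ i → Inverse.to faceEdges (onFace Ψ i))
    (λ {Ψ} {Ψ′} i i′ eq → label-≡ faceEdges {onFace Ψ i} {onFace Ψ′ i′} eq)
    (λ {Ψ} {Ψ′} i i′ eq → ≡-label {B = _≼ f Φ} faceEdges (λ b b′ → ≼-irrelevant b b′) {onFace Ψ i} {onFace Ψ′ i′} eq)
    (λ l → let d , dd , df = Inverse.from faceEdges l
               Ψ , eqe , eqf = faceFlag dd (f-face Φ) df
           in Ψ , eqf , ≡.trans (≡-label {B = _≼ f Φ} faceEdges (λ b b′ → ≼-irrelevant b b′) {onFace Ψ eqf} {Inverse.from faceEdges l} eqe) (Inverse.strictlyInverseˡ faceEdges l))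
    (λ S c₁ c₀ s Ψ i → Around.atFace S c₁ c₀ Φ s Ψ i)
    σ₁ act-σ₁

  vertexTurning : Turning (invAut P σ₂) q (λ Ψ → v Ψ ≡ v Φ)
  vertexTurning = Side.turning 2F q (λ Ψ → ≡.sym (proj₁ (proj₂ (adj-Adj 2F Ψ)))) (λ Ψ → v Ψ ≡ v Φ) ≡.refl
    (λ Ψ h → ≡.trans (≡.sym (proj₁ (adj-Adj 2F (adj 1F Ψ)))) (≡.trans (≡.sym (proj₁ (adj-Adj 1F Ψ))) h))
    (λ i i′ h → same₂ (≡.trans i (≡.sym i′)) h)
    (λ Ψ i → Inverse.to vertexEdges (onVertex Ψ i))
    (λ {Ψ} {Ψ′} i i′ eq → label-≡ vertexEdges {onVertex Ψ i} {onVertex Ψ′ i′} eq)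
    (λ {Ψ} {Ψ′} i i′ eq → ≡-label {B = v Φ ≼_} vertexEdges (λ b b′ → ≼-irrelevant b b′) {onVertex Ψ i} {onVertex Ψ′ i′} eq)
    (λ l → let d , dd , dv = Inverse.from vertexEdges l
               Ψ , eqv , eqe = vertexFlag (v-vert Φ) dd dv
           in Ψ , eqv , ≡.trans (≡-label {B = v Φ ≼_} vertexEdges (λ b b′ → ≼-irrelevant b b′) {onVertex Ψ eqv} {Inverse.from vertexEdges l} eqe) (Inverse.strictlyInverseˡ vertexEdges l))
    (λ S c₁ c₂ s Ψ i → Around.atVertex S c₁ c₂ Φ s Ψ i)
    (invAut P σ₂) act-σ₂⁻¹

  open import Algebra.Properties.Group (autGroup P) using (⁻¹-injective)
  open A using (_≈_; _∙_; ε; _⁻¹)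

  σ₂-period : σ₂ ^ q ≈ ε
  σ₂-period = ⁻¹-injective {σ₂ ^ q} {ε} λ a →
    ≡.trans (≡.sym (^-⁻¹ σ₂ q a)) (Turning.period vertexTurning a)

  σ₂-order : ∀ k → σ₂ ^ k ≈ ε → q ∣ k
  σ₂-order k h = Turning.order vertexTurning k λ a →
    ≡.trans (^-⁻¹ σ₂ k a) (A.⁻¹-cong {σ₂ ^ k} {ε} h a)

  vertex-fixed : ∀ k → v (act P (σ₂ ^ k) Φ) ≡ v Φ
  vertex-fixed k = ≡.trans (≡.cong (Aut.to (σ₂ ^ k)) (≡.trans (≡.sym (Turning.inside vertexTurning k)) (^-⁻¹ σ₂ k (v Φ)))) (Aut.to-from (σ₂ ^ k) (v Φ))

  turn : Flag P → Flag P
  turn Ψ = adj 1F (adj 2F (adj 0F (adj 1F Ψ)))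

  act-σ₁σ₂ : act P (σ₁ ∙ σ₂) Φ ≡ turn Φ
  act-σ₁σ₂ = ≡.trans (act-∘ σ₁ σ₂ Φ) (≡.trans (≡.cong (act P σ₁) act-σ₂) (≡.trans (act-adj-adj σ₁ 1F 2F Φ) (≡.cong (adj 1F ∘ adj 2F) act-σ₁)))

  -- The changes of rank 0 and rank 2 commute, so the eight adjacencies cancel.
  turn-turn : ∀ Ψ → turn (turn Ψ) ≡ Ψ
  turn-turn Ψ = ≡.trans (≡.cong (adj 1F ∘ adj 2F ∘ adj 0F) (adj-adj 1F _))
    (≡.trans (≡.cong (adj 1F ∘ adj 2F) (adj-0-2 _))
    (≡.trans (≡.cong (adj 1F) (adj-adj 2F _)) (≡.trans (≡.cong (adj 1F) (adj-adj 0F _)) (adj-adj 1F Ψ))))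

  σ-involution : (σ₁ ∙ σ₂) ∙ (σ₁ ∙ σ₂) ≈ ε
  σ-involution = rigid {(σ₁ ∙ σ₂) ∙ (σ₁ ∙ σ₂)} {ε} Φ (≡.trans (act-∘ (σ₁ ∙ σ₂) (σ₁ ∙ σ₂) Φ) (≡.trans (≡.cong (act P (σ₁ ∙ σ₂)) act-σ₁σ₂)
    (≡.trans (≡.trans (act-adj-adj (σ₁ ∙ σ₂) 1F 2F _) (≡.cong (adj 1F ∘ adj 2F) (act-adj-adj (σ₁ ∙ σ₂) 0F 1F Φ)))
    (≡.trans (≡.cong turn act-σ₁σ₂) (≡.trans (turn-turn Φ) (≡.sym (act-id Φ)))))))

  cls-σ₁^ : ∀ k Ψ → cls (act P (σ₁ ^ k) Ψ) ≡ cls Ψ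
  cls-σ₁^ zero Ψ = ≡.cong cls (act-id Ψ)
  cls-σ₁^ (suc k) Ψ = ≡.trans (≡.cong cls (act-∘ σ₁ (σ₁ ^ k) Ψ)) (≡.trans (cls-σ₁ _) (cls-σ₁^ k Ψ))

  cls-σ₂^ : ∀ k Ψ → cls (act P (σ₂ ^ k) Ψ) ≡ cls Ψ
  cls-σ₂^ zero Ψ = ≡.cong cls (act-id Ψ)
  cls-σ₂^ (suc k) Ψ = ≡.trans (≡.cong cls (act-∘ σ₂ (σ₂ ^ k) Ψ)) (≡.trans (cls-σ₂ _) (cls-σ₂^ k Ψ))

  -- The common element fixes the base vertex and the base face, so it sends Φ to Φ or Φ¹, and Φ¹ is
  -- in the other class.
  σ-meet : ∀ a b → σ₁ ^ a ≈ σ₂ ^ b → σ₁ ^ a ≈ ε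
  σ-meet a b h with same₁ {Φ} {act P (σ₁ ^ a) Φ} (≡.sym (≡.trans (h (v Φ)) (vertex-fixed b))) (≡.sym (Turning.inside faceTurning a))
  ... | inj₁ eq = rigid {σ₁ ^ a} {ε} Φ (≡.trans eq (≡.sym (act-id Φ)))
  ... | inj₂ eq = ⊥-elim (not-¬ {cls Φ} ≡.refl (≡.trans (≡.sym (cls-σ₁^ a Φ)) (≡.trans (≡.cong cls eq) (cls-adj 1F Φ))))

  reflect : Fin 2 → Flag P → Flag P
  reflect zero Ψ = Ψ
  reflect (suc zero) Ψ = adj 0F Ψ

  place : ℕ → ℕ → Flag P
  place a b = act P (σ₁ ^ a ∙ σ₂ ^ b) Φ

  cls-place : ∀ a b → cls (place a b) ≡ cls Φ
  cls-place a b = ≡.trans (≡.cong cls (act-∘ (σ₁ ^ a) (σ₂ ^ b) Φ)) (≡.trans (cls-σ₁^ a _) (cls-σ₂^ b Φ))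

  reflect-injective : ∀ s t {Ψ Ψ′} → cls Ψ ≡ cls Ψ′ → reflect s Ψ ≡ reflect t Ψ′ → s ≡ t × Ψ ≡ Ψ′
  reflect-injective zero zero h eq = ≡.refl , eq
  reflect-injective zero (suc zero) {Ψ} {Ψ′} h eq = ⊥-elim (not-¬ {cls Ψ} h (≡.trans (≡.cong cls eq) (cls-adj 0F Ψ′)))
  reflect-injective (suc zero) zero {Ψ} {Ψ′} h eq = ⊥-elim (not-¬ {cls Ψ′} (≡.sym h) (≡.trans (≡.cong cls (≡.sym eq)) (cls-adj 0F Ψ)))
  reflect-injective (suc zero) (suc zero) h eq = ≡.refl , adj-injective 0F eq

module RotationGroup (P : Polyhedron) (p q : ℕ) (tight : Tight P p q) (chiral : Chiral P)
  (Φ : Flag P) (σ₁ σ₂ : Aut P) (isσ₁ : IsSigma1 P Φ σ₁) (isσ₂ : IsSigma2 P Φ σ₂) where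
  open Rotation P p q tight chiral Φ σ₁ σ₂ isσ₁ isσ₂ public
  open Polyhedron P
  open Flag
  open A using (_≈_; _∙_; ε; _⁻¹)

  place-injective : ∀ {a a′ b b′} → a ℕ.< p → a′ ℕ.< p → b ℕ.< q → b′ ℕ.< q → place a b ≡ place a′ b′ → a ≡ a′ × b ≡ b′
  place-injective {a} {a′} {b} {b′} a< a′< b< b′< eq =
    let eqₐ , eq_b = factors-unique {σ₁} {σ₂} {p} {q} (Turning.period faceTurning) σ₂-period
          (λ {g} (i , h) (j , k) → A.trans {g} {σ₁ ^ i} {ε} h (σ-meet i j (A.trans {σ₁ ^ i} {g} {σ₂ ^ j} (A.sym {g} {σ₁ ^ i} h) k)))
          {σ₁ ^ a} {σ₁ ^ a′} {σ₂ ^ b} {σ₂ ^ b′} (a , A.refl {σ₁ ^ a}) (a′ , A.refl {σ₁ ^ a′}) (b , A.refl {σ₂ ^ b}) (b′ , A.refl {σ₂ ^ b′})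
          (rigid {σ₁ ^ a ∙ σ₂ ^ b} {σ₁ ^ a′ ∙ σ₂ ^ b′} Φ eq)
    in ^-injective {σ₁} {p} (Turning.order faceTurning) a< a′< eqₐ , ^-injective {σ₂} {q} σ₂-order b< b′< eq_b

  decode : Fin (2 ℕ.* p ℕ.* q) → (Fin 2 × Fin p) × Fin q
  decode i = let r , b = remQuot {2 ℕ.* p} q i in remQuot {2} p r , b

  decode-injective : ∀ i j → decode i ≡ decode j → i ≡ j
  decode-injective i j eq = ≡.trans (≡.sym (code i)) (≡.trans (≡.cong encode eq) (code j))
    where
    encode : (Fin 2 × Fin p) × Fin q → Fin (2 ℕ.* p ℕ.* q)
    encode ((s , a) , b) = combine (combine s a) b
    code : ∀ i → encode (decode i) ≡ i
    code i = ≡.trans (≡.cong (λ r → combine r (proj₂ (remQuot {2 ℕ.* p} q i))) (combine-remQuot {2} p (proj₁ (remQuot {2 ℕ.* p} q i)))) (combine-remQuot {2 ℕ.* p} q i)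

  flagAt : (Fin 2 × Fin p) × Fin q → Flag P
  flagAt ((s , a) , b) = reflect s (place (toℕ a) (toℕ b))

  flagAt-injective : ∀ i j → flagAt i ≡ flagAt j → i ≡ j
  flagAt-injective ((s , a) , b) ((t , a′) , b′) eq =
    let eqₛ , eqₚ = reflect-injective s t (≡.trans (cls-place (toℕ a) (toℕ b)) (≡.sym (cls-place (toℕ a′) (toℕ b′)))) eq
        eqₐ , eq_b = place-injective (toℕ<n a) (toℕ<n a′) (toℕ<n b) (toℕ<n b′) eqₚ
    in ≡.cong₂ _,_ (≡.cong₂ _,_ eqₛ (toℕ-injective eqₐ)) (toℕ-injective eq_b)

  to-flags-injective : ∀ {Ψ Ψ′} → Inverse.to flags↔ Ψ ≡ Inverse.to flags↔ Ψ′ → Ψ ≡ Ψ′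
  to-flags-injective eq = ≡.trans (≡.sym (Inverse.strictlyInverseʳ flags↔ _)) (≡.trans (≡.cong (Inverse.from flags↔) eq) (Inverse.strictlyInverseʳ flags↔ _))

  opaque
    -- The 2pq listed flags are distinct, and there are exactly 2pq flags.
    flagAt-surjective : ∀ Ψ → ∃ λ i → flagAt i ≡ Ψ
    flagAt-surjective Ψ = let i , eq = injective⇒surjective (λ i → Inverse.to flags↔ (flagAt (decode i)))
                                (λ {i} {j} eq → decode-injective i j (flagAt-injective (decode i) (decode j) (to-flags-injective eq)))
                                (Inverse.to flags↔ Ψ)
      in decode i , to-flags-injective eq

  -- Tightness enters here: the rotations σ₁^a σ₂^b already reach every flag in the class of Φ.
  in-class : ∀ Ψ → cls Ψ ≡ cls Φ → ∃₂ λ a b → place a b ≡ Ψ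
  in-class Ψ h with flagAt-surjective Ψ
  ... | ((zero , a) , b) , eq = toℕ a , toℕ b , eq
  ... | ((suc zero , a) , b) , eq = ⊥-elim (not-¬ {cls Φ} ≡.refl (≡.trans (≡.sym h) (≡.trans (≡.cong cls (≡.sym eq))
    (≡.trans (cls-adj 0F (place (toℕ a) (toℕ b))) (≡.cong not (cls-place (toℕ a) (toℕ b)))))))

  factorisation : ∀ w → ∃₂ λ a b → ev w ≈ σ₁ ^ a ∙ σ₂ ^ b
  factorisation w = let a , b , eq = in-class (act P (ev w) Φ) (cls-ev w Φ)
    in a , b , rigid {ev w} {σ₁ ^ a ∙ σ₂ ^ b} Φ (≡.sym eq)

  module WG = WordGroup (autGroup P) σ₁ σ₂

  rotationGroup : TightGroup p q
  rotationGroup = WG.tightGroup p q p≢0 q≢0 σ-involution (Turning.period faceTurning) σ₂-period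
    (Turning.order faceTurning) σ₂-order factorisation σ-meet

  trivial⇒ : ∀ w → evalWord P σ₁ σ₂ w ≈ ε → TightGroup._≈_ rotationGroup (TightGroup.ev rotationGroup w) []
  trivial⇒ w h a = ≡.trans (WG.ev-ev w a) (≡.trans (≡.sym (evalWord≈ev P σ₁ σ₂ w a)) (h a))

  ⇒trivial : ∀ w → TightGroup._≈_ rotationGroup (TightGroup.ev rotationGroup w) [] → evalWord P σ₁ σ₂ w ≈ ε
  ⇒trivial w h a = ≡.trans (evalWord≈ev P σ₁ σ₂ w a) (≡.trans (≡.sym (WG.ev-ev w a)) (h a))

  comp : Fin 3 → Flag P → Elem
  comp 0F = v
  comp 1F = e
  comp 2F = f

  rank-comp : ∀ r Ψ → rank (comp r Ψ) ≡ r
  rank-comp 0F = v-vert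
  rank-comp 1F = e-edge
  rank-comp 2F = f-face

  comp-act : ∀ r α Ψ → comp r (act P α Ψ) ≡ Aut.to α (comp r Ψ)
  comp-act 0F α Ψ = ≡.refl
  comp-act 1F α Ψ = ≡.refl
  comp-act 2F α Ψ = ≡.refl

  comp-adj : ∀ r k Ψ → r ≢ k → comp r (adj k Ψ) ≡ comp r Ψ
  comp-adj 0F 0F Ψ ne = ⊥-elim (ne ≡.refl)
  comp-adj 0F 1F Ψ ne = ≡.sym (proj₁ (adj-Adj 1F Ψ))
  comp-adj 0F 2F Ψ ne = ≡.sym (proj₁ (adj-Adj 2F Ψ))
  comp-adj 1F 0F Ψ ne = ≡.sym (proj₁ (proj₂ (adj-Adj 0F Ψ)))
  comp-adj 1F 1F Ψ ne = ⊥-elim (ne ≡.refl)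
  comp-adj 1F 2F Ψ ne = ≡.sym (proj₁ (proj₂ (adj-Adj 2F Ψ)))
  comp-adj 2F 0F Ψ ne = ≡.sym (proj₂ (proj₂ (adj-Adj 0F Ψ)))
  comp-adj 2F 1F Ψ ne = ≡.sym (proj₂ (proj₂ (adj-Adj 1F Ψ)))
  comp-adj 2F 2F Ψ ne = ⊥-elim (ne ≡.refl)

  comp-≼ : ∀ r s Ψ → r Fin.≤ s → comp r Ψ ≼ comp s Ψ
  comp-≼ 0F 0F Ψ _ = ≼-refl
  comp-≼ 0F 1F Ψ _ = v≼e Ψ
  comp-≼ 0F 2F Ψ _ = ≼-trans (v≼e Ψ) (e≼f Ψ)
  comp-≼ 1F 1F Ψ _ = ≼-refl
  comp-≼ 1F 2F Ψ _ = e≼f Ψ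
  comp-≼ 2F 2F Ψ _ = ≼-refl
  comp-≼ 1F 0F Ψ ()
  comp-≼ 2F 0F Ψ ()
  comp-≼ 2F 1F Ψ (ℕ.s≤s ())

  comp-∈ : ∀ {x Ψ} → x ∈ᶠ Ψ → ∃ λ r → comp r Ψ ≡ x
  comp-∈ (inj₁ eq) = 0F , eq
  comp-∈ (inj₂ (inj₁ eq)) = 1F , eq
  comp-∈ (inj₂ (inj₂ eq)) = 2F , eq

  third : ∀ (r s : Fin 3) → ∃ λ k → r ≢ k × s ≢ k
  third 0F 0F = 1F , (λ ()) , (λ ())
  third 0F 1F = 2F , (λ ()) , (λ ())
  third 0F 2F = 1F , (λ ()) , (λ ())
  third 1F 0F = 2F , (λ ()) , (λ ())
  third 1F 1F = 0F , (λ ()) , (λ ())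
  third 1F 2F = 0F , (λ ()) , (λ ())
  third 2F 0F = 1F , (λ ()) , (λ ())
  third 2F 1F = 0F , (λ ()) , (λ ())
  third 2F 2F = 0F , (λ ()) , (λ ())

  -- An element or an incident pair uses at most two ranks, so a flag through it can be moved into
  -- the class of Φ by changing the remaining rank k.
  toClass : ∀ k Ψ → Σ (Flag P) λ Ψ′ → cls Ψ′ ≡ cls Φ × (∀ r → r ≢ k → comp r Ψ′ ≡ comp r Ψ)
  toClass k Ψ with cls Ψ ≟ᵇ cls Φ
  ... | yes h = Ψ , h , λ _ _ → ≡.refl
  ... | no h = adj k Ψ , ≡.trans (cls-adj k Ψ) (≡.trans (≡.cong not (¬-not h)) (not-involutive (cls Φ))) , λ r ne → comp-adj r k Ψ ne

  opaque
    in-class-word : ∀ Ψ → cls Ψ ≡ cls Φ → ∃ λ w → act P (ev w) Φ ≡ Ψ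
    in-class-word Ψ h = let a , b , eq = in-class Ψ h in
      (WG.X WG.W.^ a) ++ (WG.Y WG.W.^ b) ,
      ≡.trans (act-cong {ev ((WG.X WG.W.^ a) ++ (WG.Y WG.W.^ b))} {σ₁ ^ a ∙ σ₂ ^ b}
        (A.trans {ev ((WG.X WG.W.^ a) ++ (WG.Y WG.W.^ b))} {ev (WG.X WG.W.^ a) ∙ ev (WG.Y WG.W.^ b)} {σ₁ ^ a ∙ σ₂ ^ b}
          (ev-++ (WG.X WG.W.^ a) (WG.Y WG.W.^ b))
          (A.∙-cong {ev (WG.X WG.W.^ a)} {σ₁ ^ a} {ev (WG.Y WG.W.^ b)} {σ₂ ^ b} (WG.ev-X^ a) (WG.ev-Y^ b))) Φ) eq

  transitive : ∀ Ψ Ψ′ → cls Ψ ≡ cls Ψ′ → ∃ λ α → act P α Ψ ≡ Ψ′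
  transitive Ψ Ψ′ h = let α , eq = proj₁ (proj₂ (proj₂ chiral)) (cls Ψ′) Ψ Ψ′ h ≡.refl in α , flag-≡ eq

  module _ (R : Aut P) (act-R : act P R Φ ≡ adj 1F Φ) where
    through : ∀ {Ψ₁ Ψ₂} ρ → act P ρ Ψ₁ ≡ Ψ₂ → ∀ Ψ Ψ′ → cls Ψ ≡ cls Ψ₁ → cls Ψ₂ ≡ cls Ψ′ → ∃ λ α → FlagEq P (act P α Ψ) Ψ′
    through {Ψ₁} {Ψ₂} ρ act-ρ Ψ Ψ′ h k =
      let α , eq = transitive Ψ Ψ₁ h
          β , eq′ = transitive Ψ₂ Ψ′ k
          total = ≡.trans (act-∘ β (ρ ∙ α) Ψ) (≡.trans (≡.cong (act P β)
            (≡.trans (act-∘ ρ α Ψ) (≡.trans (≡.cong (act P ρ) eq) act-ρ))) eq′)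
      in β ∙ (ρ ∙ α) , ≡.cong v total , ≡.cong e total , ≡.cong f total

    reflection⇒regular : Regular P
    reflection⇒regular Ψ Ψ′ _ _ = by (cls Ψ ≟ᵇ cls Ψ′) (cls Ψ ≟ᵇ cls Φ)
      where
      by : Dec (cls Ψ ≡ cls Ψ′) → Dec (cls Ψ ≡ cls Φ) → ∃ λ α → FlagEq P (act P α Ψ) Ψ′
      by (yes h) _ = proj₁ (proj₂ (proj₂ chiral)) (cls Ψ′) Ψ Ψ′ h ≡.refl
      by (no h) (yes k) = through R act-R Ψ Ψ′ k
        (≡.trans (cls-adj 1F Φ) (≡.trans (≡.cong not (≡.sym k)) (≡.sym (¬-not (h ∘ ≡.sym)))))
      by (no h) (no k) = through (invAut P R) (act-inv′ R act-R) Ψ Ψ′ (≡.trans (¬-not k) (≡.sym (cls-adj 1F Φ)))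
        (≡.trans (≡.sym (not-involutive _)) (≡.trans (≡.cong not (≡.sym (¬-not k))) (≡.sym (¬-not (h ∘ ≡.sym)))))

  -- An automorphism of the rotation group inverting σ₁ and σ₂ induces a reflection of P.
  module Reflection (reg : ∀ w → ev w ≈ ε → ev (mirror w) ≈ ε) where
    Φ¹ : Flag P
    Φ¹ = adj 1F Φ

    mirror-unique : ∀ {g g′ h h′} → Mirror g h → Mirror g′ h′ → g ≈ g′ → h ≈ h′
    mirror-unique {g} {g′} {h} {h′} (w , e₁ , f₁) (w′ , e₂ , f₂) eq a =
      ≡.trans (≡.sym (f₁ a)) (≡.trans (≡.sym (Aut.to-from (ev (mirror w′)) (Aut.to (ev (mirror w)) a)))
        (≡.trans (f₂ _) (≡.cong (Aut.to h′) (quotient a))))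
      where
      word : Word
      word = invert w′ ++ w
      word≈ : ev word ≈ ε
      word≈ a = ≡.trans (ev-++ (invert w′) w a) (≡.trans (ev-invert w′ _)
        (≡.trans (≡.cong (Aut.from (ev w′)) (≡.trans (e₁ a) (≡.trans (eq a) (≡.sym (e₂ a))))) (Aut.from-to (ev w′) a)))
      quotient : ∀ a → Aut.from (ev (mirror w′)) (Aut.to (ev (mirror w)) a) ≡ a
      quotient a = ≡.trans (≡.sym (≡.trans (≡.cong (λ u → Aut.to (ev u) a) (≡.trans (mirror-++ (invert w′) w) (≡.cong (_++ mirror w) (mirror-invert w′))))
        (≡.trans (ev-++ (invert (mirror w′)) (mirror w) a) (ev-invert (mirror w′) _)))) (reg word word≈ a)

    word-mirror : ∀ w → Mirror (ev w) (ev (mirror w))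
    word-mirror w = w , A.refl {ev w} , A.refl {ev (mirror w)}

    fix-edge : Aut.to (σ₁ ∙ σ₂) (e Φ¹) ≡ e Φ¹
    fix-edge = ≡.trans (≡.cong e eq) (≡.trans (comp-adj 1F 2F (adj 0F Φ¹) λ ()) (comp-adj 1F 0F Φ¹ λ ()))
      where
      eq : act P (σ₁ ∙ σ₂) Φ¹ ≡ adj 2F (adj 0F Φ¹)
      eq = ≡.trans (act-adj (σ₁ ∙ σ₂) 1F Φ) (≡.trans (≡.cong (adj 1F) act-σ₁σ₂) (adj-adj 1F _))

    act-σ₂σ₁ : act P (σ₂ ∙ σ₁) Φ ≡ adj 0F (adj 2F Φ)
    act-σ₂σ₁ = ≡.trans (act-∘ σ₂ σ₁ Φ) (≡.trans (≡.cong (act P σ₂) act-σ₁) (≡.trans (act-adj-adj σ₂ 0F 1F Φ)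
      (≡.trans (≡.cong (adj 0F ∘ adj 1F) act-σ₂) (≡.cong (adj 0F) (adj-adj 1F _)))))

    edge-class : ∀ Ψ → e Ψ ≡ e Φ → cls Ψ ≡ cls Φ → Ψ ≡ Φ ⊎ Ψ ≡ adj 0F (adj 2F Φ)
    edge-class Ψ eq h with same₂ {Φ′} {Ψ} ≡.refl (≡.sym eq) | same₀ {Φ} {Φ′} ≡.refl ≡.refl
      where
      Φ′ : Flag P
      Φ′ = flag (v Ψ) (e Φ) (f Φ) (v-vert Ψ) (e-edge Φ) (f-face Φ) (≡.subst (v Ψ ≼_) eq (v≼e Ψ)) (e≼f Φ)
    ... | inj₁ i | inj₁ j = inj₁ (≡.trans i j)
    ... | inj₂ i | inj₂ j = inj₂ (≡.trans i (≡.trans (≡.cong (adj 2F) j) (≡.sym (adj-0-2 Φ))))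
    ... | inj₁ i | inj₂ j = ⊥-elim (not-¬ {cls Φ} ≡.refl (≡.trans (≡.sym h) (≡.trans (≡.cong cls (≡.trans i j)) (cls-adj 0F Φ))))
    ... | inj₂ i | inj₁ j = ⊥-elim (not-¬ {cls Φ} ≡.refl (≡.trans (≡.sym h) (≡.trans (≡.cong cls (≡.trans i (≡.cong (adj 2F) j))) (cls-adj 2F Φ))))

    -- Makes the reflection well defined: the base vertex, edge and face have the stabilisers ⟨σ₂⟩,
    -- ⟨σ₂σ₁⟩ and ⟨σ₁⟩, and their mirror images fix the corresponding elements of Φ¹.
    stabilizer : ∀ r w → Aut.to (ev w) (comp r Φ) ≡ comp r Φ → Aut.to (ev (mirror w)) (comp r Φ¹) ≡ comp r Φ¹
    stabilizer 0F w h = let k , eq = Turning.reach vertexTurning (act P (ev w) Φ) h (cls-ev w Φ)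
                            m = mirror-unique {ev w} {(σ₂ ⁻¹) ^ k} {ev (mirror w)} {(σ₂ ⁻¹ ⁻¹) ^ k} (word-mirror w)
                                  (mirror-^ {σ₂ ⁻¹} {σ₂ ⁻¹ ⁻¹} k (mirror-⁻¹ {σ₂} {σ₂ ⁻¹} mirror-y))
                                  (rigid {ev w} {(σ₂ ⁻¹) ^ k} Φ (≡.sym eq))
      in ≡.trans (≡.cong (Aut.to (ev (mirror w))) same) (≡.trans (m (v Φ))
           (≡.trans (^-cong {σ₂ ⁻¹ ⁻¹} {σ₂} k (λ _ → ≡.refl) (v Φ)) (≡.trans (vertex-fixed k) (≡.sym same))))
      where
      same : v Φ¹ ≡ v Φ
      same = comp-adj 0F 1F Φ λ ()
    stabilizer 2F w h = let k , eq = Turning.reach faceTurning (act P (ev w) Φ) h (cls-ev w Φ)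
                            m = mirror-unique {ev w} {σ₁ ^ k} {ev (mirror w)} {(σ₁ ⁻¹) ^ k} (word-mirror w)
                                  (mirror-^ {σ₁} {σ₁ ⁻¹} k mirror-x)
                                  (rigid {ev w} {σ₁ ^ k} Φ (≡.sym eq))
      in ≡.trans (≡.cong (Aut.to (ev (mirror w))) same) (≡.trans (m (f Φ)) (≡.trans (^-⁻¹ σ₁ k (f Φ))
           (≡.trans (≡.cong (Aut.from (σ₁ ^ k)) (≡.sym (Turning.inside faceTurning k))) (≡.trans (Aut.from-to (σ₁ ^ k) (f Φ)) (≡.sym same)))))
      where
      same : f Φ¹ ≡ f Φ
      same = comp-adj 2F 1F Φ λ ()
    stabilizer 1F w h with edge-class (act P (ev w) Φ) h (cls-ev w Φ)
    ... | inj₁ eq = mirror-unique {ev w} {ε} {ev (mirror w)} {ε} (word-mirror w) mirror-ε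
            (rigid {ev w} {ε} Φ (≡.trans eq (≡.sym (act-id Φ)))) (e Φ¹)
    ... | inj₂ eq = ≡.trans (mirror-unique {ev w} {σ₂ ∙ σ₁} {ev (mirror w)} {σ₂ ⁻¹ ∙ σ₁ ⁻¹} (word-mirror w)
              (mirror-∙ {σ₂} {σ₂ ⁻¹} {σ₁} {σ₁ ⁻¹} mirror-y mirror-x)
              (rigid {ev w} {σ₂ ∙ σ₁} Φ (≡.trans eq (≡.sym act-σ₂σ₁))) (e Φ¹))
            (≡.trans (≡.cong (Aut.from (σ₁ ∙ σ₂)) (≡.sym fix-edge)) (Aut.from-to (σ₁ ∙ σ₂) (e Φ¹)))

    key : ∀ r w w′ → Aut.to (ev w) (comp r Φ) ≡ Aut.to (ev w′) (comp r Φ) →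
      Aut.to (ev (mirror w)) (comp r Φ¹) ≡ Aut.to (ev (mirror w′)) (comp r Φ¹)
    key r w w′ h = ≡.trans (≡.sym (Aut.to-from (ev (mirror w′)) _)) (≡.cong (Aut.to (ev (mirror w′)))
      (≡.trans (≡.sym (≡.trans (≡.cong (λ u → Aut.to (ev u) (comp r Φ¹)) (≡.trans (mirror-++ (invert w′) w) (≡.cong (_++ mirror w) (mirror-invert w′))))
        (≡.trans (ev-++ (invert (mirror w′)) (mirror w) _) (ev-invert (mirror w′) _))))
      (stabilizer r (invert w′ ++ w) (≡.trans (ev-++ (invert w′) w _) (≡.trans (ev-invert w′ _)
        (≡.trans (≡.cong (Aut.from (ev w′)) h) (Aut.from-to (ev w′) _)))))))

    opaque
      word-of : ∀ x → ∃ λ w → Aut.to (ev w) (comp (rank x) Φ) ≡ x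
      word-of x = let Ψ , x∈ = inFlag x
                      r , eq = comp-∈ {x} {Ψ} x∈
                      k , r≢k , _ = third r r
                      Ψ′ , h , same = toClass k Ψ
                      w , eq′ = in-class-word Ψ′ h
                      x≡ = ≡.trans (same r r≢k) eq
                      r≡ = ≡.trans (≡.sym (≡.cong rank x≡)) (rank-comp r Ψ′)
        in w , ≡.subst (λ s → Aut.to (ev w) (comp s Φ) ≡ x) (≡.sym r≡)
             (≡.trans (≡.sym (comp-act r (ev w) Φ)) (≡.trans (≡.cong (comp r) eq′) x≡))

    -- The element g·(component of Φ) goes to mirror(g)·(component of Φ¹), for any word g reaching
    -- it.
    ρ : Elem → Elem
    ρ x = Aut.to (ev (mirror (proj₁ (word-of x)))) (comp (rank x) Φ¹)

    ρ-spec : ∀ r w x → rank x ≡ r → Aut.to (ev w) (comp r Φ) ≡ x → ρ x ≡ Aut.to (ev (mirror w)) (comp r Φ¹)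
    ρ-spec _ w x ≡.refl h = key (rank x) (proj₁ (word-of x)) w (≡.trans (proj₂ (word-of x)) (≡.sym h))

    ρ-flag : ∀ r w → ρ (comp r (act P (ev w) Φ)) ≡ comp r (act P (ev (mirror w)) Φ¹)
    ρ-flag r w = ≡.trans (ρ-spec r w _ (rank-comp r _) (≡.sym (comp-act r (ev w) Φ))) (≡.sym (comp-act r (ev (mirror w)) Φ¹))

    ρ-rank : ∀ x → rank (ρ x) ≡ rank x
    ρ-rank x = ≡.trans (Aut.rank-pres (ev (mirror (proj₁ (word-of x)))) _) (rank-comp (rank x) Φ¹)

    ρ-mono : ∀ {x y} → x ≼ y → ρ x ≼ ρ y
    ρ-mono {x} {y} h = let Ψ , x∈ , y∈ = common {x} {y} (inj₁ h)
                           r , eqₓ = comp-∈ {x} {Ψ} x∈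
                           s , eq_y = comp-∈ {y} {Ψ} y∈
                           k , r≢k , s≢k = third r s
                           Ψ′ , c , same = toClass k Ψ
                           w , eq = in-class-word Ψ′ c
                           x≡ = ≡.trans (≡.cong (comp r) eq) (≡.trans (same r r≢k) eqₓ)
                           y≡ = ≡.trans (≡.cong (comp s) eq) (≡.trans (same s s≢k) eq_y)
                           r≤s = ≡.subst₂ Fin._≤_ (≡.trans (≡.cong rank (≡.sym eqₓ)) (rank-comp r Ψ)) (≡.trans (≡.cong rank (≡.sym eq_y)) (rank-comp s Ψ)) (rank-mono-≤ h)
      in ≡.subst₂ _≼_ (≡.trans (≡.sym (ρ-flag r w)) (≡.cong ρ x≡)) (≡.trans (≡.sym (ρ-flag s w)) (≡.cong ρ y≡))
           (comp-≼ r s (act P (ev (mirror w)) Φ¹) r≤s)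
      where
      rank-mono-≤ : ∀ {x y} → x ≼ y → rank x Fin.≤ rank y
      rank-mono-≤ h = ℕₚ.≮⇒≥ (rank-≤ h)

    -- A word carrying the component of Φ to that of Φ¹. Only the edge moves, and σ₁ carries it;
    -- this rewrites ρ x over Φ so that ρ can be applied again.
    shift : Fin 3 → Word
    shift 0F = []
    shift 1F = WG.X
    shift 2F = []

    e-shift : Aut.to σ₁ (e Φ) ≡ e Φ¹
    e-shift = ≡.trans (≡.cong e act-σ₁) (comp-adj 1F 0F Φ¹ λ ())

    shift-to : ∀ r → Aut.to (ev (shift r)) (comp r Φ) ≡ comp r Φ¹
    shift-to 0F = ≡.sym (comp-adj 0F 1F Φ λ ())
    shift-to 1F = e-shift
    shift-to 2F = ≡.sym (comp-adj 2F 1F Φ λ ())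

    shift-from : ∀ r → Aut.to (ev (mirror (shift r))) (comp r Φ¹) ≡ comp r Φ
    shift-from 0F = comp-adj 0F 1F Φ λ ()
    shift-from 1F = ≡.trans (≡.cong (Aut.from σ₁) (≡.sym e-shift)) (Aut.from-to σ₁ (e Φ))
    shift-from 2F = comp-adj 2F 1F Φ λ ()

    ρ-ρ : ∀ x → ρ (ρ x) ≡ x
    ρ-ρ x = ≡.trans (ρ-spec r (mirror w ++ shift r) (ρ x) (ρ-rank x)
        (≡.trans (ev-++ (mirror w) (shift r) _) (≡.cong (Aut.to (ev (mirror w))) (shift-to r))))
      (≡.trans (≡.cong (λ u → Aut.to (ev u) (comp r Φ¹)) (≡.trans (mirror-++ (mirror w) (shift r)) (≡.cong (_++ mirror (shift r)) (mirror-mirror w))))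
      (≡.trans (ev-++ w (mirror (shift r)) _) (≡.trans (≡.cong (Aut.to (ev w)) (shift-from r)) (proj₂ (word-of x)))))
      where
      r = rank x
      w = proj₁ (word-of x)

    reflection : Aut P
    reflection = record
      { to = ρ ; from = ρ ; to-from = ρ-ρ ; from-to = ρ-ρ ; mono = ρ-mono
      ; mono⁻ = λ {x} {y} h → ≡.subst₂ _≼_ (ρ-ρ x) (ρ-ρ y) (ρ-mono h)
      ; rank-pres = ρ-rank }

    act-reflection : act P reflection Φ ≡ Φ¹
    act-reflection = flag-≡ (at 0F , at 1F , at 2F)
      where
      at : ∀ r → ρ (comp r Φ) ≡ comp r Φ¹
      at r = ρ-spec r [] (comp r Φ) (rank-comp r Φ) ≡.refl

  not-regular : ¬ TightGroup.Regular⁺ rotationGroup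
  not-regular reg = proj₂ (proj₂ (proj₂ chiral)) (reflection⇒regular (Reflection.reflection reg′) (Reflection.act-reflection reg′))
    where
    reg′ : ∀ w → ev w ≈ ε → ev (mirror w) ≈ ε
    reg′ w h a = ≡.trans (≡.sym (WG.ev-ev (mirror w) a)) (reg w (λ a → ≡.trans (WG.ev-ev w a) (h a)) a)

-- Coset polyhedra

first : ∀ {n} → (Fin n → Bool) → Maybe (Fin n)
first {zero} b = nothing
first {suc n} b with b zero
... | true = just zero
... | false = Maybe.map suc (first (b ∘ suc))

first-cong : ∀ {n} {b c : Fin n → Bool} → (∀ i → b i ≡ c i) → first b ≡ first c
first-cong {zero} h = ≡.refl
first-cong {suc n} {b} {c} h with b zero | c zero | h zero
... | true | .true | ≡.refl = ≡.refl
... | false | .false | ≡.refl = ≡.cong (Maybe.map suc) (first-cong (h ∘ suc))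

first-just : ∀ {n} (b : Fin n → Bool) i → b i ≡ true → ∃ λ j → first b ≡ just j × b j ≡ true
first-just {suc n} b i h with b zero in eq
... | true = zero , ≡.refl , eq
first-just {suc n} b zero h | false with () ← ≡.trans (≡.sym eq) h
first-just {suc n} b (suc i) h | false with first-just (b ∘ suc) i h
... | j , e , t = suc j , ≡.cong (Maybe.map suc) e , t

-- A class of a decidable equivalence on `Fin n` is represented by its first member; equivalent
-- indices give the same Boolean test and therefore the same first member.
module Representative {n : ℕ} {_~_ : Fin n → Fin n → Set} (_~?_ : ∀ i j → Dec (i ~ j))
  (~-refl : ∀ i → i ~ i) (~-sym : ∀ {i j} → i ~ j → j ~ i) (~-trans : ∀ {i j k} → i ~ j → j ~ k → i ~ k) where
  found : ∀ i → ∃ λ j → first (λ k → does (k ~? i)) ≡ just j × does (j ~? i) ≡ true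
  found i = first-just (λ k → does (k ~? i)) i (dec-true (i ~? i) (~-refl i))

  representative : Fin n → Fin n
  representative i = proj₁ (found i)

  representative-~ : ∀ i → representative i ~ i
  representative-~ i with representative i ~? i | proj₂ (proj₂ (found i))
  ... | yes h | _ = h

  representative-cong : ∀ {i j} → i ~ j → representative i ≡ representative j
  representative-cong {i} {j} h = just-injective (≡.trans (≡.sym (proj₁ (proj₂ (found i))))
    (≡.trans (first-cong λ k → does-⇔ (mk⇔ (λ k~i → ~-trans k~i h) (λ k~j → ~-trans k~j (~-sym h))) (k ~? i) (k ~? j)) (proj₁ (proj₂ (found j)))))

-- The stabilizers of the base vertex, edge and face.
module Subgroups {p q : ℕ} (T : TightGroup p q) where
  open TightGroup T
  open Theory T
  open GroupSolver group
  open import Algebra.Properties.Group group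

  u : Carrier
  u = y ∙ x

  uu : u ∙ u ≈ ε
  uu = TightGroup.involution (dual T)

  u⁻¹ : u ⁻¹ ≈ u
  u⁻¹ = sym (inverseˡ-unique _ _ uu)

  H : Fin 3 → Carrier → Set
  H 0F g = g ∈⟨ y ⟩
  H 1F g = g ≈ ε ⊎ g ≈ u
  H 2F g = g ∈⟨ x ⟩

  H-ε : ∀ r → H r ε
  H-ε 0F = ∈-ε
  H-ε 1F = inj₁ refl
  H-ε 2F = ∈-ε

  H-resp : ∀ r {g h} → g ≈ h → H r g → H r h
  H-resp 0F = ∈-resp
  H-resp 1F e (inj₁ h) = inj₁ (trans (sym e) h)
  H-resp 1F e (inj₂ h) = inj₂ (trans (sym e) h)
  H-resp 2F = ∈-resp

  H-∙ : ∀ r {g h} → H r g → H r h → H r (g ∙ h)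
  H-∙ 0F = ∈-∙
  H-∙ 1F (inj₁ a) (inj₁ b) = inj₁ (trans (∙-cong a b) (identityˡ ε))
  H-∙ 1F (inj₁ a) (inj₂ b) = inj₂ (trans (∙-cong a b) (identityˡ u))
  H-∙ 1F (inj₂ a) (inj₁ b) = inj₂ (trans (∙-cong a b) (identityʳ u))
  H-∙ 1F (inj₂ a) (inj₂ b) = inj₁ (trans (∙-cong a b) uu)
  H-∙ 2F = ∈-∙

  H-⁻¹ : ∀ r {g} → H r g → H r (g ⁻¹)
  H-⁻¹ 0F = ∈y-⁻¹
  H-⁻¹ 1F (inj₁ a) = inj₁ (trans (⁻¹-cong a) ε⁻¹≈ε)
  H-⁻¹ 1F (inj₂ a) = inj₂ (trans (⁻¹-cong a) u⁻¹)
  H-⁻¹ 2F = ∈x-⁻¹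

  ∈x? : ∀ g → Dec (g ∈⟨ x ⟩)
  ∈x? g with factor g
  ... | a , b , e = map′ (λ h → a , trans e (trans (∙-congˡ h) (identityʳ _)))
    (λ h → meet∈ (∈-resp (trans (∙-congˡ e) (\\-leftDividesʳ _ _)) (∈-∙ (x⁻¹∈ a) h)) (b , refl))
    (ε? (y ^ b))

  ∈y? : ∀ g → Dec (g ∈⟨ y ⟩)
  ∈y? g with factorʳ g
  ... | b , a , e = map′ (λ h → b , trans e (trans (∙-congˡ h) (identityʳ _)))
    (λ h → meet∈ (a , refl) (∈-resp (trans (∙-congˡ e) (\\-leftDividesʳ _ _)) (∈-∙ (y⁻¹∈ b) h)))
    (ε? (x ^ a))

  H? : ∀ r g → Dec (H r g)
  H? 0F = ∈y?
  H? 1F g = (g ≈? ε) ⊎-dec (g ≈? u)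
  H? 2F = ∈x?

  infix 4 _~[_]_
  _~[_]_ : Carrier → Fin 3 → Carrier → Set
  g ~[ r ] h = H r (g ⁻¹ ∙ h)

  ~-≈ : ∀ r {g h} → g ≈ h → g ~[ r ] h
  ~-≈ r {g} e = H-resp r (trans (sym (inverseˡ g)) (∙-congˡ e)) (H-ε r)

  ~-sym : ∀ r {g h} → g ~[ r ] h → h ~[ r ] g
  ~-sym r {g} {h} k = H-resp r (solve 2 (λ g h → ⊖ (⊖ g ⊕ h) ⊜ ⊖ h ⊕ g) refl g h) (H-⁻¹ r k)

  ~-trans : ∀ r {g h k} → g ~[ r ] h → h ~[ r ] k → g ~[ r ] k
  ~-trans r {g} {h} {k} a b = H-resp r (solve 3 (λ g h k → (⊖ g ⊕ h) ⊕ (⊖ h ⊕ k) ⊜ ⊖ g ⊕ k) refl g h k) (H-∙ r a b)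

  ~-left : ∀ r k {g h} → g ~[ r ] h → (k ∙ g) ~[ r ] (k ∙ h)
  ~-left r k {g} {h} = H-resp r (solve 3 (λ k g h → ⊖ g ⊕ h ⊜ ⊖ (k ⊕ g) ⊕ (k ⊕ h)) refl k g h)

  ~-∙ : ∀ r g {a} → H r a → g ~[ r ] (g ∙ a)
  ~-∙ r g {a} = H-resp r (sym (\\-leftDividesʳ g a))

  -- Cosets with propositional equality, as the elements of a `Polyhedron` require, over a group
  -- that has only a setoid equality.
  record Cosets : Set₁ where
    field
      Class : Fin 3 → Set
      cl : ∀ r → Carrier → Class r
      cl-≡ : ∀ r {g h} → g ~[ r ] h → cl r g ≡ cl r h
      cl-~ : ∀ r {g h} → cl r g ≡ cl r h → g ~[ r ] h
      rep : ∀ r → Class r → Carrier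
      cl-rep : ∀ r X → cl r (rep r X) ≡ X
    Meet : ∀ r s → Class r → Class s → Set
    Meet r s X Y = ∃ λ g → cl r g ≡ X × cl s g ≡ Y
    field
      meet? : ∀ r s X Y → Dec (Meet r s X Y)

  elt : Fin (p ℕ.* q) → Carrier
  elt k = let a , b = remQuot {p} q k in x ^ toℕ a ∙ y ^ toℕ b

  code : Carrier → Fin (p ℕ.* q)
  code g = let a , b , _ = factor g in combine (fromℕ< (m%n<n a p)) (fromℕ< (m%n<n b q))

  elt-code : ∀ g → elt (code g) ≈ g
  elt-code g with factor g
  ... | a , b , e = trans (reflexive (≡.cong (λ (i , j) → x ^ toℕ i ∙ y ^ toℕ j) (remQuot-combine {p} {q} (fromℕ< (m%n<n a p)) (fromℕ< (m%n<n b q)))))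
    (trans (∙-cong (trans (^-≡ x (toℕ-fromℕ< (m%n<n a p))) (sym (x^-% a))) (trans (^-≡ y (toℕ-fromℕ< (m%n<n b q))) (sym (y^-% b)))) (sym e))

  module Build {n : ℕ} (elt : Fin n → Carrier) (code : Carrier → Fin n) (elt-code : ∀ g → elt (code g) ≈ g)
    (ρ : Fin 3 → Fin n → Fin n) (ρ-~ : ∀ r k → elt (ρ r k) ~[ r ] elt k)
    (ρ-cong : ∀ r {k l} → elt k ~[ r ] elt l → ρ r k ≡ ρ r l) where
    Class : Fin 3 → Set
    Class r = Σ (Fin n) λ k → ρ r k ≡ k

    class-≡ : ∀ r {X Y : Class r} → proj₁ X ≡ proj₁ Y → X ≡ Y
    class-≡ r {k , h} {_ , h′} ≡.refl = ≡.cong (k ,_) (≡-irrelevant h h′)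

    class? : ∀ r (X Y : Class r) → Dec (X ≡ Y)
    class? r X Y = map′ (class-≡ r) (≡.cong proj₁) (proj₁ X ≟ᶠ proj₁ Y)

    cl : ∀ r → Carrier → Class r
    cl r g = ρ r (code g) , ρ-cong r (ρ-~ r (code g))

    code-~ : ∀ r g → elt (code g) ~[ r ] g
    code-~ r g = ~-≈ r (elt-code g)

    cl-≡ : ∀ r {g h} → g ~[ r ] h → cl r g ≡ cl r h
    cl-≡ r {g} {h} e = class-≡ r (ρ-cong r (~-trans r (code-~ r g) (~-trans r e (~-sym r (code-~ r h)))))

    cl-~ : ∀ r {g h} → cl r g ≡ cl r h → g ~[ r ] h
    cl-~ r {g} {h} e = ~-trans r (~-sym r (code-~ r g)) (~-trans r (~-sym r (ρ-~ r (code g)))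
      (~-trans r (≡.subst (λ k → elt k ~[ r ] elt (code h)) (≡.sym (≡.cong proj₁ e)) (ρ-~ r (code h))) (code-~ r h)))

    meetAt? : ∀ r s X Y k → Dec (cl r (elt k) ≡ X × cl s (elt k) ≡ Y)
    meetAt? r s X Y k = class? r (cl r (elt k)) X ×-dec class? s (cl s (elt k)) Y

    cosets : Cosets
    cosets = record
      { Class = Class ; cl = cl ; cl-≡ = cl-≡ ; cl-~ = cl-~ ; rep = λ r X → elt (proj₁ X)
      ; cl-rep = λ r X → class-≡ r (≡.trans (ρ-cong r (code-~ r (elt (proj₁ X)))) (proj₂ X))
      ; meet? = λ r s X Y → map′ (λ (k , a , b) → elt k , a , b)
          (λ (g , a , b) → code g , ≡.trans (cl-≡ r (code-~ r g)) a , ≡.trans (cl-≡ s (code-~ s g)) b)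
          (any? (meetAt? r s X Y)) }

  module R (r : Fin 3) = Representative {p ℕ.* q} {λ i j → elt i ~[ r ] elt j} (λ i j → H? r (elt i ⁻¹ ∙ elt j))
    (λ i → ~-≈ r refl) (~-sym r) (~-trans r)

  cosets : Cosets
  cosets = Build.cosets elt code elt-code R.representative R.representative-~ R.representative-cong

module Geometry {p q : ℕ} (T : TightGroup p q) (p≢1 : p ≢ 1) (q≢1 : q ≢ 1) (C : Subgroups.Cosets T) where
  open TightGroup T
  open Theory T
  open Subgroups T hiding (cosets; elt; code; elt-code; module Build; module R)
  open Subgroups.Cosets C
  open GroupSolver group
  open import Algebra.Properties.Group group

  Elem : Set
  Elem = Σ (Fin 3) Class

  rank : Elem → Fin 3
  rank = proj₁

  infix 4 _≼_
  -- Incidence means that two cosets meet. `True` of the decision replaces the common element, so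
  -- that incidence is proof-irrelevant.
  _≼_ : Elem → Elem → Set
  (r , X) ≼ (s , Y) = r Fin.≤ s × True (meet? r s X Y)

  node : Fin 3 → Carrier → Elem
  node r g = r , cl r g

  node-≡ : ∀ r {g h} → g ~[ r ] h → node r g ≡ node r h
  node-≡ r e = ≡.cong (r ,_) (cl-≡ r e)

  node-~ : ∀ r {g h} → node r g ≡ node r h → g ~[ r ] h
  node-~ r e = cl-~ r (same e)
    where
    same : ∀ {X Y : Class r} → (r , X) ≡ (r , Y) → X ≡ Y
    same ≡.refl = ≡.refl

  node-rep : ∀ r X → node r (rep r X) ≡ (r , X)
  node-rep r X = ≡.cong (r ,_) (cl-rep r X)

  mk≼ : ∀ {r s} g {X Y} → r Fin.≤ s → cl r g ≡ X → cl s g ≡ Y → (r , X) ≼ (s , Y)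
  mk≼ {r} {s} g {X} {Y} r≤s a b = r≤s , fromWitness {a? = meet? r s X Y} (g , a , b)

  meeting : ∀ {r s X Y} → (r , X) ≼ (s , Y) → Meet r s X Y
  meeting {r} {s} {X} {Y} (_ , h) = toWitness {a? = meet? r s X Y} h

  node-≼ : ∀ {r s} g → r Fin.≤ s → node r g ≼ node s g
  node-≼ g r≤s = mk≼ g r≤s ≡.refl ≡.refl

  x≉ε : ¬ x ≈ ε
  x≉ε h = p≢1 (∣1⇒≡1 (x-order 1 (trans (^-1 x) h)))
  y≉ε : ¬ y ≈ ε
  y≉ε h = q≢1 (∣1⇒≡1 (y-order 1 (trans (^-1 y) h)))
  x∉y : ¬ x ∈⟨ y ⟩
  x∉y h = x≉ε (meet∈ ∈-self h)
  y∉x : ¬ y ∈⟨ x ⟩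
  y∉x h = y≉ε (meet∈ h ∈-self)
  u∉y : ¬ u ∈⟨ y ⟩
  u∉y h = x∉y (∈-resp (\\-leftDividesʳ y x) (∈-∙ (∈y-⁻¹ ∈-self) h))
  u∉x : ¬ u ∈⟨ x ⟩
  u∉x h = y∉x (∈-resp (//-rightDividesʳ x y) (∈-∙ h (∈x-⁻¹ ∈-self)))

  ≈⇒node : ∀ r {g h} → g ≈ h → node r g ≡ node r h
  ≈⇒node r e = node-≡ r (~-≈ r e)

  from-quotient : ∀ {g h a} → g ⁻¹ ∙ h ≈ a → h ≈ g ∙ a
  from-quotient {g} {h} e = trans (sym (\\-leftDividesˡ g h)) (∙-congˡ e)

  ≼-trans : ∀ {X Y Z} → X ≼ Y → Y ≼ Z → X ≼ Z
  ≼-trans {r , X} {s , Y} {t , Z} a@(r≤s , _) b@(s≤t , _) with meeting a | meeting b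
  ... | g , gX , gY | h , hY , hZ = let k , gk , kh = between r s t r≤s s≤t (cl-~ s (≡.trans gY (≡.sym hY))) in
    mk≼ k (Finₚ.≤-trans r≤s s≤t) (≡.trans (≡.sym (cl-≡ r gk)) gX) (≡.trans (cl-≡ t kh) hZ)
    where
    between : ∀ r s t → r Fin.≤ s → s Fin.≤ t → g ~[ s ] h → ∃ λ k → g ~[ r ] k × k ~[ t ] h
    between 0F 0F t _ _ e = h , e , ~-≈ t refl
    between 0F 1F 1F _ _ e = g , ~-≈ 0F refl , e
    between 0F 1F 2F _ _ (inj₁ e) = g , ~-≈ 0F refl , H-resp 2F (sym e) (H-ε 2F)
    -- The edge stabiliser lies in ⟨y⟩⟨x⟩: from h = gyx, the element gy shares the vertex of g and
    -- the face of h.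
    between 0F 1F 2F _ _ (inj₂ e) = g ∙ y , ~-∙ 0F g ∈-self , H-resp 2F (trans (sym (\\-leftDividesʳ y x))
      (trans (∙-congˡ (sym e)) (solve 3 (λ g y h → ⊖ y ⊕ (⊖ g ⊕ h) ⊜ ⊖ (g ⊕ y) ⊕ h) refl g y h))) ∈-self
    between 0F 2F 2F _ _ e = g , ~-≈ 0F refl , e
    between 1F 1F t _ _ e = h , e , ~-≈ t refl
    between 1F 2F 2F _ _ e = g , ~-≈ 1F refl , e
    between 2F 2F t _ _ e = h , e , ~-≈ t refl
    between 0F 1F 0F _ () _
    between 0F 2F 0F _ () _
    between 0F 2F 1F _ (s≤s ()) _
    between 1F 0F _ () _ _
    between 1F 2F 0F _ () _
    between 1F 2F 1F _ (s≤s ()) _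
    between 2F 0F _ () _ _
    between 2F 1F _ (s≤s ()) _ _

  same-rank : ∀ {r X Y} → (r , X) ≼ (r , Y) → X ≡ Y
  same-rank h = let g , a , b = meeting h in ≡.trans (≡.sym a) b

  ≼-antisym : ∀ {X Y} → X ≼ Y → Y ≼ X → X ≡ Y
  ≼-antisym {r , X} {s , Y} a b with Finₚ.≤-antisym (proj₁ a) (proj₁ b)
  ... | ≡.refl = ≡.cong (r ,_) (same-rank a)

  rank-mono : ∀ {X Y} → X ≼ Y → X ≢ Y → rank X Fin.< rank Y
  rank-mono {r , X} {s , Y} a ne = Finₚ.≤∧≢⇒< (proj₁ a) λ { ≡.refl → ne (≡.cong (r ,_) (same-rank a)) }

  open RankedPoset _≼_ rank

  two-on-edge : ∀ r (R : Elem → Set) → ¬ H r u → ∀ X →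
    (∀ g → cl 1F g ≡ X → R (node r g)) → (∀ Y → R Y → ∃ λ g → Y ≡ node r g × cl 1F g ≡ X) → ExactlyTwo R
  two-on-edge r R u∉ X incident only =
    node r g , node r (g ∙ u) , (λ e → u∉ (H-resp r (\\-leftDividesʳ g u) (node-~ r e))) ,
    incident g (cl-rep 1F X) , incident (g ∙ u) (≡.trans (≡.sym (cl-≡ 1F (~-∙ 1F g (inj₂ refl)))) (cl-rep 1F X)) ,
    λ Y h → let k , Y≡ , kX = only Y h in decide Y≡ (cl-~ 1F (≡.trans (cl-rep 1F X) (≡.sym kX)))
    where
    g = rep 1F X
    decide : ∀ {Y k} → Y ≡ node r k → g ~[ 1F ] k → Y ≡ node r g ⊎ Y ≡ node r (g ∙ u)
    decide Y≡ (inj₁ e) = inj₁ (≡.trans Y≡ (≈⇒node r (trans (from-quotient e) (identityʳ g))))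
    decide Y≡ (inj₂ e) = inj₂ (≡.trans Y≡ (≈⇒node r (from-quotient e)))

  0≤1 : Fin._≤_ {3} {3} 0F 1F
  0≤1 = z≤n
  1≤2 : Fin._≤_ {3} {3} 1F 2F
  1≤2 = s≤s z≤n

  edge-vertices : ∀ e → IsEdge e → ExactlyTwo (λ v → IsVertex v × v ≼ e)
  edge-vertices (_ , X) ≡.refl = two-on-edge 0F _ u∉y X
    (λ g e → ≡.refl , mk≼ g 0≤1 ≡.refl e)
    (λ { (_ , Y) (≡.refl , h) → let g , a , b = meeting h in g , ≡.cong (0F ,_) (≡.sym a) , b })

  edge-faces : ∀ e → IsEdge e → ExactlyTwo (λ f → IsFace f × e ≼ f)
  edge-faces (_ , X) ≡.refl = two-on-edge 2F _ u∉x X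
    (λ g e → ≡.refl , mk≼ g 1≤2 e ≡.refl)
    (λ { (_ , Y) (≡.refl , h) → let g , a , b = meeting h in g , ≡.cong (2F ,_) (≡.sym b) , a })

  y⁻¹-edge : ∀ g → cl 1F (g ∙ x) ≡ cl 1F (g ∙ y ⁻¹)
  y⁻¹-edge g = cl-≡ 1F (inj₂ (trans (solve 3 (λ g x y → ⊖ (g ⊕ x) ⊕ (g ⊕ ⊖ y) ⊜ ⊖ (y ⊕ x)) refl g x y) u⁻¹))

  -- An edge through both contains some k in g⟨y⟩ and some l in g⟨x⟩. If k = l, both are g. If l =
  -- kyx, then g⁻¹ky lies in ⟨x⟩ and ⟨y⟩, so k = gy⁻¹.
  diamond : ∀ v f → IsVertex v → IsFace f → v ≼ f → ExactlyTwo (λ e → IsEdge e × v ≼ e × e ≼ f)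
  diamond (_ , V) (_ , F) ≡.refl ≡.refl h with meeting h
  ... | g , gV , gF = node 1F g , node 1F (g ∙ y ⁻¹) , (λ e → distinct (H-resp 1F (\\-leftDividesʳ g (y ⁻¹)) (node-~ 1F e))) ,
      (≡.refl , mk≼ g 0≤1 gV ≡.refl , mk≼ g 1≤2 ≡.refl gF) ,
      (≡.refl , mk≼ (g ∙ y ⁻¹) 0≤1 (≡.trans (≡.sym (cl-≡ 0F (~-∙ 0F g (∈y-⁻¹ ∈-self)))) gV) ≡.refl ,
        mk≼ (g ∙ x) 1≤2 (y⁻¹-edge g) (≡.trans (≡.sym (cl-≡ 2F (~-∙ 2F g ∈-self))) gF)) ,
      λ { (_ , Z) (≡.refl , a , b) → only Z (meeting a) (meeting b) }
    where
    distinct : ¬ H 1F (y ⁻¹)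
    distinct (inj₁ e) = y≉ε (trans (sym (⁻¹-involutive y)) (trans (⁻¹-cong e) ε⁻¹≈ε))
    distinct (inj₂ e) = u∉y (∈-resp e (∈y-⁻¹ ∈-self))
    only : ∀ Z → Meet 0F 1F V Z → Meet 1F 2F Z F → (1F , Z) ≡ node 1F g ⊎ (1F , Z) ≡ node 1F (g ∙ y ⁻¹)
    only Z (k , kV , kZ) (l , lZ , lF) = by (cl-~ 1F (≡.trans kZ (≡.sym lZ)))
      where
      B∈ : g ⁻¹ ∙ k ∈⟨ y ⟩
      B∈ = cl-~ 0F (≡.trans gV (≡.sym kV))
      A∈ : g ⁻¹ ∙ l ∈⟨ x ⟩
      A∈ = cl-~ 2F (≡.trans gF (≡.sym lF))
      by : k ~[ 1F ] l → (1F , Z) ≡ node 1F g ⊎ (1F , Z) ≡ node 1F (g ∙ y ⁻¹)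
      by (inj₁ e) = inj₁ (≡.trans (≡.cong (1F ,_) (≡.sym kZ)) (≈⇒node 1F (trans (from-quotient
        (meet∈ (∈-resp (∙-congˡ (trans (from-quotient e) (identityʳ k))) A∈) B∈)) (identityʳ g))))
      by (inj₂ e) = inj₂ (≡.trans (≡.cong (1F ,_) (≡.sym kZ)) (≈⇒node 1F (from-quotient (inverseˡ-unique _ _
        (meet∈ (∈-resp (trans (∙-congʳ (∙-congˡ (from-quotient e)))
            (solve 4 (λ g k x y → ⊖ g ⊕ (k ⊕ (y ⊕ x)) ⊕ ⊖ x ⊜ ⊖ g ⊕ k ⊕ y) refl g k x y)) (∈-∙ A∈ (∈x-⁻¹ ∈-self)))
          (∈-∙ B∈ ∈-self))))))

  Inc-sym : ∀ {X Y} → Inc X Y → Inc Y X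
  Inc-sym = swap

  node-Inc : ∀ r s g → Inc (node r g) (node s g)
  node-Inc r s g = [ (λ h → inj₁ (node-≼ g h)) , (λ h → inj₂ (node-≼ g h)) ]′ (Finₚ.≤-total r s)

  -- The factorisation x^a y^b of a representative is a path: along the base face to x^a, around the
  -- vertex of x^a to x^a y^b, then to F.
  hub : ∀ F → Star Inc (node 2F ε) F
  hub (r , X) with factor (rep r X)
  ... | a , b , e = ≡.subst (λ Y → Inc (node 2F ε) Y) face≡ (inj₁ (node-≼ ε (ℕₚ.≤-refl {2}))) ◂
    node-Inc 2F 0F (x ^ a) ◂ ≡.subst (λ Y → Inc Y (r , X)) (≡.sym vertex≡)
      (≡.subst (Inc (node 0F (x ^ a ∙ y ^ b))) end (node-Inc 0F r (x ^ a ∙ y ^ b))) ◂ nil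
    where
    face≡ : node 2F ε ≡ node 2F (x ^ a)
    face≡ = node-≡ 2F (a , trans (∙-congʳ ε⁻¹≈ε) (identityˡ _))
    vertex≡ : node 0F (x ^ a) ≡ node 0F (x ^ a ∙ y ^ b)
    vertex≡ = node-≡ 0F (~-∙ 0F (x ^ a) (b , refl))
    end : node r (x ^ a ∙ y ^ b) ≡ (r , X)
    end = ≡.trans (≈⇒node r (sym e)) (node-rep r X)

  connected : ∀ X Y → Star Inc X Y
  connected X Y = reverse Inc-sym (hub X) ◅◅ hub Y

  module Link (F : Elem) where
    Linked : Elem → Elem → Set
    Linked a b = Nbr F a × Nbr F b × Inc a b

    linked-sym : ∀ {a b} → Linked a b → Linked b a
    linked-sym (a , b , h) = b , a , swap h

    via-hub : ∀ {Z} → (∀ X → Nbr F X → Star Linked Z X) → ∀ X Y → Nbr F X → Nbr F Y → Star Linked X Y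
    via-hub h X Y nX nY = reverse linked-sym (h X nX) ◅◅ h Y nY

  Nbr-node : ∀ r s g → s ≢ r → Nbr (node r g) (node s g)
  Nbr-node r s g ne = node-Inc r s g , λ e → ne (≡.cong proj₁ e)

  Nbr-meet : ∀ {r s V X} → Nbr (r , V) (s , X) → s ≢ r × Meet r s V X
  Nbr-meet {r} {s} {V} {X} (h , ne) = (λ { ≡.refl → ne (≡.cong (r ,_) (eq h)) }) , meets h
    where
    eq : ∀ {Y Z} → Inc (r , Y) (r , Z) → Z ≡ Y
    eq (inj₁ h) = ≡.sym (same-rank h)
    eq (inj₂ h) = same-rank h
    meets : Inc (r , V) (s , X) → Meet r s V X
    meets (inj₁ h) = meeting h
    meets (inj₂ h) = let g , a , b = meeting h in g , b , a

  module AtVertex (V : Class 0F) where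
    F : Elem
    F = 0F , V
    open Link F
    g : Carrier
    g = rep 0F V
    at : ℕ → Carrier
    at b = g ∙ y ^ b
    F≡ : ∀ b → node 0F (at b) ≡ F
    F≡ b = ≡.trans (≡.sym (node-≡ 0F (~-∙ 0F g (b , refl)))) (node-rep 0F V)
    nbr : ∀ s b → s ≢ 0F → Nbr F (node s (at b))
    nbr s b ne = ≡.subst (λ Z → Nbr Z (node s (at b))) (F≡ b) (Nbr-node 0F s (at b) ne)
    next : ∀ b → node 2F (at b ∙ u) ≡ node 2F (at (suc b))
    next b = node-≡ 2F (∈-resp (trans (solve 4 (λ g b y x → ⊖ x ⊜ ⊖ (g ⊕ b ⊕ (y ⊕ x)) ⊕ (g ⊕ (b ⊕ y))) refl g (y ^ b) y x)
      (∙-congˡ (∙-congˡ (comm-^ˡ b comm-refl)))) (∈x-⁻¹ ∈-self))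
    -- The faces around the vertex are those of g y^b; two consecutive ones share the edge of g y^b,
    -- as g y^b u lies in the next face.
    walk : ∀ b → Star Linked (node 2F (at 0)) (node 2F (at b))
    walk zero = nil
    walk (suc b) = walk b ◅◅ (nbr 2F b (λ ()) , nbr 1F b (λ ()) , node-Inc 2F 1F (at b)) ◂
      (nbr 1F b (λ ()) , nbr 2F (suc b) (λ ()) , ≡.subst₂ Inc (≡.sym (node-≡ 1F (~-∙ 1F (at b) (inj₂ refl)))) (next b) (node-Inc 1F 2F (at b ∙ u))) ◂ nil
    reach : ∀ X → Nbr F X → Star Linked (node 2F (at 0)) X
    reach (s , X) n with Nbr-meet n
    ... | ne , k , kV , kX with cl-~ 0F (≡.trans (cl-rep 0F V) (≡.sym kV))
    ... | b , e = walk b ◅◅ (nbr 2F b (λ ()) , n , ≡.subst (Inc (node 2F (at b)))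
      (≡.trans (≈⇒node s (sym (from-quotient e))) (≡.cong (s ,_) kX)) (node-Inc 2F s (at b))) ◂ nil

  module AtFace (V : Class 2F) where
    F : Elem
    F = 2F , V
    open Link F
    g : Carrier
    g = rep 2F V
    at : ℕ → Carrier
    at a = g ∙ x ^ a
    F≡ : ∀ a → node 2F (at a) ≡ F
    F≡ a = ≡.trans (≡.sym (node-≡ 2F (~-∙ 2F g (a , refl)))) (node-rep 2F V)
    nbr : ∀ s a → s ≢ 2F → Nbr F (node s (at a))
    nbr s a ne = ≡.subst (λ Z → Nbr Z (node s (at a))) (F≡ a) (Nbr-node 2F s (at a) ne)
    xyx : x ∙ y ∙ x ≈ y ⁻¹
    xyx = inverseˡ-unique _ _ (trans (assoc _ _ _) involution)
    next : ∀ a → node 0F (at (suc a) ∙ u) ≡ node 0F (at a)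
    next a = ≡.sym (node-≡ 0F (∈-resp (trans (sym xyx) (trans
      (solve 4 (λ g a x y → x ⊕ y ⊕ x ⊜ ⊖ (g ⊕ a) ⊕ (g ⊕ (a ⊕ x) ⊕ (y ⊕ x))) refl g (x ^ a) x y)
      (∙-congˡ (∙-congʳ (∙-congˡ (comm-^ˡ a comm-refl)))))) (∈y-⁻¹ ∈-self)))
    walk : ∀ a → Star Linked (node 0F (at 0)) (node 0F (at a))
    walk zero = nil
    walk (suc a) = walk a ◅◅ (nbr 0F a (λ ()) , nbr 1F (suc a) (λ ()) ,
        ≡.subst₂ Inc (next a) (≡.sym (node-≡ 1F (~-∙ 1F (at (suc a)) (inj₂ refl)))) (node-Inc 0F 1F (at (suc a) ∙ u))) ◂
      (nbr 1F (suc a) (λ ()) , nbr 0F (suc a) (λ ()) , node-Inc 1F 0F (at (suc a))) ◂ nil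
    reach : ∀ X → Nbr F X → Star Linked (node 0F (at 0)) X
    reach (s , X) n with Nbr-meet n
    ... | ne , k , kV , kX with cl-~ 2F (≡.trans (cl-rep 2F V) (≡.sym kV))
    ... | a , e = walk a ◅◅ (nbr 0F a (λ ()) , n , ≡.subst (Inc (node 0F (at a)))
      (≡.trans (≈⇒node s (sym (from-quotient e))) (≡.cong (s ,_) kX)) (node-Inc 0F s (at a))) ◂ nil

  locally-connected : ∀ F → IsVertex F ⊎ IsFace F → ∀ X Y → Nbr F X → Nbr F Y →
    Star (λ a b → Nbr F a × Nbr F b × Inc a b) X Y
  locally-connected (_ , V) (inj₁ ≡.refl) = Link.via-hub (0F , V) (AtVertex.reach V)
  locally-connected (_ , V) (inj₂ ≡.refl) = Link.via-hub (2F , V) (AtFace.reach V)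

  Q : Polyhedron
  Q = record
    { Elem = Elem ; _≼_ = _≼_
    ; ≼-irrelevant = λ (a , b) (c , d) → ≡.cong₂ _,_ (ℕₚ.≤-irrelevant a c) (T-irrelevant b d)
    ; ≼-refl = λ { {r , X} → mk≼ (rep r X) Finₚ.≤-refl (cl-rep r X) (cl-rep r X) }
    ; ≼-trans = λ {X} {Y} {Z} → ≼-trans {X} {Y} {Z}
    ; ≼-antisym = ≼-antisym
    ; rank = rank ; rank-mono = rank-mono
    ; edge-vertices = edge-vertices ; edge-faces = edge-faces ; diamond = diamond
    ; connected = connected ; locally-connected = locally-connected }

  -- flagOf false g is the image of the base flag under g, and flagOf true g its neighbour through another face.
  flagOf : Bool → Carrier → Flag Q
  flagOf false g = flag (node 0F g) (node 1F g) (node 2F g) ≡.refl ≡.refl ≡.refl (node-≼ g 0≤1) (node-≼ g 1≤2)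
  flagOf true g = flag (node 0F g) (node 1F g) (node 2F (g ∙ u)) ≡.refl ≡.refl ≡.refl (node-≼ g 0≤1)
    (mk≼ (g ∙ u) 1≤2 (≡.sym (cl-≡ 1F (~-∙ 1F g (inj₂ refl)))) ≡.refl)

  flag-≡ : ∀ {Φ Ψ : Flag Q} → FlagEq Q Φ Ψ → Φ ≡ Ψ
  flag-≡ = flagEq⇒≡ Q

  flagOf-≈ : ∀ b {g h} → g ≈ h → FlagEq Q (flagOf b g) (flagOf b h)
  flagOf-≈ false e = ≈⇒node 0F e , ≈⇒node 1F e , ≈⇒node 2F e
  flagOf-≈ true e = ≈⇒node 0F e , ≈⇒node 1F e , ≈⇒node 2F (∙-congʳ e)

  classify : ∀ Ψ → ∃₂ λ b g → FlagEq Q (flagOf b g) Ψ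
  classify (flag (_ , V) (_ , E) (_ , F) ≡.refl ≡.refl ≡.refl ve ef) with meeting ve | meeting ef
  ... | k , kV , kE | l , lE , lF with cl-~ 1F (≡.trans kE (≡.sym lE))
  ... | inj₁ e = false , k , ≡.cong (0F ,_) kV , ≡.cong (1F ,_) kE ,
    ≡.trans (≈⇒node 2F (sym (trans (from-quotient e) (identityʳ k)))) (≡.cong (2F ,_) lF)
  ... | inj₂ e = true , k , ≡.cong (0F ,_) kV , ≡.cong (1F ,_) kE ,
    ≡.trans (≈⇒node 2F (sym (from-quotient e))) (≡.cong (2F ,_) lF)

  ∩-ve : ∀ {g h} → g ~[ 0F ] h → g ~[ 1F ] h → g ≈ h
  ∩-ve {g} a (inj₁ e) = sym (trans (from-quotient e) (identityʳ g))
  ∩-ve a (inj₂ e) = ⊥-elim (u∉y (∈-resp e a))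

  ∩-ef : ∀ {g h} → g ~[ 2F ] h → g ~[ 1F ] h → g ≈ h
  ∩-ef {g} a (inj₁ e) = sym (trans (from-quotient e) (identityʳ g))
  ∩-ef a (inj₂ e) = ⊥-elim (u∉x (∈-resp e a))

  ∩-vf : ∀ {g h} → g ~[ 0F ] h → g ~[ 2F ] h → g ≈ h
  ∩-vf {g} a b = sym (trans (from-quotient (meet∈ b a)) (identityʳ g))

  u-conj : ∀ {g h} → (g ∙ u) ~[ 2F ] (h ∙ u) → y ⁻¹ ∙ (g ⁻¹ ∙ h) ∙ y ∈⟨ x ⟩
  u-conj {g} {h} k = ∈-resp (solve 4 (λ g h x y → x ⊕ (⊖ (g ⊕ (y ⊕ x)) ⊕ (h ⊕ (y ⊕ x))) ⊕ ⊖ x ⊜ ⊖ y ⊕ (⊖ g ⊕ h) ⊕ y) refl g h x y)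
    (∈-∙ (∈-∙ ∈-self k) (∈x-⁻¹ ∈-self))

  flagOf-unique : ∀ b c {g h} → FlagEq Q (flagOf b g) (flagOf c h) → b ≡ c × g ≈ h
  flagOf-unique false false (a , b , _) = ≡.refl , ∩-ve (node-~ 0F a) (node-~ 1F b)
  flagOf-unique true true (a , b , _) = ≡.refl , ∩-ve (node-~ 0F a) (node-~ 1F b)
  flagOf-unique false true {g} (a , b , c) = ⊥-elim (u∉x (∈-resp (trans (∙-congˡ (∙-congʳ (sym (∩-ve (node-~ 0F a) (node-~ 1F b))))) (\\-leftDividesʳ g u)) (node-~ 2F c)))
  flagOf-unique true false {g} {h} (a , b , c) = ⊥-elim (u∉x (∈-resp (trans (∙-congˡ (∙-congʳ (∩-ve (node-~ 0F a) (node-~ 1F b)))) (\\-leftDividesʳ h u)) (node-~ 2F (≡.sym c))))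

  cls : Flag Q → Bool
  cls Ψ = proj₁ (classify Ψ)

  -- Two flags with the same Boolean that agree in two ranks agree in the third, since vertex, edge
  -- and face stabilisers meet pairwise trivially; for `true` the face stabiliser is conjugated by
  -- u. So the Boolean is a proper colouring.
  adjacent-same : ∀ i b {g h} → ¬ Adj Q i (flagOf b g) (flagOf b h)
  adjacent-same 0F false (ne , a , b) = ne (≈⇒node 0F (∩-ef (node-~ 2F b) (node-~ 1F a)))
  adjacent-same 0F true {g} {h} (ne , a , b) = ne (≈⇒node 0F (same (node-~ 1F a)))
    where
    same : g ~[ 1F ] h → g ≈ h
    same (inj₁ e) = sym (trans (from-quotient e) (identityʳ g))
    same (inj₂ e) = ⊥-elim (u∉x (∈-resp (solve 2 (λ x y → ⊖ x ⊕ (⊖ y ⊕ (y ⊕ x) ⊕ y) ⊕ x ⊜ y ⊕ x) refl x y)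
      (∈-∙ (∈-∙ (∈x-⁻¹ ∈-self) (∈-resp (∙-congʳ (∙-congˡ e)) (u-conj (node-~ 2F b)))) ∈-self)))
  adjacent-same 1F false (a , ne , b) = ne (≈⇒node 1F (∩-vf (node-~ 0F a) (node-~ 2F b)))
  adjacent-same 1F true {g} {h} (a , ne , b) = ne (≈⇒node 1F (∩-vf (node-~ 0F a)
    (∈-resp (trans (assoc _ _ _) (trans (∙-congˡ (∈-comm′ (node-~ 0F a))) (\\-leftDividesʳ y _))) (u-conj (node-~ 2F b)))))
    where
    ∈-comm′ : ∀ {B} → B ∈⟨ y ⟩ → B ∙ y ≈ y ∙ B
    ∈-comm′ B∈ = sym (∈-comm B∈ comm-refl)
  adjacent-same 2F false (a , b , ne) = ne (≈⇒node 2F (∩-ve (node-~ 0F a) (node-~ 1F b)))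
  adjacent-same 2F true (a , b , ne) = ne (≈⇒node 2F (∙-congʳ (∩-ve (node-~ 0F a) (node-~ 1F b))))

  cls-adjacent : ∀ i Φ Ψ → Adj Q i Φ Ψ → cls Φ ≢ cls Ψ
  cls-adjacent i Φ Ψ h same = let b , g , e = classify Φ ; c , k , e′ = classify Ψ in
    adjacent-same i b (≡.subst₂ (Adj Q i) (≡.sym (flag-≡ e)) (≡.sym (≡.trans (≡.cong (λ b → flagOf b k) same) (flag-≡ e′))) h)

-- Rotations based at different flags

module Intertwine (P : Polyhedron)
  (edgeAt : ∀ v → Polyhedron.IsVertex P v → EdgesAtVertex P v)
  (edgeOf : ∀ f → Polyhedron.IsFace P f → EdgesOfFace P f) where
  open Flags P edgeAt edgeOf
  module A = Group (autGroup P)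
  open A using (_≈_; _∙_; ε; _⁻¹)

  record Rotations (Φ : Flag P) (σ₁ σ₂ : Aut P) : Set where
    field
      turn₁ : act P σ₁ Φ ≡ adj 0F (adj 1F Φ)
      turn₂ : act P σ₂ Φ ≡ adj 1F (adj 2F Φ)

  rotations : ∀ {Φ σ₁ σ₂} → IsSigma1 P Φ σ₁ → IsSigma2 P Φ σ₂ → Rotations Φ σ₁ σ₂
  rotations {Φ} (Φ₁ , Φ₁₀ , a₁ , a₀ , eq) (Φ₂ , Φ₂₁ , b₂ , b₁ , eq′) = record
    { turn₁ = ≡.trans (flag-≡ eq) (≡.trans (adj-unique 0F Φ₁ Φ₁₀ a₀) (≡.cong (adj 0F) (adj-unique 1F Φ Φ₁ a₁)))
    ; turn₂ = ≡.trans (flag-≡ eq′) (≡.trans (adj-unique 1F Φ₂ Φ₂₁ b₁) (≡.cong (adj 1F) (adj-unique 2F Φ Φ₂ b₂))) }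

  module E (σ₁ σ₂ : Aut P) = Evaluation (autGroup P) σ₁ σ₂

  module _ {σ₁ σ₂ τ₁ τ₂ κ : Aut P} (h₁ : σ₁ ∙ κ ≈ κ ∙ τ₁) (h₂ : σ₂ ∙ κ ≈ κ ∙ τ₂) where
    inverse-step : ∀ {σ τ : Aut P} → σ ∙ κ ≈ κ ∙ τ → σ ⁻¹ ∙ κ ≈ κ ∙ τ ⁻¹
    inverse-step {σ} {τ} h a = ≡.trans (≡.cong (Aut.from σ) (≡.trans (≡.cong (Aut.to κ) (≡.sym (Aut.to-from τ a))) (≡.sym (h (Aut.from τ a)))))
      (Aut.from-to σ (Aut.to κ (Aut.from τ a)))

    letter : ∀ {σ τ : Aut P} → σ ∙ κ ≈ κ ∙ τ → ∀ {α β : Aut P} → α ∙ κ ≈ κ ∙ β → (σ ∙ α) ∙ κ ≈ κ ∙ (τ ∙ β)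
    letter {σ} h {β = β} k a = ≡.trans (≡.cong (Aut.to σ) (k a)) (h (Aut.to β a))

    intertwine : ∀ w → E.ev σ₁ σ₂ w ∙ κ ≈ κ ∙ E.ev τ₁ τ₂ w
    intertwine [] a = ≡.refl
    intertwine ((false , false) ∷ w) = letter {σ₁} {τ₁} h₁ {E.ev σ₁ σ₂ w} {E.ev τ₁ τ₂ w} (intertwine w)
    intertwine ((false , true) ∷ w) = letter {σ₁ ⁻¹} {τ₁ ⁻¹} (inverse-step {σ₁} {τ₁} h₁) {E.ev σ₁ σ₂ w} {E.ev τ₁ τ₂ w} (intertwine w)
    intertwine ((true , false) ∷ w) = letter {σ₂} {τ₂} h₂ {E.ev σ₁ σ₂ w} {E.ev τ₁ τ₂ w} (intertwine w)
    intertwine ((true , true) ∷ w) = letter {σ₂ ⁻¹} {τ₂ ⁻¹} (inverse-step {σ₂} {τ₂} h₂) {E.ev σ₁ σ₂ w} {E.ev τ₁ τ₂ w} (intertwine w)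

    transfer : ∀ w → E.ev τ₁ τ₂ w ≈ ε → E.ev σ₁ σ₂ w ≈ ε
    transfer w h a = ≡.trans (≡.cong (Aut.to (E.ev σ₁ σ₂ w)) (≡.sym (Aut.to-from κ a)))
      (≡.trans (intertwine w (Aut.from κ a)) (≡.trans (≡.cong (Aut.to κ) (h (Aut.from κ a))) (Aut.to-from κ a)))

  ev-inverses : ∀ τ₁ τ₂ w → E.ev (τ₁ ⁻¹) (τ₂ ⁻¹) w ≈ E.ev τ₁ τ₂ (mirror w)
  ev-inverses τ₁ τ₂ [] a = ≡.refl
  ev-inverses τ₁ τ₂ ((false , false) ∷ w) a = ≡.cong (Aut.from τ₁) (ev-inverses τ₁ τ₂ w a)
  ev-inverses τ₁ τ₂ ((false , true) ∷ w) a = ≡.cong (Aut.to τ₁) (ev-inverses τ₁ τ₂ w a)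
  ev-inverses τ₁ τ₂ ((true , false) ∷ w) a = ≡.cong (Aut.from τ₂) (ev-inverses τ₁ τ₂ w a)
  ev-inverses τ₁ τ₂ ((true , true) ∷ w) a = ≡.cong (Aut.to τ₂) (ev-inverses τ₁ τ₂ w a)

  module _ {Φ Ψ : Flag P} {σ₁ σ₂ τ₁ τ₂ : Aut P} (R : Rotations Φ σ₁ σ₂) (S : Rotations Ψ τ₁ τ₂) (κ : Aut P) where
    open Rotations

    same-class : act P κ Ψ ≡ Φ → ∀ w → E.ev τ₁ τ₂ w ≈ ε → E.ev σ₁ σ₂ w ≈ ε
    same-class h = transfer {σ₁} {σ₂} {τ₁} {τ₂} {κ} (at σ₁ τ₁ 0F 1F (turn₁ R) (turn₁ S)) (at σ₂ τ₂ 1F 2F (turn₂ R) (turn₂ S))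
      where
      at : ∀ σ τ i j → act P σ Φ ≡ adj i (adj j Φ) → act P τ Ψ ≡ adj i (adj j Ψ) → σ ∙ κ ≈ κ ∙ τ
      at σ τ i j eq eq′ = rigid {σ ∙ κ} {κ ∙ τ} Ψ (≡.trans (act-∘ σ κ Ψ) (≡.trans (≡.cong (act P σ) h) (≡.trans eq
        (≡.sym (≡.trans (act-∘ κ τ Ψ) (≡.trans (≡.cong (act P κ) eq′) (≡.trans (act-adj-adj κ i j Ψ) (≡.cong (adj i ∘ adj j) h))))))))

    -- τ₁⁻¹ and τ₂⁻¹ are the rotations based at Ψ¹, so an automorphism carrying Ψ¹ to Φ intertwines
    -- them with σ₁ and σ₂.
    opposite-class : act P κ (adj 1F Ψ) ≡ Φ → ∀ w → E.ev τ₁ τ₂ (mirror w) ≈ ε → E.ev σ₁ σ₂ w ≈ ε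
    opposite-class h w k = transfer {σ₁} {σ₂} {τ₁ ⁻¹} {τ₂ ⁻¹} {κ}
        (at σ₁ (τ₁ ⁻¹) (turn₁ R) (≡.trans (≡.cong (act P κ) back₁) (≡.trans (act-adj-adj κ 0F 1F (adj 1F Ψ)) (≡.cong (adj 0F ∘ adj 1F) h))))
        (at σ₂ (τ₂ ⁻¹) (turn₂ R) (≡.trans (≡.cong (act P κ) back₂) (≡.trans (act-adj-adj κ 1F 2F (adj 1F Ψ)) (≡.cong (adj 1F ∘ adj 2F) h))))
        w (λ a → ≡.trans (ev-inverses τ₁ τ₂ w a) (k a))
      where
      back₁ : act P (τ₁ ⁻¹) (adj 1F Ψ) ≡ adj 0F (adj 1F (adj 1F Ψ))
      back₁ = act-inv′ τ₁ {adj 0F (adj 1F (adj 1F Ψ))} (≡.trans (act-adj-adj τ₁ 0F 1F (adj 1F Ψ)) (≡.trans (≡.cong (adj 0F ∘ adj 1F) (act-adj τ₁ 1F Ψ))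
        (≡.trans (≡.cong (adj 0F) (adj-adj 1F _)) (≡.trans (≡.cong (adj 0F) (turn₁ S)) (adj-adj 0F _)))))
      back₂ : act P (τ₂ ⁻¹) (adj 1F Ψ) ≡ adj 1F (adj 2F (adj 1F Ψ))
      back₂ = act-inv′ τ₂ {adj 1F (adj 2F (adj 1F Ψ))} (≡.trans (act-adj-adj τ₂ 1F 2F (adj 1F Ψ)) (≡.trans (≡.cong (adj 1F ∘ adj 2F) (act-adj τ₂ 1F Ψ))
        (≡.cong (adj 1F) (≡.trans (≡.cong (adj 2F ∘ adj 1F) (turn₂ S)) (≡.trans (≡.cong (adj 2F) (adj-adj 1F _)) (adj-adj 2F Ψ))))))
      at : ∀ σ τ {Φ′} → act P σ Φ ≡ Φ′ → act P κ (act P τ (adj 1F Ψ)) ≡ Φ′ → σ ∙ κ ≈ κ ∙ τ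
      at σ τ eq eq′ = rigid {σ ∙ κ} {κ ∙ τ} (adj 1F Ψ) (≡.trans (act-∘ σ κ (adj 1F Ψ)) (≡.trans (≡.cong (act P σ) h) (≡.trans eq
        (≡.sym (≡.trans (act-∘ κ τ (adj 1F Ψ)) eq′)))))

module CosetPolyhedron {p q : ℕ} (T : TightGroup p q) (p≢1 : p ≢ 1) (q≢1 : q ≢ 1) (C : Subgroups.Cosets T) where
  open TightGroup T
  open Theory T
  open Subgroups T hiding (cosets; elt; code; elt-code; module Build; module R)
  open Subgroups.Cosets C
  open Geometry T p≢1 q≢1 C public
  open GroupSolver group
  open import Algebra.Properties.Group group

  translate : Carrier → Elem → Elem
  translate h (r , X) = r , cl r (h ∙ rep r X)

  translate-node : ∀ h r g → translate h (node r g) ≡ node r (h ∙ g)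
  translate-node h r g = node-≡ r (~-left r h (cl-~ r (cl-rep r (cl r g))))

  translate-∙ : ∀ g h X → translate g (translate h X) ≡ translate (g ∙ h) X
  translate-∙ g h (r , X) = ≡.trans (translate-node g r (h ∙ rep r X)) (≈⇒node r (sym (assoc g h _)))

  translate-ε : ∀ {g} → g ≈ ε → ∀ X → translate g X ≡ X
  translate-ε e (r , X) = ≡.trans (≈⇒node r (trans (∙-congʳ e) (identityˡ _))) (node-rep r X)

  translate-mono : ∀ h {X Y} → X ≼ Y → translate h X ≼ translate h Y
  translate-mono h {r , X} {s , Y} k = let g , a , b = meeting k in
    mk≼ (h ∙ g) (proj₁ k) (cl-≡ r (~-left r h (cl-~ r (≡.trans a (≡.sym (cl-rep r X))))))
      (cl-≡ s (~-left s h (cl-~ s (≡.trans b (≡.sym (cl-rep s Y))))))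

  opaque
    left : Carrier → Aut Q
    left h = record
      { to = translate h ; from = translate (h ⁻¹)
      ; to-from = λ X → ≡.trans (translate-∙ h (h ⁻¹) X) (translate-ε (inverseʳ h) X)
      ; from-to = λ X → ≡.trans (translate-∙ (h ⁻¹) h X) (translate-ε (inverseˡ h) X)
      ; mono = λ {X} {Y} → translate-mono h {X} {Y}
      ; mono⁻ = λ {X} {Y} k → ≡.subst₂ _≼_
          (≡.trans (translate-∙ (h ⁻¹) h X) (translate-ε (inverseˡ h) X))
          (≡.trans (translate-∙ (h ⁻¹) h Y) (translate-ε (inverseˡ h) Y)) (translate-mono (h ⁻¹) {translate h X} {translate h Y} k)
      ; rank-pres = λ _ → ≡.refl }

    to-left : ∀ h X → Aut.to (left h) X ≡ translate h X
    to-left h X = ≡.refl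

    from-left : ∀ h X → Aut.from (left h) X ≡ translate (h ⁻¹) X
    from-left h X = ≡.refl

  left-node : ∀ h r g → Aut.to (left h) (node r g) ≡ node r (h ∙ g)
  left-node h r g = ≡.trans (to-left h (node r g)) (translate-node h r g)

  left-flag : ∀ h b g → FlagEq Q (act Q (left h) (flagOf b g)) (flagOf b (h ∙ g))
  left-flag h false g = left-node h 0F g , left-node h 1F g , left-node h 2F g
  left-flag h true g = left-node h 0F g , left-node h 1F g , ≡.trans (left-node h 2F (g ∙ u)) (≈⇒node 2F (sym (assoc h g u)))

  -- Treats faces (t = x) and vertices (t = y) at once: the edges around g₀H are those of g₀t^k for
  -- k < n, distinct because t-powers and the edge stabiliser share only ε.
  module EdgesAround (r : Fin 3) (t : Carrier) (n : ℕ) {{n≢0 : NonZero n}} (tⁿ : t ^ n ≈ ε) (order : ∀ k → t ^ k ≈ ε → n ∣ k)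
    (H⇒ : ∀ {g} → H r g → g ∈⟨ t ⟩) (⇒H : ∀ {g} → g ∈⟨ t ⟩ → H r g) (u∉ : ¬ H r u) (V : Class r)
    (R : Elem → Set) (irrelevant : ∀ {X} (a b : R X) → a ≡ b)
    (incident : ∀ g → cl r g ≡ V → R (node 1F g)) (meets : ∀ X → R (1F , X) → Meet r 1F V X) where

    Edges : Set
    Edges = Σ Elem λ X → rank X ≡ 1F × R X

    edges-≡ : ∀ {a b : Edges} → proj₁ a ≡ proj₁ b → a ≡ b
    edges-≡ {X , i , a} {_ , j , b} ≡.refl = ≡.cong₂ (λ i a → X , i , a) (≡-irrelevant i j) (irrelevant a b)

    g₀ : Carrier
    g₀ = rep r V

    exponent : ∀ {X} → Meet r 1F V X → ℕ
    exponent (k , kV , _) = proj₁ (H⇒ (cl-~ r (≡.trans (cl-rep r V) (≡.sym kV))))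

    exponent-≈ : ∀ {X} (M : Meet r 1F V X) → g₀ ⁻¹ ∙ proj₁ M ≈ t ^ exponent M
    exponent-≈ (k , kV , _) = proj₂ (H⇒ (cl-~ r (≡.trans (cl-rep r V) (≡.sym kV))))

    reduce : ℕ → Fin n
    reduce k = fromℕ< (m%n<n k n)

    reduce-≈ : ∀ k → t ^ toℕ (reduce k) ≈ t ^ k
    reduce-≈ k = trans (^-≡ t (Finₚ.toℕ-fromℕ< (m%n<n k n))) (sym (Periodic.^-% {n = n} tⁿ k))

    toEdge : Fin n → Edges
    toEdge i = node 1F (g₀ ∙ t ^ toℕ i) , ≡.refl ,
      incident _ (≡.trans (≡.sym (cl-≡ r (~-∙ r g₀ (⇒H (toℕ i , refl))))) (cl-rep r V))

    fromMeet : ∀ {X} → Meet r 1F V X → Fin n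
    fromMeet M = reduce (exponent M)

    fromEdge : Edges → Fin n
    fromEdge ((_ , X) , ≡.refl , h) = fromMeet (meets X h)

    to-from : ∀ E → toEdge (fromEdge E) ≡ E
    to-from ((_ , X) , ≡.refl , h) = edges-≡ (≡.trans (≈⇒node 1F (trans (∙-congˡ (trans (reduce-≈ _) (sym (exponent-≈ (meets X h))))) (\\-leftDividesˡ g₀ _)))
      (≡.cong (1F ,_) (proj₂ (proj₂ (meets X h)))))

    fromMeet-≡ : ∀ i (M : Meet r 1F V (cl 1F (g₀ ∙ t ^ toℕ i))) → fromMeet M ≡ i
    fromMeet-≡ i M = Finₚ.toℕ-injective (^-injective order (Finₚ.toℕ<n (fromMeet M)) (Finₚ.toℕ<n i) (trans (reduce-≈ (exponent M)) (close (cl-~ 1F (≡.sym (proj₂ (proj₂ M)))))))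
      where
      quotient : (g₀ ∙ t ^ toℕ i) ⁻¹ ∙ proj₁ M ≈ (t ^ toℕ i) ⁻¹ ∙ t ^ exponent M
      quotient = trans (solve 3 (λ g a m → ⊖ (g ⊕ a) ⊕ m ⊜ ⊖ a ⊕ (⊖ g ⊕ m)) refl g₀ (t ^ toℕ i) (proj₁ M)) (∙-congˡ (exponent-≈ M))
      close : (g₀ ∙ t ^ toℕ i) ~[ 1F ] proj₁ M → t ^ exponent M ≈ t ^ toℕ i
      close (inj₁ e) = trans (from-quotient (trans (sym quotient) e)) (identityʳ _)
      close (inj₂ e) = ⊥-elim (u∉ (⇒H (∈-resp (trans (sym quotient) e) (∈-∙ (Periodic.∈-⁻¹ {n = n} tⁿ (toℕ i , refl)) (exponent M , refl)))))

    edges↔ : Edges ↔ Fin n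
    edges↔ = mk↔ₛ′ fromEdge toEdge (λ i → fromMeet-≡ i (meets _ (proj₂ (proj₂ (toEdge i))))) to-from

  hasType : HasType Q p q
  hasType = (λ { (_ , V) ≡.refl → EdgesAround.edges↔ 2F x p x-period x-order (λ h → h) (λ h → h) u∉x V (_≼ (2F , V))
                 (λ {X} → Polyhedron.≼-irrelevant Q {X}) (λ g e → mk≼ g 1≤2 ≡.refl e) (λ X h → let g , a , b = meeting h in g , b , a) })
          , (λ { (_ , V) ≡.refl → EdgesAround.edges↔ 0F y q y-period y-order (λ h → h) (λ h → h) u∉y V ((0F , V) ≼_)
                 (λ {X} → Polyhedron.≼-irrelevant Q {0F , V} {X}) (λ g e → mk≼ g 0≤1 e ≡.refl) (λ X h → meeting h) })

  value : Fin p × Fin q → Carrier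
  value (i , j) = x ^ toℕ i ∙ y ^ toℕ j

  index : Carrier → Fin p × Fin q
  index g = let a , b , _ = factor g in fromℕ< (m%n<n a p) , fromℕ< (m%n<n b q)

  value-index : ∀ g → value (index g) ≈ g
  value-index g with factor g
  ... | a , b , e = trans (∙-cong (trans (^-≡ x (Finₚ.toℕ-fromℕ< (m%n<n a p))) (sym (x^-% a))) (trans (^-≡ y (Finₚ.toℕ-fromℕ< (m%n<n b q))) (sym (y^-% b)))) (sym e)

  value-injective : ∀ k l → value k ≈ value l → k ≡ l
  value-injective (i , j) (i′ , j′) e =
    let e₁ , e₂ = factors-unique {m = p} {n = q} x-period y-period meet∈ (toℕ i , refl) (toℕ i′ , refl) (toℕ j , refl) (toℕ j′ , refl) e
    in ≡.cong₂ _,_ (Finₚ.toℕ-injective (^-injective x-order (Finₚ.toℕ<n i) (Finₚ.toℕ<n i′) e₁))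
                   (Finₚ.toℕ-injective (^-injective y-order (Finₚ.toℕ<n j) (Finₚ.toℕ<n j′) e₂))

  bit : Bool → Fin 2
  bit false = 0F
  bit true = 1F

  unbit : Fin 2 → Bool
  unbit 0F = false
  unbit 1F = true

  bit-unbit : ∀ i → bit (unbit i) ≡ i
  bit-unbit 0F = ≡.refl
  bit-unbit 1F = ≡.refl

  unbit-bit : ∀ b → unbit (bit b) ≡ b
  unbit-bit false = ≡.refl
  unbit-bit true = ≡.refl

  encode : Bool → Fin p × Fin q → Fin (2 ℕ.* p ℕ.* q)
  encode b (i , j) = combine (combine (bit b) i) j

  decode : Fin (2 ℕ.* p ℕ.* q) → Bool × Fin p × Fin q
  decode k = let r , j = remQuot {2 ℕ.* p} q k ; s , i = remQuot {2} p r in unbit s , i , j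

  encode-decode : ∀ k → encode (proj₁ (decode k)) (proj₂ (decode k)) ≡ k
  encode-decode k = ≡.trans (≡.cong (λ s → combine (combine s (proj₂ (remQuot {2} p (proj₁ (remQuot {2 ℕ.* p} q k))))) (proj₂ (remQuot {2 ℕ.* p} q k))) (bit-unbit (proj₁ (remQuot {2} p (proj₁ (remQuot {2 ℕ.* p} q k))))))
    (≡.trans (≡.cong (λ r → combine r (proj₂ (remQuot {2 ℕ.* p} q k))) (Finₚ.combine-remQuot {2} p (proj₁ (remQuot {2 ℕ.* p} q k)))) (Finₚ.combine-remQuot {2 ℕ.* p} q k))

  decode-encode : ∀ b k → decode (encode b k) ≡ (b , k)
  decode-encode b (i , j) = ≡.trans (≡.cong (λ (r , j) → let s , i = remQuot {2} p r in unbit s , i , j) (Finₚ.remQuot-combine {2 ℕ.* p} {q} (combine (bit b) i) j))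
    (≡.trans (≡.cong (λ (s , i) → unbit s , i , j) (Finₚ.remQuot-combine {2} {p} (bit b) i)) (≡.cong (λ b → b , i , j) (unbit-bit b)))

  toFlag : Bool × Fin p × Fin q → Flag Q
  toFlag (b , k) = flagOf b (value k)

  fromFlag : Flag Q → Bool × Fin p × Fin q
  fromFlag Ψ = let b , g , _ = classify Ψ in b , index g

  toFlag-fromFlag : ∀ Ψ → toFlag (fromFlag Ψ) ≡ Ψ
  toFlag-fromFlag Ψ = let b , g , e = classify Ψ in ≡.trans (flag-≡ (flagOf-≈ b (value-index g))) (flag-≡ {flagOf b g} {Ψ} e)

  fromFlag-toFlag : ∀ k → fromFlag (toFlag k) ≡ k
  fromFlag-toFlag (b , k) = let c , g , e = classify (flagOf b (value k))
                                c≡b , g≈ = flagOf-unique c b e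
    in ≡.cong₂ _,_ c≡b (value-injective (index g) k (trans (value-index g) g≈))

  flags↔ : Flag Q ↔ Fin (2 ℕ.* p ℕ.* q)
  flags↔ = mk↔ₛ′ (λ Ψ → let b , k = fromFlag Ψ in encode b k) (λ i → toFlag (decode i))
    (λ i → ≡.trans (≡.cong (λ (b , k) → encode b k) (fromFlag-toFlag (decode i))) (encode-decode i))
    (λ Ψ → ≡.trans (≡.cong toFlag (decode-encode (proj₁ (fromFlag Ψ)) (proj₂ (fromFlag Ψ)))) (toFlag-fromFlag Ψ))

  tight : Tight Q p q
  tight = hasType , flags↔

  base : Flag Q
  base = flagOf false ε

  isSigma1 : IsSigma1 Q base (left x)
  isSigma1 = flag (node 0F ε) (node 1F (ε ∙ x)) (node 2F ε) ≡.refl ≡.refl ≡.refl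
      -- The new edge, that of x, is also the edge of y⁻¹, which lies in the base vertex.
      (mk≼ (ε ∙ y ⁻¹) 0≤1 (≡.sym (cl-≡ 0F (~-∙ 0F ε (∈y-⁻¹ ∈-self)))) (≡.sym (y⁻¹-edge ε)))
      (mk≼ (ε ∙ x) 1≤2 ≡.refl (≡.sym (cl-≡ 2F (~-∙ 2F ε ∈-self)))) ,
    flagOf false (ε ∙ x) ,
    (≡.refl , (λ e → x∉edge (H-resp 1F (\\-leftDividesʳ ε x) (node-~ 1F e))) , ≡.refl) ,
    ((λ e → x∉y (∈-resp (\\-leftDividesʳ ε x) (node-~ 0F e))) , ≡.refl , node-≡ 2F (~-∙ 2F ε ∈-self)) ,
    ≡.cong Flag.v total , ≡.cong Flag.e total , ≡.cong Flag.f total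
    where
    x∉edge : ¬ H 1F x
    x∉edge (inj₁ e) = x≉ε e
    x∉edge (inj₂ e) = u∉x (∈-resp e ∈-self)
    total : act Q (left x) base ≡ flagOf false (ε ∙ x)
    total = ≡.trans (flag-≡ {act Q (left x) base} {flagOf false (x ∙ ε)} (left-flag x false ε)) (flag-≡ (flagOf-≈ false (trans (identityʳ x) (sym (identityˡ x)))))

  isSigma2 : IsSigma2 Q base (left y)
  isSigma2 = flagOf true ε , flagOf false (ε ∙ y) ,
    (≡.refl , ≡.refl , (λ e → u∉x (∈-resp (\\-leftDividesʳ ε u) (node-~ 2F e)))) ,
    (node-≡ 0F (~-∙ 0F ε ∈-self) , (λ e → y∉edge (H-resp 1F (\\-leftDividesʳ ε y) (node-~ 1F e))) ,
      node-≡ 2F (∈-resp (solve 2 (λ x y → ⊖ x ⊜ ⊖ (𝟙 ⊕ (y ⊕ x)) ⊕ (𝟙 ⊕ y)) refl x y) (∈x-⁻¹ ∈-self))) ,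
    ≡.cong Flag.v total , ≡.cong Flag.e total , ≡.cong Flag.f total
    where
    y∉edge : ¬ H 1F y
    y∉edge (inj₁ e) = y≉ε e
    y∉edge (inj₂ e) = u∉y (∈-resp e ∈-self)
    total : act Q (left y) base ≡ flagOf false (ε ∙ y)
    total = ≡.trans (flag-≡ {act Q (left y) base} {flagOf false (y ∙ ε)} (left-flag y false ε)) (flag-≡ (flagOf-≈ false (trans (identityʳ y) (sym (identityˡ y)))))

  open TightFlags Q p q tight base using (edgeAt; edgeOf)
  open Flags Q edgeAt edgeOf using (adj; adj-Adj; act-inv′)
  open Intertwine Q edgeAt edgeOf public using (module E; rotations; same-class; opposite-class; Rotations)

  left-ev : ∀ w X → Aut.to (E.ev (left x) (left y) w) X ≡ translate (ev w) X
  left-ev [] X = ≡.sym (translate-ε refl X)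
  left-ev ((false , false) ∷ w) X = ≡.trans (≡.cong (Aut.to (left x)) (left-ev w X)) (≡.trans (to-left x _) (translate-∙ x (ev w) X))
  left-ev ((false , true) ∷ w) X = ≡.trans (≡.cong (Aut.from (left x)) (left-ev w X)) (≡.trans (from-left x _) (translate-∙ (x ⁻¹) (ev w) X))
  left-ev ((true , false) ∷ w) X = ≡.trans (≡.cong (Aut.to (left y)) (left-ev w X)) (≡.trans (to-left y _) (translate-∙ y (ev w) X))
  left-ev ((true , true) ∷ w) X = ≡.trans (≡.cong (Aut.from (left y)) (left-ev w X)) (≡.trans (from-left y _) (translate-∙ (y ⁻¹) (ev w) X))

  trivial⇒ : ∀ w → AutEq Q (E.ev (left x) (left y) w) (idAut Q) → ev w ≈ ε
  trivial⇒ w h = sym (∩-ve (at 0F) (at 1F))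
    where
    at : ∀ r → ε ~[ r ] ev w
    at r = node-~ r (≡.trans (≡.sym (h (node r ε))) (≡.trans (left-ev w (node r ε)) (≡.trans (translate-node (ev w) r ε) (≈⇒node r (identityʳ _)))))

  ⇒trivial : ∀ w → ev w ≈ ε → AutEq Q (E.ev (left x) (left y) w) (idAut Q)
  ⇒trivial w h X = ≡.trans (left-ev w X) (translate-ε h X)

  transitive : ∀ b → FlagTransitive Q (λ Φ → cls Φ ≡ b)
  transitive b Φ Ψ eq eq′ = move (classify Φ) (classify Ψ) eq eq′
    where
    move : (F : ∃₂ λ c g → FlagEq Q (flagOf c g) Φ) (G : ∃₂ λ c g → FlagEq Q (flagOf c g) Ψ) → proj₁ F ≡ b → proj₁ G ≡ b →
      ∃ λ α → FlagEq Q (act Q α Φ) Ψ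
    move (c , g , e) (_ , h , e′) ≡.refl ≡.refl = left (h ∙ g ⁻¹) , ≡.cong Flag.v total , ≡.cong Flag.e total , ≡.cong Flag.f total
      where
      total : act Q (left (h ∙ g ⁻¹)) Φ ≡ Ψ
      total = ≡.trans (≡.cong (act Q (left (h ∙ g ⁻¹))) (≡.sym (flag-≡ {flagOf c g} {Φ} e)))
        (≡.trans (flag-≡ {act Q (left (h ∙ g ⁻¹)) (flagOf c g)} {flagOf c (h ∙ g ⁻¹ ∙ g)} (left-flag (h ∙ g ⁻¹) c g))
        (≡.trans (flag-≡ {flagOf c (h ∙ g ⁻¹ ∙ g)} {flagOf c h} (flagOf-≈ c (//-rightDividesˡ g h))) (flag-≡ {flagOf c h} {Ψ} e′)))

  base-rotations : Rotations base (left x) (left y)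
  base-rotations = rotations isSigma1 isSigma2

  -- Rotations at a flag of the class of `base` satisfy the relators of the group, and those at a
  -- flag of the other class satisfy their mirror images.
  at-any-flag : ∀ {Φ σ₁ σ₂} → Rotations Φ σ₁ σ₂ →
    (∀ w → ev w ≈ ε → AutEq Q (E.ev σ₁ σ₂ w) (idAut Q)) ⊎ (∀ w → ev (mirror w) ≈ ε → AutEq Q (E.ev σ₁ σ₂ w) (idAut Q))
  at-any-flag {Φ} {σ₁} {σ₂} R = by (cls Φ ≟ᵇ cls base)
    where
    by : Dec (cls Φ ≡ cls base) → _
    by (yes h) = inj₁ λ w e → same-class R base-rotations (proj₁ κ) (flag-≡ {act Q (proj₁ κ) base} {Φ} (proj₂ κ)) w (⇒trivial w e)
      where κ = transitive (cls Φ) base Φ (≡.sym h) ≡.refl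
    by (no h) = inj₂ λ w e → opposite-class R base-rotations (proj₁ κ) (flag-≡ {act Q (proj₁ κ) (adj 1F base)} {Φ} (proj₂ κ)) w (⇒trivial (mirror w) e)
      where
      κ = transitive (cls Φ) (adj 1F base) Φ
        (≡.trans (¬-not (cls-adjacent 1F base (adj 1F base) (adj-Adj 1F base) ∘ ≡.sym)) (≡.sym (¬-not h))) ≡.refl

  module _ (chiral⁺ : ¬ Regular⁺) where
    -- An automorphism joining the base flag to its 1-neighbour intertwines x, y with their
    -- inverses, which would close the relators under `mirror`.
    not-regular : ¬ Regular Q
    not-regular reg = chiral⁺ λ w e → trivial⇒ (mirror w) (opposite-class base-rotations base-rotations (invAut Q (proj₁ K))
        (act-inv′ (proj₁ K) {base} {adj 1F base} (flag-≡ {act Q (proj₁ K) base} {adj 1F base} (proj₂ K)))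
        (mirror w) (≡.subst (λ v → AutEq Q (E.ev (left x) (left y) v) (idAut Q)) (≡.sym (mirror-mirror w)) (⇒trivial w e)))
      where
      K = reg base (adj 1F base) tt tt

    chiral : Chiral Q
    chiral = cls , cls-adjacent , transitive , not-regular

-- Covers

-- The enantiomorphic form, which appears when a covering is based at a flag of the opposite class.
mirrored : ∀ {p q} → TightGroup p q → TightGroup p q
mirrored {p} {q} T = record
  { group = group ; x = x ⁻¹ ; y = y ⁻¹ ; p≢0 = p≢0 ; q≢0 = q≢0
  ; involution = trans (solve 2 (λ x y → ⊖ x ⊕ ⊖ y ⊕ (⊖ x ⊕ ⊖ y) ⊜ ⊖ (y ⊕ x ⊕ (y ⊕ x))) refl x y)
      (trans (⁻¹-cong (TightGroup.involution (dual T))) ε⁻¹≈ε)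
  ; x-period = inverse-ε x p x-period
  ; y-period = inverse-ε y q y-period
  ; x-order = λ a e → x-order a (ε-inverse x a e)
  ; y-order = λ b e → y-order b (ε-inverse y b e)
  ; factor = λ g → let a , b , e = factor g ; a′ , ea = x⁻¹∈ a ; b′ , eb = y⁻¹∈ b in
      a′ , b′ , trans e (∙-cong (flip x {a} {a′} ea) (flip y {b} {b′} eb))
  ; meet = λ a b e → inverse-ε x a (meet a b (⁻¹-injective (trans (sym (^-⁻¹ x a)) (trans e (^-⁻¹ y b)))))
  }
  where
  open TightGroup T
  open Theory T
  open GroupSolver group
  open import Algebra.Properties.Group group
  inverse-ε : ∀ g n → g ^ n ≈ ε → (g ⁻¹) ^ n ≈ ε
  inverse-ε g n e = trans (^-⁻¹ g n) (trans (⁻¹-cong e) ε⁻¹≈ε)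
  ε-inverse : ∀ g n → (g ⁻¹) ^ n ≈ ε → g ^ n ≈ ε
  ε-inverse g n e = ⁻¹-injective (trans (sym (^-⁻¹ g n)) (trans e (sym ε⁻¹≈ε)))
  flip : ∀ g {a a′} → (g ^ a) ⁻¹ ≈ g ^ a′ → g ^ a ≈ (g ⁻¹) ^ a′
  flip g {a} {a′} e = trans (sym (⁻¹-involutive _)) (trans (⁻¹-cong e) (sym (^-⁻¹ g a′)))

ev-mirrored : ∀ {p q} (T : TightGroup p q) w → let open TightGroup T in TightGroup.ev (mirrored T) w ≈ ev (mirror w)
ev-mirrored T [] = TightGroup.refl T
ev-mirrored T ((false , false) ∷ w) = TightGroup.∙-congˡ T (ev-mirrored T w)
ev-mirrored T ((false , true) ∷ w) = TightGroup.∙-cong T (⁻¹-involutive _) (ev-mirrored T w)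
  where open import Algebra.Properties.Group (TightGroup.group T)
ev-mirrored T ((true , false) ∷ w) = TightGroup.∙-congˡ T (ev-mirrored T w)
ev-mirrored T ((true , true) ∷ w) = TightGroup.∙-cong T (⁻¹-involutive _) (ev-mirrored T w)
  where open import Algebra.Properties.Group (TightGroup.group T)

mirrored-chiral : ∀ {p q} (T : TightGroup p q) → ¬ TightGroup.Regular⁺ T → ¬ TightGroup.Regular⁺ (mirrored T)
mirrored-chiral T chiral reg = chiral λ w e →
  trans (sym (ev-mirrored T w)) (≡.subst (λ v → TightGroup.ev (mirrored T) v ≈ ε) (mirror-mirror w)
    (reg (mirror w) (trans (ev-mirrored T (mirror w)) (≡.subst (λ v → ev v ≈ ε) (≡.sym (mirror-mirror w)) e))))
  where open TightGroup T

powers : ℕ → ℕ → Word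
powers (suc a) b = (false , false) ∷ powers a b
powers zero (suc b) = (true , false) ∷ powers zero b
powers zero zero = []

module Kernel {p q n : ℕ} (T : TightGroup p q) (S : TightGroup n q) (onto : T ⇒ S) where
  open TightGroup T
  open Theory T
  open import Algebra.Properties.Group group
  module S = TightGroup S
  module SP = Theory S
  open import Algebra.Properties.Group S.group using () renaming (x∙y⁻¹≈ε⇒x≈y to S-x∙y⁻¹≈ε⇒x≈y)

  lift : ∀ v w → ev v ≈ ev w → S.ev v S.≈ S.ev w
  lift v w e = S-x∙y⁻¹≈ε⇒x≈y _ _ (S.trans (S.sym (S.trans (S.ev-++ v (invert w)) (S.∙-congˡ (S.ev-invert w))))
    (onto (v ++ invert w) (trans (ev-++ v (invert w)) (trans (∙-congˡ (ev-invert w)) (x≈y⇒x∙y⁻¹≈ε e)))))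

  ev-powers : ∀ a b → ev (powers a b) ≈ x ^ a ∙ y ^ b
  ev-powers (suc a) b = trans (∙-congˡ (ev-powers a b)) (sym (assoc _ _ _))
  ev-powers zero (suc b) = trans (∙-congˡ (trans (ev-powers zero b) (identityˡ _))) (sym (identityˡ _))
  ev-powers zero zero = sym (identityˡ _)

  S-ev-powers : ∀ a b → S.ev (powers a b) S.≈ S.x S.^ a S.∙ S.y S.^ b
  S-ev-powers (suc a) b = S.trans (S.∙-congˡ (S-ev-powers a b)) (S.sym (S.assoc _ _ _))
  S-ev-powers zero (suc b) = S.trans (S.∙-congˡ (S.trans (S-ev-powers zero b) (S.identityˡ _))) (S.sym (S.identityˡ _))
  S-ev-powers zero zero = S.sym (S.identityˡ _)

  lift-powers : ∀ w a b → ev w ≈ x ^ a ∙ y ^ b → S.ev w S.≈ S.x S.^ a S.∙ S.y S.^ b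
  lift-powers w a b e = S.trans (lift w (powers a b) (trans e (sym (ev-powers a b)))) (S-ev-powers a b)

  n∣p : n ∣ p
  n∣p = S.x-order p (S.trans (S.sym (S.identityʳ _)) (S.sym (lift-powers [] p 0 (sym (trans (∙-congʳ x-period) (identityˡ _))))))

  -- For w = x^a y^b, unique factorisation in S gives n ∣ a and q ∣ b; y has order q in T as well,
  -- so only a power of x^n is left.
  kernel⇒ : ∀ w → S.ev w S.≈ S.ε → ev w ∈⟨ x ^ n ⟩
  kernel⇒ w e = let a , b , f = factor (ev w)
                    A≈ε , B≈ε = SP.split-ε (a , S.refl) (b , S.refl) (S.trans (S.sym (lift-powers w a b f)) e)
    in ∈-resp (sym f) (∣⇒∈x^ a b (S.x-order a A≈ε , S.y-order b B≈ε))

  ⇒kernel : ∀ w → ev w ∈⟨ x ^ n ⟩ → S.ev w S.≈ S.ε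
  ⇒kernel w (k , e) = S.trans (lift-powers w (n ℕ.* k) 0 (trans e (trans (sym (^-* x n k)) (sym (identityʳ _)))))
    (S.trans (S.identityʳ _) (SP.x^-∣ (m∣m*n k)))

  normal : NormalX T n
  normal = ∈-resp same (kernel⇒ w trivial)
    where
    w : Word
    w = (true , false) ∷ powers n 0 ++ (true , true) ∷ []
    same : ev w ≈ conj y (x ^ n)
    same = trans (∙-congˡ (trans (ev-++ (powers n 0) _) (∙-cong (trans (ev-powers n 0) (identityʳ _)) (identityʳ _)))) (sym (assoc _ _ _))
    trivial : S.ev w S.≈ S.ε
    trivial = S.trans (S.∙-congˡ (S.trans (S.ev-++ (powers n 0) _) (S.∙-cong (S.trans (S-ev-powers n 0) (S.trans (S.identityʳ _) S.x-period)) (S.identityʳ _))))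
      (S.trans (S.∙-congˡ (S.identityˡ _)) (S.inverseʳ S.y))

  no-smaller : AtomicX T → n < p → ¬ S.Regular⁺ → ⊥
  no-smaller atomic n<p chiral = chiral λ w e → ⇒kernel (mirror w) (atomic n n∣p n<p normal w (kernel⇒ w e))

module Cover (P Q : Polyhedron) (σ₁ σ₂ : Aut P) (λ₁ λ₂ : Aut Q) where
  module A = Group (autGroup P)
  module B = Group (autGroup Q)
  module EA = Evaluation (autGroup P) σ₁ σ₂
  module EB = Evaluation (autGroup Q) λ₁ λ₂

  Image : Set
  Image = Σ ((α : Aut P) → InRot P σ₁ σ₂ α → Aut Q) λ φ →
      (∀ α β hα hβ → AutEq P α β → AutEq Q (φ α hα) (φ β hβ))
    × (∀ α β hα hβ hαβ → AutEq Q (φ (_∘A_ P α β) hαβ) (_∘A_ Q (φ α hα) (φ β hβ)))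
    × (∀ h → AutEq Q (φ σ₁ h) λ₁)
    × (∀ h → AutEq Q (φ σ₂ h) λ₂)

  module _ (kernel : ∀ w → EA.ev w A.≈ A.ε → EB.ev w B.≈ B.ε) where
    lift : ∀ v w → EA.ev v A.≈ EA.ev w → EB.ev v B.≈ EB.ev w
    lift v w e a = ≡.trans (≡.sym (Aut.to-from (EB.ev w) _)) (≡.cong (Aut.to (EB.ev w)) (≡.trans
      (≡.sym (≡.trans (EB.ev-++ (invert w) v a) (EB.ev-invert w _))) (kernel (invert w ++ v) trivial a)))
      where
      trivial : EA.ev (invert w ++ v) A.≈ A.ε
      trivial a = ≡.trans (EA.ev-++ (invert w) v a) (≡.trans (EA.ev-invert w _) (≡.trans (≡.cong (Aut.from (EA.ev w)) (e a)) (Aut.from-to (EA.ev w) a)))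

    word : ∀ {α} (h : InRot P σ₁ σ₂ α) → EA.ev (proj₁ h) A.≈ α
    word (w , e) a = ≡.trans (≡.sym (evalWord≈ev P σ₁ σ₂ w a)) (e a)

    -- The homomorphism evaluates in Q the word carried by `InRot`; `lift` makes the value
    -- independent of that word.
    image : Image
    image = (λ α h → EB.ev (proj₁ h)) ,
      (λ α β hα hβ e → lift (proj₁ hα) (proj₁ hβ) λ a → ≡.trans (word {α} hα a) (≡.trans (e a) (≡.sym (word {β} hβ a)))) ,
      (λ α β hα hβ hαβ a → ≡.trans (lift (proj₁ hαβ) (proj₁ hα ++ proj₁ hβ) (λ a → ≡.trans (word {_∘A_ P α β} hαβ a)
          (≡.sym (≡.trans (EA.ev-++ (proj₁ hα) (proj₁ hβ) a) (≡.trans (word {α} hα _) (≡.cong (Aut.to α) (word {β} hβ a)))))) a)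
        (EB.ev-++ (proj₁ hα) (proj₁ hβ) a)) ,
      (λ h → lift (proj₁ h) ((false , false) ∷ []) (word {σ₁} h)) ,
      (λ h → lift (proj₁ h) ((true , false) ∷ []) (word {σ₂} h))

  module _ (I : Image) where
    φ : ∀ α → InRot P σ₁ σ₂ α → Aut Q
    φ = proj₁ I
    φ-cong : ∀ α β hα hβ → AutEq P α β → AutEq Q (φ α hα) (φ β hβ)
    φ-cong = proj₁ (proj₂ I)
    φ-∘ : ∀ α β hα hβ hαβ → AutEq Q (φ (_∘A_ P α β) hαβ) (_∘A_ Q (φ α hα) (φ β hβ))
    φ-∘ = proj₁ (proj₂ (proj₂ I))

    rot : ∀ w → InRot P σ₁ σ₂ (EA.ev w)
    rot w = w , evalWord≈ev P σ₁ σ₂ w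

    φ-ε : ∀ α h → α A.≈ A.ε → φ α h B.≈ B.ε
    φ-ε α h e a = ≡.trans (φ-cong α A.ε h (rot []) e a) (idempotent a)
      where
      twice : ∀ a → Aut.to (φ A.ε (rot [])) a ≡ Aut.to (φ A.ε (rot [])) (Aut.to (φ A.ε (rot [])) a)
      twice a = ≡.trans (φ-cong A.ε (A.ε A.∙ A.ε) (rot []) (rot []) (λ _ → ≡.refl) a) (φ-∘ A.ε A.ε (rot []) (rot []) (rot []) a)
      idempotent : ∀ a → Aut.to (φ A.ε (rot [])) a ≡ a
      idempotent a = ≡.trans (≡.sym (Aut.from-to (φ A.ε (rot [])) _)) (≡.trans (≡.cong (Aut.from (φ A.ε (rot []))) (≡.sym (twice a))) (Aut.from-to (φ A.ε (rot [])) a))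

    φ-inverse : ∀ σ τ hσ hσ′ → φ σ hσ B.≈ τ → φ (invAut P σ) hσ′ B.≈ invAut Q τ
    φ-inverse σ τ hσ hσ′ e a = ≡.trans (≡.sym (Aut.from-to τ _)) (≡.cong (Aut.from τ)
      (≡.trans (≡.sym (e _)) (≡.trans (≡.sym (φ-∘ σ (invAut P σ) hσ hσ′ both a)) (φ-ε (σ A.∙ invAut P σ) both (A.inverseʳ σ) a))))
      where
      both : InRot P σ₁ σ₂ (σ A.∙ invAut P σ)
      both = [] , A.sym {σ A.∙ invAut P σ} {A.ε} (A.inverseʳ σ)

    φ-ev : ∀ w h → φ (EA.ev w) h B.≈ EB.ev w
    φ-ev [] h = φ-ε A.ε h (λ _ → ≡.refl)
    φ-ev ((g , s) ∷ w) h a = ≡.trans (φ-∘ (letterA g s) (EA.ev w) (rotL g s) (rot w) h a)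
      (≡.trans (letter g s (rotL g s) _) (≡.cong (Aut.to (letterB g s)) (φ-ev w (rot w) a)))
      where
      letterA : Bool → Bool → Aut P
      letterA g s = GroupSolver.signed (autGroup P) s (EA.generator g)
      letterB : Bool → Bool → Aut Q
      letterB g s = GroupSolver.signed (autGroup Q) s (EB.generator g)
      rotL : ∀ g s → InRot P σ₁ σ₂ (letterA g s)
      rotL g s = (g , s) ∷ [] , evalWord≈ev P σ₁ σ₂ ((g , s) ∷ [])
      letter : ∀ g s h → φ (letterA g s) h B.≈ letterB g s
      letter false false h = proj₁ (proj₂ (proj₂ (proj₂ I))) h
      letter true false h = proj₂ (proj₂ (proj₂ (proj₂ I))) h
      letter false true h = φ-inverse σ₁ λ₁ (rotL false false) h (letter false false (rotL false false))
      letter true true h = φ-inverse σ₂ λ₂ (rotL true false) h (letter true false (rotL true false))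

    preserves-trivial : ∀ w → EA.ev w A.≈ A.ε → EB.ev w B.≈ B.ε
    preserves-trivial w e a = ≡.trans (≡.sym (φ-ev w (rot w) a)) (φ-ε (EA.ev w) (rot w) e a)

-- Without flags, flag transitivity would hold vacuously, against chirality.
some-flag : (P : Polyhedron) (p q : ℕ) → Chiral P → Tight P p q → Flag P
some-flag P p q chiral tight = by (2 ℕ.* p ℕ.* q) (proj₂ tight)
  where
  by : ∀ n → Flag P ↔ Fin n → Flag P
  by zero I = ⊥-elim (proj₂ (proj₂ (proj₂ chiral)) λ Φ _ _ _ → ⊥-elim (¬Fin0 (Inverse.to I Φ)))
    where
    ¬Fin0 : ¬ Fin 0
    ¬Fin0 ()
  by (suc n) I = Inverse.from I zero

module Generators (P : Polyhedron) (p q : ℕ) (chiral : Chiral P) (tight : Tight P p q) (Φ : Flag P) where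
  open TightFlags P p q tight Φ
  open Flags P edgeAt edgeOf

  turn : ∀ i j → ∃ λ σ → FlagEq P (act P σ Φ) (adj i (adj j Φ))
  turn i j = proj₁ (proj₂ (proj₂ chiral)) (proj₁ chiral Φ) Φ (adj i (adj j Φ)) ≡.refl
    (≡.trans (flips i (adj j Φ)) (≡.trans (≡.cong not (flips j Φ)) (not-involutive _)))
    where
    flips : ∀ i Ψ → proj₁ chiral (adj i Ψ) ≡ not (proj₁ chiral Ψ)
    flips i Ψ = ¬-not (λ e → proj₁ (proj₂ chiral) i Ψ (adj i Ψ) (adj-Adj i Ψ) (≡.sym e))

  σ₁ σ₂ : Aut P
  σ₁ = proj₁ (turn 0F 1F)
  σ₂ = proj₁ (turn 1F 2F)

  isσ₁ : IsSigma1 P Φ σ₁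
  isσ₁ = adj 1F Φ , adj 0F (adj 1F Φ) , adj-Adj 1F Φ , adj-Adj 0F (adj 1F Φ) , proj₂ (turn 0F 1F)

  isσ₂ : IsSigma2 P Φ σ₂
  isσ₂ = adj 2F Φ , adj 1F (adj 2F Φ) , adj-Adj 2F Φ , adj-Adj 1F (adj 2F Φ) , proj₂ (turn 1F 2F)

module AtomicPolyhedron {p q : ℕ} (T : TightGroup p q) (chiral : ¬ TightGroup.Regular⁺ T)
  (atomicX : AtomicX T) (atomicY : AtomicX (dual T)) where
  p≢1 : p ≢ 1
  p≢1 = chiral ∘ RegularityCriteria.p≡1⇒regular T
  q≢1 : q ≢ 1
  q≢1 e = chiral (undual-regular T (λ g → TightGroup._≈_ T g (TightGroup.ε T)) (RegularityCriteria.p≡1⇒regular (dual T) e))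

  module CP = CosetPolyhedron T p≢1 q≢1 (Subgroups.cosets T)

  -- The base flag of the covering is arbitrary. In the class of `base` the rotation group of Q′ is
  -- the required quotient; in the other class its `mirrored` version is, with the same type and
  -- still chiral.
  image-of : ∀ Q′ {p′ q′} → Chiral Q′ → Tight Q′ p′ q′ → Covers CP.Q Q′ →
    Σ (TightGroup p′ q′) λ S → ¬ TightGroup.Regular⁺ S × T ⇒ S
  image-of Q′ {p′} {q′} ch ti (Φ , Ψ , σ₁ , σ₂ , λ₁ , λ₂ , s₁ , s₂ , l₁ , l₂ , I) =
    [ (λ h → RG.rotationGroup , RG.not-regular , λ w e → image w (h w e))
    , (λ h → mirrored RG.rotationGroup , mirrored-chiral RG.rotationGroup RG.not-regular , λ w e →
        TightGroup.trans RG.rotationGroup {TightGroup.ev (mirrored RG.rotationGroup) w} {TightGroup.ev RG.rotationGroup (mirror w)} {[]}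
          (ev-mirrored RG.rotationGroup w) (image (mirror w) (h (mirror w) (≡.subst (λ v → T.ev v T.≈ T.ε) (≡.sym (mirror-mirror w)) e)))) ]′
    (CP.at-any-flag {Φ} {σ₁} {σ₂} (CP.rotations s₁ s₂))
    where
    module T = TightGroup T
    module RG = RotationGroup Q′ p′ q′ ti ch Ψ λ₁ λ₂ l₁ l₂
    module Co = Cover CP.Q Q′ σ₁ σ₂ λ₁ λ₂
    image : ∀ w → AutEq CP.Q (Co.EA.ev w) (idAut CP.Q) → TightGroup._≈_ RG.rotationGroup (TightGroup.ev RG.rotationGroup w) []
    image w h a = ≡.trans (RG.WG.ev-ev w a) (Co.preserves-trivial I w h a)

  atomic : Atomic CP.Q p q
  atomic = CP.chiral chiral , CP.tight ,
    (λ Q′ p′ p′<p ch ti co → let S , chS , onto = image-of Q′ ch ti co in Kernel.no-smaller T S onto atomicX p′<p chS) ,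
    (λ Q′ q′ q′<q ch ti co → let S , chS , onto = image-of Q′ ch ti co in
      Kernel.no-smaller (dual T) (dual S) (⇒-undual (dual T) S onto) atomicY q′<q
        (λ r → chS (undual-regular S (λ g → TightGroup._≈_ S g (TightGroup.ε S)) r)))

theorem4p15 : (P : Polyhedron) (p q : ℕ) → Chiral P → Tight P p q →
    Σ Polyhedron λ Q → Σ ℕ λ p' → Σ ℕ λ q' →
    Covers P Q × Atomic Q p' q' × AtomicTypeList p' q'
theorem4p15 P p q chiral tight = AP.CP.Q , p′ , q′ , covers , AP.atomic , classification T chiral′ atomicX atomicY
  where
  Φ : Flag P
  Φ = some-flag P p q chiral tight
  open Generators P p q chiral tight Φ
  module RG = RotationGroup P p q tight chiral Φ σ₁ σ₂ isσ₁ isσ₂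
  D = descent RG.rotationGroup RG.not-regular
  p′ = proj₁ D
  q′ = proj₁ (proj₂ D)
  T = proj₁ (proj₂ (proj₂ D))
  chiral′ = proj₁ (proj₂ (proj₂ (proj₂ D)))
  atomicX = proj₁ (proj₂ (proj₂ (proj₂ (proj₂ D))))
  atomicY = proj₁ (proj₂ (proj₂ (proj₂ (proj₂ (proj₂ D)))))
  onto = proj₂ (proj₂ (proj₂ (proj₂ (proj₂ (proj₂ D)))))
  module AP = AtomicPolyhedron T chiral′ atomicX atomicY
  module Co = Cover P AP.CP.Q σ₁ σ₂ (AP.CP.left (TightGroup.x T)) (AP.CP.left (TightGroup.y T))
  covers : Covers P AP.CP.Q
  covers = Φ , AP.CP.base , σ₁ , σ₂ , AP.CP.left (TightGroup.x T) , AP.CP.left (TightGroup.y T) , isσ₁ , isσ₂ , AP.CP.isSigma1 , AP.CP.isSigma2 ,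
    Co.image λ w h → AP.CP.⇒trivial w (onto w λ a → ≡.trans (RG.WG.ev-ev w a) (h a))
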